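{- Let $\mathcal{G}_{n,3}$ denote the uniformly random $3$-regular (simple) graph on vertex set $[n]=\{1,\dots,n\}$ ($n$ even). Then asymptotically almost surely (i.e. with probability tending to $1$ as $n\to\infty$), $s(\mathcal{G}_{n,3}) \leq (1+o(1))\frac{n}{3}$.
   Context: For a graph $G=(V,E)$ with chromatic number $\chi(G)$, a set $S\subseteq V$ is a Sudoku set for $G$ if there is a partial proper $\chi(G)$-colouring of the vertices of $S$ that has a unique extension to a proper $\chi(G)$-colouring of all of $G$. The Sudoku number $s(G)$ is the minimum size of a Sudoku set for $G$. -}

module Defs where

open import Data.Bool using (Bool; true; false; _∧_; _∨_; not; if_then_else_)
open import Data.Nat using (ℕ; zero; suc; _+_; _*_; _≤_; _≡ᵇ_; _⊓_)
open import Data.Fin using (Fin; zero; suc) renaming (_≟_ to _≟ᶠ_)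
open import Data.List using (List; []; _∷_; map; concatMap; foldr; allFin; upTo)
open import Data.Bool.ListAction using (and; or)
open import Data.Maybe using (Maybe; just; nothing)
open import Relation.Nullary.Decidable using (⌊_⌋)

Graph : ℕ → Set
Graph n = Fin n → Fin n → Bool

allFuns : {A : Set} (n : ℕ) → List A → List (Fin n → A)
allFuns zero    xs = (λ ()) ∷ []
allFuns (suc n) xs =
  concatMap (λ a → map (λ f → λ { zero → a ; (suc i) → f i }) (allFuns n xs)) xs

countᵇ : {A : Set} → (A → Bool) → List A → ℕ
countᵇ p []       = 0
countᵇ p (x ∷ xs) = (if p x then 1 else 0) + countᵇ p xs

allᵇ : {A : Set} → List A → (A → Bool) → Bool
allᵇ xs p = and (map p xs)

anyᵇ : {A : Set} → List A → (A → Bool) → Bool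
anyᵇ xs p = or (map p xs)

allGraphs : (n : ℕ) → List (Graph n)
allGraphs n = allFuns n (allFuns n (true ∷ false ∷ []))

isSimple3Regular : {n : ℕ} → Graph n → Bool
isSimple3Regular {n} G =
  allᵇ (allFin n) (λ i →
    not (G i i)
    ∧ allᵇ (allFin n) (λ j → ⌊ Data.Bool._≟_ (G i j) (G j i) ⌋)
    ∧ (countᵇ (λ j → G i j) (allFin n) ≡ᵇ 3))
  where import Data.Bool

isProper : {n k : ℕ} → Graph n → (Fin n → Fin k) → Bool
isProper {n} G c =
  allᵇ (allFin n) (λ i → allᵇ (allFin n) (λ j →
    not (G i j) ∨ not ⌊ c i ≟ᶠ c j ⌋))

colourable : {n : ℕ} → Graph n → ℕ → Bool
colourable {n} G k = anyᵇ (allFuns n (allFin k)) (isProper G)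

-- Chromatic number: least k with a proper k-colouring
-- (k = n always works, so the search over 0..n suffices).
chromatic : {n : ℕ} → Graph n → ℕ
chromatic {n} G = foldr (λ k r → if colourable G k then k else r) n (upTo n)

PartialColouring : ℕ → ℕ → Set
PartialColouring n k = Fin n → Maybe (Fin k)

domSize : {n k : ℕ} → PartialColouring n k → ℕ
domSize {n} p = countᵇ (λ i → isJust (p i)) (allFin n)
  where
  isJust : {A : Set} → Maybe A → Bool
  isJust (just _) = true
  isJust nothing  = false

isPartialProper : {n k : ℕ} → Graph n → PartialColouring n k → Bool
isPartialProper {n} G p =
  allᵇ (allFin n) (λ i → allᵇ (allFin n) (λ j → ok (G i j) (p i) (p j)))
  where
  ok : Bool → Maybe _ → Maybe _ → Bool
  ok true (just a) (just b) = not ⌊ a ≟ᶠ b ⌋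
  ok _    _        _        = true

extends : {n k : ℕ} → (Fin n → Fin k) → PartialColouring n k → Bool
extends {n} c p = allᵇ (allFin n) (λ i → agree (c i) (p i))
  where
  agree : Fin _ → Maybe (Fin _) → Bool
  agree a (just b) = ⌊ a ≟ᶠ b ⌋
  agree a nothing  = true

uniquelyExtends : {n k : ℕ} → Graph n → PartialColouring n k → Bool
uniquelyExtends {n} {k} G p =
  isPartialProper G p
  ∧ (countᵇ (λ c → isProper G c ∧ extends c p) (allFuns n (allFin k)) ≡ᵇ 1)

-- Sudoku number s(G): minimum |S| over Sudoku sets S, i.e. over partial proper
-- χ(G)-colourings with a unique extension to a proper χ(G)-colouring.
-- (A full proper χ(G)-colouring is always such, so n is an upper bound.)
sudokuNumber : {n : ℕ} → Graph n → ℕ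
sudokuNumber {n} G =
  foldr (λ p r → if uniquelyExtends G p then domSize p ⊓ r else r) n
        (allFuns n (nothing ∷ map just (allFin (chromatic G))))

numCubic : ℕ → ℕ
numCubic n = countᵇ isSimple3Regular (allGraphs n)

-- Number of simple 3-regular graphs G on [n] with
--   s(G) ≤ (1 + 1/(a+1)) · n/3,  i.e.  3·(a+1)·s(G) ≤ (a+2)·n.
numGood : ℕ → ℕ → ℕ
numGood a n =
  countᵇ (λ G → isSimple3Regular G ∧ leᵇ (3 * suc a * sudokuNumber G) (suc (suc a) * n))
         (allGraphs n)
  where open import Data.Nat using () renaming (_≤ᵇ_ to leᵇ)

-- By switching and Markov's inequality, a.a.s. a cubic graph has few short cycles and no diamond. For such G we bound s(G).
-- If χ(G) = 2, a maximal packing of closed neighbourhoods leaves a Sudoku set of at most n/4 vertices.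
-- If χ(G) = 3, Hall's theorem gives a permutation along edges, hence a nearly perfect matching whose complement is nearly a
-- 2-factor, so almost all of G is tiled by long paths each of whose inner vertices has one outer neighbour. The paths are
-- coloured in the order of a bounded rank, each shifted by a random element of ℤ/3. As short cycles are rare, the labels which
-- a path sees on its earlier outer neighbours depend on disjoint sets of shifts, so they are independent and uniform.
-- A dynamic programme then precolours on average at most 1/2 of the vertices whose outer neighbour comes later, and 1/6 of the
-- others, hence about n/3 altogether, the rest of the path being determined. The o(n) vertices outside the paths are precoloured,
-- consistently by greedy colouring away from vertices with two equally coloured neighbours (Brooks).

module Submission where

open import Defs
import Data.Bool
open import Data.Bool using (Bool; true; false; _∧_; _∨_; not; if_then_else_; _xor_)
open import Data.Nat hiding (_!)
open import Data.Nat.Properties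
open import Data.Nat.Divisibility using (_∣_)
open import Data.Nat.Solver using (module +-*-Solver)
open import Data.Fin using (Fin; zero; suc; toℕ; #_) renaming (_≟_ to _≟ᶠ_)
open import Data.Fin.Properties using (all?; toℕ-injective; toℕ<n)
import Data.Maybe as Maybe
open import Data.Maybe using (Maybe; just; nothing; _<∣>_)
import Data.List as List
open import Data.List using (List; []; _∷_; map; concatMap; foldr; allFin; length; _++_; tabulate)
open import Data.List.Properties
 using (++-assoc; ++-identityʳ; ∷-injectiveˡ; ∷-injectiveʳ; length-++; length-map; length-take; length-drop; take++drop≡id)
open import Data.List.Membership.Propositional using () renaming (_∈_ to _∈ₗ_)
open import Data.List.Membership.Propositional.Properties using (∈-∃++; ∈-++⁻; ∈-++⁺ˡ; ∈-++⁺ʳ)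
open import Data.List.Relation.Unary.All using (All; []; _∷_)
import Data.List.Relation.Unary.All as All
import Data.List.Relation.Unary.All.Properties as All
open import Data.List.Relation.Unary.Any using (Any; here; there)
import Data.List.Relation.Unary.Any as Any
import Data.List.Relation.Unary.Any.Properties as Any
open import Data.Vec using (Vec; []; _∷_)
import Data.Vec as Vec
open import Data.Product using (∃; ∃₂; Σ; ∃-syntax; _×_; _,_; proj₁; proj₂)
open import Data.Sum using (_⊎_; inj₁; inj₂)
open import Data.Unit using (⊤)
open import Data.Empty using (⊥; ⊥-elim)
open import Relation.Binary.Construct.Closure.ReflexiveTransitive using (Star; ε; _◅_; _◅◅_; gmap)
open import Relation.Binary.Definitions using (tri<; tri≈; tri>)
open import Relation.Binary.PropositionalEquality
open import Relation.Nullary using (¬_; Dec; yes; no)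
open import Relation.Nullary.Decidable using (⌊_⌋; _→-dec_; ¬?; from-yes)
open import Function using (_∘_; id)
open ≤-Reasoning using (begin_; begin-equality_; _∎; step-≤; step-≡-⟩)
open +-*-Solver using (solve; _:+_; _:*_; _:=_; con)

-- The obstacle is the order of colouring. A path coloured greedily can get stuck at its last
-- vertex, and so can the leftover vertices, which are coloured after all paths; both need slack.
-- For the paths it comes from the rank: every path ends beside a vertex that is coloured later. For
-- the leftover it comes from sinks: the three neighbours of a vertex use only two colours of a
-- proper 3-colouring, so two of them agree, and precolouring these lets the vertex come last. Sinks
-- must be rare, so each is given a large component of its own. The ranks must be bounded, so that
-- everything on which a colour depends lies within the range that is free of short cycles. The
-- density 1/3 is the mean of 1/2 and 1/6: an edge between inner vertices of different paths has one
-- earlier and one later end, so the two kinds of vertices are about equally frequent. The value 1/6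
-- needs random labels. Shifting whole paths in ℤ/3 supplies them without spoiling properness, since
-- each path is planned relative to its own shift.

variable
 n : ℕ

infix 10 ⟦_⟧

⟦_⟧ : Bool → ℕ
⟦ b ⟧ = if b then 1 else 0

infix 4 _!

_! : Bool → Set
b ! = b ≡ true

-- Finite sums and cardinalities of decidable sets.

∑ : {A : Set} → List A → (A → ℕ) → ℕ
∑ [] f = 0
∑ (x ∷ xs) f = f x + ∑ xs f

countᵇ≡∑ : {A : Set} (p : A → Bool) (xs : List A) → countᵇ p xs ≡ ∑ xs (λ x → ⟦ p x ⟧)
countᵇ≡∑ p [] = refl
countᵇ≡∑ p (x ∷ xs) = cong (⟦ p x ⟧ +_) (countᵇ≡∑ p xs)

module _ {A : Set} where

 ∑-cong : (xs : List A) {f g : A → ℕ} → (∀ x → f x ≡ g x) → ∑ xs f ≡ ∑ xs g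
 ∑-cong [] e = refl
 ∑-cong (x ∷ xs) e = cong₂ _+_ (e x) (∑-cong xs e)

 ∑-mono : (xs : List A) {f g : A → ℕ} → (∀ x → f x ≤ g x) → ∑ xs f ≤ ∑ xs g
 ∑-mono [] e = z≤n
 ∑-mono (x ∷ xs) e = +-mono-≤ (e x) (∑-mono xs e)

 ∑-+ : (xs : List A) (f g : A → ℕ) → ∑ xs (λ x → f x + g x) ≡ ∑ xs f + ∑ xs g
 ∑-+ [] f g = refl
 ∑-+ (x ∷ xs) f g = begin-equality
  f x + g x + ∑ xs (λ x → f x + g x) ≡⟨ cong (f x + g x +_) (∑-+ xs f g) ⟩
  f x + g x + (∑ xs f + ∑ xs g) ≡⟨ +-assoc (f x) (g x) _ ⟩
  f x + (g x + (∑ xs f + ∑ xs g)) ≡⟨ cong (f x +_) (trans (sym (+-assoc (g x) _ _)) (trans (cong (_+ ∑ xs g) (+-comm (g x) _)) (+-assoc (∑ xs f) _ _))) ⟩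
  f x + (∑ xs f + (g x + ∑ xs g)) ≡⟨ sym (+-assoc (f x) _ _) ⟩
  f x + ∑ xs f + (g x + ∑ xs g) ∎

 ∑-*ˡ : (c : ℕ) (xs : List A) (f : A → ℕ) → ∑ xs (λ x → c * f x) ≡ c * ∑ xs f
 ∑-*ˡ c [] f = sym (*-zeroʳ c)
 ∑-*ˡ c (x ∷ xs) f = trans (cong (c * f x +_) (∑-*ˡ c xs f)) (sym (*-distribˡ-+ c (f x) _))

 ∑-*ʳ : (c : ℕ) (xs : List A) (f : A → ℕ) → ∑ xs (λ x → f x * c) ≡ ∑ xs f * c
 ∑-*ʳ c xs f = trans (∑-cong xs (λ x → *-comm (f x) c)) (trans (∑-*ˡ c xs f) (*-comm c _))

 ∑-const : (xs : List A) (c : ℕ) → ∑ xs (λ _ → c) ≡ length xs * c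
 ∑-const [] c = refl
 ∑-const (x ∷ xs) c = cong (c +_) (∑-const xs c)

 ∑-zero : (xs : List A) → ∑ xs (λ _ → 0) ≡ 0
 ∑-zero xs = trans (∑-const xs 0) (*-zeroʳ (length xs))

 ∑-++ : (xs ys : List A) (f : A → ℕ) → ∑ (xs ++ ys) f ≡ ∑ xs f + ∑ ys f
 ∑-++ [] ys f = refl
 ∑-++ (x ∷ xs) ys f = trans (cong (f x +_) (∑-++ xs ys f)) (sym (+-assoc (f x) _ _))

∑-swap : {A B : Set} (xs : List A) (ys : List B) (f : A → B → ℕ) →
     ∑ xs (λ x → ∑ ys (f x)) ≡ ∑ ys (λ y → ∑ xs (λ x → f x y))
∑-swap [] ys f = sym (∑-zero ys)
∑-swap (x ∷ xs) ys f =
 trans (cong (∑ ys (f x) +_) (∑-swap xs ys f)) (sym (∑-+ ys (f x) _))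

∑-map : {A B : Set} (h : A → B) (xs : List A) (f : B → ℕ) → ∑ (map h xs) f ≡ ∑ xs (f ∘ h)
∑-map h [] f = refl
∑-map h (x ∷ xs) f = cong (f (h x) +_) (∑-map h xs f)

∑-concatMap : {A B : Set} (h : A → List B) (xs : List A) (f : B → ℕ) →
       ∑ (concatMap h xs) f ≡ ∑ xs (λ x → ∑ (h x) f)
∑-concatMap h [] f = refl
∑-concatMap h (x ∷ xs) f =
 trans (∑-++ (h x) _ f) (cong (∑ (h x) f +_) (∑-concatMap h xs f))

-- Keeping the smaller of two values at each element gives the first-moment method. `x₀` starts the
-- recursion, so the witness need not lie in the list.
∑-average : {A : Set} (x₀ : A) (xs : List A) (f : A → ℕ) →
      ∃[ x ] length xs * f x ≤ ∑ xs f
∑-average x₀ [] f = x₀ , z≤n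
∑-average x₀ (y ∷ ys) f with ∑-average x₀ ys f
... | x , p with ≤-total (f x) (f y)
... | inj₁ q = x , +-mono-≤ q p
... | inj₂ q = y , +-monoʳ-≤ (f y) (≤-trans (*-monoʳ-≤ (length ys) q) p)

∑ᶠ : (Fin n → ℕ) → ℕ
∑ᶠ {n} = ∑ (allFin n)

∑-tabulate : {A : Set} (h : Fin n → A) (f : A → ℕ) → ∑ (tabulate h) f ≡ ∑ᶠ (f ∘ h)
∑-tabulate {zero} h f = refl
∑-tabulate {suc n} h f = cong (f (h zero) +_)
 (trans (∑-tabulate (h ∘ suc) f) (sym (∑-tabulate suc (f ∘ h))))

∑ᶠ-suc : (f : Fin (suc n) → ℕ) → ∑ᶠ f ≡ f zero + ∑ᶠ (f ∘ suc)
∑ᶠ-suc f = cong (f zero +_) (∑-tabulate suc f)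

∑ᶠ-pt : (f : Fin n → ℕ) (w : Fin n) → f w ≤ ∑ᶠ f
∑ᶠ-pt {suc n} f zero = m≤m+n _ _
∑ᶠ-pt {suc n} f (suc w) = ≤-trans (∑ᶠ-pt (f ∘ suc) w)
 (≤-trans (m≤n+m _ (f zero)) (≤-reflexive (sym (∑ᶠ-suc f))))

∑ᶠ-const : (n c : ℕ) → ∑ᶠ {n} (λ _ → c) ≡ n * c
∑ᶠ-const zero c = refl
∑ᶠ-const (suc n) c = trans (∑ᶠ-suc {n} (λ _ → c)) (cong (c +_) (∑ᶠ-const n c))

⌊⌋-true : {P : Set} (d : Dec P) → ⌊ d ⌋ ! → P
⌊⌋-true (yes p) _ = p

true-⌊⌋ : {P : Set} (d : Dec P) → P → ⌊ d ⌋ !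
true-⌊⌋ (yes _) _ = refl
true-⌊⌋ (no ¬p) p = ⊥-elim (¬p p)

infix 7 _==_

opaque
 _==_ : Fin n → Fin n → Bool
 u == v = ⌊ u ≟ᶠ v ⌋

 ==-true : {u v : Fin n} → u == v ! → u ≡ v
 ==-true {u = u} {v} = ⌊⌋-true (u ≟ᶠ v)

 ==-refl : {u : Fin n} → u == u !
 ==-refl {u = u} = true-⌊⌋ (u ≟ᶠ u) refl

 ==-suc : (u v : Fin n) → (suc u == suc v) ≡ (u == v)
 ==-suc u v with u ≟ᶠ v
 ... | yes _ = refl
 ... | no _ = refl

≢-== : {u v : Fin n} → u ≢ v → u == v ≡ false
≢-== {u = u} {v} ne with u == v in e
... | true = ⊥-elim (ne (==-true e))
... | false = refl

∑ᶠ-δ : (f : Fin n → ℕ) (w : Fin n) → ∑ᶠ (λ v → ⟦ v == w ⟧ * f v) ≡ f w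
∑ᶠ-δ {suc n} f zero = trans (∑ᶠ-suc {n} (λ v → ⟦ v == zero ⟧ * f v))
 (trans (cong₂ _+_ (trans (cong (λ b → ⟦ b ⟧ * f zero) ==-refl) (+-identityʳ (f zero)))
  (trans (∑-cong (allFin n) (λ v → cong (λ b → ⟦ b ⟧ * f (suc v)) (≢-== λ ()))) (∑-zero (allFin n)))) (+-identityʳ _))
∑ᶠ-δ {suc n} f (suc w) = trans (∑ᶠ-suc {n} (λ v → ⟦ v == suc w ⟧ * f v))
 (trans (cong₂ _+_ (cong (λ b → ⟦ b ⟧ * f zero) (≢-== λ ()))
  (∑-cong (allFin n) (λ v → cong (λ b → ⟦ b ⟧ * f (suc v)) (==-suc v w)))) (∑ᶠ-δ (f ∘ suc) w))

∣_∣ : (Fin n → Bool) → ℕ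
∣ P ∣ = ∑ᶠ (λ v → ⟦ P v ⟧)

⟦⟧≤1 : (b : Bool) → ⟦ b ⟧ ≤ 1
⟦⟧≤1 true = ≤-refl
⟦⟧≤1 false = z≤n

⟦⟧-mono : {a b : Bool} → (a ! → b !) → ⟦ a ⟧ ≤ ⟦ b ⟧
⟦⟧-mono {false} f = z≤n
⟦⟧-mono {true} f rewrite f refl = ≤-refl

⟦⟧-le : {a : Bool} {k : ℕ} → (a ! → 1 ≤ k) → ⟦ a ⟧ ≤ k
⟦⟧-le {false} f = z≤n
⟦⟧-le {true} f = f refl

⟦⟧-∧ : (a b : Bool) → ⟦ a ∧ b ⟧ ≡ ⟦ a ⟧ * ⟦ b ⟧
⟦⟧-∧ true b = sym (+-identityʳ _)
⟦⟧-∧ false b = refl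

∧-true : {a b : Bool} → a ∧ b ! → a ! × b !
∧-true {true} e = refl , e

∧ˡ : {a b : Bool} → a ∧ b ! → a !
∧ˡ e = proj₁ (∧-true e)

∧ʳ : {a b : Bool} → a ∧ b ! → b !
∧ʳ {true} e = e

true-∧ : {a b : Bool} → a ! → b ! → a ∧ b !
true-∧ refl refl = refl

∨-true : {a b : Bool} → a ∨ b ! → a ! ⊎ b !
∨-true {true} e = inj₁ refl
∨-true {false} e = inj₂ e

true-∨ˡ : {a : Bool} (b : Bool) → a ! → a ∨ b !
true-∨ˡ b refl = refl

true-∨ʳ : (a : Bool) {b : Bool} → b ! → a ∨ b !
true-∨ʳ true refl = refl
true-∨ʳ false refl = refl

true≢false : true ≢ false
true≢false ()

not-true : {a : Bool} → not a ! → a ≡ false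
not-true {false} e = refl

¬true : {a : Bool} → ¬ (a !) → a ≡ false
¬true {false} f = refl
¬true {true} f = ⊥-elim (f refl)

∣∣-mono : {P Q : Fin n → Bool} → (∀ v → P v ! → Q v !) → ∣ P ∣ ≤ ∣ Q ∣
∣∣-mono {n} f = ∑-mono (allFin n) (λ v → ⟦⟧-mono (f v))

∣∣-empty : {P : Fin n → Bool} → (∀ v → P v ≡ false) → ∣ P ∣ ≡ 0
∣∣-empty {n} f = trans (∑-cong (allFin n) (λ v → cong ⟦_⟧ (f v))) (∑-zero (allFin n))

∣∣≤n : (P : Fin n → Bool) → ∣ P ∣ ≤ n
∣∣≤n {n} P = ≤-trans (∑-mono (allFin n) (λ v → ⟦⟧≤1 (P v)))
 (≤-reflexive (trans (∑ᶠ-const n 1) (*-identityʳ n)))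

∣∣-∨ : (P Q : Fin n → Bool) → ∣ (λ v → P v ∨ Q v) ∣ ≤ ∣ P ∣ + ∣ Q ∣
∣∣-∨ {n} P Q = ≤-trans (∑-mono (allFin n) (λ v → h (P v) (Q v))) (≤-reflexive (∑-+ (allFin n) _ _))
 where
 h : ∀ a b → ⟦ a ∨ b ⟧ ≤ ⟦ a ⟧ + ⟦ b ⟧
 h true b = m≤m+n 1 _
 h false b = ≤-refl

∣∣-== : (w : Fin n) → ∣ (λ v → v == w) ∣ ≡ 1
∣∣-== {n} w = trans (∑-cong (allFin n) (λ v → sym (*-identityʳ _))) (∑ᶠ-δ (λ _ → 1) w)

∣∣-pos : (P : Fin n → Bool) (v : Fin n) → P v ! → 1 ≤ ∣ P ∣
∣∣-pos P v e = ≤-trans (≤-reflexive (cong ⟦_⟧ (sym e))) (∑ᶠ-pt (λ v → ⟦ P v ⟧) v)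

-- Each x in `P` picks a related y in `Q`, and at most `c` of them pick the same y. Many of the size
-- estimates below are instances.
double-count : {A B : Set} (xs : List A) (ys : List B) (P : A → Bool) (Q : B → Bool)
 (R : A → B → Bool) (c : ℕ) →
 (∀ x → P x ! → 1 ≤ ∑ ys (λ y → ⟦ Q y ∧ R x y ⟧)) →
 (∀ y → Q y ! → ∑ xs (λ x → ⟦ R x y ⟧) ≤ c) →
 ∑ xs (λ x → ⟦ P x ⟧) ≤ c * ∑ ys (λ y → ⟦ Q y ⟧)
double-count xs ys P Q R c f g = begin
 ∑ xs (λ x → ⟦ P x ⟧) ≤⟨ ∑-mono xs (λ x → ⟦⟧-le (f x)) ⟩
 ∑ xs (λ x → ∑ ys (λ y → ⟦ Q y ∧ R x y ⟧)) ≡⟨ ∑-swap xs ys _ ⟩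
 ∑ ys (λ y → ∑ xs (λ x → ⟦ Q y ∧ R x y ⟧)) ≤⟨ ∑-mono ys h ⟩
 ∑ ys (λ y → c * ⟦ Q y ⟧) ≡⟨ ∑-*ˡ c ys _ ⟩
 c * ∑ ys (λ y → ⟦ Q y ⟧) ∎
 where
 h : ∀ y → ∑ xs (λ x → ⟦ Q y ∧ R x y ⟧) ≤ c * ⟦ Q y ⟧
 h y with Q y in e
 ... | true = ≤-trans (g y e) (≤-reflexive (sym (*-identityʳ c)))
 ... | false = ≤-reflexive (trans (∑-zero xs) (sym (*-zeroʳ c)))

-- Sums over function spaces; the summand need only respect pointwise equality.

module FunctionSums {A : Set} (_≈_ : A → A → Set) (≈-refl : ∀ {a} → a ≈ a) where

 Resp : ((Fin n → A) → ℕ) → Set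
 Resp F = ∀ f g → (∀ i → f i ≈ g i) → F f ≡ F g

 infixr 5 _◂_
 _◂_ : A → (Fin n → A) → Fin (suc n) → A
 (a ◂ f) zero = a
 (a ◂ f) (suc i) = f i

 ∑-allFuns-suc : (n : ℕ) (xs : List A) (F : (Fin (suc n) → A) → ℕ) → Resp F →
  ∑ (allFuns (suc n) xs) F ≡ ∑ xs (λ a → ∑ (allFuns n xs) (λ f → F (a ◂ f)))
 ∑-allFuns-suc n xs F r = trans (∑-concatMap _ xs F) (∑-cong xs λ a →
  trans (∑-map _ (allFuns n xs) F) (∑-cong (allFuns n xs) λ f →
   r _ _ λ { zero → ≈-refl ; (suc i) → ≈-refl }))

 -- Reindexing along a bijection in every coordinate. Bijectivity of `π i` enters only through
 -- `inv`, and summands need only respect `_≈_`, because functions are compared pointwise. So one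
 -- instance can act on the rows of a matrix and another on the entries of a row.
 ∑-allFuns-shift : (n : ℕ) (xs : List A) (π : Fin n → A → A) →
  (∀ i {a b} → a ≈ b → π i a ≈ π i b) →
  (∀ i (H : A → ℕ) → (∀ a b → a ≈ b → H a ≡ H b) → ∑ xs (H ∘ π i) ≡ ∑ xs H) →
  (F : (Fin n → A) → ℕ) → Resp F →
  ∑ (allFuns n xs) (λ f → F (λ i → π i (f i))) ≡ ∑ (allFuns n xs) F
 ∑-allFuns-shift zero xs π πc inv F r = cong (_+ 0) (r _ _ λ ())
 ∑-allFuns-shift (suc n) xs π πc inv F r = begin-equality
  ∑ (allFuns (suc n) xs) (λ f → F (λ i → π i (f i)))
   ≡⟨ ∑-allFuns-suc n xs (λ f → F (λ i → π i (f i))) (λ f g e → r _ _ λ i → πc i (e i)) ⟩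
  ∑ xs (λ a → ∑ (allFuns n xs) (λ f → F (λ i → π i ((a ◂ f) i))))
   ≡⟨ ∑-cong xs (λ a → ∑-cong (allFuns n xs) λ f → r _ _ λ { zero → ≈-refl ; (suc i) → ≈-refl }) ⟩
  ∑ xs (λ a → ∑ (allFuns n xs) (λ f → F (π zero a ◂ (λ i → π (suc i) (f i)))))
   ≡⟨ ∑-cong xs (λ a → ∑-allFuns-shift n xs (π ∘ suc) (λ i → πc (suc i)) (λ i → inv (suc i))
      (λ f → F (π zero a ◂ f)) (λ f g e → r _ _ λ { zero → ≈-refl ; (suc i) → e i })) ⟩
  ∑ xs (λ a → ∑ (allFuns n xs) (λ f → F (π zero a ◂ f)))
   ≡⟨ inv zero (λ a → ∑ (allFuns n xs) (λ f → F (a ◂ f)))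
      (λ a b e → ∑-cong (allFuns n xs) λ f → r _ _ λ { zero → e ; (suc i) → ≈-refl }) ⟩
  ∑ xs (λ a → ∑ (allFuns n xs) (λ f → F (a ◂ f)))
   ≡⟨ sym (∑-allFuns-suc n xs F r) ⟩
  ∑ (allFuns (suc n) xs) F ∎

length-allFuns : {A : Set} (n : ℕ) (xs : List A) → length (allFuns n xs) ≡ length xs ^ n
length-allFuns {A} n xs = trans (sym (trans (∑-const (allFuns n xs) 1) (*-identityʳ _))) (lem n)
 where
 open FunctionSums {A} _≡_ refl
 lem : ∀ n → ∑ (allFuns n xs) (λ _ → 1) ≡ length xs ^ n
 lem zero = refl
 lem (suc n) = trans (∑-allFuns-suc n xs (λ _ → 1) (λ _ _ _ → refl))
  (trans (∑-cong xs (λ _ → lem n)) (∑-const xs _))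

module BoolSums = FunctionSums {Bool} _≡_ refl

SumG : (Graph n → ℕ) → ℕ
SumG {n} = ∑ (allGraphs n)

_≗²_ : Graph n → Graph n → Set
G ≗² H = ∀ i j → G i j ≡ H i j

-- Symmetric difference with a fixed `δ` is an involution on all Boolean matrices, checked entry by
-- entry and then row by row. It makes a switching a bijection without describing its inverse.
∑-graphs-xor : (δ : Graph n) (F : Graph n → ℕ) → (∀ G H → G ≗² H → F G ≡ F H) →
 SumG (λ G → F (λ i j → G i j xor δ i j)) ≡ SumG F
∑-graphs-xor {n} δ F r =
 RowSums.∑-allFuns-shift n (allFuns n (true ∷ false ∷ []))
  (λ i row j → row j xor δ i j) (λ i e j → cong (_xor δ i j) (e j))
  (λ i H Hr → BoolSums.∑-allFuns-shift n (true ∷ false ∷ []) (λ j b → b xor δ i j)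
   (λ j e → cong (_xor δ i j) e) (λ j K _ → flip (δ i j) K) H Hr) F r
 where
 module RowSums = FunctionSums {Fin n → Bool} _≗_ (λ _ → refl)
 flip : ∀ d (K : Bool → ℕ) → K (true xor d) + (K (false xor d) + 0) ≡ K true + (K false + 0)
 flip false K = refl
 flip true K = trans (cong (K false +_) (+-identityʳ _)) (trans (+-comm (K false) _) (cong (K true +_) (sym (+-identityʳ _))))

allᵇ-tab : {A : Set} {n : ℕ} (h : Fin n → A) (p : A → Bool) →
 allᵇ (tabulate h) p ! → ∀ i → p (h i) !
allᵇ-tab h p e zero = ∧ˡ e
allᵇ-tab h p e (suc i) = allᵇ-tab (h ∘ suc) p (∧ʳ {p (h zero)} e) i

tab-allᵇ : {A : Set} {n : ℕ} (h : Fin n → A) (p : A → Bool) →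
 (∀ i → p (h i) !) → allᵇ (tabulate h) p !
tab-allᵇ {n = zero} h p f = refl
tab-allᵇ {n = suc n} h p f = true-∧ (f zero) (tab-allᵇ (h ∘ suc) p (f ∘ suc))

≡ᵇ-true : {m k : ℕ} → (m ≡ᵇ k) ! → m ≡ k
≡ᵇ-true {m} {k} e = ≡ᵇ⇒≡ m k (subst Data.Bool.T (sym e) _)

true-≡ᵇ : {m k : ℕ} → m ≡ k → (m ≡ᵇ k) !
true-≡ᵇ {zero} refl = refl
true-≡ᵇ {suc m} refl = true-≡ᵇ {m} refl

-- Cubic graphs.

record Cubic {n : ℕ} (G : Graph n) : Set where
 field
  irr : ∀ i → G i i ≡ false
  sm : ∀ i j → G i j ≡ G j i
  deg : ∀ i → ∣ G i ∣ ≡ 3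

 syms : ∀ {i j} → G i j ! → G j i !
 syms {i} {j} e = trans (sm j i) e

 edge≢ : ∀ {i j} → G i j ! → i ≢ j
 edge≢ {i} e refl = true≢false (trans (sym e) (irr i))

simple3Regular⇒Cubic : (G : Graph n) → isSimple3Regular G ! → Cubic G
simple3Regular⇒Cubic {n} G e = record
 { irr = λ i → not-true (∧ˡ (h i))
 ; sm = λ i j → ⌊⌋-true (G i j Data.Bool.≟ G j i) (allᵇ-tab id _ (∧ˡ (∧ʳ {not (G i i)} (h i))) j)
 ; deg = λ i → trans (sym (countᵇ≡∑ (G i) (allFin n)))
   (≡ᵇ-true (∧ʳ {allᵇ (allFin n) _} (∧ʳ {not (G i i)} (h i))))
 }
 where h = allᵇ-tab id _ e

Cubic⇒simple3Regular : (G : Graph n) → Cubic G → isSimple3Regular G !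
Cubic⇒simple3Regular {n} G c = tab-allᵇ id _ λ i →
 true-∧ (cong not (irr i)) (true-∧ (tab-allᵇ id _ λ j → true-⌊⌋ (G i j Data.Bool.≟ G j i) (sm i j))
  (true-≡ᵇ (trans (countᵇ≡∑ (G i) (allFin n)) (deg i))))
 where open Cubic c

Cubic-resp : {G H : Graph n} → G ≗² H → Cubic G → Cubic H
Cubic-resp {n} e c = record
 { irr = λ i → trans (sym (e i i)) (irr i)
 ; sm = λ i j → trans (sym (e i j)) (trans (sm i j) (e j i))
 ; deg = λ i → trans (∑-cong (allFin n) (λ j → cong ⟦_⟧ (sym (e i j)))) (deg i) }
 where open Cubic c

iff-≡ : {a b : Bool} → (a ! → b !) → (b ! → a !) → a ≡ b
iff-≡ {true} {b} f g = sym (f refl)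
iff-≡ {false} {true} f g = g refl
iff-≡ {false} {false} f g = refl

cub : Graph n → Bool
cub = isSimple3Regular

-- Reindexing sums over `allGraphs` changes its entries up to pointwise equality only, so every
-- summand has to be shown invariant.
cub-resp : {G H : Graph n} → G ≗² H → cub G ≡ cub H
cub-resp {G = G} {H} e = iff-≡
 (λ p → Cubic⇒simple3Regular H (Cubic-resp e (simple3Regular⇒Cubic G p)))
 (λ p → Cubic⇒simple3Regular G (Cubic-resp (λ i j → sym (e i j)) (simple3Regular⇒Cubic H p)))

-- Edge switchings.

opaque
 isPair : (a b i j : Fin n) → Bool
 isPair a b i j = (i == a ∧ j == b) ∨ (i == b ∧ j == a)

 isPair-true : {a b i j : Fin n} → isPair a b i j ! → (i ≡ a × j ≡ b) ⊎ (i ≡ b × j ≡ a)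
 isPair-true {a = a} {b} {i} {j} e with ∨-true {i == a ∧ j == b} e
 ... | inj₁ p = inj₁ (==-true (∧ˡ p) , ==-true (∧ʳ {i == a} p))
 ... | inj₂ p = inj₂ (==-true (∧ˡ p) , ==-true (∧ʳ {i == b} p))

 true-isPair : {a b i j : Fin n} → (i ≡ a × j ≡ b) ⊎ (i ≡ b × j ≡ a) → isPair a b i j !
 true-isPair {a = a} {b} (inj₁ (refl , refl)) = true-∨ˡ _ (true-∧ (==-refl {u = a}) (==-refl {u = b}))
 true-isPair {a = a} {b} {i} {j} (inj₂ (refl , refl)) = true-∨ʳ (i == a ∧ j == b) (true-∧ (==-refl {u = b}) (==-refl {u = a}))

 isPair-deg : {a b : Fin n} → a ≢ b → ∀ i → ∣ isPair a b i ∣ ≡ ⟦ i == a ⟧ + ⟦ i == b ⟧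
 isPair-deg {n} {a} {b} a≢b i with i == a in p | i == b in q
 ... | true | true = ⊥-elim (a≢b (trans (sym (==-true p)) (==-true q)))
 ... | true | false = trans (∑-cong (allFin n) (λ j → cong ⟦_⟧ (∨f (j == b)))) (∣∣-== b)
  where
  ∨f : ∀ x → x ∨ false ≡ x
  ∨f true = refl
  ∨f false = refl
 ... | false | true = ∣∣-== a
 ... | false | false = ∑-zero (allFin n)

swap-pair : {A : Set} {i j a b : A} → (i ≡ a × j ≡ b) ⊎ (i ≡ b × j ≡ a) → (j ≡ a × i ≡ b) ⊎ (j ≡ b × i ≡ a)
swap-pair (inj₁ (p , q)) = inj₂ (q , p)
swap-pair (inj₂ (p , q)) = inj₁ (q , p)

isPair-sym : (a b i j : Fin n) → isPair a b i j ≡ isPair a b j i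
isPair-sym a b i j = iff-≡ (λ e → true-isPair (swap-pair (isPair-true e)))
 (λ e → true-isPair (swap-pair (isPair-true e)))

-- The edges uv and xy are exchanged for ux and vy. Written as a symmetric difference with four
-- pairs, the switch is an involution for fixed u, v, x, y.
module Switch {n : ℕ} (u v x y : Fin n) where

 δ : Graph n
 δ i j = (isPair u v i j xor isPair x y i j) xor (isPair u x i j xor isPair v y i j)

 toggle : Graph n → Graph n
 toggle G i j = G i j xor δ i j

 toggle-old : (G : Graph n) (i j : Fin n) →
  isPair u v i j ≡ false → isPair x y i j ≡ false → isPair u x i j ≡ false → isPair v y i j ≡ false →
  toggle G i j ≡ G i j
 toggle-old G i j p q r s rewrite p | q | r | s with G i j
 ... | true = refl
 ... | false = refl

 module _ {G : Graph n} (c : Cubic G) (uv : G u v !) (xy : G x y !)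
      (ux : G u x ≡ false) (vy : G v y ≡ false)
      (u≢v : u ≢ v) (x≢y : x ≢ y) (u≢x : u ≢ x) (u≢y : u ≢ y) (v≢x : v ≢ x) (v≢y : v ≢ y) where
  open Cubic c

  private
   along : ∀ {a b i j t} → G a b ≡ t → isPair a b i j ! → G i j ≡ t
   along {a} {b} {i} {j} e p with isPair-true {a = a} {b} {i} {j} p
   ... | inj₁ (refl , refl) = e
   ... | inj₂ (refl , refl) = trans (sm _ _) e

   apart : ∀ {a b a' b' i j : Fin n} → a ≢ a' → a ≢ b' → isPair a b i j ! → isPair a' b' i j ≡ false
   apart {a} {b} {a'} {b'} {i} {j} p q e = ¬true λ e' → h (isPair-true {a = a} {b} {i} {j} e) (isPair-true {a = a'} {b'} {i} {j} e')
    where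
    h : ∀ {i j} → (i ≡ a × j ≡ b) ⊎ (i ≡ b × j ≡ a) → (i ≡ a' × j ≡ b') ⊎ (i ≡ b' × j ≡ a') → ⊥
    h (inj₁ (refl , _)) (inj₁ (r , _)) = p r
    h (inj₁ (refl , _)) (inj₂ (r , _)) = q r
    h (inj₂ (_ , refl)) (inj₁ (_ , r)) = q r
    h (inj₂ (_ , refl)) (inj₂ (_ , r)) = p r

   cancel : ∀ g a b c' d → (a ! → g !) → (b ! → g !) →
    (c' ! → g ≡ false) → (d ! → g ≡ false) →
    (a ! → b ≡ false) → (c' ! → d ≡ false) →
    ⟦ g xor ((a xor b) xor (c' xor d)) ⟧ + (⟦ a ⟧ + ⟦ b ⟧) ≡ ⟦ g ⟧ + (⟦ c' ⟧ + ⟦ d ⟧)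
   cancel true true true _ _ _ _ _ _ h _ = ⊥-elim (true≢false (h refl))
   cancel false true _ _ _ h _ _ _ _ _ = ⊥-elim (true≢false (sym (h refl)))
   cancel false false true _ _ _ h _ _ _ _ = ⊥-elim (true≢false (sym (h refl)))
   cancel true false _ true _ _ _ h _ _ _ = ⊥-elim (true≢false (h refl))
   cancel true true false true _ _ _ h _ _ _ = ⊥-elim (true≢false (h refl))
   cancel true false _ false true _ _ _ h _ _ = ⊥-elim (true≢false (h refl))
   cancel true true false false true _ _ _ h _ _ = ⊥-elim (true≢false (h refl))
   cancel false false false true true _ _ _ _ _ h = ⊥-elim (true≢false (h refl))
   cancel true true false false false _ _ _ _ _ _ = refl
   cancel true false true false false _ _ _ _ _ _ = refl
   cancel true false false false false _ _ _ _ _ _ = refl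
   cancel false false false true false _ _ _ _ _ _ = refl
   cancel false false false false true _ _ _ _ _ _ = refl
   cancel false false false false false _ _ _ _ _ _ = refl

   -- Pointwise balance between removed and added pairs. Summed over j it preserves degrees, since
   -- each of u, v, x, y lies in one removed and in one added pair.
   local : ∀ i j → ⟦ toggle G i j ⟧ + (⟦ isPair u v i j ⟧ + ⟦ isPair x y i j ⟧)
          ≡ ⟦ G i j ⟧ + (⟦ isPair u x i j ⟧ + ⟦ isPair v y i j ⟧)
   local i j = cancel (G i j) _ _ _ _ (along uv) (along xy) (along ux) (along vy)
    (apart {u} {v} {x} {y} u≢x u≢y) (apart {u} {x} {v} {y} u≢v u≢y)

   rows : ∀ {a b a' b' : Fin n} → a ≢ b → a' ≢ b' → ∀ i →
    ∑ᶠ (λ j → ⟦ isPair a b i j ⟧ + ⟦ isPair a' b' i j ⟧) ≡ (⟦ i == a ⟧ + ⟦ i == b ⟧) + (⟦ i == a' ⟧ + ⟦ i == b' ⟧)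
   rows p q i = trans (∑-+ (allFin n) _ _) (cong₂ _+_ (isPair-deg p i) (isPair-deg q i))

   comm4 : ∀ a b c d → (a + b) + (c + d) ≡ (a + c) + (b + d)
   comm4 a b c d = begin-equality
    (a + b) + (c + d) ≡⟨ +-assoc a b _ ⟩
    a + (b + (c + d)) ≡⟨ cong (a +_) (trans (sym (+-assoc b c d)) (trans (cong (_+ d) (+-comm b c)) (+-assoc c b d))) ⟩
    a + (c + (b + d)) ≡⟨ sym (+-assoc a c _) ⟩
    (a + c) + (b + d) ∎

   δ-sym : ∀ i j → δ i j ≡ δ j i
   δ-sym i j rewrite isPair-sym u v i j | isPair-sym x y i j | isPair-sym u x i j | isPair-sym v y i j = refl

   off : ∀ {a b : Fin n} → a ≢ b → ∀ i → isPair a b i i ≡ false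
   off {a} {b} p i = ¬true λ e → h (isPair-true {a = a} {b} {i} {i} e)
    where
    h : (i ≡ a × i ≡ b) ⊎ (i ≡ b × i ≡ a) → ⊥
    h (inj₁ (q , r)) = p (trans (sym q) r)
    h (inj₂ (q , r)) = p (trans (sym r) q)

  toggle-Cubic : Cubic (toggle G)
  toggle-Cubic = record
   { irr = λ i → trans (toggle-old G i i (off u≢v i) (off x≢y i) (off u≢x i) (off v≢y i)) (irr i)
   ; sm = λ i j → cong₂ _xor_ (sm i j) (δ-sym i j)
   ; deg = λ i → +-cancelʳ-≡ ((⟦ i == u ⟧ + ⟦ i == v ⟧) + (⟦ i == x ⟧ + ⟦ i == y ⟧)) _ _ (begin-equality
     ∣ toggle G i ∣ + ((⟦ i == u ⟧ + ⟦ i == v ⟧) + (⟦ i == x ⟧ + ⟦ i == y ⟧))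
      ≡⟨ cong (∣ toggle G i ∣ +_) (sym (rows u≢v x≢y i)) ⟩
     ∣ toggle G i ∣ + ∑ᶠ (λ j → ⟦ isPair u v i j ⟧ + ⟦ isPair x y i j ⟧)
      ≡⟨ sym (∑-+ (allFin n) _ _) ⟩
     ∑ᶠ (λ j → ⟦ toggle G i j ⟧ + (⟦ isPair u v i j ⟧ + ⟦ isPair x y i j ⟧))
      ≡⟨ ∑-cong (allFin n) (local i) ⟩
     ∑ᶠ (λ j → ⟦ G i j ⟧ + (⟦ isPair u x i j ⟧ + ⟦ isPair v y i j ⟧))
      ≡⟨ ∑-+ (allFin n) _ _ ⟩
     ∣ G i ∣ + ∑ᶠ (λ j → ⟦ isPair u x i j ⟧ + ⟦ isPair v y i j ⟧)
      ≡⟨ cong₂ _+_ (deg i) (trans (rows u≢x v≢y i) (comm4 ⟦ i == u ⟧ ⟦ i == x ⟧ ⟦ i == v ⟧ ⟦ i == y ⟧)) ⟩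
     3 + ((⟦ i == u ⟧ + ⟦ i == v ⟧) + (⟦ i == x ⟧ + ⟦ i == y ⟧)) ∎) }

  toggle-ux : toggle G u x !
  toggle-ux = eval ux (¬true λ e → h (isPair-true {a = u} {v} {u} {x} e)) (¬true λ e → h' (isPair-true {a = x} {y} {u} {x} e))
    (true-isPair {a = u} {x} {u} {x} (inj₁ (refl , refl))) (¬true λ e → h'' (isPair-true {a = v} {y} {u} {x} e))
   where
   eval : ∀ {g a b c d} → g ≡ false → a ≡ false → b ≡ false → c ! → d ≡ false → g xor ((a xor b) xor (c xor d)) !
   eval refl refl refl refl refl = refl
   h : (u ≡ u × x ≡ v) ⊎ (u ≡ v × x ≡ u) → ⊥
   h (inj₁ (_ , q)) = v≢x (sym q)
   h (inj₂ (q , _)) = u≢v q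
   h' : (u ≡ x × x ≡ y) ⊎ (u ≡ y × x ≡ x) → ⊥
   h' (inj₁ (q , _)) = u≢x q
   h' (inj₂ (q , _)) = u≢y q
   h'' : (u ≡ v × x ≡ y) ⊎ (u ≡ y × x ≡ v) → ⊥
   h'' (inj₁ (q , _)) = u≢v q
   h'' (inj₂ (q , _)) = u≢y q

  toggle-vy : toggle G v y !
  toggle-vy = eval vy (¬true λ e → h (isPair-true {a = u} {v} {v} {y} e)) (¬true λ e → h' (isPair-true {a = x} {y} {v} {y} e))
    (true-isPair {a = v} {y} {v} {y} (inj₁ (refl , refl))) (¬true λ e → h'' (isPair-true {a = u} {x} {v} {y} e))
   where
   eval : ∀ {g a b c d} → g ≡ false → a ≡ false → b ≡ false → d ! → c ≡ false → g xor ((a xor b) xor (c xor d)) !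
   eval refl refl refl refl refl = refl
   h : (v ≡ u × y ≡ v) ⊎ (v ≡ v × y ≡ u) → ⊥
   h (inj₁ (q , _)) = u≢v (sym q)
   h (inj₂ (_ , q)) = u≢y (sym q)
   h' : (v ≡ x × y ≡ y) ⊎ (v ≡ y × y ≡ x) → ⊥
   h' (inj₁ (q , _)) = v≢x q
   h' (inj₂ (q , _)) = v≢y q
   h'' : (v ≡ u × y ≡ x) ⊎ (v ≡ x × y ≡ u) → ⊥
   h'' (inj₁ (q , _)) = u≢v (sym q)
   h'' (inj₂ (q , _)) = v≢x q

-- Switching: removing one edge from a prescribed pattern multiplies the number of
-- cubic graphs containing it by order n.

hasAll : Graph n → List (Fin n × Fin n) → Bool
hasAll G [] = true
hasAll G ((a , b) ∷ E) = G a b ∧ hasAll G E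

hasAll-resp : {G H : Graph n} → G ≗² H → ∀ E → hasAll G E ≡ hasAll H E
hasAll-resp e [] = refl
hasAll-resp e ((a , b) ∷ E) = cong₂ _∧_ (e a b) (hasAll-resp e E)

embeddings : List (Fin n × Fin n) → ℕ
embeddings E = SumG (λ G → ⟦ cub G ∧ hasAll G E ⟧)

∣∣-sym : {G : Graph n} → Cubic G → ∀ y → ∑ᶠ (λ x → ⟦ G x y ⟧) ≡ 3
∣∣-sym {n} c y = trans (∑-cong (allFin n) (λ x → cong ⟦_⟧ (sm x y))) (deg y)
 where open Cubic c

module _ {n : ℕ} (T : Fin n → Bool) (E : List (Fin n × Fin n)) (u v : Fin n)
 (uT : T u !) (vT : T v !) (u≢v : u ≢ v)
 (ET : All (λ e → T (proj₁ e) ! × T (proj₂ e) ! × isPair u v (proj₁ e) (proj₂ e) ≡ false) E) where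

 private
  A : Graph n → Fin n → Fin n → Bool
  A G x y = (cub G ∧ hasAll G ((u , v) ∷ E)) ∧ (G x y ∧ ((not (T x) ∧ not (T y)) ∧ (not (G u x) ∧ not (G v y))))

  B : Graph n → Fin n → Fin n → Bool
  B G x y = (cub G ∧ hasAll G E) ∧ (G u x ∧ G v y)

  -- Apart from uv, which does not occur in the pattern, each toggled pair contains x or y and so
  -- leaves `T`.
  keep : (G : Graph n) (x y : Fin n) → T x ≡ false → T y ≡ false → ∀ E' →
   All (λ e → T (proj₁ e) ! × T (proj₂ e) ! × isPair u v (proj₁ e) (proj₂ e) ≡ false) E' →
   hasAll G E' ! → hasAll (Switch.toggle u v x y G) E' !
  keep G x y fx fy [] [] h = refl
  keep G x y fx fy ((a , b) ∷ E') ((ta , tb , nb) ∷ ps) h =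
   true-∧ (trans (Switch.toggle-old u v x y G a b nb (k x y (inj₁ fx)) (k u x (inj₂ fx)) (k v y (inj₂ fy))) (∧ˡ h))
       (keep G x y fx fy E' ps (∧ʳ {G a b} h))
   where
   clash : ∀ {s t} → T s ! → T t ≡ false → s ≢ t
   clash p q refl = true≢false (trans (sym p) q)
   k : ∀ s t → T s ≡ false ⊎ T t ≡ false → isPair s t a b ≡ false
   k s t f = ¬true λ e → h' (isPair-true {a = s} {t} {a} {b} e) f
    where
    h' : (a ≡ s × b ≡ t) ⊎ (a ≡ t × b ≡ s) → T s ≡ false ⊎ T t ≡ false → ⊥
    h' (inj₁ (p , q)) (inj₁ r) = clash ta r p
    h' (inj₁ (p , q)) (inj₂ r) = clash tb r q
    h' (inj₂ (p , q)) (inj₁ r) = clash tb r q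
    h' (inj₂ (p , q)) (inj₂ r) = clash ta r p

  A⇒B : ∀ G x y → A G x y ! → B (Switch.toggle u v x y G) x y !
  A⇒B G x y e = true-∧
   (true-∧ (Cubic⇒simple3Regular _ (Sw.toggle-Cubic c uv xy ux vy u≢v x≢y u≢x u≢y v≢x v≢y))
       (keep G x y Tx Ty E ET (∧ʳ {G u v} hE)))
   (true-∧ (Sw.toggle-ux c uv xy ux vy u≢v x≢y u≢x u≢y v≢x v≢y)
       (Sw.toggle-vy c uv xy ux vy u≢v x≢y u≢x u≢y v≢x v≢y))
   where
   module Sw = Switch u v x y
   e₁ = ∧ˡ e
   e₂ = ∧ʳ {cub G ∧ hasAll G ((u , v) ∷ E)} e
   c = simple3Regular⇒Cubic G (∧ˡ e₁)
   hE = ∧ʳ {cub G} e₁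
   uv = ∧ˡ hE
   xy = ∧ˡ e₂
   e₃ = ∧ʳ {G x y} e₂
   e₄ = ∧ˡ e₃
   e₅ = ∧ʳ {not (T x) ∧ not (T y)} e₃
   Tx = not-true (∧ˡ e₄)
   Ty = not-true (∧ʳ {not (T x)} e₄)
   ux = not-true (∧ˡ e₅)
   vy = not-true (∧ʳ {not (G u x)} e₅)
   x≢y = Cubic.edge≢ c xy
   ne : ∀ {s t} → T s ! → T t ≡ false → s ≢ t
   ne p q refl = true≢false (trans (sym p) q)
   u≢x = ne uT Tx
   u≢y = ne uT Ty
   v≢x = ne vT Tx
   v≢y = ne vT Ty

  ∑A≤∑B : ∀ x y → SumG (λ G → ⟦ A G x y ⟧) ≤ SumG (λ G → ⟦ B G x y ⟧)
  ∑A≤∑B x y = ≤-trans (∑-mono (allGraphs n) (λ G → ⟦⟧-mono (A⇒B G x y)))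
   (≤-reflexive (∑-graphs-xor (Switch.δ u v x y) (λ G → ⟦ B G x y ⟧)
    (λ G H e → cong ⟦_⟧ (cong₂ _∧_ (cong₂ _∧_ (cub-resp e) (hasAll-resp e E)) (cong₂ _∧_ (e u x) (e v y))))))

  -- Of the 3n ordered edges xy, at most 6∣T∣ meet `T`, and at most 9 + 9 have x adjacent to u or y
  -- adjacent to v. All others admit the switch.
  many : ∀ G → 3 * n * ⟦ cub G ∧ hasAll G ((u , v) ∷ E) ⟧
        ≤ ∑ᶠ (λ x → ∑ᶠ (λ y → ⟦ A G x y ⟧)) + (6 * ∣ T ∣ + 18) * ⟦ cub G ∧ hasAll G ((u , v) ∷ E) ⟧
  many G with cub G in eq | cub G ∧ hasAll G ((u , v) ∷ E) in eq'
  ... | _ | false = ≤-trans (≤-reflexive (*-zeroʳ (3 * n))) z≤n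
  ... | false | true = ⊥-elim (true≢false (sym eq'))
  ... | true | true = begin
   3 * n * 1 ≡⟨ *-identityʳ (3 * n) ⟩
   3 * n ≡⟨ *-comm 3 n ⟩
   n * 3 ≡⟨ sym (∑ᶠ-const n 3) ⟩
   ∑ᶠ {n} (λ _ → 3) ≡⟨ ∑-cong (allFin n) (λ x → sym (deg x)) ⟩
   ∑ᶠ (λ x → ∑ᶠ (λ y → ⟦ G x y ⟧)) ≤⟨ ∑-mono (allFin n) (λ x → ≤-trans (∑-mono (allFin n) (λ y → split (G x y) (T x) (T y) (G u x) (G v y)))
    (≤-reflexive (five x))) ⟩
   ∑ᶠ (λ x → g x + (t x + (s x + (p x + q x)))) ≡⟨ ∑five ⟩
   ∑ᶠ g + (∑ᶠ t + (∑ᶠ s + (∑ᶠ p + ∑ᶠ q))) ≤⟨ +-monoʳ-≤ (∑ᶠ g) (≤-reflexive (cong₂ _+_ tt (cong₂ _+_ ss (cong₂ _+_ pp qq)))) ⟩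
   ∑ᶠ g + (3 * ∣ T ∣ + (3 * ∣ T ∣ + (9 + 9))) ≡⟨ cong (∑ᶠ g +_) (arith ∣ T ∣) ⟩
   ∑ᶠ g + (6 * ∣ T ∣ + 18) * 1 ∎
   where
   c = simple3Regular⇒Cubic G eq
   open Cubic c
   g t s p q : Fin n → ℕ
   g x = ∑ᶠ (λ y → ⟦ G x y ∧ ((not (T x) ∧ not (T y)) ∧ (not (G u x) ∧ not (G v y))) ⟧)
   t x = ∑ᶠ (λ y → ⟦ T x ⟧ * ⟦ G x y ⟧)
   s x = ∑ᶠ (λ y → ⟦ T y ⟧ * ⟦ G x y ⟧)
   p x = ∑ᶠ (λ y → ⟦ G u x ⟧ * ⟦ G x y ⟧)
   q x = ∑ᶠ (λ y → ⟦ G v y ⟧ * ⟦ G x y ⟧)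
   split : ∀ e a b c d → ⟦ e ⟧ ≤ ⟦ e ∧ ((not a ∧ not b) ∧ (not c ∧ not d)) ⟧ + (⟦ a ⟧ * ⟦ e ⟧ + (⟦ b ⟧ * ⟦ e ⟧ + (⟦ c ⟧ * ⟦ e ⟧ + ⟦ d ⟧ * ⟦ e ⟧)))
   split false _ _ _ _ = z≤n
   split true true _ _ _ = s≤s z≤n
   split true false true _ _ = s≤s z≤n
   split true false false true _ = s≤s z≤n
   split true false false false true = s≤s z≤n
   split true false false false false = s≤s z≤n
   five : ∀ x → ∑ᶠ (λ y → ⟦ G x y ∧ ((not (T x) ∧ not (T y)) ∧ (not (G u x) ∧ not (G v y))) ⟧ + (⟦ T x ⟧ * ⟦ G x y ⟧ + (⟦ T y ⟧ * ⟦ G x y ⟧ + (⟦ G u x ⟧ * ⟦ G x y ⟧ + ⟦ G v y ⟧ * ⟦ G x y ⟧))))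
       ≡ g x + (t x + (s x + (p x + q x)))
   five x = trans (∑-+ (allFin n) _ _) (cong (g x +_) (trans (∑-+ (allFin n) _ _) (cong (t x +_) (trans (∑-+ (allFin n) _ _) (cong (s x +_) (∑-+ (allFin n) _ _))))))
   ∑five : ∑ᶠ (λ x → g x + (t x + (s x + (p x + q x)))) ≡ ∑ᶠ g + (∑ᶠ t + (∑ᶠ s + (∑ᶠ p + ∑ᶠ q)))
   ∑five = trans (∑-+ (allFin n) _ _) (cong (∑ᶠ g +_) (trans (∑-+ (allFin n) _ _) (cong (∑ᶠ t +_) (trans (∑-+ (allFin n) _ _) (cong (∑ᶠ s +_) (∑-+ (allFin n) _ _))))))
   weigh : (w : Fin n → ℕ) → ∑ᶠ (λ x → ∑ᶠ (λ y → w x * ⟦ G x y ⟧)) ≡ 3 * ∑ᶠ w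
   weigh w = trans (∑-cong (allFin n) (λ x → trans (∑-*ˡ (w x) (allFin n) _) (trans (cong (w x *_) (deg x)) (*-comm (w x) 3)))) (∑-*ˡ 3 (allFin n) w)
   weigh' : (w : Fin n → ℕ) → ∑ᶠ (λ x → ∑ᶠ (λ y → w y * ⟦ G x y ⟧)) ≡ 3 * ∑ᶠ w
   weigh' w = trans (∑-swap (allFin n) (allFin n) _) (trans (∑-cong (allFin n) (λ y → trans (∑-*ˡ (w y) (allFin n) _) (trans (cong (w y *_) (∣∣-sym c y)) (*-comm (w y) 3)))) (∑-*ˡ 3 (allFin n) w))
   tt : ∑ᶠ t ≡ 3 * ∣ T ∣
   tt = weigh (λ x → ⟦ T x ⟧)
   ss : ∑ᶠ s ≡ 3 * ∣ T ∣
   ss = weigh' (λ x → ⟦ T x ⟧)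
   pp : ∑ᶠ p ≡ 9
   pp = trans (weigh (λ x → ⟦ G u x ⟧)) (cong (3 *_) (deg u))
   qq : ∑ᶠ q ≡ 9
   qq = trans (weigh' (λ x → ⟦ G v x ⟧)) (cong (3 *_) (deg v))
   arith : ∀ k → 3 * k + (3 * k + 18) ≡ (6 * k + 18) * 1
   arith k = trans (sym (+-assoc (3 * k) (3 * k) 18)) (trans (cong (_+ 18) (sym (*-distribʳ-+ k 3 3))) (sym (*-identityʳ _)))

 -- Double counting of switches: a graph containing the pattern together with uv admits about 3n of
 -- them, whereas a graph containing `E` arises from at most 9, because afterwards x is a neighbour
 -- of u and y is a neighbour of v.
 switching : 3 * n * embeddings ((u , v) ∷ E) ≤ 9 * embeddings E + (6 * ∣ T ∣ + 18) * embeddings ((u , v) ∷ E)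
 switching = begin
  3 * n * embeddings ((u , v) ∷ E)
   ≡⟨ sym (∑-*ˡ (3 * n) (allGraphs n) _) ⟩
  SumG (λ G → 3 * n * ⟦ cub G ∧ hasAll G ((u , v) ∷ E) ⟧)
   ≤⟨ ∑-mono (allGraphs n) many ⟩
  SumG (λ G → ∑ᶠ (λ x → ∑ᶠ (λ y → ⟦ A G x y ⟧)) + (6 * ∣ T ∣ + 18) * ⟦ cub G ∧ hasAll G ((u , v) ∷ E) ⟧)
   ≡⟨ trans (∑-+ (allGraphs n) _ _) (cong₂ _+_ sw (∑-*ˡ (6 * ∣ T ∣ + 18) (allGraphs n) _)) ⟩
  ∑ᶠ (λ x → ∑ᶠ (λ y → SumG (λ G → ⟦ A G x y ⟧))) + (6 * ∣ T ∣ + 18) * embeddings ((u , v) ∷ E)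
   ≤⟨ +-monoˡ-≤ _ (∑-mono (allFin n) (λ x → ∑-mono (allFin n) (λ y → ∑A≤∑B x y))) ⟩
  ∑ᶠ (λ x → ∑ᶠ (λ y → SumG (λ G → ⟦ B G x y ⟧))) + (6 * ∣ T ∣ + 18) * embeddings ((u , v) ∷ E)
   ≤⟨ +-monoˡ-≤ _ (≤-trans (≤-reflexive sw') (≤-trans (∑-mono (allGraphs n) nine) (≤-reflexive (∑-*ˡ 9 (allGraphs n) _)))) ⟩
  9 * embeddings E + (6 * ∣ T ∣ + 18) * embeddings ((u , v) ∷ E) ∎
  where
  sw : SumG (λ G → ∑ᶠ (λ x → ∑ᶠ (λ y → ⟦ A G x y ⟧))) ≡ ∑ᶠ (λ x → ∑ᶠ (λ y → SumG (λ G → ⟦ A G x y ⟧)))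
  sw = trans (∑-swap (allGraphs n) (allFin n) _) (∑-cong (allFin n) (λ x → ∑-swap (allGraphs n) (allFin n) _))
  sw' : ∑ᶠ (λ x → ∑ᶠ (λ y → SumG (λ G → ⟦ B G x y ⟧))) ≡ SumG (λ G → ∑ᶠ (λ x → ∑ᶠ (λ y → ⟦ B G x y ⟧)))
  sw' = sym (trans (∑-swap (allGraphs n) (allFin n) _) (∑-cong (allFin n) (λ x → ∑-swap (allGraphs n) (allFin n) _)))
  nine : ∀ G → ∑ᶠ (λ x → ∑ᶠ (λ y → ⟦ B G x y ⟧)) ≤ 9 * ⟦ cub G ∧ hasAll G E ⟧
  nine G with cub G in eq
  ... | false = ≤-reflexive (trans (∑-cong (allFin n) (λ _ → ∑-zero (allFin n))) (∑-zero (allFin n)))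
  ... | true with hasAll G E
  ... | false = ≤-reflexive (trans (∑-cong (allFin n) (λ _ → ∑-zero (allFin n))) (∑-zero (allFin n)))
  ... | true = ≤-reflexive (trans (∑-cong (allFin n) (λ x → trans (∑-cong (allFin n) (λ y → ⟦⟧-∧ (G u x) (G v y))) (trans (∑-*ˡ ⟦ G u x ⟧ (allFin n) _) (cong (⟦ G u x ⟧ *_) (Cubic.deg c v)))))
           (trans (∑-*ʳ 3 (allFin n) _) (cong (_* 3) (Cubic.deg c u))))
   where c = simple3Regular⇒Cubic G eq

-- Expected numbers of short cycles and diamonds.

elemᵇ : Fin n → List (Fin n) → Bool
elemᵇ v [] = false
elemᵇ v (w ∷ ws) = v == w ∨ elemᵇ v ws

infix 4 _∈_

_∈_ : Fin n → List (Fin n) → Set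
v ∈ l = elemᵇ v l !

distinctᵇ : List (Fin n) → Bool
distinctᵇ [] = true
distinctᵇ (v ∷ vs) = not (elemᵇ v vs) ∧ distinctᵇ vs

pathE : Fin n → List (Fin n) → List (Fin n × Fin n)
pathE v [] = []
pathE v (w ∷ ws) = (v , w) ∷ pathE w ws

lastOf : Fin n → List (Fin n) → Fin n
lastOf v [] = v
lastOf v (w ∷ ws) = lastOf w ws

∣elem∣≤ : (ws : List (Fin n)) → ∣ (λ v → elemᵇ v ws) ∣ ≤ length ws
∣elem∣≤ {n} [] = ≤-reflexive (∑-zero (allFin n))
∣elem∣≤ {n} (w ∷ ws) = ≤-trans (∣∣-∨ (λ v → v == w) (λ v → elemᵇ v ws))
 (+-mono-≤ (≤-reflexive (∣∣-== w)) (∣elem∣≤ ws))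

last-elem : (v : Fin n) (ws : List (Fin n)) → (lastOf v ws) ∈ (v ∷ ws)
last-elem v [] = true-∨ˡ false ==-refl
last-elem v (w ∷ ws) = true-∨ʳ (lastOf w ws == v) (last-elem w ws)

pathE-elem : (v : Fin n) (ws : List (Fin n)) →
 All (λ e → (proj₁ e) ∈ (v ∷ ws) × (proj₂ e) ∈ (v ∷ ws)) (pathE v ws)
pathE-elem v [] = []
pathE-elem v (w ∷ ws) = (true-∨ˡ _ ==-refl , true-∨ʳ (w == v) (true-∨ˡ _ ==-refl))
 ∷ All.map (λ {e} p → true-∨ʳ (proj₁ e == v) (proj₁ p) , true-∨ʳ (proj₂ e == v) (proj₂ p)) (pathE-elem w ws)

elem≢ : {u v : Fin n} (ws : List (Fin n)) → u ∈ ws → elemᵇ v ws ≡ false → u ≢ v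
elem≢ ws p q refl = true≢false (trans (sym p) q)

cycleE : Fin n → List (Fin n) → List (Fin n × Fin n)
cycleE v ws = (lastOf v ws , v) ∷ pathE v ws

isCycle : Graph n → Fin n → List (Fin n) → Bool
isCycle G v (w ∷ x ∷ ws) = distinctᵇ (v ∷ w ∷ x ∷ ws) ∧ hasAll G (cycleE v (w ∷ x ∷ ws))
isCycle G v _ = false

opaque
 tuples : ℕ → List (List (Fin n))
 tuples zero = [] ∷ []
 tuples {n} (suc k) = concatMap (λ v → map (v ∷_) (tuples k)) (allFin n)

 ∑-tuples-zero : (f : List (Fin n) → ℕ) → ∑ (tuples 0) f ≡ f []
 ∑-tuples-zero f = +-identityʳ (f [])

 ∑-tuples-suc : (k : ℕ) (f : List (Fin n) → ℕ) →
  ∑ (tuples (suc k)) f ≡ ∑ᶠ (λ v → ∑ (tuples k) (λ t → f (v ∷ t)))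
 ∑-tuples-suc {n} k f = trans (∑-concatMap _ (allFin n) f) (∑-cong (allFin n) (λ v → ∑-map (v ∷_) (tuples k) f))

∑-tuples-len : (k : ℕ) {f g : List (Fin n) → ℕ} → (∀ t → length t ≡ k → f t ≤ g t) →
 ∑ (tuples k) f ≤ ∑ (tuples k) g
∑-tuples-len zero {f} {g} h = subst₂ _≤_ (sym (∑-tuples-zero f)) (sym (∑-tuples-zero g)) (h [] refl)
∑-tuples-len {n} (suc k) {f} {g} h = subst₂ _≤_ (sym (∑-tuples-suc k f)) (sym (∑-tuples-suc k g))
 (∑-mono (allFin n) (λ v → ∑-tuples-len k (λ t e → h (v ∷ t) (cong suc e))))

∑-tuples-pt : (f : List (Fin n) → ℕ) (t : List (Fin n)) → f t ≤ ∑ (tuples (length t)) f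
∑-tuples-pt f [] = ≤-reflexive (sym (∑-tuples-zero f))
∑-tuples-pt f (v ∷ t) = ≤-trans (∑-tuples-pt (λ t → f (v ∷ t)) t)
 (≤-trans (∑ᶠ-pt (λ v → ∑ (tuples (length t)) (λ t → f (v ∷ t))) v) (≤-reflexive (sym (∑-tuples-suc (length t) f))))

∑-walks : {G : Graph n} → Cubic G → ∀ v k → ∑ (tuples k) (λ t → ⟦ hasAll G (pathE v t) ⟧) ≡ 3 ^ k
∑-walks c v zero = ∑-tuples-zero _
∑-walks {n} {G} c v (suc k) = begin-equality
 ∑ (tuples (suc k)) (λ t → ⟦ hasAll G (pathE v t) ⟧)
  ≡⟨ ∑-tuples-suc k _ ⟩
 ∑ᶠ (λ w → ∑ (tuples k) (λ t → ⟦ G v w ∧ hasAll G (pathE w t) ⟧))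
  ≡⟨ ∑-cong (allFin n) (λ w → trans (∑-cong (tuples k) (λ t → ⟦⟧-∧ (G v w) _)) (∑-*ˡ ⟦ G v w ⟧ (tuples k) _)) ⟩
 ∑ᶠ (λ w → ⟦ G v w ⟧ * ∑ (tuples k) (λ t → ⟦ hasAll G (pathE w t) ⟧))
  ≡⟨ ∑-cong (allFin n) (λ w → cong (⟦ G v w ⟧ *_) (∑-walks c w k)) ⟩
 ∑ᶠ (λ w → ⟦ G v w ⟧ * 3 ^ k)
  ≡⟨ ∑-*ʳ (3 ^ k) (allFin n) _ ⟩
 ∣ G v ∣ * 3 ^ k ≡⟨ cong (_* 3 ^ k) (Cubic.deg c v) ⟩
 3 * 3 ^ k ∎

∑-embeddings-walks : (k : ℕ) →
 ∑ᶠ {n} (λ v → ∑ (tuples k) (λ t → embeddings (pathE v t))) ≤ numCubic n * (n * 3 ^ k)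
∑-embeddings-walks {n} k = begin
 ∑ᶠ {n} (λ v → ∑ (tuples k) (λ t → embeddings (pathE v t)))
  ≡⟨ ∑-cong (allFin n) (λ v → ∑-swap (tuples k) (allGraphs n) _) ⟩
 ∑ᶠ {n} (λ v → SumG (λ G → ∑ (tuples k) (λ t → ⟦ cub G ∧ hasAll G (pathE v t) ⟧)))
  ≡⟨ ∑-swap (allFin n) (allGraphs n) _ ⟩
 SumG (λ G → ∑ᶠ {n} (λ v → ∑ (tuples k) (λ t → ⟦ cub G ∧ hasAll G (pathE v t) ⟧)))
  ≤⟨ ∑-mono (allGraphs n) each ⟩
 SumG {n} (λ G → ⟦ cub G ⟧ * (n * 3 ^ k))
  ≡⟨ ∑-*ʳ (n * 3 ^ k) (allGraphs n) _ ⟩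
 SumG {n} (λ G → ⟦ cub G ⟧) * (n * 3 ^ k)
  ≡⟨ cong (_* (n * 3 ^ k)) (sym (countᵇ≡∑ isSimple3Regular (allGraphs n))) ⟩
 numCubic n * (n * 3 ^ k) ∎
 where
 each : ∀ G → ∑ᶠ {n} (λ v → ∑ (tuples k) (λ t → ⟦ cub G ∧ hasAll G (pathE v t) ⟧)) ≤ ⟦ cub G ⟧ * (n * 3 ^ k)
 each G with cub G in e
 ... | false = ≤-reflexive (trans (∑-cong (allFin n) (λ _ → ∑-zero (tuples k))) (∑-zero (allFin n)))
 ... | true = ≤-reflexive (trans (∑-cong (allFin n) (λ v → ∑-walks (simple3Regular⇒Cubic G e) v k))
         (trans (∑ᶠ-const n (3 ^ k)) (sym (+-identityʳ _))))

-- For large n the error term is at most n x; moving it to the left leaves 2 n x ≤ 9 y, and 9 is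
-- rounded up to 10.
switching-absorbed : (n m x y : ℕ) → 6 * m + 18 ≤ n → 3 * n * x ≤ 9 * y + (6 * m + 18) * x → n * x ≤ 5 * y
switching-absorbed n m x y h p = *-cancelˡ-≤ 2 (+-cancelʳ-≤ (n * x) (2 * (n * x)) (2 * (5 * y)) (begin
 2 * (n * x) + n * x ≡⟨ +-comm (2 * (n * x)) (n * x) ⟩
 3 * (n * x) ≡⟨ sym (*-assoc 3 n x) ⟩
 3 * n * x ≤⟨ p ⟩
 9 * y + (6 * m + 18) * x ≤⟨ +-mono-≤ (≤-trans (*-monoˡ-≤ y (n≤1+n 9)) (≤-reflexive (*-assoc 2 5 y))) (*-monoˡ-≤ x h) ⟩
 2 * (5 * y) + n * x ∎))

module _ {n : ℕ} where

 -- Only the closing edge is switched away. The path that remains needs no further switching, as its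
 -- embeddings are summed as walks.
 cycle-switch : (v : Fin n) (t : List (Fin n)) → 6 * suc (length t) + 18 ≤ n →
  n * SumG {n} (λ G → ⟦ cub G ∧ isCycle G v t ⟧) ≤ 5 * embeddings (pathE v t)
 cycle-switch v [] h = ≤-trans (≤-reflexive (trans (cong (n *_) (trans (∑-cong (allGraphs n) (λ G → f (cub G))) (∑-zero (allGraphs n)))) (*-zeroʳ n))) z≤n
  where
  f : ∀ b → ⟦ b ∧ false ⟧ ≡ 0
  f true = refl
  f false = refl
 cycle-switch v (_ ∷ []) h = ≤-trans (≤-reflexive (trans (cong (n *_) (trans (∑-cong (allGraphs n) (λ G → f (cub G))) (∑-zero (allGraphs n)))) (*-zeroʳ n))) z≤n
  where
  f : ∀ b → ⟦ b ∧ false ⟧ ≡ 0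
  f true = refl
  f false = refl
 cycle-switch v t@(w ∷ x ∷ ws) h with distinctᵇ (v ∷ t) in d
 ... | false = ≤-trans (≤-reflexive (trans (cong (n *_) (trans (∑-cong (allGraphs n) (λ G → f (cub G))) (∑-zero (allGraphs n)))) (*-zeroʳ n))) z≤n
  where
  f : ∀ b → ⟦ b ∧ false ⟧ ≡ 0
  f true = refl
  f false = refl
 ... | true = switching-absorbed n (length (v ∷ t)) (embeddings (cycleE v t)) (embeddings (pathE v t)) h
  (≤-trans (switching T (pathE v t) u v uT (true-∨ˡ _ ==-refl) u≢v ET)
   (+-monoʳ-≤ (9 * embeddings (pathE v t)) (*-monoˡ-≤ (embeddings (cycleE v t)) (+-monoˡ-≤ 18 (*-monoʳ-≤ 6 (∣elem∣≤ (v ∷ t)))))))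
  where
  T = λ z → elemᵇ z (v ∷ t)
  u = lastOf v t
  v∉ = not-true (∧ˡ {not (elemᵇ v t)} d)
  w∉ = not-true (∧ˡ {not (elemᵇ w (x ∷ ws))} (∧ʳ {not (elemᵇ v t)} d))
  uT = last-elem v t
  u≢v : u ≢ v
  u≢v = elem≢ t (last-elem w (x ∷ ws)) v∉
  u≢w : u ≢ w
  u≢w = elem≢ (x ∷ ws) (last-elem x ws) w∉
  first : isPair u v v w ≡ false
  first = ¬true λ e → k (isPair-true e)
   where
   k : (v ≡ u × w ≡ v) ⊎ (v ≡ v × w ≡ u) → ⊥
   k (inj₁ (p , _)) = u≢v (sym p)
   k (inj₂ (_ , q)) = u≢w (sym q)
  later : {e : Fin n × Fin n} → (proj₁ e) ∈ t × (proj₂ e) ∈ t → isPair u v (proj₁ e) (proj₂ e) ≡ false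
  later {a , b} (p , q) = ¬true λ e → k (isPair-true e)
   where
   k : (a ≡ u × b ≡ v) ⊎ (a ≡ v × b ≡ u) → ⊥
   k (inj₁ (_ , r)) = elem≢ t q v∉ r
   k (inj₂ (r , _)) = elem≢ t p v∉ r
  ET : All (λ e → T (proj₁ e) ! × T (proj₂ e) ! × isPair u v (proj₁ e) (proj₂ e) ≡ false) (pathE v t)
  ET = (true-∨ˡ _ ==-refl , true-∨ʳ (w == v) (true-∨ˡ _ ==-refl) , first)
    ∷ All.map (λ {e} p → true-∨ʳ (proj₁ e == v) (proj₁ p) , true-∨ʳ (proj₂ e == v) (proj₂ p) , later {e} p) (pathE-elem w (x ∷ ws))

 -- `g` bounds the length of `t`, so the cycles counted have at most g + 1 vertices; each is counted
 -- once for either direction.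
 cyclesAt : Graph n → ℕ → Fin n → ℕ
 cyclesAt G zero v = 0
 cyclesAt G (suc g) v = ∑ (tuples {n} (suc g)) (λ t → ⟦ isCycle G v t ⟧) + cyclesAt G g v

 onShortCycle : Graph n → ℕ → Fin n → Bool
 onShortCycle G g v = 1 ≤ᵇ cyclesAt G g v

 cycleWeight : Graph n → ℕ → ℕ
 cycleWeight G g = ∑ᶠ (cyclesAt G g)

 -- A cubic graph has n · 3^k walks with k edges, and switching shows that only a proportion of
 -- about 5 / n of them closes up. The geometric sum over k gives a factor that is free of n.
 ∑-cycleWeight : (g : ℕ) → 6 * suc g + 18 ≤ n → 1 ≤ n →
  SumG {n} (λ G → ⟦ cub G ⟧ * cycleWeight G g) ≤ 5 * 3 ^ suc g * numCubic n
 ∑-cycleWeight zero h n>0 = ≤-trans (≤-reflexive (trans (∑-cong (allGraphs n) (λ G → trans (cong (⟦ cub G ⟧ *_) (∑-zero (allFin n))) (*-zeroʳ ⟦ cub G ⟧))) (∑-zero (allGraphs n)))) z≤n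
 ∑-cycleWeight (suc g) h n>0 = begin
  SumG {n} (λ G → ⟦ cub G ⟧ * cycleWeight G (suc g))
   ≡⟨ ∑-cong (allGraphs n) (λ G → trans (cong (⟦ cub G ⟧ *_) (∑-+ (allFin n) _ _)) (*-distribˡ-+ ⟦ cub G ⟧ _ _)) ⟩
  SumG {n} (λ G → ⟦ cub G ⟧ * ∑ᶠ (λ v → ∑ (tuples {n} (suc g)) (λ t → ⟦ isCycle G v t ⟧)) + ⟦ cub G ⟧ * cycleWeight G g)
   ≡⟨ ∑-+ (allGraphs n) _ _ ⟩
  SumG {n} (λ G → ⟦ cub G ⟧ * ∑ᶠ (λ v → ∑ (tuples {n} (suc g)) (λ t → ⟦ isCycle G v t ⟧))) + SumG {n} (λ G → ⟦ cub G ⟧ * cycleWeight G g)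
   ≤⟨ +-mono-≤ top (∑-cycleWeight g (≤-trans (+-monoˡ-≤ 18 (*-monoʳ-≤ 6 (n≤1+n (suc g)))) h) n>0) ⟩
  5 * 3 ^ suc g * numCubic n + 5 * 3 ^ suc g * numCubic n
   ≡⟨ sym (*-distribʳ-+ (numCubic n) (5 * 3 ^ suc g) (5 * 3 ^ suc g)) ⟩
  (5 * 3 ^ suc g + 5 * 3 ^ suc g) * numCubic n
   ≡⟨ cong (_* numCubic n) (sym (*-distribˡ-+ 5 (3 ^ suc g) (3 ^ suc g))) ⟩
  5 * (3 ^ suc g + 3 ^ suc g) * numCubic n
   ≤⟨ *-monoˡ-≤ (numCubic n) (*-monoʳ-≤ 5 (+-monoʳ-≤ (3 ^ suc g) (m≤m+n (3 ^ suc g) _))) ⟩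
  5 * 3 ^ suc (suc g) * numCubic n ∎
  where
  instance
   nz : NonZero n
   nz = >-nonZero n>0
  top : SumG {n} (λ G → ⟦ cub G ⟧ * ∑ᶠ (λ v → ∑ (tuples {n} (suc g)) (λ t → ⟦ isCycle G v t ⟧))) ≤ 5 * 3 ^ suc g * numCubic n
  top = *-cancelˡ-≤ n (begin
   n * SumG {n} (λ G → ⟦ cub G ⟧ * ∑ᶠ (λ v → ∑ (tuples {n} (suc g)) (λ t → ⟦ isCycle G v t ⟧)))
    ≡⟨ cong (n *_) reorder ⟩
   n * ∑ᶠ (λ v → ∑ (tuples {n} (suc g)) (λ t → SumG {n} (λ G → ⟦ cub G ∧ isCycle G v t ⟧)))
    ≡⟨ trans (sym (∑-*ˡ n (allFin n) _)) (∑-cong (allFin n) (λ v → sym (∑-*ˡ n (tuples {n} (suc g)) _))) ⟩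
   ∑ᶠ (λ v → ∑ (tuples {n} (suc g)) (λ t → n * SumG {n} (λ G → ⟦ cub G ∧ isCycle G v t ⟧)))
    ≤⟨ ∑-mono (allFin n) (λ v → ∑-tuples-len (suc g) (λ t e → cycle-switch v t (subst (λ k → 6 * suc k + 18 ≤ n) (sym e) h))) ⟩
   ∑ᶠ (λ v → ∑ (tuples {n} (suc g)) (λ t → 5 * embeddings (pathE v t)))
    ≡⟨ trans (∑-cong (allFin n) (λ v → ∑-*ˡ 5 (tuples {n} (suc g)) _)) (∑-*ˡ 5 (allFin n) _) ⟩
   5 * ∑ᶠ (λ v → ∑ (tuples {n} (suc g)) (λ t → embeddings (pathE v t)))
    ≤⟨ *-monoʳ-≤ 5 (∑-embeddings-walks {n} (suc g)) ⟩
   5 * (numCubic n * (n * 3 ^ suc g))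
    ≡⟨ arith (numCubic n) n (3 ^ suc g) ⟩
   n * (5 * 3 ^ suc g * numCubic n) ∎)
   where
   arith : ∀ a b c → 5 * (a * (b * c)) ≡ b * (5 * c * a)
   arith a b c = trans (cong (5 *_) (trans (*-comm a (b * c)) (*-assoc b c a)))
    (trans (trans (sym (*-assoc 5 b (c * a))) (trans (cong (_* (c * a)) (*-comm 5 b)) (*-assoc b 5 (c * a)))) (cong (b *_) (sym (*-assoc 5 c a))))
   reorder : SumG {n} (λ G → ⟦ cub G ⟧ * ∑ᶠ (λ v → ∑ (tuples {n} (suc g)) (λ t → ⟦ isCycle G v t ⟧)))
       ≡ ∑ᶠ (λ v → ∑ (tuples {n} (suc g)) (λ t → SumG {n} (λ G → ⟦ cub G ∧ isCycle G v t ⟧)))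
   reorder = trans (∑-cong (allGraphs n) (λ G → trans (sym (∑-*ˡ ⟦ cub G ⟧ (allFin n) _))
     (∑-cong (allFin n) (λ v → trans (sym (∑-*ˡ ⟦ cub G ⟧ (tuples {n} (suc g)) _)) (∑-cong (tuples {n} (suc g)) (λ t → sym (⟦⟧-∧ (cub G) (isCycle G v t))))))))
    (trans (∑-swap (allGraphs n) (allFin n) _) (∑-cong (allFin n) (λ v → ∑-swap (allGraphs n) (tuples {n} (suc g)) _)))

 -- As a subgraph, K₄ minus the edge ad, written as a path a, b, c, d with the chords ac and bd.
 isDiamond : Graph n → Fin n → List (Fin n) → Bool
 isDiamond G a (b ∷ c ∷ d ∷ []) = distinctᵇ (a ∷ b ∷ c ∷ d ∷ []) ∧ hasAll G ((a , c) ∷ (b , d) ∷ pathE a (b ∷ c ∷ d ∷ []))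
 isDiamond G a _ = false

 diamonds : Graph n → ℕ
 diamonds G = ∑ᶠ (λ a → ∑ (tuples {n} 3) (λ t → ⟦ isDiamond G a t ⟧))

 -- Two switchings, one for each chord, gain a factor 5 / n each and leave a path. Hence the
 -- expected number of diamonds is of order 1 / n, while that of short cycles merely stays bounded.
 diamond-switch : 6 * 4 + 18 ≤ n → (a b c d : Fin n) →
  n * (n * SumG {n} (λ G → ⟦ cub G ∧ isDiamond G a (b ∷ c ∷ d ∷ []) ⟧)) ≤ 25 * embeddings (pathE a (b ∷ c ∷ d ∷ []))
 diamond-switch h a b c d with distinctᵇ (a ∷ b ∷ c ∷ d ∷ []) in e
 ... | false = ≤-trans (≤-reflexive (trans (cong (λ z → n * (n * z)) (trans (∑-cong (allGraphs n) (λ G → f (cub G))) (∑-zero (allGraphs n)))) (trans (cong (n *_) (*-zeroʳ n)) (*-zeroʳ n)))) z≤n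
  where
  f : ∀ b → ⟦ b ∧ false ⟧ ≡ 0
  f true = refl
  f false = refl
 ... | true = begin
  n * (n * embeddings ((a , c) ∷ E₁)) ≤⟨ *-monoʳ-≤ n (go a c E₁ (in₁ , in₃) ne-ac ((in₂ , in₄ , off₁) ∷ (in₁ , in₂ , off₂) ∷ (in₂ , in₃ , off₃) ∷ (in₃ , in₄ , off₄) ∷ [])) ⟩
  n * (5 * embeddings E₁) ≡⟨ trans (sym (*-assoc n 5 _)) (trans (cong (_* embeddings E₁) (*-comm n 5)) (*-assoc 5 n _)) ⟩
  5 * (n * embeddings E₁) ≤⟨ *-monoʳ-≤ 5 (go b d E₀ (in₂ , in₄) ne-bd ((in₁ , in₂ , off₅) ∷ (in₂ , in₃ , off₆) ∷ (in₃ , in₄ , off₇) ∷ [])) ⟩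
  5 * (5 * embeddings E₀) ≡⟨ sym (*-assoc 5 5 (embeddings E₀)) ⟩
  25 * embeddings E₀ ∎
  where
  E₀ = pathE a (b ∷ c ∷ d ∷ [])
  E₁ = (b , d) ∷ E₀
  vs = a ∷ b ∷ c ∷ d ∷ []
  T = λ z → elemᵇ z vs
  in₁ : T a !
  in₁ = true-∨ˡ _ ==-refl
  in₂ : T b !
  in₂ = true-∨ʳ (b == a) (true-∨ˡ _ ==-refl)
  in₃ : T c !
  in₃ = true-∨ʳ (c == a) (true-∨ʳ (c == b) (true-∨ˡ _ ==-refl))
  in₄ : T d !
  in₄ = true-∨ʳ (d == a) (true-∨ʳ (d == b) (true-∨ʳ (d == c) (true-∨ˡ _ ==-refl)))
  e₁ = not-true (∧ˡ {not (elemᵇ a (b ∷ c ∷ d ∷ []))} e)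
  e' = ∧ʳ {not (elemᵇ a (b ∷ c ∷ d ∷ []))} e
  e₂ = not-true (∧ˡ {not (elemᵇ b (c ∷ d ∷ []))} e')
  e₃ = not-true (∧ˡ {not (elemᵇ c (d ∷ []))} (∧ʳ {not (elemᵇ b (c ∷ d ∷ []))} e'))
  ba : b ≢ a
  ba = elem≢ (b ∷ c ∷ d ∷ []) (true-∨ˡ _ ==-refl) e₁
  ca : c ≢ a
  ca = elem≢ (b ∷ c ∷ d ∷ []) (true-∨ʳ (c == b) (true-∨ˡ _ ==-refl)) e₁
  da : d ≢ a
  da = elem≢ (b ∷ c ∷ d ∷ []) (true-∨ʳ (d == b) (true-∨ʳ (d == c) (true-∨ˡ _ ==-refl))) e₁
  cb : c ≢ b
  cb = elem≢ (c ∷ d ∷ []) (true-∨ˡ _ ==-refl) e₂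
  db : d ≢ b
  db = elem≢ (c ∷ d ∷ []) (true-∨ʳ (d == c) (true-∨ˡ _ ==-refl)) e₂
  dc : d ≢ c
  dc = elem≢ (d ∷ []) (true-∨ˡ _ ==-refl) e₃
  ne-ac : a ≢ c
  ne-ac p = ca (sym p)
  ne-bd : b ≢ d
  ne-bd p = db (sym p)
  off : {s t x y : Fin n} → x ≢ s ⊎ y ≢ t → x ≢ t ⊎ y ≢ s → isPair s t x y ≡ false
  off p q = ¬true λ r → k p q (isPair-true r)
   where
   k : ∀ {s t x y : Fin n} → x ≢ s ⊎ y ≢ t → x ≢ t ⊎ y ≢ s → (x ≡ s × y ≡ t) ⊎ (x ≡ t × y ≡ s) → ⊥
   k (inj₁ p) _ (inj₁ (r , _)) = p r
   k (inj₂ p) _ (inj₁ (_ , r)) = p r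
   k _ (inj₁ p) (inj₂ (r , _)) = p r
   k _ (inj₂ p) (inj₂ (_ , r)) = p r
  off₁ : isPair a c b d ≡ false
  off₁ = off (inj₁ ba) (inj₂ da)
  off₂ : isPair a c a b ≡ false
  off₂ = off (inj₂ (λ p → cb (sym p))) (inj₂ ba)
  off₃ : isPair a c b c ≡ false
  off₃ = off (inj₁ ba) (inj₂ ca)
  off₄ : isPair a c c d ≡ false
  off₄ = off (inj₁ ca) (inj₂ da)
  off₅ : isPair b d a b ≡ false
  off₅ = off (inj₁ (λ p → ba (sym p))) (inj₁ (λ p → da (sym p)))
  off₆ : isPair b d b c ≡ false
  off₆ = off (inj₂ (λ p → dc (sym p))) (inj₂ cb)
  off₇ : isPair b d c d ≡ false
  off₇ = off (inj₁ cb) (inj₂ db)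
  go : ∀ u v E → T u ! × T v ! → u ≢ v →
   All (λ e → T (proj₁ e) ! × T (proj₂ e) ! × isPair u v (proj₁ e) (proj₂ e) ≡ false) E →
   n * embeddings ((u , v) ∷ E) ≤ 5 * embeddings E
  go u v E (pu , pv) ne ET = switching-absorbed n 4 (embeddings ((u , v) ∷ E)) (embeddings E) h
   (≤-trans (switching T E u v pu pv ne ET)
    (+-monoʳ-≤ (9 * embeddings E) (*-monoˡ-≤ (embeddings ((u , v) ∷ E)) (+-monoˡ-≤ 18 (*-monoʳ-≤ 6 (∣elem∣≤ vs))))))

 ∑-diamonds : 6 * 4 + 18 ≤ n → 1 ≤ n → n * SumG {n} (λ G → ⟦ cub G ⟧ * diamonds G) ≤ 675 * numCubic n
 ∑-diamonds h n>0 = *-cancelˡ-≤ n (begin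
  n * (n * SumG {n} (λ G → ⟦ cub G ⟧ * diamonds G))
   ≡⟨ cong (λ z → n * (n * z)) reorder ⟩
  n * (n * ∑ᶠ (λ v → ∑ (tuples {n} 3) (λ t → SumG {n} (λ G → ⟦ cub G ∧ isDiamond G v t ⟧))))
   ≡⟨ trans (cong (n *_) (inside _)) (inside _) ⟩
  ∑ᶠ (λ v → ∑ (tuples {n} 3) (λ t → n * (n * SumG {n} (λ G → ⟦ cub G ∧ isDiamond G v t ⟧))))
   ≤⟨ ∑-mono (allFin n) (λ v → ∑-tuples-len 3 (each v)) ⟩
  ∑ᶠ (λ v → ∑ (tuples {n} 3) (λ t → 25 * embeddings (pathE v t)))
   ≡⟨ trans (∑-cong (allFin n) (λ v → ∑-*ˡ 25 (tuples {n} 3) _)) (∑-*ˡ 25 (allFin n) _) ⟩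
  25 * ∑ᶠ {n} (λ v → ∑ (tuples {n} 3) (λ t → embeddings (pathE v t)))
   ≤⟨ *-monoʳ-≤ 25 (∑-embeddings-walks {n} 3) ⟩
  25 * (numCubic n * (n * 27))
   ≡⟨ arith (numCubic n) n ⟩
  n * (675 * numCubic n) ∎)
  where
  instance
   nz : NonZero n
   nz = >-nonZero n>0
  inside : (f : Fin n → List (Fin n) → ℕ) → n * ∑ᶠ (λ v → ∑ (tuples {n} 3) (f v)) ≡ ∑ᶠ (λ v → ∑ (tuples {n} 3) (λ t → n * f v t))
  inside f = trans (sym (∑-*ˡ n (allFin n) _)) (∑-cong (allFin n) (λ v → sym (∑-*ˡ n (tuples {n} 3) _)))
  each : ∀ v t → length t ≡ 3 → n * (n * SumG {n} (λ G → ⟦ cub G ∧ isDiamond G v t ⟧)) ≤ 25 * embeddings (pathE v t)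
  each v (b ∷ c ∷ d ∷ []) e = diamond-switch h v b c d
  arith : ∀ a b → 25 * (a * (b * 27)) ≡ b * (675 * a)
  arith a b = trans (cong (25 *_) (trans (*-comm a (b * 27)) (*-assoc b 27 a)))
   (trans (trans (sym (*-assoc 25 b (27 * a))) (trans (cong (_* (27 * a)) (*-comm 25 b)) (*-assoc b 25 (27 * a)))) (cong (b *_) (sym (*-assoc 25 27 a))))
  reorder : SumG {n} (λ G → ⟦ cub G ⟧ * diamonds G)
      ≡ ∑ᶠ (λ v → ∑ (tuples {n} 3) (λ t → SumG {n} (λ G → ⟦ cub G ∧ isDiamond G v t ⟧)))
  reorder = trans (∑-cong (allGraphs n) (λ G → trans (sym (∑-*ˡ ⟦ cub G ⟧ (allFin n) _))
    (∑-cong (allFin n) (λ v → trans (sym (∑-*ˡ ⟦ cub G ⟧ (tuples {n} 3) _)) (∑-cong (tuples {n} 3) (λ t → sym (⟦⟧-∧ (cub G) (isDiamond G v t))))))))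
   (trans (∑-swap (allGraphs n) (allFin n) _) (∑-cong (allFin n) (λ v → ∑-swap (allGraphs n) (tuples {n} 3) _)))

≤ᵇ-true : {m k : ℕ} → (m ≤ᵇ k) ! → m ≤ k
≤ᵇ-true {m} {k} e = ≤ᵇ⇒≤ m k (subst Data.Bool.T (sym e) _)

true-≤ᵇ : {m k : ℕ} → m ≤ k → (m ≤ᵇ k) !
true-≤ᵇ {zero} h = refl
true-≤ᵇ {suc m} (s≤s h) = true-<ᵇ h
 where
 true-<ᵇ : {m k : ℕ} → m ≤ k → (m <ᵇ suc k) !
 true-<ᵇ z≤n = refl
 true-<ᵇ (s≤s h) = true-<ᵇ h

atypical : ℕ → ℕ → Graph n → Bool
atypical {n} g κ G = (suc n ≤ᵇ κ * cycleWeight G g) ∨ (1 ≤ᵇ diamonds G)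

-- n times the indicator of an atypical graph is at most κ times its cycle weight plus n times its
-- number of diamonds. Both have sums of order `numCubic n`, so it suffices that n exceeds
-- `suc b * C`.
markov : (g κ b N₁ A B : ℕ) →
 (∀ n → N₁ ≤ n → 1 ≤ n × SumG {n} (λ G → ⟦ cub G ⟧ * cycleWeight {n} G g) ≤ A * numCubic n
        × n * SumG {n} (λ G → ⟦ cub G ⟧ * diamonds {n} G) ≤ B * numCubic n) →
 ∃[ N ] ∀ n → N ≤ n →
 suc b * SumG {n} (λ G → ⟦ cub G ∧ atypical {n} g κ G ⟧) ≤ numCubic n
markov g κ b N₁ A B hyp = N₁ + suc b * C , λ n le → main n (≤-trans (m≤m+n _ _) le) (≤-trans (m≤n+m _ N₁) le)
 where
 C = κ * A + B
 main : ∀ n → N₁ ≤ n → suc b * C ≤ n → suc b * SumG {n} (λ G → ⟦ cub G ∧ atypical {n} g κ G ⟧) ≤ numCubic n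
 main n h₁ h₂ = *-cancelˡ-≤ n (begin
  n * (suc b * S) ≡⟨ trans (sym (*-assoc n (suc b) S)) (trans (cong (_* S) (*-comm n (suc b))) (*-assoc (suc b) n S)) ⟩
  suc b * (n * S) ≤⟨ *-monoʳ-≤ (suc b) nS ⟩
  suc b * (C * numCubic n) ≡⟨ sym (*-assoc (suc b) C (numCubic n)) ⟩
  suc b * C * numCubic n ≤⟨ *-monoˡ-≤ (numCubic n) h₂ ⟩
  n * numCubic n ∎)
  where
  n>0 : 1 ≤ n
  n>0 = proj₁ (hyp n h₁)
  instance
   nz : NonZero n
   nz = >-nonZero n>0
  S = SumG {n} (λ G → ⟦ cub G ∧ atypical {n} g κ G ⟧)
  either : ∀ p q x y → (p ! → suc n ≤ κ * x) → (q ! → 1 ≤ y) → n * ⟦ p ∨ q ⟧ ≤ κ * (1 * x) + n * (1 * y)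
  either true q x y f g = ≤-trans (≤-reflexive (*-identityʳ n)) (≤-trans (≤-trans (n≤1+n n) (f refl))
   (≤-trans (≤-reflexive (cong (κ *_) (sym (+-identityʳ x)))) (m≤m+n _ _)))
  either false true x y f g = ≤-trans (*-monoʳ-≤ n (≤-trans (g refl) (≤-reflexive (sym (+-identityʳ y))))) (m≤n+m _ (κ * (1 * x)))
  either false false x y f g = ≤-trans (≤-reflexive (*-zeroʳ n)) z≤n
  each : ∀ G → n * ⟦ cub G ∧ atypical {n} g κ G ⟧ ≤ κ * (⟦ cub G ⟧ * cycleWeight {n} G g) + n * (⟦ cub G ⟧ * diamonds {n} G)
  each G = by (cub G)
   where
   by : ∀ b → n * ⟦ b ∧ atypical {n} g κ G ⟧ ≤ κ * (⟦ b ⟧ * cycleWeight {n} G g) + n * (⟦ b ⟧ * diamonds {n} G)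
   by false = ≤-trans (≤-reflexive (*-zeroʳ n)) z≤n
   by true = either (suc n ≤ᵇ κ * cycleWeight {n} G g) (1 ≤ᵇ diamonds {n} G) (cycleWeight {n} G g) (diamonds {n} G)
    (≤ᵇ-true {suc n} {κ * cycleWeight {n} G g}) (≤ᵇ-true {1} {diamonds {n} G})
  nS : n * S ≤ C * numCubic n
  nS = begin
   n * S ≡⟨ sym (∑-*ˡ n (allGraphs n) _) ⟩
   SumG {n} (λ G → n * ⟦ cub G ∧ atypical {n} g κ G ⟧) ≤⟨ ∑-mono (allGraphs n) each ⟩
   SumG {n} (λ G → κ * (⟦ cub G ⟧ * cycleWeight G g) + n * (⟦ cub G ⟧ * diamonds G))
    ≡⟨ trans (∑-+ (allGraphs n) _ _) (cong₂ _+_ (∑-*ˡ κ (allGraphs n) _) (∑-*ˡ n (allGraphs n) _)) ⟩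
   κ * SumG {n} (λ G → ⟦ cub G ⟧ * cycleWeight G g) + n * SumG {n} (λ G → ⟦ cub G ⟧ * diamonds G)
    ≤⟨ +-mono-≤ (*-monoʳ-≤ κ (proj₁ (proj₂ (hyp n h₁)))) (proj₂ (proj₂ (hyp n h₁))) ⟩
   κ * (A * numCubic n) + B * numCubic n
    ≡⟨ cong (_+ B * numCubic n) (sym (*-assoc κ A (numCubic n))) ⟩
   κ * A * numCubic n + B * numCubic n
    ≡⟨ sym (*-distribʳ-+ (numCubic n) (κ * A) B) ⟩
   C * numCubic n ∎

few-atypical : (g κ b : ℕ) → ∃[ N ] ∀ n → N ≤ n →
 suc b * SumG {n} (λ G → ⟦ cub G ∧ atypical {n} g κ G ⟧) ≤ numCubic n
few-atypical g κ b = markov g κ b (6 * suc g + 42) (5 * 3 ^ suc g) 675 λ n le →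
 let
  n≥42 = ≤-trans (m≤n+m 42 (6 * suc g)) le
  n>0 = ≤-trans (s≤s z≤n) n≥42
 in n>0 , ∑-cycleWeight {n} g (≤-trans (+-monoʳ-≤ (6 * suc g) (m≤m+n 18 24)) le) n>0 , ∑-diamonds {n} n≥42 n>0

-- Neighbourhoods in a cubic graph.

search : (P : Fin n → Bool) → (∃[ v ] P v !) ⊎ (∀ v → P v ≡ false)
search {zero} P = inj₂ λ ()
search {suc n} P with P zero in e
... | true = inj₁ (zero , e)
... | false with search (P ∘ suc)
... | inj₁ (v , p) = inj₁ (suc v , p)
... | inj₂ f = inj₂ λ { zero → e ; (suc v) → f v }

_∖_ : (Fin n → Bool) → Fin n → Fin n → Bool
(P ∖ a) v = P v ∧ not (v == a)

∖-true : {P : Fin n → Bool} {a v : Fin n} → (P ∖ a) v ! → P v ! × v ≢ a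
∖-true {P = P} {a} {v} e = ∧ˡ e , λ { refl → true≢false (trans (sym ==-refl) (not-true (∧ʳ {P v} e))) }

true-∖ : {P : Fin n → Bool} {a v : Fin n} → P v ! → v ≢ a → (P ∖ a) v !
true-∖ p ne = true-∧ p (cong not (≢-== ne))

∣∖∣ : (P : Fin n → Bool) (a : Fin n) → P a ! → ∣ P ∣ ≡ suc ∣ P ∖ a ∣
∣∖∣ {n} P a pa = begin-equality
 ∣ P ∣ ≡⟨ ∑-cong (allFin n) point ⟩
 ∑ᶠ (λ v → ⟦ v == a ⟧ * 1 + ⟦ (P ∖ a) v ⟧) ≡⟨ ∑-+ (allFin n) _ _ ⟩
 ∑ᶠ (λ v → ⟦ v == a ⟧ * 1) + ∣ P ∖ a ∣ ≡⟨ cong (_+ ∣ P ∖ a ∣) (∑ᶠ-δ (λ _ → 1) a) ⟩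
 suc ∣ P ∖ a ∣ ∎
 where
 point : ∀ v → ⟦ P v ⟧ ≡ ⟦ v == a ⟧ * 1 + ⟦ P v ∧ not (v == a) ⟧
 point v with v == a in e
 ... | true rewrite ==-true e | pa = refl
 ... | false with P v
 ... | true = refl
 ... | false = refl

∣∣-0 : (P : Fin n → Bool) → ∣ P ∣ ≡ 0 → ∀ v → P v ≡ false
∣∣-0 P e v = ¬true λ p → 1+n≰n (≤-trans (∣∣-pos P v p) (≤-reflexive e))

∣∣-witness : {n k : ℕ} (P : Fin n → Bool) → ∣ P ∣ ≡ suc k → ∃[ v ] P v !
∣∣-witness {n} P e with search P
... | inj₁ w = w
... | inj₂ f = ⊥-elim (0≢1+n (trans (sym (∣∣-empty f)) e))

record Nbrs {n : ℕ} (G : Graph n) (v : Fin n) : Set where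
 field
  a b c : Fin n
  va : G v a !
  vb : G v b !
  vc : G v c !
  a≢b : a ≢ b
  a≢c : a ≢ c
  b≢c : b ≢ c
  only : ∀ w → G v w ! → w ≡ a ⊎ w ≡ b ⊎ w ≡ c

three-only : (P : Fin n → Bool) (a b c : Fin n) → ∣ ((P ∖ a) ∖ b) ∖ c ∣ ≡ 0 →
 ∀ w → P w ! → w ≡ a ⊎ w ≡ b ⊎ w ≡ c
three-only P a b c e w p = by (w ≟ᶠ a) (w ≟ᶠ b) (w ≟ᶠ c)
 where
 by : Dec (w ≡ a) → Dec (w ≡ b) → Dec (w ≡ c) → w ≡ a ⊎ w ≡ b ⊎ w ≡ c
 by (yes x) _ _ = inj₁ x
 by (no _) (yes x) _ = inj₂ (inj₁ x)
 by (no _) (no _) (yes x) = inj₂ (inj₂ x)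
 by (no x) (no y) (no z) = ⊥-elim (true≢false (trans (sym (true-∖ {P = (P ∖ a) ∖ b} (true-∖ {P = P ∖ a} (true-∖ {P = P} p x) y) z)) (∣∣-0 _ e w)))

nbrs₃ : {G : Graph n} (v a b c : Fin n) → ∣ G v ∣ ≡ 3 → G v a ! → (G v ∖ a) b ! →
 ((G v ∖ a) ∖ b) c ! → Nbrs G v
nbrs₃ {n} {G} v a b c d pa pb pc = record { a = a ; b = b ; c = c ; va = pa
 ; vb = proj₁ (∖-true {P = G v} pb) ; vc = proj₁ (∖-true {P = G v} (proj₁ (∖-true {P = G v ∖ a} pc)))
 ; a≢b = λ e → proj₂ (∖-true {P = G v} pb) (sym e)
 ; a≢c = λ e → proj₂ (∖-true {P = G v} (proj₁ (∖-true {P = G v ∖ a} pc))) (sym e)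
 ; b≢c = λ e → proj₂ (∖-true {P = G v ∖ a} pc) (sym e)
 ; only = three-only (G v) a b c (suc-injective (trans (sym (∣∖∣ ((G v ∖ a) ∖ b) c pc))
       (suc-injective (trans (sym (∣∖∣ (G v ∖ a) b pb)) (suc-injective (trans (sym (∣∖∣ (G v) a pa)) d)))))) }

nbrs : {G : Graph n} → Cubic G → ∀ v → Nbrs G v
nbrs {n} {G} cG v = step₁ (∣∣-witness (G v) (Cubic.deg cG v))
 where
 step₂ : ∀ a → G v a ! → ∣ G v ∖ a ∣ ≡ 2 → (∃[ b ] (G v ∖ a) b !) → Nbrs G v
 step₂ a pa d₂ (b , pb) = let (c , pc) = ∣∣-witness ((G v ∖ a) ∖ b) (suc-injective (trans (sym (∣∖∣ (G v ∖ a) b pb)) d₂)) in nbrs₃ v a b c (Cubic.deg cG v) pa pb pc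
 step₁ : (∃[ a ] G v a !) → Nbrs G v
 step₁ (a , pa) = step₂ a pa d₂ (∣∣-witness (G v ∖ a) d₂)
  where
  d₂ : ∣ G v ∖ a ∣ ≡ 2
  d₂ = suc-injective (trans (sym (∣∖∣ (G v) a pa)) (Cubic.deg cG v))

-- Loop erasure and short cycles.

data Path {V : Set} (E : V → V → Set) : V → List V → V → Set where
 [] : ∀ {u} → Path E u [] u
 _∷_ : ∀ {u v w t} → E u v → Path E v t w → Path E u (v ∷ t) w

data Walk {V : Set} (E : V → V → Set) : ℕ → V → V → Set where
 [] : ∀ {u} → Walk E 0 u u
 _∷_ : ∀ {u v w k} → E u v → Walk E k v w → Walk E (suc k) u w

module _ {V : Set} {E : V → V → Set} where

 _+++_ : ∀ {j k u v w} → Walk E j u v → Walk E k v w → Walk E (j + k) u w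
 [] +++ q = q
 (e ∷ p) +++ q = e ∷ (p +++ q)

 snoc-walk : ∀ {k u v w} → Walk E k u v → E v w → Walk E (suc k) u w
 snoc-walk [] f = f ∷ []
 snoc-walk (e ∷ p) f = e ∷ snoc-walk p f

 reverse-walk : (∀ {x y} → E x y → E y x) → ∀ {k u v} → Walk E k u v → Walk E k v u
 reverse-walk s [] = []
 reverse-walk s (e ∷ p) = snoc-walk (reverse-walk s p) (s e)

map-walk : {V : Set} {E F : V → V → Set} → (∀ {x y} → E x y → F x y) → ∀ {k u v} → Walk E k u v → Walk F k u v
map-walk f [] = []
map-walk f (e ∷ p) = f e ∷ map-walk f p

module _ {n : ℕ} {E : Fin n → Fin n → Set} where

 cut-at : ∀ {v w} (u : Fin n) (t : List (Fin n)) → Path E v t w → distinctᵇ (v ∷ t) ! → u ∈ (v ∷ t) →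
  ∃[ t' ] Path E u t' w × distinctᵇ (u ∷ t') ! × length t' ≤ length t
 cut-at {v} u t p d e with u == v in q
 ... | true with refl ← ==-true q = t , p , d , ≤-refl
 cut-at {v} u (x ∷ t) (_ ∷ p) d e | false with cut-at u t p (∧ʳ {not (elemᵇ v (x ∷ t))} d) e
 ... | t' , p' , d' , l = t' , p' , d' , ≤-trans l (n≤1+n _)

 loop-erase : ∀ {k u w} → Walk E k u w → ∃[ t ] Path E u t w × distinctᵇ (u ∷ t) ! × length t ≤ k
 loop-erase [] = [] , [] , refl , z≤n
 loop-erase {u = u} (_∷_ {v = v} e p) with loop-erase p
 ... | t , q , d , l with elemᵇ u (v ∷ t) in m
 ... | false = v ∷ t , e ∷ q , true-∧ (cong not m) d , s≤s l
 ... | true with cut-at u t q d m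
 ... | t' , q' , d' , l' = t' , q' , d' , ≤-trans l' (≤-trans l (n≤1+n _))

module _ {n : ℕ} (G : Graph n) (c : Cubic G) where
 open Cubic c

 Avoiding : Fin n → Fin n → Fin n → Fin n → Set
 Avoiding u w x y = G x y ! × isPair u w x y ≡ false

 path-edges : ∀ {u w x t y} → Path (Avoiding u w) x t y → hasAll G (pathE x t) !
 path-edges [] = refl
 path-edges (e ∷ p) = true-∧ (proj₁ e) (path-edges p)

 path-last : ∀ {E : Fin n → Fin n → Set} {x t y} → Path E x t y → lastOf x t ≡ y
 path-last [] = refl
 path-last (e ∷ p) = path-last p

 cyclesAt-mono : ∀ v {k g} → k ≤ g → cyclesAt G k v ≤ cyclesAt G g v
 cyclesAt-mono v {zero} _ = z≤n
 cyclesAt-mono v {suc k} {suc g} (s≤s h) with m≤n⇒m<n∨m≡n h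
 ... | inj₂ refl = ≤-refl
 ... | inj₁ k<g = ≤-trans (cyclesAt-mono v k<g) (m≤n+m _ _)

 -- Loop erasure leaves a path from u to w that avoids the edge uw, hence has at least two edges,
 -- and uw closes it to a cycle. The absence of short cycles is always exploited by exhibiting such
 -- a walk.
 short-cycle : ∀ {u w k g} → G u w ! → Walk (Avoiding u w) k u w → k ≤ g → onShortCycle G g u !
 short-cycle {u} {w} {k} {g} uw p h with loop-erase p
 ... | [] , [] , _ , _ = ⊥-elim (edge≢ uw refl)
 ... | (.w ∷ []) , ((e , ne) ∷ []) , _ , _ = ⊥-elim (true≢false (trans (sym (true-isPair (inj₁ (refl , refl)))) ne))
 ... | t@(x ∷ y ∷ z) , q , d , l = true-≤ᵇ (≤-trans (≤-trans one (m≤m+n _ (cyclesAt G (suc (length z)) u)))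
     (cyclesAt-mono u (≤-trans l h)))
  where
  one : 1 ≤ ∑ (tuples {n} (suc (suc (length z)))) (λ t → ⟦ isCycle G u t ⟧)
  one = ≤-trans (≤-reflexive (sym (cong ⟦_⟧ (true-∧ d (true-∧ (trans (cong (λ r → G r u) (path-last q)) (syms uw)) (path-edges q))))))
         (∑-tuples-pt (λ t → ⟦ isCycle G u t ⟧) t)

-- Greedy colouring: a region all of whose vertices are joined, inside it, to vertices
-- having two equally coloured neighbours can be coloured, farthest vertices first.

other-than : (x y : Fin 3) → ∃[ z ] z ≢ x × z ≢ y
other-than zero zero = suc zero , (λ ()) , λ ()
other-than zero (suc zero) = suc (suc zero) , (λ ()) , λ ()
other-than zero (suc (suc zero)) = suc zero , (λ ()) , λ ()
other-than (suc zero) zero = suc (suc zero) , (λ ()) , λ ()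
other-than (suc zero) (suc zero) = zero , (λ ()) , λ ()
other-than (suc zero) (suc (suc zero)) = zero , (λ ()) , λ ()
other-than (suc (suc zero)) zero = suc zero , (λ ()) , λ ()
other-than (suc (suc zero)) (suc zero) = zero , (λ ()) , λ ()
other-than (suc (suc zero)) (suc (suc zero)) = zero , (λ ()) , λ ()

module Greedy {n : ℕ} (G : Graph n) (cG : Cubic G) where
 open Cubic cG

 Colouring : Set
 Colouring = Fin n → Fin 3

 ProperOn : (Fin n → Bool) → Colouring → Set
 ProperOn S c = ∀ i j → S i ! → S j ! → G i j ! → c i ≢ c j

 _[_≔_] : Colouring → Fin n → Fin 3 → Colouring
 (c [ v ≔ z ]) w = if w == v then z else c w

 ≔-same : ∀ c v z → (c [ v ≔ z ]) v ≡ z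
 ≔-same c v z rewrite ==-refl {u = v} = refl

 ≔-other : ∀ c v z {w} → w ≢ v → (c [ v ≔ z ]) w ≡ c w
 ≔-other c v z ne rewrite ≢-== ne = refl

 Slack : (Fin n → Bool) → Colouring → Fin n → Set
 Slack S c v = (∃[ w ] G v w ! × S w ≡ false)
       ⊎ (∃₂ λ p q → p ≢ q × G v p ! × G v q ! × c p ≡ c q)

 -- With slack, a cubic vertex sees at most two colours inside `S`: either one neighbour does not
 -- count or two neighbours share their colour.
 free-colour : ∀ S c v → Slack S c v → ∃[ z ] ∀ w → S w ! → G v w ! → z ≢ c w
 free-colour S c v s with nbrs cG v
 ... | record { a = a ; b = b ; c = d ; va = va ; vb = vb ; vc = vc ; only = only } = pick s
  where
  two : ∀ x y → (∀ w → S w ! → G v w ! → c w ≡ c x ⊎ c w ≡ c y) →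
   ∃[ z ] ∀ w → S w ! → G v w ! → z ≢ c w
  two x y f with other-than (c x) (c y)
  ... | z , p , q = z , λ w sw gw e → h (f w sw gw) e
   where
   h : ∀ {w} → c w ≡ c x ⊎ c w ≡ c y → z ≢ c w
   h (inj₁ r) e = p (trans e r)
   h (inj₂ r) e = q (trans e r)
  drop : ∀ u x y → (∀ w → G v w ! → w ≡ u ⊎ w ≡ x ⊎ w ≡ y) → S u ≡ false → ∃[ z ] ∀ w → S w ! → G v w ! → z ≢ c w
  drop u x y f su = two x y λ w sw gw → h sw (f w gw)
   where
   h : ∀ {w} → S w ! → w ≡ u ⊎ w ≡ x ⊎ w ≡ y → c w ≡ c x ⊎ c w ≡ c y
   h sw (inj₁ refl) = ⊥-elim (true≢false (trans (sym sw) su))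
   h sw (inj₂ (inj₁ refl)) = inj₁ refl
   h sw (inj₂ (inj₂ refl)) = inj₂ refl
  rot : ∀ {w : Fin n} → w ≡ a ⊎ w ≡ b ⊎ w ≡ d → w ≡ b ⊎ w ≡ a ⊎ w ≡ d
  rot (inj₁ e) = inj₂ (inj₁ e)
  rot (inj₂ (inj₁ e)) = inj₁ e
  rot (inj₂ (inj₂ e)) = inj₂ (inj₂ e)
  rot' : ∀ {w : Fin n} → w ≡ a ⊎ w ≡ b ⊎ w ≡ d → w ≡ d ⊎ w ≡ a ⊎ w ≡ b
  rot' (inj₁ e) = inj₂ (inj₁ e)
  rot' (inj₂ (inj₁ e)) = inj₂ (inj₂ e)
  rot' (inj₂ (inj₂ e)) = inj₁ e
  same : ∀ x y → c x ≡ c y → ∀ u → (∀ w → G v w ! → w ≡ u ⊎ w ≡ x ⊎ w ≡ y) → ∃[ z ] ∀ w → S w ! → G v w ! → z ≢ c w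
  same x y e u f = two u x λ w _ gw → h (f w gw)
   where
   h : ∀ {w} → w ≡ u ⊎ w ≡ x ⊎ w ≡ y → c w ≡ c u ⊎ c w ≡ c x
   h (inj₁ refl) = inj₁ refl
   h (inj₂ (inj₁ refl)) = inj₂ refl
   h (inj₂ (inj₂ refl)) = inj₂ (sym e)
  pick : Slack S c v → ∃[ z ] ∀ w → S w ! → G v w ! → z ≢ c w
  pick (inj₁ (w , gw , sw)) with only w gw
  ... | inj₁ refl = drop a b d only sw
  ... | inj₂ (inj₁ refl) = drop b a d (λ w g → rot (only w g)) sw
  ... | inj₂ (inj₂ refl) = drop d a b (λ w g → rot' (only w g)) sw
  pick (inj₂ (p , q , ne , gp , gq , e)) with only p gp | only q gq
  ... | inj₁ refl | inj₁ refl = ⊥-elim (ne refl)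
  ... | inj₂ (inj₁ refl) | inj₂ (inj₁ refl) = ⊥-elim (ne refl)
  ... | inj₂ (inj₂ refl) | inj₂ (inj₂ refl) = ⊥-elim (ne refl)
  ... | inj₁ refl | inj₂ (inj₁ refl) = same a b e d (λ w g → rot' (only w g))
  ... | inj₂ (inj₁ refl) | inj₁ refl = same a b (sym e) d (λ w g → rot' (only w g))
  ... | inj₁ refl | inj₂ (inj₂ refl) = same a d e b (λ w g → rot (only w g))
  ... | inj₂ (inj₂ refl) | inj₁ refl = same a d (sym e) b (λ w g → rot (only w g))
  ... | inj₂ (inj₁ refl) | inj₂ (inj₂ refl) = same b d e a only
  ... | inj₂ (inj₂ refl) | inj₂ (inj₁ refl) = same b d (sym e) a only

 extend : ∀ S S' c v → ProperOn S c → S v ≡ false → (∀ w → S' w ! → w ≡ v ⊎ S w !) → Slack S c v →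
  ∃[ c' ] ProperOn S' c' × (∀ w → S w ! → c' w ≡ c w)
 extend S S' c v pr sv sub sl = finish (free-colour S c v sl)
  where
  ne : ∀ {w} → S w ! → w ≢ v
  ne sw refl = true≢false (trans (sym sw) sv)
  finish : (∃[ z ] ∀ w → S w ! → G v w ! → z ≢ c w) →
   ∃[ c' ] ProperOn S' c' × (∀ w → S w ! → c' w ≡ c w)
  finish (z , f) = c [ v ≔ z ] , pr' , λ w sw → ≔-other c v z (ne sw)
   where
   by : ∀ i j → G i j ! → i ≡ v ⊎ S i ! → j ≡ v ⊎ S j ! → (c [ v ≔ z ]) i ≢ (c [ v ≔ z ]) j
   by i j g (inj₁ refl) (inj₁ refl) = ⊥-elim (edge≢ g refl)
   by i j g (inj₁ refl) (inj₂ tj) = λ e → f j tj g (trans (sym (≔-same c v z)) (trans e (≔-other c v z (ne tj))))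
   by i j g (inj₂ ti) (inj₁ refl) = λ e → f i ti (syms g) (trans (sym (≔-same c v z)) (trans (sym e) (≔-other c v z (ne ti))))
   by i j g (inj₂ ti) (inj₂ tj) = λ e → pr i j ti tj g (trans (sym (≔-other c v z (ne ti))) (trans e (≔-other c v z (ne tj))))
   pr' : ProperOn S' (c [ v ≔ z ])
   pr' i j si sj g = by i j g (sub i si) (sub j sj)

 Within : (Fin n → Bool) → Fin n → Fin n → Set
 Within W x y = G x y ! × W y !

 Twins : (Fin n → Bool) → Colouring → Fin n → Set
 Twins U c y = ∃₂ λ p q → p ≢ q × G y p ! × G y q ! × U p ! × U q ! × c p ≡ c q

 module Rooted (U W Y : Fin n → Bool) (c : Colouring) (pr : ProperOn U c)
  (disj : ∀ v → U v ! → W v ≡ false)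
  (Y⊂W : ∀ v → Y v ! → W v !)
  (root : ∀ y → Y y ! → Twins U c y)
  (walk : ∀ v → W v ! → ∃[ y ] Y y ! × Star (Within W) v y) where

  Result : Set
  Result = ∃[ c' ] ProperOn (λ v → U v ∨ W v) c' × (∀ v → U v ! → c' v ≡ c v)

  private
   rest : (Fin n → Bool) → Fin n → Bool
   rest D v = U v ∨ (W v ∧ not (D v))

   -- The order of colouring is built from its end: `D` holds the vertices that are coloured last,
   -- and it grows until it exhausts `W`.
   Postponable : (Fin n → Bool) → Set
   Postponable D = ∀ c₁ → ProperOn (rest D) c₁ → (∀ v → U v ! → c₁ v ≡ c v) → Result

   add : (Fin n → Bool) → Fin n → Fin n → Bool
   add D v w = D w ∨ w == v

   rest-split : ∀ D v w → rest D w ! → w ≡ v ⊎ rest (add D v) w !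
   rest-split D v w e with w ≟ᶠ v
   ... | yes p = inj₁ p
   ... | no ne with ∨-true {U w} e
   ... | inj₁ u = inj₂ (true-∨ˡ _ u)
   ... | inj₂ x = inj₂ (true-∨ʳ (U w) (true-∧ (∧ˡ x) (cong not (∨-false (not-true (∧ʳ {W w} x)) (≢-== ne)))))
    where
    ∨-false : ∀ {a b} → a ≡ false → b ≡ false → a ∨ b ≡ false
    ∨-false refl refl = refl

   not-rest : ∀ D v → W v ! → D v ! → rest D v ≡ false
   not-rest D v w d = ¬true λ e → h (∨-true {U v} e)
    where
    h : U v ! ⊎ (W v ∧ not (D v)) ! → ⊥
    h (inj₁ u) = true≢false (trans (sym w) (disj v u))
    h (inj₂ x) = true≢false (trans (sym d) (not-true (∧ʳ {W v} x)))

   -- Needed to see that v is uncoloured while the vertices before it are being coloured.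
   add-self : ∀ D v → add D v v !
   add-self D v = true-∨ʳ (D v) ==-refl

   -- When v is coloured just before the vertices of `D`, a neighbour in `D` is still uncoloured; a
   -- root has instead two equally coloured neighbours in `U`.
   postpone : ∀ D v → W v ! → Postponable D →
    (Y v ! ⊎ (∃[ w ] G v w ! × W w ! × D w !)) → Postponable (add D v)
   postpone D v wv q h c₁ pr₁ ag = done (extend (rest (add D v)) (rest D) c₁ v pr₁ (not-rest (add D v) v wv (add-self D v)) (rest-split D v) (slack h))
    where
    slack : (Y v ! ⊎ (∃[ w ] G v w ! × W w ! × D w !)) → Slack (rest (add D v)) c₁ v
    slack (inj₂ (w , g , ww , dw)) = inj₁ (w , g , not-rest (add D v) w ww (true-∨ˡ _ dw))
    slack (inj₁ y) with root v y
    ... | p , s , ne , gp , gs , up , us , e = inj₂ (p , s , ne , gp , gs , trans (ag p up) (trans e (sym (ag s us))))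
    done : (∃[ c' ] ProperOn (rest D) c' × (∀ w → rest (add D v) w ! → c' w ≡ c₁ w)) → Result
    done (c₂ , pr₂ , ag₂) = q c₂ pr₂ (λ w u → trans (ag₂ w (true-∨ˡ _ u)) (ag w u))

   crossing : ∀ (D : Fin n → Bool) {v y} → W v ! → D v ≡ false → Star (Within W) v y → D y ! →
    ∃[ a ] W a ! × D a ≡ false × (∃[ b ] G a b ! × W b ! × D b !)
   crossing D wv dv ε dy = ⊥-elim (true≢false (trans (sym dy) dv))
   crossing D {v} wv dv (_◅_ {j = b} (g , wb) s) dy with D b in e
   ... | true = v , wv , dv , b , g , wb , e
   ... | false = crossing D wb e s dy

   grow : ∀ m D → ∣ (λ v → W v ∧ not (D v)) ∣ ≤ m → Postponable D → Result
   grow m D le q with search (λ v → W v ∧ not (D v))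
   ... | inj₂ none = q c (λ i j ui uj → pr i j (fromU i ui) (fromU j uj)) (λ _ _ → refl)
    where
    fromU : ∀ i → rest D i ! → U i !
    fromU i r with ∨-true {U i} r
    ... | inj₁ u = u
    ... | inj₂ x = ⊥-elim (true≢false (trans (sym x) (none i)))
   ... | inj₁ (v , e) = step m le (next (walk v (∧ˡ e)))
    where
    wv = ∧ˡ {W v} e
    dv = not-true (∧ʳ {W v} e)
    Next = ∃[ a ] W a ! × D a ≡ false × (Y a ! ⊎ (∃[ w ] G a w ! × W w ! × D w !))
    next : (∃[ y ] Y y ! × Star (Within W) v y) → Next
    next (y , yy , s) with D y in dy
    ... | false = y , Y⊂W y yy , dy , inj₁ yy
    ... | true with crossing D wv dv s dy
    ... | a , wa , da , x = a , wa , da , inj₂ x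
    step : ∀ m → ∣ (λ v → W v ∧ not (D v)) ∣ ≤ m → Next → Result
    step zero le (a , wa , da , x) = ⊥-elim (1+n≰n (≤-trans (∣∣-pos (λ v → W v ∧ not (D v)) a (true-∧ wa (cong not da))) le))
    step (suc m) le (a , wa , da , x) = grow m (add D a) (s≤s⁻¹ (≤-trans smaller le)) (postpone D a wa q x)
     where
     smaller : suc ∣ (λ v → W v ∧ not (add D a v)) ∣ ≤ ∣ (λ v → W v ∧ not (D v)) ∣
     smaller = ≤-trans (s≤s (∣∣-mono {Q = (λ v → W v ∧ not (D v)) ∖ a} λ v p → true-∖ {P = λ v → W v ∧ not (D v)}
       (true-∧ (∧ˡ p) (h (D v) (not-true (∧ʳ {W v} p)))) λ { refl → true≢false (trans (sym (add-self D v)) (not-true (∧ʳ {W v} p))) }))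
      (≤-reflexive (sym (∣∖∣ (λ v → W v ∧ not (D v)) a (true-∧ wa (cong not da)))))
      where
      h : ∀ d {x} → d ∨ x ≡ false → not d !
      h false _ = refl

  rooted-colouring : Result
  rooted-colouring = grow n (λ _ → false) (∣∣≤n _) λ c₁ pr₁ ag → c₁ , (λ i j si sj → pr₁ i j (h i si) (h j sj)) , ag
   where
   h : ∀ i → U i ∨ W i ! → rest (λ _ → false) i !
   h i s with ∨-true {U i} s
   ... | inj₁ u = true-∨ˡ _ u
   ... | inj₂ w = true-∨ʳ (U i) (true-∧ w refl)

-- Brooks' theorem for cubic graphs without diamonds.

elem-++ : (v : Fin n) (xs ys : List (Fin n)) → elemᵇ v (xs ++ ys) ≡ elemᵇ v xs ∨ elemᵇ v ys
elem-++ v [] ys = refl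
elem-++ v (x ∷ xs) ys with v == x
... | true = refl
... | false = elem-++ v xs ys

elem-here : (v : Fin n) (xs : List (Fin n)) → v ∈ (v ∷ xs)
elem-here v xs = true-∨ˡ _ ==-refl

elem-there : (v x : Fin n) (xs : List (Fin n)) → v ∈ xs → v ∈ (x ∷ xs)
elem-there v x xs e = true-∨ʳ (v == x) e

elem-cons : {v x : Fin n} (xs : List (Fin n)) → v ∈ (x ∷ xs) → v ≡ x ⊎ v ∈ xs
elem-cons {v = v} {x} xs e with ∨-true {v == x} e
... | inj₁ p = inj₁ (==-true p)
... | inj₂ p = inj₂ p

elem-++ˡ : (v : Fin n) (xs ys : List (Fin n)) → v ∈ xs → v ∈ (xs ++ ys)
elem-++ˡ v xs ys e = trans (elem-++ v xs ys) (true-∨ˡ _ e)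

elem-++ʳ : (v : Fin n) (xs ys : List (Fin n)) → v ∈ ys → v ∈ (xs ++ ys)
elem-++ʳ v xs ys e = trans (elem-++ v xs ys) (true-∨ʳ (elemᵇ v xs) e)

elem-split : (v : Fin n) (xs ys : List (Fin n)) → v ∈ (xs ++ ys) → v ∈ xs ⊎ v ∈ ys
elem-split v xs ys e = ∨-true (trans (sym (elem-++ v xs ys)) e)

both-false : ∀ {a b} → a ≡ false → b ≡ false → a ∨ b ≡ false
both-false refl refl = refl

∨-falseˡ : ∀ {a b} → a ∨ b ≡ false → a ≡ false
∨-falseˡ {false} _ = refl

∨-falseʳ : ∀ a {b} → a ∨ b ≡ false → b ≡ false
∨-falseʳ false e = e

contra : ∀ {b} {A : Set} → b ! → b ≡ false → A
contra refl ()

distinct-tail : (x : Fin n) (xs : List (Fin n)) → distinctᵇ (x ∷ xs) ! → distinctᵇ xs !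
distinct-tail x xs d = ∧ʳ {not (elemᵇ x xs)} d

distinct-head : (x : Fin n) (xs : List (Fin n)) → distinctᵇ (x ∷ xs) ! → elemᵇ x xs ≡ false
distinct-head x xs d = not-true (∧ˡ {not (elemᵇ x xs)} d)

distinct-disjoint : (xs ys : List (Fin n)) → distinctᵇ (xs ++ ys) ! → ∀ v → v ∈ xs → v ∈ ys → ⊥
distinct-disjoint (x ∷ xs) ys d v ex ey with elem-cons xs ex
... | inj₁ refl = contra (elem-++ʳ v xs ys ey) (distinct-head v (xs ++ ys) d)
... | inj₂ e = distinct-disjoint xs ys (distinct-tail x (xs ++ ys) d) v e ey

distinct-++ʳ : (xs ys : List (Fin n)) → distinctᵇ (xs ++ ys) ! → distinctᵇ ys !
distinct-++ʳ [] ys d = d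
distinct-++ʳ (x ∷ xs) ys d = distinct-++ʳ xs ys (distinct-tail x (xs ++ ys) d)

lastOf-++ : (x : Fin n) (xs : List (Fin n)) (y : Fin n) (ys : List (Fin n)) → lastOf x (xs ++ y ∷ ys) ≡ lastOf y ys
lastOf-++ x [] y ys = refl
lastOf-++ x (z ∷ xs) y ys = lastOf-++ z xs y ys

last-split : (P : Fin n → Bool) (l : List (Fin n)) (v : Fin n) → v ∈ l → P v ! →
 ∃₂ λ a j → ∃[ b ] l ≡ a ++ j ∷ b × P j ! × (∀ w → w ∈ b → P w ≡ false)
last-split {n} P (x ∷ l) v e p = step (search (λ w → elemᵇ w l ∧ P w))
 where
 Goal = ∃₂ λ a j → ∃[ b ] x ∷ l ≡ a ++ j ∷ b × P j ! × (∀ w → w ∈ b → P w ≡ false)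
 step : ((∃[ w ] elemᵇ w l ∧ P w !) ⊎ (∀ w → elemᵇ w l ∧ P w ≡ false)) → Goal
 step (inj₁ (w , q)) with last-split P l w (∧ˡ q) (∧ʳ {elemᵇ w l} q)
 ... | a , j , b , refl , pj , f = x ∷ a , j , b , refl , pj , f
 step (inj₂ f) = [] , x , l , refl , px (elem-cons l e) , λ w ew → ¬true λ pw → contra (true-∧ ew pw) (f w)
  where
  px : v ≡ x ⊎ v ∈ l → P x !
  px (inj₁ refl) = p
  px (inj₂ ev) = contra (true-∧ ev p) (f v)

transition : (P : Fin n → Bool) (x : Fin n) (t : List (Fin n)) → P x ≡ false → ∀ v → v ∈ (x ∷ t) → P v ! →
 ∃₂ λ pre z → ∃₂ λ y post → x ∷ t ≡ pre ++ z ∷ y ∷ post × P z ≡ false × P y !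
transition P x [] px v e pv with elem-cons [] e
... | inj₁ refl = contra pv px
transition P x (y ∷ t) px v e pv with P y in q
... | true = [] , x , y , t , refl , px , q
... | false = deeper (elem-cons (y ∷ t) e)
 where
 deeper : v ≡ x ⊎ v ∈ (y ∷ t) → ∃₂ λ pre z → ∃₂ λ y' post → x ∷ y ∷ t ≡ pre ++ z ∷ y' ∷ post × P z ≡ false × P y' !
 deeper (inj₁ refl) = contra pv px
 deeper (inj₂ e') with transition P y t q v e' pv
 ... | pre , z , y' , post , eq , r = x ∷ pre , z , y' , post , cong (x ∷_) eq , r

module _ {n : ℕ} (G : Graph n) where

 Linked : List (Fin n) → Set
 Linked [] = ⊤
 Linked (x ∷ []) = ⊤
 Linked (x ∷ y ∷ t) = G x y ! × Linked (y ∷ t)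

 linked-tail : ∀ x t → Linked (x ∷ t) → Linked t
 linked-tail x [] _ = _
 linked-tail x (y ∷ t) (_ , l) = l

 linked-++ʳ : ∀ xs ys → Linked (xs ++ ys) → Linked ys
 linked-++ʳ [] ys l = l
 linked-++ʳ (x ∷ xs) ys l = linked-++ʳ xs ys (linked-tail x (xs ++ ys) l)

 linked-++ˡ : ∀ xs ys → Linked (xs ++ ys) → Linked xs
 linked-++ˡ [] ys l = _
 linked-++ˡ (x ∷ []) ys l = _
 linked-++ˡ (x ∷ y ∷ xs) ys (e , l) = e , linked-++ˡ (y ∷ xs) ys l

 linked-join : ∀ x xs y ys → Linked (x ∷ xs) → G (lastOf x xs) y ! → Linked (y ∷ ys) → Linked ((x ∷ xs) ++ y ∷ ys)
 linked-join x [] y ys l e m = e , m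
 linked-join x (z ∷ xs) y ys (f , l) e m = f , linked-join z xs y ys l e m

 module _ (cG : Cubic G) (W : Fin n → Bool) where
  open Cubic cG
  open Greedy G cG using (Within)

  to-head : ∀ y l → Linked (y ∷ l) → (∀ v → v ∈ (y ∷ l) → W v !) → ∀ v → v ∈ (y ∷ l) → Star (Within W) v y
  to-head y [] k h v e with elem-cons [] e
  ... | inj₁ refl = ε
  to-head y (x ∷ l) (g , k) h v e with elem-cons (x ∷ l) e
  ... | inj₁ refl = ε
  ... | inj₂ e' = to-head x l k (λ w ew → h w (elem-there w y (x ∷ l) ew)) v e' ◅◅ (syms g , h y (elem-here y (x ∷ l))) ◅ ε

  from-head : ∀ y l → Linked (y ∷ l) → (∀ v → v ∈ (y ∷ l) → W v !) → ∀ v → v ∈ (y ∷ l) → Star (Within W) y v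
  from-head y [] k h v e with elem-cons [] e
  ... | inj₁ refl = ε
  from-head y (x ∷ l) (g , k) h v e with elem-cons (x ∷ l) e
  ... | inj₁ refl = ε
  ... | inj₂ e' = (g , h x (elem-there x y (x ∷ l) (elem-here x l))) ◅ from-head x l k (λ w ew → h w (elem-there w y (x ∷ l) ew)) v e'

  connected : ∀ l → Linked l → (∀ v → v ∈ l → W v !) → ∀ v w → v ∈ l → w ∈ l → Star (Within W) v w
  connected (y ∷ l) k h v w ev ew = to-head y l k h v ev ◅◅ from-head y l k h w ew

NoDiamond : Graph n → Set
NoDiamond G = ∀ x y z w → G x y ! → G x z ! → G y z ! → G w y ! → G w z ! → x ≡ w

module Brooks {n : ℕ} (G : Graph n) (cG : Cubic G) (nd : NoDiamond G) where
 open Cubic cG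
 open Greedy G cG

 Colours : (Fin n → Bool) → Set
 Colours U = ∃[ c ] ProperOn U c

 Closed : (Fin n → Bool) → Set
 Closed U = ∀ v w → U v ! → G v w ! → U w !

 -- Otherwise the neighbours a, b, c of u span the edges ab and bc, and a and c are the tips of a
 -- diamond over the edge bu.
 nonadjacent : ∀ u → ∃₂ λ x y → G u x ! × G u y ! × x ≢ y × G x y ≡ false
 nonadjacent u = by (nbrs cG u)
  where
  by : Nbrs G u → ∃₂ λ x y → G u x ! × G u y ! × x ≢ y × G x y ≡ false
  by record { a = a ; b = b ; c = c ; va = va ; vb = vb ; vc = vc ; a≢b = ab ; a≢c = ac ; b≢c = bc } with G a b in p | G b c in q
  ... | false | _ = a , b , va , vb , ab , p
  ... | true | false = b , c , vb , vc , bc , q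
  ... | true | true = ⊥-elim (ac (nd a b u c p (syms va) (syms vb) (syms q) (syms vc)))

 _⊖_ : (Fin n → Bool) → List (Fin n) → Fin n → Bool
 (U ⊖ s) v = U v ∧ not (elemᵇ v s)

 ⊖-smaller : ∀ U s x m → x ∈ s → U x ! → ∣ U ∣ ≤ suc m → ∣ U ⊖ s ∣ ≤ m
 ⊖-smaller U s x m e ux le = s≤s⁻¹ (≤-trans (s≤s (∣∣-mono {P = U ⊖ s} {Q = U ∖ x} λ v p →
  true-∖ {P = U} (∧ˡ p) λ { refl → contra e (not-true (∧ʳ {U v} p)) })) (≤-trans (≤-reflexive (sym (∣∖∣ U x ux))) le))

 leaves : List (Fin n) → Fin n → Bool
 leaves s v = 1 ≤ᵇ ∣ (λ w → G v w ∧ not (elemᵇ w s)) ∣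

 leaves-witness : ∀ s v → leaves s v ! → ∃[ w ] G v w ! × elemᵇ w s ≡ false
 leaves-witness s v e with search (λ w → G v w ∧ not (elemᵇ w s))
 ... | inj₁ (w , p) = w , ∧ˡ p , not-true (∧ʳ {G v w} p)
 ... | inj₂ f = ⊥-elim (1+n≰n (≤-trans (≤ᵇ-true {1} e) (≤-reflexive (∣∣-empty f))))

 stays : ∀ s v → leaves s v ≡ false → ∀ w → G v w ! → w ∈ s
 stays s v e w g with elemᵇ w s in q
 ... | true = refl
 ... | false = contra (true-≤ᵇ (∣∣-pos (λ w → G v w ∧ not (elemᵇ w s)) w (true-∧ g (cong not q)))) e

 -- A vertex of the cycle `s` all of whose neighbours lie on `s` can take any colour while `s` is
 -- uncoloured. Here `z` is given to an independent set of such vertices.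
 module Recolour (U : Fin n → Bool) (s : List (Fin n)) (c : Colouring) (pr : ProperOn (U ⊖ s) c) (z : Fin 3) where

  c₁ : Colouring
  c₁ v = if elemᵇ v s then z else c v

  c₁-in : ∀ v → v ∈ s → c₁ v ≡ z
  c₁-in v e rewrite e = refl

  c₁-out : ∀ v → elemᵇ v s ≡ false → c₁ v ≡ c v
  c₁-out v e rewrite e = refl

  proper : (I : Fin n → Bool) → (∀ v → I v ! → v ∈ s × leaves s v ≡ false) →
   (∀ v w → I v ! → I w ! → G v w ! → ⊥) → ProperOn (λ v → (U ⊖ s) v ∨ I v) c₁
  proper I h ind i j si sj g = by (∨-true {(U ⊖ s) i} si) (∨-true {(U ⊖ s) j} sj)
   where
   out : ∀ {v} → (U ⊖ s) v ! → elemᵇ v s ≡ false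
   out {v} p = not-true (∧ʳ {U v} p)
   by : (U ⊖ s) i ! ⊎ I i ! → (U ⊖ s) j ! ⊎ I j ! → c₁ i ≢ c₁ j
   by (inj₁ p) (inj₁ q) e = pr i j p q g (trans (sym (c₁-out i (out p))) (trans e (c₁-out j (out q))))
   by (inj₁ p) (inj₂ q) _ = contra (stays s j (proj₂ (h j q)) i (syms g)) (out p)
   by (inj₂ p) (inj₁ q) _ = contra (stays s i (proj₂ (h i p)) j g) (out q)
   by (inj₂ p) (inj₂ q) _ = ind i j p q g

 finish : ∀ {ℓ} {Q : Colouring → Set ℓ} U (V W : Fin n → Bool) → (∀ v → U v ! → V v ∨ W v !) → (∃[ c' ] ProperOn (λ v → V v ∨ W v) c' × Q c') → Colours U
 finish U V W sub (c' , pr , _) = c' , λ i j ui uj → pr i j (sub i ui) (sub j uj)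

 -- The cycle leaves itself somewhere, and hence right after a vertex z that has no outside neighbour.
 case-open : ∀ U x t c → ProperOn (U ⊖ (x ∷ t)) c → (∀ v → v ∈ (x ∷ t) → U v !) → Closed U →
  Linked G (x ∷ t) → distinctᵇ (x ∷ t) ! → G (lastOf x t) x ! →
  leaves (x ∷ t) x ≡ false → ∀ v → v ∈ (x ∷ t) → leaves (x ∷ t) v ! → Colours U
 case-open U x t c pr s⊂U clo lk dis cyc lx v ev lv = go (transition (leaves (x ∷ t)) x t lx v ev lv)
  where
  go : (∃₂ λ pre z → ∃₂ λ y post → x ∷ t ≡ pre ++ z ∷ y ∷ post × leaves (x ∷ t) z ≡ false × leaves (x ∷ t) y !) → Colours U
  go (pre , z , y , post , eq , lz , ly) = go₂ (leaves-witness (x ∷ t) y ly)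
   where
   s = x ∷ t
   arc = y ∷ post ++ pre
   arc⇒s : ∀ v → v ∈ arc → v ∈ s
   arc⇒s v e = trans (cong (elemᵇ v) eq) (h (elem-split v (y ∷ post) pre e))
    where
    h : v ∈ (y ∷ post) ⊎ v ∈ pre → v ∈ (pre ++ z ∷ y ∷ post)
    h (inj₁ p) = elem-++ʳ v pre _ (elem-there v z (y ∷ post) p)
    h (inj₂ p) = elem-++ˡ v pre _ p
   s⇒arc : ∀ v → v ∈ s → v ≡ z ⊎ v ∈ arc
   s⇒arc v e = h (elem-split v pre _ (trans (cong (elemᵇ v) (sym eq)) e))
    where
    h : v ∈ pre ⊎ v ∈ (z ∷ y ∷ post) → v ≡ z ⊎ v ∈ arc
    h (inj₁ p) = inj₂ (elem-++ʳ v (y ∷ post) pre p)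
    h (inj₂ p) with elem-cons {v = v} (y ∷ post) p
    ... | inj₁ q = inj₁ q
    ... | inj₂ q = inj₂ (elem-++ˡ v (y ∷ post) pre q)
   dis' : distinctᵇ (pre ++ z ∷ y ∷ post) !
   dis' = trans (cong distinctᵇ (sym eq)) dis
   z∉arc : elemᵇ z arc ≡ false
   z∉arc = ¬true λ e → h (elem-split z (y ∷ post) pre e)
    where
    h : z ∈ (y ∷ post) ⊎ z ∈ pre → ⊥
    h (inj₁ p) = contra p (distinct-head z (y ∷ post) (distinct-++ʳ pre _ dis'))
    h (inj₂ p) = distinct-disjoint pre (z ∷ y ∷ post) dis' z p (elem-here z (y ∷ post))
   z∈s : z ∈ s
   z∈s = trans (cong (elemᵇ z) eq) (elem-++ʳ z pre _ (elem-here z (y ∷ post)))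
   lk' : Linked G (pre ++ z ∷ y ∷ post)
   lk' = subst (Linked G) eq lk
   lk-arc : ∀ pre → x ∷ t ≡ pre ++ z ∷ y ∷ post → Linked G pre → Linked G (y ∷ post) → Linked G (y ∷ post ++ pre)
   lk-arc [] _ _ k = subst (Linked G) (sym (++-identityʳ (y ∷ post))) k
   lk-arc (x' ∷ pre') refl k₁ k₂ = linked-join G y post x' pre' k₂
    (subst (λ l → G l x' !) (lastOf-++ x' pre' z (y ∷ post)) cyc) k₁
   zy : G z y !
   zy = proj₁ (linked-++ʳ G pre (z ∷ y ∷ post) lk')
   y∈arc : y ∈ arc
   y∈arc = elem-here y (post ++ pre)
   go₂ : (∃[ o ] G y o ! × elemᵇ o s ≡ false) → Colours U
   go₂ (o , yo , o∉s) = finish U U' W cover R.rooted-colouring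
    where
    -- z takes the colour of the outside neighbour o of y, so y sees a repeated colour. The rest of
    -- the cycle is the path `arc` starting at y, which is coloured towards y.
    open Recolour U s c pr (c o)
    U' W Y : Fin n → Bool
    U' v = (U ⊖ s) v ∨ v == z
    W v = elemᵇ v arc
    Y v = v == y
    oU : U' o !
    oU = true-∨ˡ _ (true-∧ (clo y o (s⊂U y (arc⇒s y y∈arc)) yo) (cong not o∉s))
    cover : ∀ v → U v ! → U' v ∨ W v !
    cover v u = h (elemᵇ v s) refl
     where
     h : ∀ e → elemᵇ v s ≡ e → U' v ∨ W v !
     h false q = true-∨ˡ (W v) (true-∨ˡ (v == z) (true-∧ u (cong not q)))
     h true q with s⇒arc v q
     ... | inj₁ refl = true-∨ˡ (W v) (true-∨ʳ ((U ⊖ s) v) (==-refl {u = v}))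
     ... | inj₂ r = true-∨ʳ (U' v) r
    dj : ∀ v → (U ⊖ s) v ! ⊎ v == z ! → W v ! → ⊥
    dj v (inj₁ u) w = contra (arc⇒s v w) (not-true (∧ʳ {U v} u))
    dj v (inj₂ e) w = contra (subst (λ v → W v !) (==-true e) w) z∉arc
    z≢o : z ≢ o
    z≢o refl = contra z∈s o∉s
    module R = Rooted U' W Y c₁
     (proper (λ v → v == z) (λ v e → subst (λ v → v ∈ s × leaves s v ≡ false) (sym (==-true e)) (z∈s , lz))
      (λ v w ev ew g → edge≢ g (trans (==-true ev) (sym (==-true ew)))))
     (λ v u → ¬true λ w → dj v (∨-true {(U ⊖ s) v} u) w)
     (λ v e → trans (cong W (==-true e)) y∈arc)
     (λ y' e → subst (Twins U' c₁) (sym (==-true e))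
      (z , o , z≢o , syms zy , yo , true-∨ʳ ((U ⊖ s) z) (==-refl {u = z}) , oU , trans (c₁-in z z∈s) (sym (c₁-out o o∉s))))
     (λ v w → y , ==-refl , to-head G cG W y (post ++ pre) (lk-arc pre eq (linked-++ˡ G pre _ lk') (proj₂ (linked-++ʳ G pre (z ∷ y ∷ post) lk'))) (λ _ e → e) v w)

 -- The cycle is a component of U; the neighbours a, b of x on it get the same colour.
 case-closed : ∀ U p a x b c → let s = p ++ a ∷ x ∷ b ∷ [] in ProperOn (U ⊖ s) c → (∀ v → v ∈ s → leaves s v ≡ false) →
  Linked G s → distinctᵇ s ! → G a b ≡ false → Colours U
 case-closed U p a x b c pr cl lk dis ab = go (nbrs cG x)
  where
  s = p ++ a ∷ x ∷ b ∷ []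
  I U' W Y : Fin n → Bool
  I v = v == a ∨ v == b
  U' v = (U ⊖ s) v ∨ I v
  W v = elemᵇ v (x ∷ p)
  Y v = v == x
  open Recolour U s c pr zero
  dt = distinct-++ʳ p (a ∷ x ∷ b ∷ []) dis
  lt = linked-++ʳ G p (a ∷ x ∷ b ∷ []) lk
  xa : G x a !
  xa = syms (proj₁ lt)
  xb : G x b !
  xb = proj₁ (proj₂ lt)
  a∈ : ∀ v → v ≡ a → v ∈ s
  a∈ v refl = elem-++ʳ v p _ (elem-here v (x ∷ b ∷ []))
  b∈ : ∀ v → v ≡ b → v ∈ s
  b∈ v refl = elem-++ʳ v p _ (elem-there v a (x ∷ v ∷ []) (elem-there v x (v ∷ []) (elem-here v [])))
  I∈ : ∀ v → I v ! → v ∈ s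
  I∈ v e with ∨-true {v == a} e
  ... | inj₁ q = a∈ v (==-true q)
  ... | inj₂ q = b∈ v (==-true q)
  a≢b : a ≢ b
  a≢b refl = contra (elem-there a x (a ∷ []) (elem-here a [])) (distinct-head a (x ∷ a ∷ []) dt)
  indep : ∀ v w → I v ! → I w ! → G v w ! → ⊥
  indep v w iv iw g with ∨-true {v == a} iv | ∨-true {w == a} iw
  ... | inj₁ q | inj₁ r = edge≢ g (trans (==-true q) (sym (==-true r)))
  ... | inj₂ q | inj₂ r = edge≢ g (trans (==-true q) (sym (==-true r)))
  ... | inj₁ q | inj₂ r = contra (subst₂ (λ v w → G v w !) (==-true q) (==-true r) g) ab
  ... | inj₂ q | inj₁ r = contra (syms (subst₂ (λ v w → G v w !) (==-true q) (==-true r) g)) ab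
  third : ∀ w → G x w ! → w ≢ a → w ≢ b → w ∈ p
  third w g na nb with elem-split w p _ (stays s x (cl x (elem-++ʳ x p _ (elem-there x a (x ∷ b ∷ []) (elem-here x (b ∷ []))))) w g)
  ... | inj₁ e = e
  ... | inj₂ e with elem-cons {v = w} (x ∷ b ∷ []) e
  ... | inj₁ q = ⊥-elim (na q)
  ... | inj₂ e' with elem-cons {v = w} (b ∷ []) e'
  ... | inj₁ q = ⊥-elim (edge≢ g (sym q))
  ... | inj₂ e'' with elem-cons {v = w} [] e''
  ... | inj₁ q = ⊥-elim (nb q)
  cover : ∀ v → U v ! → U' v ∨ W v !
  cover v u = h (elemᵇ v s) refl
   where
   h : ∀ e → elemᵇ v s ≡ e → U' v ∨ W v !
   h false e = true-∨ˡ _ (true-∨ˡ _ (true-∧ u (cong not e)))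
   h true e with elem-split v p _ e
   ... | inj₁ q = true-∨ʳ (U' v) (elem-there v x p q)
   ... | inj₂ q with elem-cons {v = v} (x ∷ b ∷ []) q
   ... | inj₁ refl = true-∨ˡ _ (true-∨ʳ ((U ⊖ s) v) (true-∨ˡ (v == b) (==-refl {u = v})))
   ... | inj₂ q' with elem-cons {v = v} (b ∷ []) q'
   ... | inj₁ refl = true-∨ʳ (U' v) (elem-here v p)
   ... | inj₂ q'' with elem-cons {v = v} [] q''
   ... | inj₁ refl = true-∨ˡ _ (true-∨ʳ ((U ⊖ s) v) (true-∨ʳ (v == a) (==-refl {u = v})))
  x∈s : x ∈ s
  x∈s = elem-++ʳ x p _ (elem-there x a (x ∷ b ∷ []) (elem-here x (b ∷ [])))
  W∈ : ∀ v → W v ! → v ∈ s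
  W∈ v e with elem-cons p e
  ... | inj₁ refl = x∈s
  ... | inj₂ q = elem-++ˡ v p _ q
  disj : ∀ v → U' v ! → W v ≡ false
  disj v u = ¬true λ w → h (∨-true {(U ⊖ s) v} u) w
   where
   h : (U ⊖ s) v ! ⊎ I v ! → W v ! → ⊥
   h (inj₁ q) w = contra (W∈ v w) (not-true (∧ʳ {U v} q))
   h (inj₂ q) w with ∨-true {v == a} q | elem-cons p w
   ... | inj₁ e | inj₁ e' = edge≢ xa (trans (sym e') (==-true e))
   ... | inj₂ e | inj₁ e' = edge≢ xb (trans (sym e') (==-true e))
   ... | inj₁ e | inj₂ e' = distinct-disjoint p _ dis v e' (subst (λ u → u ∈ (a ∷ x ∷ b ∷ [])) (sym (==-true e)) (elem-here a (x ∷ b ∷ [])))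
   ... | inj₂ e | inj₂ e' = distinct-disjoint p _ dis v e' (subst (λ u → u ∈ (a ∷ x ∷ b ∷ [])) (sym (==-true e)) (elem-there b a (x ∷ b ∷ []) (elem-there b x (b ∷ []) (elem-here b []))))
  -- The third neighbour of x lies on `p`, and this chord joins x to what remains of the cycle once
  -- a and b are coloured.
  with-third : (∃[ w ] G x w ! × w ≢ a × w ≢ b) → Colours U
  with-third (w , xw , wa , wb) = finish U U' W cover R.rooted-colouring
   where
   w∈p = third w xw wa wb
   walk : ∀ v → W v ! → Star (Within W) v x
   walk v e with elem-cons p e
   ... | inj₁ refl = ε
   ... | inj₂ q = connected G cG W p (linked-++ˡ G p _ lk) (λ u → elem-there u x p) v w q w∈p ◅◅ (syms xw , elem-here x p) ◅ ε
   module R = Rooted U' W Y c₁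
    (proper I (λ v e → I∈ v e , cl v (I∈ v e)) indep) disj
    (λ v e → trans (cong W (==-true e)) (elem-here x p))
    (λ y' e → subst (Twins U' c₁) (sym (==-true e))
     (a , b , a≢b , xa , xb , true-∨ʳ ((U ⊖ s) a) (true-∨ˡ (a == b) (==-refl {u = a})) , true-∨ʳ ((U ⊖ s) b) (true-∨ʳ (b == a) (==-refl {u = b})) , trans (c₁-in a (a∈ a refl)) (sym (c₁-in b (b∈ b refl)))))
    (λ v e → x , ==-refl , walk v e)
  go : Nbrs G x → Colours U
  go N = pick (N.a ≟ᶠ a) (N.a ≟ᶠ b) (N.b ≟ᶠ a) (N.b ≟ᶠ b)
   where
   module N = Nbrs N
   pick : Dec (N.a ≡ a) → Dec (N.a ≡ b) → Dec (N.b ≡ a) → Dec (N.b ≡ b) → Colours U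
   pick (no p) (no q) _ _ = with-third (N.a , N.va , p , q)
   pick _ _ (no p) (no q) = with-third (N.b , N.vb , p , q)
   pick (yes p) _ (yes q) _ = ⊥-elim (N.a≢b (trans p (sym q)))
   pick _ (yes p) _ (yes q) = ⊥-elim (N.a≢b (trans p (sym q)))
   pick (yes p) _ _ (yes q) = with-third (N.c , N.vc , (λ e → N.a≢c (trans p (sym e))) , λ e → N.b≢c (trans q (sym e)))
   pick _ (yes p) (yes q) _ = with-third (N.c , N.vc , (λ e → N.b≢c (trans q (sym e))) , λ e → N.a≢c (trans p (sym e)))

 -- The path starts as a, x, b with a and b nonadjacent and grows only at its head. So this triple
 -- stays at its end, where `case-closed` needs it.
 module Component (U : Fin n → Bool) (clo : Closed U) (ih : ∀ s x → x ∈ s → U x ! → Colours (U ⊖ s))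
  (a x b : Fin n) (ab : G a b ≡ false) where

  Tail : List (Fin n) → Set
  Tail l = ∃[ p ] l ≡ p ++ a ∷ x ∷ b ∷ []

  -- The segment up to the farthest neighbour j of y is a cycle that contains all neighbours of y,
  -- so y does not leave it. What remains is whether another vertex of the cycle does.
  closing : ∀ y t → Tail (y ∷ t) → (∀ v → v ∈ (y ∷ t) → U v !) → Linked G (y ∷ t) → distinctᵇ (y ∷ t) ! →
   leaves (y ∷ t) y ≡ false → Colours U
  closing y t (p , eq) l⊂U lk dis ly = go (last-split (G y) t w (inTail w (stays (y ∷ t) y ly w yw) yw) yw)
   where
   w = Nbrs.a (nbrs cG y)
   yw = Nbrs.va (nbrs cG y)
   inTail : ∀ v → v ∈ (y ∷ t) → G y v ! → v ∈ t
   inTail v e g with elem-cons t e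
   ... | inj₁ refl = ⊥-elim (edge≢ g refl)
   ... | inj₂ q = q
   go : (∃₂ λ q j → ∃[ r ] t ≡ q ++ j ∷ r × G y j ! × (∀ v → v ∈ r → G y v ≡ false)) → Colours U
   go (q , j , r , eqt , yj , none) = decide (ih s y (elem-here y (q ++ j ∷ [])) (l⊂U y (elem-here y t))) (search (λ v → elemᵇ v s ∧ leaves s v))
    where
    s = y ∷ q ++ j ∷ []
    eqs : y ∷ t ≡ s ++ r
    eqs = cong (y ∷_) (trans eqt (sym (++-assoc q (j ∷ []) r)))
    lks : Linked G s
    lks = linked-++ˡ G s r (subst (Linked G) eqs lk)
    diss' : distinctᵇ (s ++ r) !
    diss' = trans (cong distinctᵇ (sym eqs)) dis
    s⊂U : ∀ v → v ∈ s → U v !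
    s⊂U v e = l⊂U v (trans (cong (elemᵇ v) eqs) (elem-++ˡ v s r e))
    ys : leaves s y ≡ false
    ys = ¬true λ e → h (leaves-witness s y e)
     where
     h : (∃[ u ] G y u ! × elemᵇ u s ≡ false) → ⊥
     h (u , g , u∉) with elem-split u s r (trans (cong (elemᵇ u) (sym eqs)) (stays (y ∷ t) y ly u g))
     ... | inj₁ e = contra e u∉
     ... | inj₂ e = contra g (none u e)
    decide : Colours (U ⊖ s) → ((∃[ v ] elemᵇ v s ∧ leaves s v !) ⊎ (∀ v → elemᵇ v s ∧ leaves s v ≡ false)) → Colours U
    decide (c , pr) (inj₁ (v , e)) = case-open U y (q ++ j ∷ []) c pr s⊂U clo lks (distinct-++ˡ s r diss')
      (subst (λ z → G z y !) (sym (lastOf-++ y q j [])) (syms yj)) ys v (∧ˡ e) (∧ʳ {elemᵇ v s} e)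
     where
     distinct-++ˡ : (xs zs : List (Fin n)) → distinctᵇ (xs ++ zs) ! → distinctᵇ xs !
     distinct-++ˡ [] zs d = refl
     distinct-++ˡ (u ∷ xs) zs d = true-∧ (cong not (∨-falseˡ (trans (sym (elem-++ u xs zs)) (distinct-head u (xs ++ zs) d)))) (distinct-++ˡ xs zs (distinct-tail u (xs ++ zs) d))
    decide (c , pr) (inj₂ f) = whole r eqs
     where
     cl : ∀ v → v ∈ s → leaves s v ≡ false
     cl v e = ¬true λ k → contra (true-∧ e k) (f v)
     whole : ∀ r → y ∷ t ≡ s ++ r → Colours U
     whole [] e = subst (λ l → ProperOn (U ⊖ l) c → (∀ v → v ∈ l → leaves l v ≡ false) → Linked G l → distinctᵇ l ! → Colours U)
      (sym s≡) (λ a₁ a₂ a₃ a₄ → case-closed U p a x b c a₁ a₂ a₃ a₄ ab) pr cl lks (trans (cong distinctᵇ (trans s≡ (sym eq))) dis)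
      where
      s≡ : s ≡ p ++ a ∷ x ∷ b ∷ []
      s≡ = trans (sym (trans e (++-identityʳ s))) eq
     -- The successor u of j on the path would be a neighbour of j outside the cycle.
     whole (u ∷ r') e = ⊥-elim (distinct-disjoint s (u ∷ r') (trans (cong distinctᵇ (sym e)) dis) u
      (stays s j (cl j (elem-there j y (q ++ j ∷ []) (elem-++ʳ j q (j ∷ []) (elem-here j [])))) u
       (proj₁ (linked-++ʳ G q (j ∷ u ∷ r') (linked-tail G y (q ++ j ∷ u ∷ r') (subst (Linked G) (trans e (cong (y ∷_) (++-assoc q (j ∷ []) (u ∷ r')))) lk))))) (elem-here u r'))

  maximal : ∀ m y t → ∣ (λ v → not (elemᵇ v (y ∷ t))) ∣ ≤ m → Tail (y ∷ t) → (∀ v → v ∈ (y ∷ t) → U v !) →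
   Linked G (y ∷ t) → distinctᵇ (y ∷ t) ! → Colours U
  maximal m y t le tl l⊂U lk dis = by (leaves (y ∷ t) y) refl
   where
   by : ∀ e → leaves (y ∷ t) y ≡ e → Colours U
   by false e = closing y t tl l⊂U lk dis e
   by true e = longer m le (leaves-witness (y ∷ t) y e)
    where
    longer : ∀ m → ∣ (λ v → not (elemᵇ v (y ∷ t))) ∣ ≤ m → (∃[ w ] G y w ! × elemᵇ w (y ∷ t) ≡ false) → Colours U
    longer zero le (w , g , w∉) = ⊥-elim (1+n≰n (≤-trans (∣∣-pos (λ v → not (elemᵇ v (y ∷ t))) w (cong not w∉)) le))
    longer (suc m) le (w , g , w∉) = maximal m w (y ∷ t) (s≤s⁻¹ (≤-trans smaller le)) (w ∷ proj₁ tl , cong (w ∷_) (proj₂ tl))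
      inU (syms g , lk) (true-∧ (cong not w∉) dis)
     where
     inU : ∀ v → v ∈ (w ∷ y ∷ t) → U v !
     inU v e with elem-cons (y ∷ t) e
     ... | inj₁ refl = clo y v (l⊂U y (elem-here y t)) g
     ... | inj₂ q = l⊂U v q
     P : Fin n → Bool
     P v = not (elemᵇ v (y ∷ t))
     smaller : suc ∣ (λ v → not (elemᵇ v (w ∷ y ∷ t))) ∣ ≤ ∣ P ∣
     smaller = ≤-trans (s≤s (∣∣-mono {Q = P ∖ w} λ v e → true-∖ {P = P} (cong not (∨-falseʳ (v == w) (not-true e)))
      λ { refl → contra ==-refl (∨-falseˡ (not-true e)) })) (≤-reflexive (sym (∣∖∣ P w (cong not w∉))))

 -- A vertex with a neighbour outside `U` is coloured after the rest of `U`. If there is none, `U`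
 -- is a union of components, and the induction is applied after removing a cycle.
 colours : ∀ m U → ∣ U ∣ ≤ m → Colours U
 colours zero U le = (λ _ → zero) , λ i j ui → contra ui (∣∣-0 U (n≤0⇒n≡0 le) i)
 colours (suc m) U le = by (search (λ v → U v ∧ (1 ≤ᵇ ∣ (λ w → G v w ∧ not (U w)) ∣)))
  where
  by : (∃[ v ] U v ∧ (1 ≤ᵇ ∣ (λ w → G v w ∧ not (U w)) ∣) !) ⊎ (∀ v → U v ∧ (1 ≤ᵇ ∣ (λ w → G v w ∧ not (U w)) ∣) ≡ false) → Colours U
  by (inj₁ (v , e)) = slack (search (λ w → G v w ∧ not (U w)))
   where
   uv = ∧ˡ {U v} e
   slack : (∃[ w ] G v w ∧ not (U w) !) ⊎ (∀ w → G v w ∧ not (U w) ≡ false) → Colours U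
   slack (inj₂ f) = ⊥-elim (1+n≰n (≤-trans (≤ᵇ-true {1} (∧ʳ {U v} e)) (≤-reflexive (∣∣-empty f))))
   slack (inj₁ (w , q)) = ext (colours m (U ∖ v) (s≤s⁻¹ (≤-trans (≤-reflexive (sym (∣∖∣ U v uv))) le)))
    where
    ext : Colours (U ∖ v) → Colours U
    ext (c , pr) = drop {Q = λ c' → ∀ w → (U ∖ v) w ! → c' w ≡ c w} (extend (U ∖ v) U c v pr (¬true λ k → proj₂ (∖-true {P = U} {v} {v} k) refl) (λ u uu → dec (u ≟ᶠ v) uu)
      (inj₁ (w , ∧ˡ q , ¬true λ k → contra (proj₁ (∖-true {P = U} k)) (not-true (∧ʳ {G v w} q)))))
     where
     dec : ∀ {u} → Dec (u ≡ v) → U u ! → u ≡ v ⊎ (U ∖ v) u !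
     dec (yes p) _ = inj₁ p
     dec (no p) uu = inj₂ (true-∖ {P = U} uu p)
     drop : ∀ {Q : Colouring → Set} → (∃[ c' ] ProperOn U c' × Q c') → Colours U
     drop (c' , pr' , _) = c' , pr'
  by (inj₂ f) = start (search U)
   where
   clo : Closed U
   clo v w uv g with U w in q
   ... | true = refl
   ... | false = contra (true-∧ uv (true-≤ᵇ (∣∣-pos (λ w → G v w ∧ not (U w)) w (true-∧ g (cong not q))))) (f v)
   start : (∃[ v ] U v !) ⊎ (∀ v → U v ≡ false) → Colours U
   start (inj₂ none) = (λ _ → zero) , λ i j ui → contra ui (none i)
   start (inj₁ (x , ux)) = path (nonadjacent x)
    where
    path : (∃₂ λ a b → G x a ! × G x b ! × a ≢ b × G a b ≡ false) → Colours U
    path (a , b , xa , xb , ne , ab) = Component.maximal U clo (λ s v e uv → colours m (U ⊖ s) (⊖-smaller U s v m e uv le)) a x b ab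
     n a (x ∷ b ∷ []) (∣∣≤n _) ([] , refl) inU (syms xa , xb , _)
     (true-∧ (cong not (both-false (≢-== λ e → edge≢ xa (sym e)) (both-false (≢-== ne) refl))) (true-∧ (cong not (both-false (≢-== (edge≢ xb)) refl)) refl))
     where
     inU : ∀ v → v ∈ (a ∷ x ∷ b ∷ []) → U v !
     inU v e with elem-cons (x ∷ b ∷ []) e
     ... | inj₁ refl = clo x v ux xa
     ... | inj₂ e' with elem-cons (b ∷ []) e'
     ... | inj₁ refl = ux
     ... | inj₂ e'' with elem-cons [] e''
     ... | inj₁ refl = clo x v ux xb

 brooks : ∃[ c ] ∀ i j → G i j ! → c i ≢ c j
 brooks = all (colours n (λ _ → true) (∣∣≤n _))
  where
  all : Colours (λ _ → true) → ∃[ c ] ∀ i j → G i j ! → c i ≢ c j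
  all (c , pr) = c , λ i j g → pr i j refl refl g

-- Disjoint families and maximal packings.

∣∣-unique : (Q : Fin n → Bool) → (∀ a b → Q a ! → Q b ! → a ≡ b) → ∣ Q ∣ ≤ 1
∣∣-unique {n} Q u = by (search Q)
 where
 by : (∃[ v ] Q v !) ⊎ (∀ v → Q v ≡ false) → ∣ Q ∣ ≤ 1
 by (inj₁ (v , q)) = ≤-trans (∣∣-mono {Q = λ w → w == v} λ w p → subst (λ w → w == v !) (u v w q p) ==-refl) (≤-reflexive (∣∣-== v))
 by (inj₂ f) = ≤-trans (≤-reflexive (∣∣-empty f)) z≤n

disjoint-count : {m n : ℕ} (D : Fin m → Bool) (B : Fin m → Fin n → Bool) (C : Fin n → Bool) (k : ℕ) →
 (∀ d → D d ! → k ≤ ∣ B d ∣) → (∀ d x → D d ! → B d x ! → C x !) →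
 (∀ d e x → D d ! → D e ! → B d x ! → B e x ! → d ≡ e) → k * ∣ D ∣ ≤ ∣ C ∣
disjoint-count {m} {n} D B C k big sub dis = begin
 k * ∣ D ∣ ≡⟨ sym (∑-*ˡ k (allFin m) _) ⟩
 ∑ᶠ (λ d → k * ⟦ D d ⟧) ≤⟨ ∑-mono (allFin m) row ⟩
 ∑ᶠ (λ d → ∑ᶠ (λ x → ⟦ D d ∧ B d x ⟧)) ≡⟨ ∑-swap (allFin m) (allFin n) _ ⟩
 ∑ᶠ (λ x → ∑ᶠ (λ d → ⟦ D d ∧ B d x ⟧)) ≤⟨ ∑-mono (allFin n) col ⟩
 ∣ C ∣ ∎
 where
 row : ∀ d → k * ⟦ D d ⟧ ≤ ∑ᶠ (λ x → ⟦ D d ∧ B d x ⟧)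
 row d with D d in e
 ... | true = ≤-trans (≤-reflexive (*-identityʳ k)) (big d e)
 ... | false = ≤-trans (≤-reflexive (*-zeroʳ k)) z≤n
 one : ∀ x c → C x ≡ c → ∑ᶠ (λ d → ⟦ D d ∧ B d x ⟧) ≤ ⟦ c ⟧
 one x true _ = ∣∣-unique (λ d → D d ∧ B d x) λ a b p q → dis a b x (∧ˡ p) (∧ˡ q) (∧ʳ {D a} p) (∧ʳ {D b} q)
 one x false e = ≤-reflexive (trans (∑-cong (allFin m) λ d → cong ⟦_⟧ (¬true {D d ∧ B d x} λ p → contra (sub d x (∧ˡ p) (∧ʳ {D d} p)) e)) (∑-zero (allFin m)))
 col : ∀ x → ∑ᶠ (λ d → ⟦ D d ∧ B d x ⟧) ≤ ⟦ C x ⟧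
 col x = one x (C x) refl

elem-tabulate : {m n : ℕ} (h : Fin m → Fin n) (i : Fin m) → (h i) ∈ (tabulate h)
elem-tabulate h zero = elem-here (h zero) (tabulate (h ∘ suc))
elem-tabulate h (suc i) = elem-there (h (suc i)) (h zero) (tabulate (h ∘ suc)) (elem-tabulate (h ∘ suc) i)

elem-allFin : (i : Fin n) → i ∈ (allFin n)
elem-allFin = elem-tabulate id

module Packing {m n : ℕ} (B : Fin m → Fin n → Bool) (P : Fin m → Bool) where

 -- Maximality is stated for the indices that have been offered so far, `Seen`, so that the packing
 -- can be built greedily along a list.
 record Packed (Seen : Fin m → Set) : Set where
  field
   D : Fin m → Bool
   D⊂P : ∀ d → D d ! → P d !
   disjoint : ∀ d e x → D d ! → D e ! → B d x ! → B e x ! → d ≡ e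
   hit : ∀ i → Seen i → P i ! → (∃[ x ] B i x !) → ∃₂ λ d x → D d ! × B i x ! × B d x !

 pack : (l : List (Fin m)) → Packed (λ i → i ∈ l)
 pack [] = record { D = λ _ → false ; D⊂P = λ _ () ; disjoint = λ _ _ _ () ; hit = λ _ () }
 pack (i ∷ l) = by (P i) refl (search (λ x → B i x ∧ (1 ≤ᵇ ∣ (λ d → D d ∧ B d x) ∣)))
  where
  open Packed (pack l)
  Result = Packed (λ j → j ∈ (i ∷ l))
  keep : (P i ! → (∃[ x ] B i x !) → ∃₂ λ d x → D d ! × B i x ! × B d x !) → Result
  keep h = record { D = D ; D⊂P = D⊂P ; disjoint = disjoint ; hit = λ j e → cases j (elem-cons l e) }
   where
   cases : ∀ j → j ≡ i ⊎ j ∈ l → P j ! → (∃[ x ] B j x !) → ∃₂ λ d x → D d ! × B j x ! × B d x !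
   cases j (inj₁ refl) = h
   cases j (inj₂ e) = hit j e
  by : ∀ p → P i ≡ p → ((∃[ x ] B i x ∧ (1 ≤ᵇ ∣ (λ d → D d ∧ B d x) ∣) !) ⊎ (∀ x → B i x ∧ (1 ≤ᵇ ∣ (λ d → D d ∧ B d x) ∣) ≡ false)) → Result
  by false e _ = keep λ p → contra p e
  by true _ (inj₁ (x , e)) = keep λ _ _ → found (search (λ d → D d ∧ B d x))
   where
   found : (∃[ d ] D d ∧ B d x !) ⊎ (∀ d → D d ∧ B d x ≡ false) → ∃₂ λ d x → D d ! × B i x ! × B d x !
   found (inj₁ (d , q)) = d , x , ∧ˡ q , ∧ˡ e , ∧ʳ {D d} q
   found (inj₂ f) = ⊥-elim (1+n≰n (≤-trans (≤ᵇ-true {1} (∧ʳ {B i x} e)) (≤-reflexive (∣∣-empty f))))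
  by true pi (inj₂ f) = record { D = D' ; D⊂P = sub ; disjoint = dis ; hit = λ j e → cases j (elem-cons l e) }
   where
   D' : Fin m → Bool
   D' d = D d ∨ d == i
   free : ∀ d x → D d ! → B d x ! → B i x ! → ⊥
   free d x p q r = contra (true-∧ r (true-≤ᵇ (∣∣-pos (λ d → D d ∧ B d x) d (true-∧ p q)))) (f x)
   sub : ∀ d → D' d ! → P d !
   sub d e with ∨-true {D d} e
   ... | inj₁ p = D⊂P d p
   ... | inj₂ p = trans (cong P (==-true p)) pi
   dis : ∀ d e x → D' d ! → D' e ! → B d x ! → B e x ! → d ≡ e
   dis d e x p q r s with ∨-true {D d} p | ∨-true {D e} q
   ... | inj₁ p' | inj₁ q' = disjoint d e x p' q' r s
   ... | inj₂ p' | inj₂ q' = trans (==-true p') (sym (==-true q'))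
   ... | inj₁ p' | inj₂ q' = ⊥-elim (free d x p' r (subst (λ e → B e x !) (==-true q') s))
   ... | inj₂ p' | inj₁ q' = ⊥-elim (free e x q' s (subst (λ e → B e x !) (==-true p') r))
   cases : ∀ j → j ≡ i ⊎ j ∈ l → P j ! → (∃[ x ] B j x !) → ∃₂ λ d x → D' d ! × B j x ! × B d x !
   cases j (inj₁ refl) _ (x , b) = j , x , true-∨ʳ (D j) ==-refl , b , b
   cases j (inj₂ e) p w = let (d , x , p , q) = hit j e p w in d , x , true-∨ˡ _ p , q

-- Unfolding the definitions of the Sudoku number.

any-true : {A : Set} (p : A → Bool) {xs : List A} → Any (λ x → p x !) xs → anyᵇ xs p !
any-true p (here e) = true-∨ˡ _ e
any-true p (there {x = x} a) = true-∨ʳ (p x) (any-true p a)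

true-any : {A : Set} (p : A → Bool) (xs : List A) → anyᵇ xs p ! → ∃[ x ] p x !
true-any p (x ∷ xs) e with ∨-true {p x} e
... | inj₁ q = x , q
... | inj₂ q = true-any p xs q

any-allFuns : {A : Set} {n : ℕ} (xs : List A) (f : Fin n → A) → (∀ i → Any (_≡ f i) xs) → Any (λ g → ∀ i → g i ≡ f i) (allFuns n xs)
any-allFuns {n = zero} xs f h = here λ ()
any-allFuns {n = suc n} xs f h = Any.concatMap⁺ _ (Any.map (λ {a} e → Any.map⁺ (Any.map (λ e' → λ { zero → e ; (suc i) → e' i }) (any-allFuns xs (f ∘ suc) (h ∘ suc)))) (h zero))

any-allFin : {k : ℕ} (a : Fin k) → Any (_≡ a) (allFin k)
any-allFin a = Any.tabulate⁺ a refl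

module _ {n k : ℕ} (G : Graph n) where

 proper-elim : (c : Fin n → Fin k) → isProper G c ! → ∀ i j → G i j ! → c i ≢ c j
 proper-elim c e i j g q = h (allᵇ-tab id _ (allᵇ-tab id _ e i) j)
  where
  h : not (G i j) ∨ not ⌊ c i ≟ᶠ c j ⌋ ! → ⊥
  h r rewrite g = contra (true-⌊⌋ (c i ≟ᶠ c j) q) (not-true r)

 proper-intro : (c : Fin n → Fin k) → (∀ i j → G i j ! → c i ≢ c j) → isProper G c !
 proper-intro c h = tab-allᵇ id _ λ i → tab-allᵇ id _ λ j → pt i j
  where
  pt : ∀ i j → not (G i j) ∨ not ⌊ c i ≟ᶠ c j ⌋ !
  pt i j with G i j in g
  ... | false = refl
  ... | true = cong not (¬true λ e → h i j g (⌊⌋-true (c i ≟ᶠ c j) e))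

 colourable-intro : (c : Fin n → Fin k) → (∀ i j → G i j ! → c i ≢ c j) → colourable G k !
 colourable-intro c h = any-true (isProper G) (Any.map (λ {g} e → proper-intro g λ i j gij q → h i j gij (trans (sym (e i)) (trans q (e j))))
  (any-allFuns (allFin k) c (λ i → any-allFin (c i))))

 colourable-elim : colourable G k ! → ∃[ c ] ∀ i j → G i j ! → c i ≢ c j
 colourable-elim e = let (c , p) = true-any (isProper G) (allFuns n (allFin k)) e in c , proper-elim c p

-- With four vertices `upTo n` begins with 0, 1, 2, 3, so the search for the chromatic number
-- unfolds to four tests. A vertex excludes the first and an edge the second.
chromatic-cubic : (G : Graph n) → Cubic G → 4 ≤ n → (∃ λ (c : Fin n → Fin 3) → ∀ i j → G i j ! → c i ≢ c j) →
 (2 ≡ chromatic G × ∃ λ (c : Fin n → Fin 2) → ∀ i j → G i j ! → c i ≢ c j) ⊎ 3 ≡ chromatic G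
chromatic-cubic {suc (suc (suc (suc n)))} G cG (s≤s (s≤s (s≤s (s≤s _)))) (c , h) =
 cases (colourable G 0) (colourable G 1) (colourable G 2) (colourable G 3) no0 no1 (colourable-elim G) (colourable-intro G c h)
 where
 N = Nbrs.a (nbrs cG zero)
 no0 : colourable G 0 ! → ⊥
 no0 e with proj₁ (colourable-elim {k = 0} G e) zero
 ... | ()
 no1 : colourable G 1 ! → ⊥
 no1 e = f (colourable-elim {k = 1} G e)
  where
  f : (∃ λ (c : Fin _ → Fin 1) → ∀ i j → G i j ! → c i ≢ c j) → ⊥
  f (c , h) = h zero N (Nbrs.va (nbrs cG zero)) (all1 (c zero) (c N))
   where
   all1 : (a b : Fin 1) → a ≡ b
   all1 zero zero = refl
 cases : ∀ {r} {Q : Set} b₀ b₁ b₂ b₃ → (b₀ ! → ⊥) → (b₁ ! → ⊥) → (b₂ ! → Q) → b₃ ! →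
  (2 ≡ (if b₀ then 0 else if b₁ then 1 else if b₂ then 2 else if b₃ then 3 else r) × Q) ⊎
  3 ≡ (if b₀ then 0 else if b₁ then 1 else if b₂ then 2 else if b₃ then 3 else r)
 cases true _ _ _ f _ _ _ = ⊥-elim (f refl)
 cases false true _ _ _ f _ _ = ⊥-elim (f refl)
 cases false false true _ _ _ f _ = inj₁ (refl , f refl)
 cases false false false true _ _ _ _ = inj₂ refl

foldr-⊓ : {A : Set} (u : A → Bool) (d : A → ℕ) (r m : ℕ) {ps : List A} → Any (λ p → u p ! × d p ≤ m) ps →
 foldr (λ p r → if u p then d p ⊓ r else r) r ps ≤ m
foldr-⊓ u d r m (here (e , le)) rewrite e = ≤-trans (m⊓n≤m _ _) le
foldr-⊓ u d r m (there {x = x} a) with u x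
... | true = ≤-trans (m⊓n≤n (d x) _) (foldr-⊓ u d r m a)
... | false = foldr-⊓ u d r m a

count-unique : {n k : ℕ} (f : Fin n → Fin k) (Q : (Fin n → Fin k) → Bool) → (∀ g → Q g ! → ∀ i → g i ≡ f i) →
 (∀ g → (∀ i → g i ≡ f i) → Q g !) → ∑ (allFuns n (allFin k)) (λ g → ⟦ Q g ⟧) ≡ 1
count-unique {zero} f Q _ h = cong (λ b → ⟦ b ⟧ + 0) (h _ λ ())
count-unique {suc n} {k} f Q u h = begin-equality
 ∑ (allFuns (suc n) (allFin k)) (λ g → ⟦ Q g ⟧) ≡⟨ ∑-allFuns-suc n (allFin k) (λ g → ⟦ Q g ⟧) respQ ⟩
 ∑ᶠ (λ a → ∑ (allFuns n (allFin k)) (λ g → ⟦ Q (a ◂ g) ⟧)) ≡⟨ ∑-cong (allFin k) (λ a → by a (a == f zero) refl) ⟩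
 ∑ᶠ (λ a → ⟦ a == f zero ⟧) ≡⟨ ∣∣-== (f zero) ⟩
 1 ∎
 where
 open FunctionSums {Fin k} _≡_ refl
 respQ : Resp (λ g → ⟦ Q g ⟧)
 respQ g g' e = cong ⟦_⟧ (iff-≡ (λ q → h g' λ i → trans (sym (e i)) (u g q i)) (λ q → h g λ i → trans (e i) (u g' q i)))
 by : ∀ a b → a == f zero ≡ b → ∑ (allFuns n (allFin k)) (λ g → ⟦ Q (a ◂ g) ⟧) ≡ ⟦ b ⟧
 by a true e = count-unique (f ∘ suc) (λ g → Q (a ◂ g)) (λ g q i → u (a ◂ g) q (suc i)) (λ g r → h (a ◂ g) λ { zero → ==-true e ; (suc i) → r i })
 by a false e = trans (∑-cong (allFuns n (allFin k)) λ g → cong ⟦_⟧ (¬true {Q (a ◂ g)} λ q → contra (subst (λ b → a == b !) (u (a ◂ g) q zero) ==-refl) e)) (∑-zero (allFuns n (allFin k)))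

any-maybe : {k : ℕ} (m : Maybe (Fin k)) → Any (_≡ m) (nothing ∷ map just (allFin k))
any-maybe nothing = here refl
any-maybe (just a) = there (Any.map⁺ (Any.map (cong just) (any-allFin a)))

module _ {n : ℕ} (G : Graph n) {k : ℕ} (c : Fin n → Fin k) (pr : ∀ i j → G i j ! → c i ≢ c j) (S : Fin n → Bool)
 (uniq : (c' : Fin n → Fin k) → (∀ i j → G i j ! → c' i ≢ c' j) → (∀ v → S v ! → c' v ≡ c v) → ∀ v → c' v ≡ c v) where

 private
  restrict : Bool → Fin k → Maybe (Fin k)
  restrict b a = if b then just a else nothing

  module _ (p : PartialColouring n k) (hp : ∀ v → p v ≡ restrict (S v) (c v)) where

   size : domSize p ≤ ∣ S ∣
   size = ≤-trans (≤-reflexive (countᵇ≡∑ _ (allFin n))) (∑-mono (allFin n) λ i → ≤-trans (≤-reflexive (sym (+-identityʳ _)))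
    (≤-trans (pt (p i) (S i) (c i) (hp i)) ≤-refl))
    where
    -- The test `isJust` is local to `domSize`, so it is met through an instance of `domSize` with
    -- one vertex. The same device serves for `ok` and `agree` below.
    pt : ∀ m b a → m ≡ restrict b a → domSize {1} {k} (λ _ → m) ≤ ⟦ b ⟧
    pt m true a refl = ≤-refl
    pt m false a refl = ≤-refl

   partial-proper : isPartialProper G p !
   partial-proper = tab-allᵇ id _ λ i → tab-allᵇ id _ λ j →
    ∧ˡ (∧ˡ (pt (G i j) (p i) (p j) (S i) (S j) (c i) (c j) (hp i) (hp j) (pr i j)))
    where
    pair : Bool → Graph 2
    pair b zero (suc zero) = b
    pair b _ _ = false
    sel : {A : Set} → A → A → Fin 2 → A
    sel a b zero = a
    sel a b (suc _) = b
    pt : ∀ g m m' b b' a a' → m ≡ restrict b a → m' ≡ restrict b' a' → (g ! → a ≢ a') → isPartialProper (pair g) (sel m m') !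
    pt false m m' b b' a a' e e' h = refl
    pt true m m' false b' a a' refl e' h = refl
    pt true m m' true false a a' refl refl h = refl
    pt true m m' true true a a' refl refl h = true-∧ (true-∧ (cong not (¬true λ q → h refl (⌊⌋-true (a ≟ᶠ a') q))) refl) refl

   agrees : ∀ c' → extends c' p ! → ∀ v → S v ! → c' v ≡ c v
   agrees c' e v s = pt (c' v) (p v) (S v) (c v) (hp v) s (true-∧ (allᵇ-tab id _ e v) refl)
    where
    pt : ∀ x m b a → m ≡ restrict b a → b ! → extends {1} {k} (λ _ → x) (λ _ → m) ! → x ≡ a
    pt x m b a refl refl q = ⌊⌋-true (x ≟ᶠ a) (∧ˡ q)

   extends-intro : ∀ c' → (∀ v → c' v ≡ c v) → extends c' p !
   extends-intro c' h = tab-allᵇ id _ λ v → ∧ˡ (pt (c' v) (p v) (S v) (c v) (hp v) (h v))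
    where
    pt : ∀ x m b a → m ≡ restrict b a → x ≡ a → extends {1} {k} (λ _ → x) (λ _ → m) !
    pt x m true a refl refl = true-∧ (true-⌊⌋ (a ≟ᶠ a) refl) refl
    pt x m false a refl refl = refl

   unique : uniquelyExtends G p !
   unique = true-∧ partial-proper (true-≡ᵇ (trans (countᵇ≡∑ _ (allFuns n (allFin k)))
    (count-unique c (λ c' → isProper G c' ∧ extends c' p)
     (λ c' q → uniq c' (proper-elim G c' (∧ˡ q)) (agrees c' (∧ʳ {isProper G c'} q)))
     (λ c' h → true-∧ (proper-intro G c' λ i j g e → pr i j g (trans (sym (h i)) (trans e (h j)))) (extends-intro c' h)))))

 sudokuNumber-≤ : k ≡ chromatic G → sudokuNumber G ≤ ∣ S ∣
 sudokuNumber-≤ refl = foldr-⊓ (uniquelyExtends G) domSize n ∣ S ∣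
  (Any.map (λ {p} h → unique p h , size p h) (any-allFuns _ (λ v → restrict (S v) (c v)) (λ v → any-maybe (restrict (S v) (c v)))))


-- Along an edge a proper 2-colouring is forced. By maximality every closed neighbourhood meets that
-- of a packed vertex, so the colours spread from the packed vertices within two steps.
bipartite-case : (G : Graph n) → Cubic G → 2 ≡ chromatic G → (∃ λ (c : Fin n → Fin 2) → ∀ i j → G i j ! → c i ≢ c j) →
 4 * sudokuNumber G ≤ n
bipartite-case {n} G cG χ (c , pr) = ≤-trans (*-monoʳ-≤ 4 (sudokuNumber-≤ G c pr D uniq χ))
 (≤-trans (disjoint-count D B (λ _ → true) 4 (λ d _ → big d) (λ _ _ _ _ → refl) disjoint) (∣∣≤n _))
 where
 B : Fin n → Fin n → Bool
 B d x = x == d ∨ G d x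
 open Packing B (λ _ → true)
 open Packed (pack (allFin n))
 big : ∀ d → 4 ≤ ∣ B d ∣
 big d = ≤-trans (s≤s (≤-trans (≤-reflexive (sym (Cubic.deg cG d))) (∣∣-mono {Q = B d ∖ d} λ v g → true-∖ {P = B d} (true-∨ʳ (v == d) g) λ { refl → Cubic.edge≢ cG g refl })))
  (≤-reflexive (sym (∣∖∣ (B d) d (true-∨ˡ _ ==-refl))))
 opposite : {a b a' b' : Fin 2} → a ≢ b → a' ≢ b' → b ≡ b' → a ≡ a'
 opposite {zero} {_} {zero} p q refl = refl
 opposite {suc zero} {_} {suc zero} p q refl = refl
 opposite {zero} {zero} {suc zero} p q refl = ⊥-elim (p refl)
 opposite {zero} {suc zero} {suc zero} p q refl = ⊥-elim (q refl)
 opposite {suc zero} {zero} {zero} p q refl = ⊥-elim (q refl)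
 opposite {suc zero} {suc zero} {zero} p q refl = ⊥-elim (p refl)
 uniq : ∀ c' → (∀ i j → G i j ! → c' i ≢ c' j) → (∀ v → D v ! → c' v ≡ c v) → ∀ v → c' v ≡ c v
 uniq c' pr' ag v = from (hit v (elem-allFin v) refl (v , true-∨ˡ _ ==-refl))
  where
  near : ∀ d x → B d x ! → c' d ≡ c d → c' x ≡ c x
  near d x b e with ∨-true {x == d} b
  ... | inj₁ q rewrite ==-true q = e
  ... | inj₂ g = opposite (λ r → pr' d x g (sym r)) (λ r → pr d x g (sym r)) e
  back : ∀ d x → B d x ! → c' x ≡ c x → c' d ≡ c d
  back d x b e with ∨-true {x == d} b
  ... | inj₁ q rewrite ==-true q = e
  ... | inj₂ g = opposite (pr' d x g) (pr d x g) e
  from : (∃₂ λ d x → D d ! × B v x ! × B d x !) → c' v ≡ c v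
  from (d , x , dd , bv , bd) = back v x bv (near d x bd (ag d dd))

-- Colouring a path by local moves: fixed a means that the previous vertex has the determined colour a,
-- owed x that the next vertex has to receive x so as to determine the vertices before it.

Label : Set
Label = Maybe (Fin 3)

data State : Set where
 fixed : Fin 3 → State
 owed : Fin 3 → State

-- `seedM` precolours a vertex. `forceM` leaves it to the previous vertex and its label. `pendM`
-- leaves it to the next vertex, which receives one of the two colours still possible, so that only
-- x remains.
data Move : Set where
 seedM pendM : Fin 3 → Move
 forceM : Move

third : Fin 3 → Fin 3 → Fin 3
third zero (suc zero) = suc (suc zero)
third zero (suc (suc zero)) = suc zero
third (suc zero) zero = suc (suc zero)
third (suc zero) (suc (suc zero)) = zero
third (suc (suc zero)) zero = suc zero
third (suc (suc zero)) (suc zero) = zero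
third x _ = x

third-only : ∀ a b x → a ≢ b → x ≢ a → x ≢ b → x ≡ third a b
third-only = from-yes (all? λ a → all? λ b → all? λ x → ¬? (a ≟ᶠ b) →-dec (¬? (x ≟ᶠ a) →-dec (¬? (x ≟ᶠ b) →-dec (x ≟ᶠ third a b))))

third-other : ∀ a b x → a ≢ b → x ≢ a → x ≢ third a b → x ≡ b
third-other = from-yes (all? λ a → all? λ b → all? λ x → ¬? (a ≟ᶠ b) →-dec (¬? (x ≟ᶠ a) →-dec (¬? (x ≟ᶠ third a b) →-dec (x ≟ᶠ b))))

third-≢ˡ : ∀ a b → a ≢ b → third a b ≢ a
third-≢ˡ = from-yes (all? λ a → all? λ b → ¬? (a ≟ᶠ b) →-dec ¬? (third a b ≟ᶠ a))

third-≢ʳ : ∀ a b → a ≢ b → third a b ≢ b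
third-≢ʳ = from-yes (all? λ a → all? λ b → ¬? (a ≟ᶠ b) →-dec ¬? (third a b ≟ᶠ b))

is : Label → Fin 3 → Bool
is nothing x = false
is (just b) x = ⌊ b ≟ᶠ x ⌋

known : Label → Bool
known nothing = false
known (just _) = true

colour : State → Label → Move → Fin 3
colour s b (seedM x) = x
colour s b (pendM x) = x
colour (fixed a) (just b) forceM = third a b
-- This case and the next one are excluded by `legal`; their values are arbitrary.
colour (fixed a) nothing forceM = a
colour (owed x) b forceM = x

legal : State → Label → Move → Bool
legal (fixed a) b (seedM x) = not ⌊ x ≟ᶠ a ⌋ ∧ not (is b x)
legal (fixed a) b (pendM x) = not ⌊ x ≟ᶠ a ⌋ ∧ not (is b x)
legal (fixed a) b forceM = known b ∧ not (is b a)
legal (owed y) b (seedM x) = ⌊ x ≟ᶠ y ⌋ ∧ not (is b x)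
legal (owed y) b (pendM x) = ⌊ x ≟ᶠ y ⌋ ∧ known b ∧ not (is b x)
legal (owed y) b forceM = false

target : State → Label → Move → State
target s b (seedM x) = fixed x
target (fixed a) b (pendM x) = owed (third a x)
target (owed y) (just b) (pendM x) = owed (third b x)
target (owed y) nothing (pendM x) = owed y
target s b forceM = fixed (colour s b forceM)

seeds : Move → Bool
seeds (seedM _) = true
seeds _ = false

Plan : State → List Label → List Move → Set
Plan (fixed a) [] [] = ⊤
Plan (owed x) [] [] = ⊥
Plan s (b ∷ bs) (m ∷ ms) = legal s b m ! × Plan (target s b m) bs ms
Plan s _ _ = ⊥

colours : State → List Label → List Move → List (Fin 3)
colours s (b ∷ bs) (m ∷ ms) = colour s b m ∷ colours (target s b m) bs ms
colours s _ _ = []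

cost : List Move → ℕ
cost ms = ∑ ms (λ m → ⟦ seeds m ⟧)

Fits : Fin 3 → List Label → List (Fin 3) → Set
Fits a [] [] = ⊤
Fits a (b ∷ bs) (x ∷ xs) = x ≢ a × is b x ≡ false × Fits x bs xs
Fits a _ _ = ⊥

Agrees : List Move → List (Fin 3) → List (Fin 3) → Set
Agrees (m ∷ ms) (x ∷ xs) (y ∷ ys) = (seeds m ! → y ≡ x) × Agrees ms xs ys
Agrees _ _ _ = ⊤

-- What properness requires of the previous colour: in state `owed y` the coming vertex gets y, so
-- the previous one must differ from y.
Allowed : State → Fin 3 → Set
Allowed (fixed a) x = x ≡ a
Allowed (owed y) x = x ≢ y

⌊⌋-false : {P : Set} (d : Dec P) → ⌊ d ⌋ ≡ false → ¬ P
⌊⌋-false (no f) _ p = f p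

not-⌊⌋ : {P : Set} (d : Dec P) → not ⌊ d ⌋ ! → ¬ P
not-⌊⌋ d e = ⌊⌋-false d (not-true e)

is-≢ : ∀ {b x} → is (just b) x ≡ false → b ≢ x
is-≢ {b} {x} = ⌊⌋-false (b ≟ᶠ x)

≢-is : ∀ {b x} → b ≢ x → is (just b) x ≡ false
≢-is {b} {x} ne = ¬true λ e → ne (⌊⌋-true (b ≟ᶠ x) e)

legal-proper : ∀ s b m {a} → legal s b m ! → Allowed s a →
 colour s b m ≢ a × is b (colour s b m) ≡ false × Allowed (target s b m) (colour s b m)
legal-proper (fixed a) b (seedM x) l refl = not-⌊⌋ (x ≟ᶠ a) (∧ˡ l) , not-true (∧ʳ {not ⌊ x ≟ᶠ a ⌋} l) , refl
legal-proper (fixed a) b (pendM x) l refl = ne , not-true (∧ʳ {not ⌊ x ≟ᶠ a ⌋} l) , λ e → third-≢ʳ a x (ne ∘ sym) (sym e)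
 where ne = not-⌊⌋ (x ≟ᶠ a) (∧ˡ l)
legal-proper (fixed a) (just b) forceM l refl = third-≢ˡ a b ne , ≢-is (λ e → third-≢ʳ a b ne (sym e)) , refl
 where ne = λ e → is-≢ {b} {a} (not-true l) (sym e)
legal-proper (owed y) b (seedM x) l al = (λ e → al (trans (sym e) (⌊⌋-true (x ≟ᶠ y) (∧ˡ l)))) , not-true (∧ʳ {⌊ x ≟ᶠ y ⌋} l) , refl
legal-proper (owed y) (just b) (pendM x) l al = (λ e → al (trans (sym e) (⌊⌋-true (x ≟ᶠ y) (∧ˡ l)))) , bx , λ e → third-≢ʳ b x (is-≢ bx) (sym e)
 where
 bx : is (just b) x ≡ false
 bx = not-true (∧ʳ {⌊ x ≟ᶠ y ⌋} l)
legal-proper (owed y) nothing (pendM x) l al = contra (∧ˡ {false} {not (is nothing x)} (∧ʳ {⌊ x ≟ᶠ y ⌋} l)) refl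

plan-fits : ∀ s bs ms {a} → Plan s bs ms → Allowed s a → Fits a bs (colours s bs ms)
plan-fits (fixed a) [] [] p al = _
plan-fits (fixed a) [] (_ ∷ _) () al
plan-fits (owed x) [] [] () al
plan-fits (owed x) [] (_ ∷ _) () al
plan-fits (fixed a) (_ ∷ _) [] () al
plan-fits (owed x) (_ ∷ _) [] () al
plan-fits s@(fixed _) (b ∷ bs) (m ∷ ms) (l , p) al with legal-proper s b m l al
... | u , v , w = u , v , plan-fits (target s b m) bs ms p w
plan-fits s@(owed _) (b ∷ bs) (m ∷ ms) (l , p) al with legal-proper s b m l al
... | u , v , w = u , v , plan-fits (target s b m) bs ms p w

colour-q : ∀ y b m → legal (owed y) b m ! → colour (owed y) b m ≡ y
colour-q y b (seedM x) l = ⌊⌋-true (x ≟ᶠ y) (∧ˡ l)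
colour-q y b (pendM x) l = ⌊⌋-true (x ≟ᶠ y) (∧ˡ l)

-- In a state owed y the colours are determined whatever the previous colour is.
Source : State → Fin 3 → Set
Source (fixed a) x = x ≡ a
Source (owed y) x = ⊤

next-differs : ∀ y bs ms {a ys} → Plan (owed y) bs ms → Fits a bs ys → ys ≡ colours (owed y) bs ms → a ≢ y
next-differs y [] [] ()
next-differs y [] (_ ∷ _) ()
next-differs y (b ∷ bs) (m ∷ ms) {ys = x ∷ xs} (l , p) (ne , _) e refl = ne (trans (∷-injectiveˡ e) (colour-q y b m l))

-- Information flows both ways. Seeds and forced vertices are determined from the left; at a pending
-- vertex the induction first determines the rest of the path, whose first colour then excludes one
-- of the two remaining alternatives.
plan-unique : ∀ s bs ms {a} ys → Plan s bs ms → Source s a → Fits a bs ys → Agrees ms (colours s bs ms) ys → ys ≡ colours s bs ms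
plan-unique (fixed a) [] [] [] p so f ag = refl
plan-unique (owed x) [] [] _ () so f ag
plan-unique (owed x) [] (_ ∷ _) _ () so f ag
plan-unique (fixed x) [] (_ ∷ _) _ () so f ag
plan-unique (fixed a) (b ∷ bs) (seedM x ∷ ms) (y ∷ ys) (l , p) so (_ , _ , f) (e , ag) with refl ← e refl =
 cong (x ∷_) (plan-unique (fixed x) bs ms ys p refl f ag)
plan-unique (owed z) (b ∷ bs) (seedM x ∷ ms) (y ∷ ys) (l , p) so (_ , _ , f) (e , ag) with refl ← e refl =
 cong (x ∷_) (plan-unique (fixed x) bs ms ys p refl f ag)
plan-unique (fixed a) (just b ∷ bs) (forceM ∷ ms) (y ∷ ys) (l , p) refl (ne , nb , f) (_ , ag)
 with refl ← third-only a b y (λ e → is-≢ {b} {a} (not-true l) (sym e)) ne (λ e → is-≢ {b} {y} nb (sym e)) =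
 cong (third a b ∷_) (plan-unique (fixed (third a b)) bs ms ys p refl f ag)
plan-unique (fixed a) (b ∷ bs) (pendM x ∷ ms) (y ∷ ys) (l , p) refl (ne , nb , f) (_ , ag)
 with plan-unique (owed (third a x)) bs ms ys p _ f ag
... | r = cong₂ _∷_ (third-other a x y (λ e → not-⌊⌋ (x ≟ᶠ a) (∧ˡ l) (sym e)) ne (next-differs (third a x) bs ms p f r)) r
plan-unique (owed z) (just b ∷ bs) (pendM x ∷ ms) (y ∷ ys) (l , p) so (ne , nb , f) (_ , ag)
 with plan-unique (owed (third b x)) bs ms ys p _ f ag
... | r = cong₂ _∷_ (third-other b x y (is-≢ {b} {x} (not-true (∧ʳ {⌊ x ≟ᶠ z ⌋} l))) (λ e → is-≢ {b} {y} nb (sym e)) (next-differs (third b x) bs ms p f r)) r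
plan-unique (owed z) (nothing ∷ bs) (pendM x ∷ ms) (y ∷ ys) (l , p) so f ag = contra (∧ˡ {false} {not (is nothing x)} (∧ʳ {⌊ x ≟ᶠ z ⌋} l)) refl

-- Backwards dynamic programming. A row of the table lists upper bounds, up to an additive constant, for the cost of completing
-- the path from the states fixed 0, fixed 1, fixed 2, owed 0, owed 1, owed 2 (9 stands for infinity), its potential in sixths,
-- and for each label of the preceding vertex (none, 0, 1, 2) the increment of the constant and the new row.

Row : Set
Row = Vec ℕ 6 × ℕ × Vec (ℕ × Fin 13) 4

opaque
 table : Vec Row 13
 table =
  -- Row 0 is the end of a path, where nothing may be owed. The other rows are exactly those reached
  -- from it by reading labels backwards.
  ((0 ∷ 0 ∷ 0 ∷ 9 ∷ 9 ∷ 9 ∷ []) , 3 , ((1 , # 7) ∷ (0 , # 3) ∷ (0 , # 1) ∷ (0 , # 2) ∷ []))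
  ∷ ((0 ∷ 1 ∷ 1 ∷ 1 ∷ 9 ∷ 1 ∷ []) , 3 , ((1 , # 7) ∷ (1 , # 9) ∷ (0 , # 6) ∷ (0 , # 4) ∷ []))
  ∷ ((0 ∷ 1 ∷ 1 ∷ 1 ∷ 1 ∷ 9 ∷ []) , 3 , ((1 , # 7) ∷ (1 , # 11) ∷ (0 , # 6) ∷ (0 , # 4) ∷ []))
  ∷ ((1 ∷ 0 ∷ 1 ∷ 9 ∷ 1 ∷ 1 ∷ []) , 3 , ((1 , # 9) ∷ (0 , # 5) ∷ (1 , # 7) ∷ (0 , # 2) ∷ []))
  ∷ ((1 ∷ 0 ∷ 1 ∷ 1 ∷ 1 ∷ 9 ∷ []) , 3 , ((1 , # 9) ∷ (0 , # 5) ∷ (1 , # 12) ∷ (0 , # 2) ∷ []))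
  ∷ ((1 ∷ 1 ∷ 0 ∷ 9 ∷ 1 ∷ 1 ∷ []) , 3 , ((1 , # 11) ∷ (0 , # 3) ∷ (0 , # 1) ∷ (1 , # 8) ∷ []))
  ∷ ((1 ∷ 1 ∷ 0 ∷ 1 ∷ 9 ∷ 1 ∷ []) , 3 , ((1 , # 11) ∷ (0 , # 3) ∷ (0 , # 1) ∷ (1 , # 10) ∷ []))
  ∷ ((0 ∷ 0 ∷ 0 ∷ 0 ∷ 9 ∷ 1 ∷ []) , 0 , ((0 , # 3) ∷ (0 , # 3) ∷ (0 , # 12) ∷ (0 , # 10) ∷ []))
  ∷ ((0 ∷ 0 ∷ 0 ∷ 0 ∷ 1 ∷ 9 ∷ []) , 0 , ((0 , # 3) ∷ (0 , # 3) ∷ (0 , # 12) ∷ (0 , # 10) ∷ []))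
  ∷ ((0 ∷ 0 ∷ 0 ∷ 9 ∷ 0 ∷ 1 ∷ []) , 0 , ((0 , # 1) ∷ (0 , # 11) ∷ (0 , # 1) ∷ (0 , # 8) ∷ []))
  ∷ ((0 ∷ 0 ∷ 0 ∷ 1 ∷ 0 ∷ 9 ∷ []) , 0 , ((0 , # 1) ∷ (0 , # 11) ∷ (0 , # 1) ∷ (0 , # 8) ∷ []))
  ∷ ((0 ∷ 0 ∷ 0 ∷ 9 ∷ 1 ∷ 0 ∷ []) , 0 , ((0 , # 1) ∷ (0 , # 9) ∷ (0 , # 7) ∷ (0 , # 2) ∷ []))
  ∷ ((0 ∷ 0 ∷ 0 ∷ 1 ∷ 9 ∷ 0 ∷ []) , 0 , ((0 , # 1) ∷ (0 , # 9) ∷ (0 , # 7) ∷ (0 , # 2) ∷ []))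
  ∷ []

 tableRow : Fin 13 → Row
 tableRow = Vec.lookup table

entry : Fin 13 → State → ℕ
entry σ (fixed zero) = Vec.lookup (proj₁ (tableRow σ)) (# 0)
entry σ (fixed (suc zero)) = Vec.lookup (proj₁ (tableRow σ)) (# 1)
entry σ (fixed (suc (suc zero))) = Vec.lookup (proj₁ (tableRow σ)) (# 2)
entry σ (owed zero) = Vec.lookup (proj₁ (tableRow σ)) (# 3)
entry σ (owed (suc zero)) = Vec.lookup (proj₁ (tableRow σ)) (# 4)
entry σ (owed (suc (suc zero))) = Vec.lookup (proj₁ (tableRow σ)) (# 5)

potential : Fin 13 → ℕ
potential σ = proj₁ (proj₂ (tableRow σ))

rowStep : Fin 13 → Label → ℕ × Fin 13
rowStep σ nothing = Vec.lookup (proj₂ (proj₂ (tableRow σ))) zero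
rowStep σ (just b) = Vec.lookup (proj₂ (proj₂ (tableRow σ))) (suc b)

fits : Fin 13 → Label → State → Move → Bool
fits σ b s m = legal s b m ∧ (entry σ (target s b m) ≤ᵇ 1) ∧ (⟦ seeds m ⟧ + entry σ (target s b m) ≤ᵇ proj₁ (rowStep σ b) + entry (proj₂ (rowStep σ b)) s)

firstᵇ : {A : Set} → (A → Bool) → A → List A → A
firstᵇ p d [] = d
firstᵇ p d (x ∷ xs) = if p x then x else firstᵇ p d xs

choose : Fin 13 → Label → State → Move
choose σ b s = firstᵇ (fits σ b s) forceM (map seedM (allFin 3) ++ map pendM (allFin 3))

-- A row promises nothing for entries of at least 2, so only the entries 0 and 1 must be justified
-- by a move.
check : Fin 13 → Label → State → Bool
check σ b s = (2 ≤ᵇ entry (proj₂ (rowStep σ b)) s) ∨ fits σ b s (choose σ b s)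

∀State : (State → Bool) → Bool
∀State p = allᵇ (allFin 3) (p ∘ fixed) ∧ allᵇ (allFin 3) (p ∘ owed)

∀Label : (Label → Bool) → Bool
∀Label p = p nothing ∧ allᵇ (allFin 3) (p ∘ just)

∀State-elim : ∀ p → ∀State p ! → ∀ s → p s !
∀State-elim p e (fixed a) = allᵇ-tab id (p ∘ fixed) (∧ˡ e) a
∀State-elim p e (owed a) = allᵇ-tab id (p ∘ owed) (∧ʳ {allᵇ (allFin 3) (p ∘ fixed)} e) a

∀Label-elim : ∀ p → ∀Label p ! → ∀ s → p s !
∀Label-elim p e nothing = ∧ˡ e
∀Label-elim p e (just a) = allᵇ-tab id (p ∘ just) (∧ʳ {p nothing} e) a

opaque
 unfolding table tableRow
 check-true : ∀ σ b s → check σ b s !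
 check-true σ b s = ∀State-elim (check σ b) (∀Label-elim (λ b → ∀State (check σ b)) (allᵇ-tab id (λ σ → ∀Label λ b → ∀State (check σ b)) refl σ) b) s

 small-entry : ∀ σ a → entry σ (fixed a) ≤ 1
 small-entry σ a = ≤ᵇ-true (allᵇ-tab id (λ a → entry σ (fixed a) ≤ᵇ 1) (allᵇ-tab id (λ σ → allᵇ (allFin 3) λ a → entry σ (fixed a) ≤ᵇ 1) refl σ) a)

 start-owed : ∀ x → ¬ (entry zero (owed x) ≤ 1)
 start-owed zero (s≤s ())
 start-owed (suc zero) (s≤s ())
 start-owed (suc (suc zero)) (s≤s ())

 potential-start : potential zero ≡ 3
 potential-start = refl

 -- Amortised cost in sixths: 3 for a vertex without a label, and in `potential-B` 3 for the three
 -- equally likely labels together, hence 1 on average. These are the densities 1/2 and 1/6.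
 potential-F : ∀ σ → 6 * proj₁ (rowStep σ nothing) + potential (proj₂ (rowStep σ nothing)) ≤ 3 + potential σ
 potential-F σ = ≤ᵇ-true (allᵇ-tab id (λ σ → 6 * proj₁ (rowStep σ nothing) + potential (proj₂ (rowStep σ nothing)) ≤ᵇ 3 + potential σ) refl σ)

 potential-B : ∀ σ → ∑ (allFin 3) (λ b → 6 * proj₁ (rowStep σ (just b)) + potential (proj₂ (rowStep σ (just b)))) ≤ 3 + 3 * potential σ
 potential-B σ = ≤ᵇ-true (allᵇ-tab id (λ σ → ∑ (allFin 3) (λ b → 6 * proj₁ (rowStep σ (just b)) + potential (proj₂ (rowStep σ (just b)))) ≤ᵇ 3 + 3 * potential σ) refl σ)

sweep : List Label → ℕ × Fin 13
sweep [] = 0 , zero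
sweep (b ∷ bs) = proj₁ (rowStep (proj₂ (sweep bs)) b) + proj₁ (sweep bs) , proj₂ (rowStep (proj₂ (sweep bs)) b)

-- Having been computed from the end, the table is now read forwards: the row belonging to the
-- remaining labels tells which move to take.
complete : State → List Label → List Move
complete s [] = []
complete s (b ∷ bs) = choose (proj₂ (sweep bs)) b s ∷ complete (target s b (choose (proj₂ (sweep bs)) b s)) bs

solve-plan : ∀ s bs → entry (proj₂ (sweep bs)) s ≤ 1 → Plan s bs (complete s bs) × cost (complete s bs) ≤ proj₁ (sweep bs) + entry (proj₂ (sweep bs)) s
solve-plan (fixed a) [] _ = _ , z≤n
solve-plan (owed x) [] small = ⊥-elim (start-owed x small)
solve-plan s (b ∷ bs) small = by (∨-true (check-true σ b s))
 where
 σ = proj₂ (sweep bs)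
 m = choose σ b s
 k = proj₁ (sweep bs)
 e' = entry (proj₂ (rowStep σ b)) s
 big : ∀ x → 2 ≤ x → x ≤ 1 → ⊥
 big x le₁ le₂ = 1+n≰n (≤-trans le₁ le₂)
 plan-cons : ∀ s b bs m ms → legal s b m ! → Plan (target s b m) bs ms → Plan s (b ∷ bs) (m ∷ ms)
 plan-cons (fixed _) b bs m ms l p = l , p
 plan-cons (owed _) b bs m ms l p = l , p
 by : (2 ≤ᵇ e') ! ⊎ fits σ b s m ! → Plan s (b ∷ bs) (complete s (b ∷ bs)) × cost (complete s (b ∷ bs)) ≤ proj₁ (rowStep σ b) + k + e'
 by (inj₁ e) = ⊥-elim (big e' (≤ᵇ-true e) small)
 by (inj₂ e) = finish (solve-plan (target s b m) bs (≤ᵇ-true (∧ˡ {entry σ (target s b m) ≤ᵇ 1} r)))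
  where
  l = ∧ˡ {legal s b m} e
  r = ∧ʳ {legal s b m} e
  le : ⟦ seeds m ⟧ + entry σ (target s b m) ≤ proj₁ (rowStep σ b) + e'
  le = ≤ᵇ-true (∧ʳ {entry σ (target s b m) ≤ᵇ 1} r)
  finish : Plan (target s b m) bs (complete (target s b m) bs) × cost (complete (target s b m) bs) ≤ k + entry σ (target s b m) →
   Plan s (b ∷ bs) (m ∷ complete (target s b m) bs) × ⟦ seeds m ⟧ + cost (complete (target s b m) bs) ≤ proj₁ (rowStep σ b) + k + e'
  finish (p , w) = plan-cons s b bs m (complete (target s b m) bs) l p , (begin
   ⟦ seeds m ⟧ + cost (complete (target s b m) bs) ≤⟨ +-monoʳ-≤ ⟦ seeds m ⟧ w ⟩
   ⟦ seeds m ⟧ + (k + entry σ (target s b m)) ≡⟨ x+[y+z] ⟦ seeds m ⟧ k _ ⟩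
   ⟦ seeds m ⟧ + entry σ (target s b m) + k ≤⟨ +-monoˡ-≤ k le ⟩
   proj₁ (rowStep σ b) + e' + k ≡⟨ swap-end (proj₁ (rowStep σ b)) e' k ⟩
   proj₁ (rowStep σ b) + k + e' ∎)
   where
   x+[y+z] : ∀ x y z → x + (y + z) ≡ x + z + y
   x+[y+z] x y z = trans (cong (x +_) (+-comm y z)) (sym (+-assoc x z y))
   swap-end : ∀ x y z → x + y + z ≡ x + z + y
   swap-end x y z = trans (+-assoc x y z) (x+[y+z] x y z)

some : (Fin n → Bool) → Bool
some P = 1 ≤ᵇ ∣ P ∣

opaque
 some-intro : (P : Fin n → Bool) (v : Fin n) → P v ! → some P !
 some-intro P v e = true-≤ᵇ (∣∣-pos P v e)

 some-elim : (P : Fin n → Bool) → some P ! → ∃[ v ] P v !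
 some-elim {n} P e with search P
 ... | inj₁ w = w
 ... | inj₂ f = ⊥-elim (1+n≰n (≤-trans (≤ᵇ-true {1} e) (≤-reflexive (∣∣-empty f))))

assoc : {A : Set} → A → List (Fin n) → List A → Fin n → A
assoc d (k ∷ ks) (x ∷ xs) v = if v == k then x else assoc d ks xs v
assoc d _ _ v = d

map-assoc : {A : Set} (d : A) (ks : List (Fin n)) (xs : List A) → distinctᵇ ks ! → length ks ≡ length xs → map (assoc d ks xs) ks ≡ xs
map-assoc d [] [] _ _ = refl
map-assoc d (k ∷ ks) (x ∷ xs) dk e = cong₂ _∷_ (cong (λ b → if b then x else assoc d ks xs k) ==-refl)
 (trans (go ks λ v m → contra (subst (λ w → w ∈ ks) m (elem-self v)) (distinct-head k ks dk)) (map-assoc d ks xs (distinct-tail k ks dk) (suc-injective e)))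
 where
 elem-self : (v : Σ (Fin _) λ w → w ∈ ks) → (proj₁ v) ∈ ks
 elem-self = proj₂
 go : ∀ l → (∀ (v : Σ (Fin _) λ w → w ∈ ks) → proj₁ v ≡ k → ⊥) → map (assoc d (k ∷ ks) (x ∷ xs)) ks ≡ map (assoc d ks xs) ks
 go _ ne = pts ks (λ v e → e)
  where
  pts : ∀ l → (∀ v → v ∈ l → v ∈ ks) → map (assoc d (k ∷ ks) (x ∷ xs)) l ≡ map (assoc d ks xs) l
  pts [] h = refl
  pts (v ∷ l) h = cong₂ _∷_ (cong (λ b → if b then x else assoc d ks xs v) (≢-== λ e → ne (v , h v (elem-here v l)) e)) (pts l (λ w e → h w (elem-there w v l e)))

consec : List (Fin n) → Fin n → Fin n → Bool
consec (a ∷ b ∷ t) v w = (v == a ∧ w == b) ∨ consec (b ∷ t) v w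
consec _ v w = false

consec-cons : (a b : Fin n) (t : List (Fin n)) {v w : Fin n} → consec (a ∷ b ∷ t) v w ! → (v ≡ a × w ≡ b) ⊎ consec (b ∷ t) v w !
consec-cons a b t {v} {w} e with ∨-true {v == a ∧ w == b} e
... | inj₁ p = inj₁ (==-true (∧ˡ p) , ==-true (∧ʳ {v == a} p))
... | inj₂ p = inj₂ p

consec-snoc : (u : Fin n) (t : List (Fin n)) (ℓ : Fin n) {v w : Fin n} → consec (u ∷ t ++ ℓ ∷ []) v w ! →
 consec (u ∷ t) v w ! ⊎ (v ≡ lastOf u t × w ≡ ℓ)
consec-snoc u [] ℓ e with consec-cons u ℓ [] e
... | inj₁ p = inj₂ p
... | inj₂ ()
consec-snoc u (x ∷ t) ℓ {v} {w} e with consec-cons u x (t ++ ℓ ∷ []) {v} {w} e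
... | inj₁ (refl , refl) = inj₁ (true-∨ˡ _ (true-∧ (==-refl {u = v}) ==-refl))
... | inj₂ p with consec-snoc x t ℓ p
... | inj₁ q = inj₁ (true-∨ʳ (v == u ∧ w == x) q)
... | inj₂ q = inj₂ q

lastOf-map : {m n : ℕ} (f : Fin m → Fin n) (a : Fin m) (t : List (Fin m)) → lastOf (f a) (map f t) ≡ f (lastOf a t)
lastOf-map f a [] = refl
lastOf-map f a (x ∷ t) = lastOf-map f x t

-- Colouring a single path from the labels around it.

avoid : Label → Label → Label → Label → Fin 3
avoid k l m o = if is k zero ∨ is l zero ∨ is m zero ∨ is o zero then
 (if is k (suc zero) ∨ is l (suc zero) ∨ is m (suc zero) ∨ is o (suc zero) then suc (suc zero) else suc zero) else zero

opaque
 avoids : ∀ k l m o → ⟦ known k ⟧ + (⟦ known l ⟧ + (⟦ known m ⟧ + ⟦ known o ⟧)) ≤ 2 →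
  is k (avoid k l m o) ≡ false × is l (avoid k l m o) ≡ false × is m (avoid k l m o) ≡ false × is o (avoid k l m o) ≡ false
 avoids k l m o le = read (∀Label-elim (test k l m) (∀Label-elim (λ m → ∀Label (test k l m)) (∀Label-elim (λ l → ∀Label λ m → ∀Label (test k l m))
  (∀Label-elim (λ k → ∀Label λ l → ∀Label λ m → ∀Label (test k l m)) refl k) l) m) o)
  where
  test : Label → Label → Label → Label → Bool
  test k l m o = not (⟦ known k ⟧ + (⟦ known l ⟧ + (⟦ known m ⟧ + ⟦ known o ⟧)) ≤ᵇ 2) ∨
   not (is k (avoid k l m o) ∨ is l (avoid k l m o) ∨ is m (avoid k l m o) ∨ is o (avoid k l m o))
  read : test k l m o ! → is k (avoid k l m o) ≡ false × is l (avoid k l m o) ≡ false × is m (avoid k l m o) ≡ false × is o (avoid k l m o) ≡ false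
  read e with ∨-true {not (⟦ known k ⟧ + (⟦ known l ⟧ + (⟦ known m ⟧ + ⟦ known o ⟧)) ≤ᵇ 2)} e
  ... | inj₁ p = contra (true-≤ᵇ le) (not-true p)
  ... | inj₂ p = ∨-falseˡ (not-true p) , ∨-falseˡ (∨-falseʳ (is k z) (not-true p)) , ∨-falseˡ (∨-falseʳ (is l z) (∨-falseʳ (is k z) (not-true p)))
         , ∨-falseʳ (is m z) (∨-falseʳ (is l z) (∨-falseʳ (is k z) (not-true p)))
   where
   z : Fin 3
   z = avoid k l m o

-- A path to be coloured: its first and last vertices are always precoloured.
data Arm (n : ℕ) : Set where
 single : Fin n → Arm n
 long : Fin n → List (Fin n) → Fin n → Arm n

keys : Arm n → List (Fin n)
keys (single u) = u ∷ []
keys (long u t ℓ) = u ∷ t ++ ℓ ∷ []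

headA : Arm n → Fin n
headA (single u) = u
headA (long u _ _) = u

inner : Arm n → List (Fin n)
inner (single u) = []
inner (long u t ℓ) = t

lastA : Arm n → Fin n
lastA (single u) = u
lastA (long u t ℓ) = ℓ

module Local {n : ℕ} (N₁ N₂ N₃ : Fin n → Fin n) where

 -- At an inner vertex both neighbours on the path are still blank, so the only label that can be
 -- found is that of its outer neighbour.
 lab : (Fin n → Label) → Fin n → Label
 lab s v = s (N₁ v) <∣> (s (N₂ v) <∣> s (N₃ v))

 headColour : (Fin n → Label) → Fin n → Fin 3
 headColour s u = avoid nothing (s (N₁ u)) (s (N₂ u)) (s (N₃ u))

 moves : (Fin n → Label) → Fin n → List (Fin n) → List Move
 moves s u t = complete (fixed (headColour s u)) (map (lab s) t)

 inside : (Fin n → Label) → Fin n → List (Fin n) → List (Fin 3)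
 inside s u t = colours (fixed (headColour s u)) (map (lab s) t) (moves s u t)

 -- Besides the labels it has to avoid the colour before it. Hence at most one label may be known at
 -- the last vertex, against two at the first.
 lastColour : (Fin n → Label) → Fin n → List (Fin n) → Fin n → Fin 3
 lastColour s u t ℓ = avoid (just (lastOf (headColour s u) (inside s u t))) (s (N₁ ℓ)) (s (N₂ ℓ)) (s (N₃ ℓ))

 vals : (Fin n → Label) → Arm n → List (Fin 3)
 vals s (single u) = headColour s u ∷ []
 vals s (long u t ℓ) = headColour s u ∷ inside s u t ++ lastColour s u t ℓ ∷ []

 flags : (Fin n → Label) → Arm n → List Bool
 flags s (single u) = true ∷ []
 flags s (long u t ℓ) = true ∷ map seeds (moves s u t) ++ true ∷ []

 local : (Fin n → Label) → Arm n → Fin n → Fin 3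
 local s A = assoc zero (keys A) (vals s A)

 flag : (Fin n → Label) → Arm n → Fin n → Bool
 flag s A = assoc false (keys A) (flags s A)

 length-solve : ∀ σ bs → length (complete σ bs) ≡ length bs
 length-solve σ [] = refl
 length-solve σ (b ∷ bs) = cong suc (length-solve _ bs)

 length-colours : ∀ σ bs ms → length ms ≡ length bs → length (colours σ bs ms) ≡ length bs
 length-colours σ [] ms e = refl
 length-colours σ (b ∷ bs) (m ∷ ms) e = cong suc (length-colours _ bs ms (suc-injective e))

 length-inside : ∀ s u t → length (inside s u t) ≡ length t
 length-inside s u t = trans (length-colours _ (map (lab s) t) (moves s u t) (length-solve _ (map (lab s) t))) (length-map (lab s) t)

 length-seeds : ∀ s u t → length (map seeds (moves s u t)) ≡ length t
 length-seeds s u t = trans (length-map seeds (moves s u t)) (trans (length-solve _ (map (lab s) t)) (length-map (lab s) t))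

 split-map : {A : Set} (f : Fin n → A) (t : List (Fin n)) (ℓ : Fin n) (xs : List A) (y : A) → length xs ≡ length t →
  map f (t ++ ℓ ∷ []) ≡ xs ++ y ∷ [] → map f t ≡ xs × f ℓ ≡ y
 split-map f [] ℓ [] y _ e = refl , ∷-injectiveˡ e
 split-map f (x ∷ t) ℓ (z ∷ xs) y l e with split-map f t ℓ xs y (suc-injective l) (∷-injectiveʳ e)
 ... | p , q = cong₂ _∷_ (∷-injectiveˡ e) p , q

 length-snoc : {A B : Set} (xs : List A) (a : A) (ys : List B) (b : B) → length ys ≡ length xs → length (xs ++ a ∷ []) ≡ length (ys ++ b ∷ [])
 length-snoc xs a ys b e = trans (length-++ xs) (trans (cong (_+ 1) (sym e)) (sym (length-++ ys)))

 fits-map : ∀ (f : Fin n → Fin 3) (g : Fin n → Label) u t → Fits (f u) (map g t) (map f t) →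
  (∀ v → v ∈ t → is (g v) (f v) ≡ false) × (∀ v w → consec (u ∷ t) v w ! → f v ≢ f w)
 fits-map f g u [] _ = (λ _ ()) , λ _ _ ()
 fits-map f g u (x ∷ t) (ne , l , ft) with fits-map f g x t ft
 ... | h , k = (λ v e → lab-ok v (elem-cons t e)) , λ v w e → diff v w (consec-cons u x t e)
  where
  lab-ok : ∀ v → v ≡ x ⊎ v ∈ t → is (g v) (f v) ≡ false
  lab-ok v (inj₁ refl) = l
  lab-ok v (inj₂ e) = h v e
  diff : ∀ v w → (v ≡ u × w ≡ x) ⊎ consec (x ∷ t) v w ! → f v ≢ f w
  diff v w (inj₁ (refl , refl)) e = ne (sym e)
  diff v w (inj₂ p) = k v w p

 map-fits : ∀ (f : Fin n → Fin 3) (g : Fin n → Label) u t → (∀ v → v ∈ t → is (g v) (f v) ≡ false) →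
  (∀ v w → consec (u ∷ t) v w ! → f v ≢ f w) → Fits (f u) (map g t) (map f t)
 map-fits f g u [] h k = _
 map-fits f g u (x ∷ t) h k = (λ e → k u x (true-∨ˡ _ (true-∧ (==-refl {u = u}) (==-refl {u = x}))) (sym e)) , h x (elem-here x t) ,
  map-fits f g x t (λ v e → h v (elem-there v x t e)) (λ v w e → k v w (true-∨ʳ (v == u ∧ w == x) e))

 module _ (s : Fin n → Label) (u : Fin n) (t : List (Fin n)) (ℓ : Fin n) (dist : distinctᵇ (u ∷ t ++ ℓ ∷ []) !) where

  private
   A = long u t ℓ
   φ = local s A
   ψ = flag s A
   plan : Plan (fixed (headColour s u)) (map (lab s) t) (moves s u t) × cost (moves s u t) ≤ proj₁ (sweep (map (lab s) t)) + entry (proj₂ (sweep (map (lab s) t))) (fixed (headColour s u))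
   plan = solve-plan (fixed (headColour s u)) (map (lab s) t) (small-entry (proj₂ (sweep (map (lab s) t))) (headColour s u))

   keys-vals : map φ (u ∷ t ++ ℓ ∷ []) ≡ vals s A
   keys-vals = map-assoc zero (keys A) (vals s A) dist (cong suc (length-snoc t ℓ (inside s u t) _ (length-inside s u t)))

   keys-flags : map ψ (u ∷ t ++ ℓ ∷ []) ≡ flags s A
   keys-flags = map-assoc false (keys A) (flags s A) dist (cong suc (length-snoc t ℓ (map seeds (moves s u t)) _ (length-seeds s u t)))

  φ-head : φ u ≡ headColour s u
  φ-head = ∷-injectiveˡ keys-vals

  φ-inner : map φ t ≡ inside s u t
  φ-inner = proj₁ (split-map φ t ℓ (inside s u t) _ (length-inside s u t) (∷-injectiveʳ keys-vals))

  φ-last : φ ℓ ≡ lastColour s u t ℓ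
  φ-last = proj₂ (split-map φ t ℓ (inside s u t) _ (length-inside s u t) (∷-injectiveʳ keys-vals))

  ψ-inner : map ψ t ≡ map seeds (moves s u t)
  ψ-inner = proj₁ (split-map ψ t ℓ (map seeds (moves s u t)) _ (length-seeds s u t) (∷-injectiveʳ keys-flags))

  ψ-head : ψ u !
  ψ-head = ∷-injectiveˡ keys-flags

  ψ-last : ψ ℓ !
  ψ-last = proj₂ (split-map ψ t ℓ (map seeds (moves s u t)) _ (length-seeds s u t) (∷-injectiveʳ keys-flags))

  -- The constant 3 pays for the first vertex, the last vertex and the entry of the table in the
  -- initial state, which is at most 1.
  flags-cost : ∑ (u ∷ t ++ ℓ ∷ []) (λ v → ⟦ ψ v ⟧) ≤ proj₁ (sweep (map (lab s) t)) + 3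
  flags-cost = begin
   ∑ (u ∷ t ++ ℓ ∷ []) (λ v → ⟦ ψ v ⟧) ≡⟨ sym (∑-map ψ (u ∷ t ++ ℓ ∷ []) ⟦_⟧) ⟩
   ∑ (map ψ (u ∷ t ++ ℓ ∷ [])) ⟦_⟧ ≡⟨ cong (λ l → ∑ l ⟦_⟧) keys-flags ⟩
   1 + ∑ (map seeds (moves s u t) ++ true ∷ []) ⟦_⟧ ≡⟨ cong suc (∑-++ (map seeds (moves s u t)) (true ∷ []) ⟦_⟧) ⟩
   1 + (∑ (map seeds (moves s u t)) ⟦_⟧ + 1) ≡⟨ cong (λ k → 1 + (k + 1)) (∑-map seeds (moves s u t) ⟦_⟧) ⟩
   1 + (cost (moves s u t) + 1) ≡⟨ +-comm 1 _ ⟩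
   cost (moves s u t) + 1 + 1 ≤⟨ +-monoˡ-≤ 1 (+-monoˡ-≤ 1 (≤-trans (proj₂ plan) (+-monoʳ-≤ base (small-entry (proj₂ (sweep (map (lab s) t))) (headColour s u))))) ⟩
   base + 1 + 1 + 1 ≡⟨ trans (+-assoc (base + 1) 1 1) (+-assoc base 1 2) ⟩
   base + 3 ∎
   where
   base = proj₁ (sweep (map (lab s) t))

  private
   fits-φ : Fits (φ u) (map (lab s) t) (map φ t)
   fits-φ = subst₂ (λ a l → Fits a (map (lab s) t) l) (sym φ-head) (sym φ-inner)
    (plan-fits (fixed (headColour s u)) (map (lab s) t) (moves s u t) (proj₁ plan) refl)

  inner-label : ∀ v → v ∈ t → is (lab s v) (φ v) ≡ false
  inner-label = proj₁ (fits-map φ (lab s) u t fits-φ)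

  last-avoids : ⟦ known (s (N₁ ℓ)) ⟧ + (⟦ known (s (N₂ ℓ)) ⟧ + ⟦ known (s (N₃ ℓ)) ⟧) ≤ 1 →
   φ (lastOf u t) ≢ φ ℓ × is (s (N₁ ℓ)) (φ ℓ) ≡ false × is (s (N₂ ℓ)) (φ ℓ) ≡ false × is (s (N₃ ℓ)) (φ ℓ) ≡ false
  last-avoids le rewrite φ-last with avoids (just (lastOf (headColour s u) (inside s u t))) (s (N₁ ℓ)) (s (N₂ ℓ)) (s (N₃ ℓ)) (s≤s le)
  ... | p , q , r , w = (λ e → is-≢ p (trans prev≡ e)) , q , r , w
   where
   prev≡ : lastOf (headColour s u) (inside s u t) ≡ φ (lastOf u t)
   prev≡ = trans (cong₂ lastOf (sym φ-head) (sym φ-inner)) (lastOf-map φ u t)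

  consecutive-differ : ⟦ known (s (N₁ ℓ)) ⟧ + (⟦ known (s (N₂ ℓ)) ⟧ + ⟦ known (s (N₃ ℓ)) ⟧) ≤ 1 →
   ∀ v w → consec (u ∷ t ++ ℓ ∷ []) v w ! → φ v ≢ φ w
  consecutive-differ le v w e with consec-snoc u t ℓ e
  ... | inj₁ p = proj₂ (fits-map φ (lab s) u t fits-φ) v w p
  ... | inj₂ (refl , refl) = proj₁ (last-avoids le)

  inner-unique : (d : Fin n → Fin 3) → d u ≡ φ u → (∀ v → v ∈ t → is (lab s v) (d v) ≡ false) →
   (∀ v w → consec (u ∷ t) v w ! → d v ≢ d w) → (∀ v → v ∈ t → ψ v ! → d v ≡ φ v) →
   ∀ v → v ∈ t → d v ≡ φ v
  inner-unique d du h k ag v e = pointwise t (trans (plan-unique (fixed (headColour s u)) (map (lab s) t) (moves s u t) (map d t) (proj₁ plan) (trans du φ-head)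
    (map-fits d (lab s) u t h k) (subst (λ xs → Agrees (moves s u t) xs (map d t)) φ-inner (agree t (moves s u t) ψ-inner ag))) (sym φ-inner)) v e
   where
   pointwise : ∀ t → map d t ≡ map φ t → ∀ v → v ∈ t → d v ≡ φ v
   pointwise (x ∷ t) eq v e with elem-cons t e
   ... | inj₁ refl = ∷-injectiveˡ eq
   ... | inj₂ e' = pointwise t (∷-injectiveʳ eq) v e'
   agree : ∀ t ms → map ψ t ≡ map seeds ms → (∀ v → v ∈ t → ψ v ! → d v ≡ φ v) → Agrees ms (map φ t) (map d t)
   agree [] [] e ag = _
   agree (x ∷ t) (m ∷ ms) e ag = (λ sd → ag x (elem-here x t) (trans (∷-injectiveˡ e) sd)) , agree t ms (∷-injectiveʳ e) (λ v p → ag v (elem-there v x t p))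

 head-avoids : ∀ s u → ⟦ known (s (N₁ u)) ⟧ + (⟦ known (s (N₂ u)) ⟧ + ⟦ known (s (N₃ u)) ⟧) ≤ 2 →
  is (s (N₁ u)) (headColour s u) ≡ false × is (s (N₂ u)) (headColour s u) ≡ false × is (s (N₃ u)) (headColour s u) ≡ false
 head-avoids s u le = proj₂ (avoids nothing (s (N₁ u)) (s (N₂ u)) (s (N₃ u)) le)

 -- The colouring of an arm depends only on the labels next to it. The translation of dependent
 -- colours in `Shift` rests on this locality.
 vals-ext : ∀ s s' A → (∀ v → v ∈ (keys A) → s (N₁ v) ≡ s' (N₁ v) × s (N₂ v) ≡ s' (N₂ v) × s (N₃ v) ≡ s' (N₃ v)) → vals s A ≡ vals s' A
 vals-ext s s' A h = by A h
  where
  headEq : ∀ u → s (N₁ u) ≡ s' (N₁ u) × s (N₂ u) ≡ s' (N₂ u) × s (N₃ u) ≡ s' (N₃ u) → headColour s u ≡ headColour s' u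
  headEq u (p , q , r) rewrite p | q | r = refl
  labEq : ∀ t → (∀ v → v ∈ t → s (N₁ v) ≡ s' (N₁ v) × s (N₂ v) ≡ s' (N₂ v) × s (N₃ v) ≡ s' (N₃ v)) → map (lab s) t ≡ map (lab s') t
  labEq [] h = refl
  labEq (x ∷ t) h = cong₂ _∷_ (cong₂ _<∣>_ (proj₁ hx) (cong₂ _<∣>_ (proj₁ (proj₂ hx)) (proj₂ (proj₂ hx)))) (labEq t λ v e → h v (elem-there v x t e))
   where hx = h x (elem-here x t)
  avoidEq : ∀ p ℓ → s (N₁ ℓ) ≡ s' (N₁ ℓ) × s (N₂ ℓ) ≡ s' (N₂ ℓ) × s (N₃ ℓ) ≡ s' (N₃ ℓ) → avoid p (s (N₁ ℓ)) (s (N₂ ℓ)) (s (N₃ ℓ)) ≡ avoid p (s' (N₁ ℓ)) (s' (N₂ ℓ)) (s' (N₃ ℓ))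
  avoidEq p ℓ (e₁ , e₂ , e₃) rewrite e₁ | e₂ | e₃ = refl
  by : ∀ A → (∀ v → v ∈ (keys A) → s (N₁ v) ≡ s' (N₁ v) × s (N₂ v) ≡ s' (N₂ v) × s (N₃ v) ≡ s' (N₃ v)) → vals s A ≡ vals s' A
  by (single u) h = cong (_∷ []) (headEq u (h u (elem-here u [])))
  by (long u t ℓ) h = eq (headEq u (h u (elem-here u (t ++ ℓ ∷ [])))) (labEq t λ v e → h v (elem-there v u (t ++ ℓ ∷ []) (elem-++ˡ v t (ℓ ∷ []) e)))
    (λ p → avoidEq p ℓ (h ℓ (elem-there ℓ u (t ++ ℓ ∷ []) (elem-++ʳ ℓ t (ℓ ∷ []) (elem-here ℓ [])))))
   where
   build : Fin 3 → List Label → (Label → Fin 3) → List (Fin 3)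
   build a bs f = a ∷ colours (fixed a) bs (complete (fixed a) bs) ++ f (just (lastOf a (colours (fixed a) bs (complete (fixed a) bs)))) ∷ []
   build-ext : ∀ {a a' bs bs'} (f f' : Label → Fin 3) → a ≡ a' → bs ≡ bs' → (∀ p → f p ≡ f' p) → build a bs f ≡ build a' bs' f'
   build-ext {a} {_} {bs} f f' refl refl e = cong (λ x → a ∷ colours (fixed a) bs (complete (fixed a) bs) ++ x ∷ []) (e _)
   eq : headColour s u ≡ headColour s' u → map (lab s) t ≡ map (lab s') t →
    (∀ p → avoid p (s (N₁ ℓ)) (s (N₂ ℓ)) (s (N₃ ℓ)) ≡ avoid p (s' (N₁ ℓ)) (s' (N₂ ℓ)) (s' (N₃ ℓ))) → vals s (long u t ℓ) ≡ vals s' (long u t ℓ)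
   eq p q r = build-ext (λ p → avoid p (s (N₁ ℓ)) (s (N₂ ℓ)) (s (N₃ ℓ))) (λ p → avoid p (s' (N₁ ℓ)) (s' (N₂ ℓ)) (s' (N₃ ℓ))) p q r

consec-∈ˡ : (l : List (Fin n)) {v w : Fin n} → consec l v w ! → v ∈ l
consec-∈ˡ (a ∷ t) {v} {w} = go a t
 where
 go : ∀ a t → consec (a ∷ t) v w ! → v ∈ a ∷ t
 go a (b ∷ t) e with consec-cons a b t {v} {w} e
 ... | inj₁ (refl , _) = elem-here v (b ∷ t)
 ... | inj₂ p = elem-there v a (b ∷ t) (go b t p)

consec-∈ʳ : (l : List (Fin n)) {v w : Fin n} → consec l v w ! → w ∈ l
consec-∈ʳ (a ∷ t) {v} {w} = go a t
 where
 go : ∀ a t → consec (a ∷ t) v w ! → w ∈ a ∷ t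
 go a (b ∷ t) e with consec-cons a b t {v} {w} e
 ... | inj₁ (_ , refl) = elem-there w a (w ∷ t) (elem-here w t)
 ... | inj₂ p = elem-there w a (b ∷ t) (go b t p)

consec-asym : (l : List (Fin n)) {v w : Fin n} → distinctᵇ l ! → consec l v w ! → consec l w v ! → ⊥
consec-asym (a ∷ t) {v} {w} = go a t
 where
 go : ∀ a t → distinctᵇ (a ∷ t) ! → consec (a ∷ t) v w ! → consec (a ∷ t) w v ! → ⊥
 go a (b ∷ t) d e f with consec-cons a b t {v} {w} e | consec-cons a b t {w} {v} f
 ... | inj₁ (refl , refl) | inj₁ (refl , _) = contra (elem-here v t) (distinct-head v (v ∷ t) d)
 ... | inj₁ (refl , _) | inj₂ p = contra (consec-∈ʳ (b ∷ t) p) (distinct-head v (b ∷ t) d)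
 ... | inj₂ p | inj₁ (refl , _) = contra (consec-∈ʳ (b ∷ t) p) (distinct-head w (b ∷ t) d)
 ... | inj₂ p | inj₂ q = go b t (distinct-tail a (b ∷ t) d) p q

consec-adjacent : (G : Graph n) (l : List (Fin n)) → Linked G l → ∀ v w → consec l v w ! → G v w !
consec-adjacent G (a ∷ t) = go a t
 where
 go : ∀ a t → Linked G (a ∷ t) → ∀ v w → consec (a ∷ t) v w ! → G v w !
 go a (b ∷ t) (g , lk) v w e with consec-cons a b t {v} {w} e
 ... | inj₁ (refl , refl) = g
 ... | inj₂ p = go b t lk v w p

consec-first : (u x : Fin n) (t : List (Fin n)) → consec (u ∷ x ∷ t) u x !
consec-first u x t = true-∨ˡ _ (true-∧ (==-refl {u = u}) (==-refl {u = x}))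

consec-later : (u x : Fin n) (t : List (Fin n)) (v w : Fin n) → consec (x ∷ t) v w ! → consec (u ∷ x ∷ t) v w !
consec-later u x t v w e = true-∨ʳ (v == u ∧ w == x) e

consec-last : (u : Fin n) (t : List (Fin n)) (ℓ : Fin n) → consec (u ∷ t ++ ℓ ∷ []) (lastOf u t) ℓ !
consec-last u [] ℓ = consec-first u ℓ []
consec-last u (x ∷ t) ℓ = consec-later u x (t ++ ℓ ∷ []) (lastOf x t) ℓ (consec-last x t ℓ)

consec-snocˡ : (u : Fin n) (t : List (Fin n)) (ℓ v w : Fin n) → consec (u ∷ t) v w ! → consec (u ∷ t ++ ℓ ∷ []) v w !
consec-snocˡ u (x ∷ t) ℓ v w e with consec-cons u x t {v} {w} e
... | inj₁ (refl , refl) = consec-first v w (t ++ ℓ ∷ [])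
... | inj₂ p = consec-later u x (t ++ ℓ ∷ []) v w (consec-snocˡ x t ℓ v w p)

inner-neighbours : (u : Fin n) (t : List (Fin n)) (ℓ v : Fin n) → v ∈ t →
 ∃₂ λ p q → consec (u ∷ t ++ ℓ ∷ []) p v ! × consec (u ∷ t ++ ℓ ∷ []) v q !
inner-neighbours u (x ∷ t) ℓ v e with elem-cons t e
... | inj₁ refl = u , next t
 where
 next : ∀ t → ∃[ q ] consec (u ∷ v ∷ t ++ ℓ ∷ []) u v ! × consec (u ∷ v ∷ t ++ ℓ ∷ []) v q !
 next [] = ℓ , consec-first u v (ℓ ∷ []) , consec-later u v (ℓ ∷ []) v ℓ (consec-first v ℓ [])
 next (y ∷ t) = y , consec-first u v (y ∷ t ++ ℓ ∷ []) , consec-later u v (y ∷ t ++ ℓ ∷ []) v y (consec-first v y (t ++ ℓ ∷ []))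
... | inj₂ e' with inner-neighbours x t ℓ v e'
... | p , q , a , b = p , q , consec-later u x (t ++ ℓ ∷ []) p v a , consec-later u x (t ++ ℓ ∷ []) v q b

only₃ : {G : Graph n} → Cubic G → ∀ v p q x → G v p ! → G v q ! → G v x ! → p ≢ q → p ≢ x → q ≢ x →
 ∀ y → G v y ! → y ≡ p ⊎ y ≡ q ⊎ y ≡ x
only₃ {G = G} cG v p q x vp vq vx pq px qx = Nbrs.only (nbrs₃ {G = G} v p q x (Cubic.deg cG v) vp (true-∖ {P = G v} vq (pq ∘ sym))
 (true-∖ {P = G v ∖ p} (true-∖ {P = G v} vx (px ∘ sym)) (qx ∘ sym)))

module AtArm {n : ℕ} (G : Graph n) (cG : Cubic G) (N : ∀ v → Nbrs G v) (σ : Fin n → Label) where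
 open Cubic cG
 open Local (λ v → Nbrs.a (N v)) (λ v → Nbrs.b (N v)) (λ v → Nbrs.c (N v))

 private
  N₁ N₂ N₃ : Fin n → Fin n
  N₁ v = Nbrs.a (N v)
  N₂ v = Nbrs.b (N v)
  N₃ v = Nbrs.c (N v)

  known≤1 : ∀ l → ⟦ known l ⟧ ≤ 1
  known≤1 l = ⟦⟧≤1 (known l)

 one-unknown : ∀ v w → G v w ! → σ w ≡ nothing → ⟦ known (σ (N₁ v)) ⟧ + (⟦ known (σ (N₂ v)) ⟧ + ⟦ known (σ (N₃ v)) ⟧) ≤ 2
 one-unknown v w g e with Nbrs.only (N v) w g
 ... | inj₁ refl rewrite e = +-mono-≤ (known≤1 (σ (N₂ v))) (known≤1 (σ (N₃ v)))
 ... | inj₂ (inj₁ refl) rewrite e = +-mono-≤ (known≤1 (σ (N₁ v))) (known≤1 (σ (N₃ v)))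
 ... | inj₂ (inj₂ refl) rewrite e = +-mono-≤ (known≤1 (σ (N₁ v))) (≤-trans (≤-reflexive (+-identityʳ _)) (known≤1 (σ (N₂ v))))

 two-unknown : ∀ v p w → p ≢ w → G v p ! → G v w ! → σ p ≡ nothing → σ w ≡ nothing →
  ⟦ known (σ (N₁ v)) ⟧ + (⟦ known (σ (N₂ v)) ⟧ + ⟦ known (σ (N₃ v)) ⟧) ≤ 1
 two-unknown v p w ne gp gw ep ew with Nbrs.only (N v) p gp | Nbrs.only (N v) w gw
 ... | inj₁ refl | inj₁ refl = ⊥-elim (ne refl)
 ... | inj₂ (inj₁ refl) | inj₂ (inj₁ refl) = ⊥-elim (ne refl)
 ... | inj₂ (inj₂ refl) | inj₂ (inj₂ refl) = ⊥-elim (ne refl)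
 ... | inj₁ refl | inj₂ (inj₁ refl) rewrite ep | ew = known≤1 (σ (N₃ v))
 ... | inj₂ (inj₁ refl) | inj₁ refl rewrite ep | ew = known≤1 (σ (N₃ v))
 ... | inj₁ refl | inj₂ (inj₂ refl) rewrite ep | ew = ≤-trans (≤-reflexive (+-identityʳ _)) (known≤1 (σ (N₂ v)))
 ... | inj₂ (inj₂ refl) | inj₁ refl rewrite ep | ew = ≤-trans (≤-reflexive (+-identityʳ _)) (known≤1 (σ (N₂ v)))
 ... | inj₂ (inj₁ refl) | inj₂ (inj₂ refl) rewrite ep | ew = ≤-trans (≤-reflexive (+-identityʳ _)) (known≤1 (σ (N₁ v)))
 ... | inj₂ (inj₂ refl) | inj₂ (inj₁ refl) rewrite ep | ew = ≤-trans (≤-reflexive (+-identityʳ _)) (known≤1 (σ (N₁ v)))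

 lab-just : ∀ v x l → G v x ! → σ x ≡ l → (∀ y → G v y ! → y ≢ x → σ y ≡ nothing) → lab σ v ≡ l
 lab-just v x l g e h with Nbrs.only (N v) x g
 ... | inj₁ refl rewrite e | h (N₂ v) (Nbrs.vb (N v)) (Nbrs.a≢b (N v) ∘ sym) | h (N₃ v) (Nbrs.vc (N v)) (Nbrs.a≢c (N v) ∘ sym) = unit l
  where
  unit : ∀ (l : Label) → l <∣> nothing ≡ l
  unit nothing = refl
  unit (just _) = refl
 ... | inj₂ (inj₁ refl) rewrite e | h (N₁ v) (Nbrs.va (N v)) (Nbrs.a≢b (N v)) | h (N₃ v) (Nbrs.vc (N v)) (Nbrs.b≢c (N v) ∘ sym) = unit l
  where
  unit : ∀ (l : Label) → l <∣> nothing ≡ l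
  unit nothing = refl
  unit (just _) = refl
 ... | inj₂ (inj₂ refl) rewrite e | h (N₁ v) (Nbrs.va (N v)) (Nbrs.a≢c (N v)) | h (N₂ v) (Nbrs.vb (N v)) (Nbrs.b≢c (N v)) = refl

 is-lab : ∀ v x → (∀ w → G v w ! → is (σ w) x ≡ false) → is (lab σ v) x ≡ false
 is-lab v x h = pick (σ (N₁ v)) (σ (N₂ v)) (σ (N₃ v)) (h _ (Nbrs.va (N v))) (h _ (Nbrs.vb (N v))) (h _ (Nbrs.vc (N v)))
  where
  pick : ∀ k l m → is k x ≡ false → is l x ≡ false → is m x ≡ false → is (k <∣> (l <∣> m)) x ≡ false
  pick (just _) _ _ p _ _ = p
  pick nothing (just _) _ _ q _ = q
  pick nothing nothing m _ _ r = r

 module _ (A : Arm n) (linked : Linked G (keys A)) (dist : distinctᵇ (keys A) !)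
  (chordless : ∀ v w → v ∈ keys A → w ∈ keys A → G v w ! → consec (keys A) v w ∨ consec (keys A) w v !)
  (blank : ∀ v → v ∈ keys A → σ v ≡ nothing)
  (z : Fin n) (ℓz : G (lastA A) z !) (z∉ : elemᵇ z (keys A) ≡ false) (zblank : σ z ≡ nothing) where

  by-nbrs : ∀ v x → is (σ (N₁ v)) x ≡ false × is (σ (N₂ v)) x ≡ false × is (σ (N₃ v)) x ≡ false → ∀ w → G v w ! → is (σ w) x ≡ false
  by-nbrs v x (p , q , r) w g with Nbrs.only (N v) w g
  ... | inj₁ refl = p
  ... | inj₂ (inj₁ refl) = q
  ... | inj₂ (inj₂ refl) = r

  -- The vertex before the last one and the neighbour z are both uncoloured. This is why every arm
  -- has to end beside a vertex that comes later.
  last-count : ∀ u t ℓ → A ≡ long u t ℓ → ⟦ known (σ (N₁ ℓ)) ⟧ + (⟦ known (σ (N₂ ℓ)) ⟧ + ⟦ known (σ (N₃ ℓ)) ⟧) ≤ 1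
  last-count u t ℓ refl = two-unknown ℓ (lastOf u t) z
   (λ { refl → contra (consec-∈ˡ (keys A) (consec-last u t ℓ)) z∉ })
   (syms (consec-adjacent G (keys A) linked (lastOf u t) ℓ (consec-last u t ℓ))) ℓz (blank (lastOf u t) (consec-∈ˡ (keys A) (consec-last u t ℓ))) zblank

  local-differ : ∀ v w → consec (keys A) v w ! → local σ A v ≢ local σ A w
  local-differ v w e = by A refl e
   where
   by : ∀ B → A ≡ B → consec (keys B) v w ! → local σ B v ≢ local σ B w
   by (single u) eq ()
   by (long u t ℓ) eq e' = consecutive-differ σ u t ℓ (subst (λ B → distinctᵇ (keys B) !) eq dist) (last-count u t ℓ eq) v w e'

  -- The two neighbours along the arm and w already account for the degree 3.
  outside-only : ∀ u t ℓ → A ≡ long u t ℓ → ∀ v → v ∈ t → ∀ w → G v w ! → elemᵇ w (keys A) ≡ false →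
   ∀ y → G v y ! → y ≢ w → y ∈ keys A
  outside-only u t ℓ refl v vt w vw w∉ y vy ne = from (inner-neighbours u t ℓ v vt)
   where
   from : (∃₂ λ p q → consec (keys A) p v ! × consec (keys A) v q !) → y ∈ keys A
   from (p , q , cp , cq) = pick (only₃ cG v p q w (syms (consec-adjacent G (keys A) linked p v cp)) (consec-adjacent G (keys A) linked v q cq) vw
     (λ { refl → consec-asym (keys A) dist cp cq }) (λ { refl → contra p∈ w∉ }) (λ { refl → contra q∈ w∉ }) y vy)
    where
    p∈ = consec-∈ˡ (keys A) {p} {v} cp
    q∈ = consec-∈ʳ (keys A) {v} {q} cq
    pick : y ≡ p ⊎ y ≡ q ⊎ y ≡ w → y ∈ keys A
    pick (inj₁ refl) = p∈
    pick (inj₂ (inj₁ refl)) = q∈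
    pick (inj₂ (inj₂ r)) = ⊥-elim (ne r)

  local-avoids : ∀ v w → v ∈ keys A → G v w ! → is (σ w) (local σ A v) ≡ false
  local-avoids v w v∈ g = by A refl v∈
   where
   is-blank : σ w ≡ nothing → ∀ x → is (σ w) x ≡ false
   is-blank e x rewrite e = refl
   by : ∀ B → A ≡ B → v ∈ keys B → is (σ w) (local σ B v) ≡ false
   by (single u) refl e with elem-cons [] e
   ... | inj₁ refl = trans (cong (is (σ w)) (∷-injectiveˡ (map-assoc zero (keys A) (vals σ A) dist refl)))
       (by-nbrs v _ (head-avoids σ v (one-unknown v z ℓz zblank)) w g)
   by (long u t ℓ) refl e with elem-cons (t ++ ℓ ∷ []) e
   ... | inj₁ refl = trans (cong (is (σ w)) (φ-head σ u t ℓ dist)) (by-nbrs v _ (head-avoids σ v (next t refl)) w g)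
    where
    next : ∀ t' → t ≡ t' → ⟦ known (σ (N₁ v)) ⟧ + (⟦ known (σ (N₂ v)) ⟧ + ⟦ known (σ (N₃ v)) ⟧) ≤ 2
    next [] refl = one-unknown v ℓ (proj₁ linked) (blank ℓ (elem-there ℓ v (ℓ ∷ []) (elem-here ℓ [])))
    next (x ∷ t') refl = one-unknown v x (proj₁ linked) (blank x (elem-there x v (x ∷ t' ++ ℓ ∷ []) (elem-here x (t' ++ ℓ ∷ []))))
   ... | inj₂ e' with elem-split v t (ℓ ∷ []) e'
   ... | inj₂ e'' with elem-cons [] e''
   ... | inj₁ refl = by-nbrs v (local σ A v) (proj₂ (last-avoids σ u t v dist (last-count u t v refl))) w g
   by (long u t ℓ) refl e | inj₂ e' | inj₁ vt = decide (elemᵇ w (keys A)) refl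
    where
    decide : ∀ b → elemᵇ w (keys A) ≡ b → is (σ w) (local σ A v) ≡ false
    decide true w∈ = is-blank (blank w w∈) _
    decide false w∉ = subst (λ l → is l (local σ A v) ≡ false)
     (lab-just v w (σ w) g refl (λ y vy ne → blank y (outside-only u t ℓ refl v vt w g w∉ y vy ne))) (inner-label σ u t ℓ dist v vt)

  local-unique : (d : Fin n → Fin 3) → (∀ v w → v ∈ keys A → G v w ! → is (σ w) (d v) ≡ false) →
   (∀ v w → consec (keys A) v w ! → d v ≢ d w) → (∀ v → v ∈ keys A → flag σ A v ! → d v ≡ local σ A v) →
   ∀ v → v ∈ keys A → d v ≡ local σ A v
  local-unique d av df ag v v∈ = by A refl v∈
   where
   by : ∀ B → A ≡ B → v ∈ keys B → d v ≡ local σ B v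
   by (single u) refl e with elem-cons [] e
   ... | inj₁ refl = ag v e (∷-injectiveˡ (map-assoc false (keys A) (flags σ A) dist refl))
   by (long u t ℓ) refl e with elem-cons (t ++ ℓ ∷ []) e
   ... | inj₁ refl = ag v e (ψ-head σ v t ℓ dist)
   ... | inj₂ e' with elem-split v t (ℓ ∷ []) e'
   ... | inj₂ e'' with elem-cons [] e''
   ... | inj₁ refl = ag v e (ψ-last σ u t v dist)
   by (long u t ℓ) refl e | inj₂ e' | inj₁ vt = inner-unique σ u t ℓ dist d (ag u (elem-here u (t ++ ℓ ∷ [])) (ψ-head σ u t ℓ dist))
    (λ w wt → is-lab w (d w) (λ x → av w x (elem-there w u (t ++ ℓ ∷ []) (elem-++ˡ w t (ℓ ∷ []) wt))))
    (λ w x c → df w x (consec-snocˡ u t ℓ w x c))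
    (λ w wt → ag w (elem-there w u (t ++ ℓ ∷ []) (elem-++ˡ w t (ℓ ∷ []) wt))) v vt

-- Colouring all paths by rank with random shifts.

infixl 6 _⊕_ _⊖_

_⊕_ : Fin 3 → Fin 3 → Fin 3
zero ⊕ y = y
suc zero ⊕ zero = suc zero
suc zero ⊕ suc zero = suc (suc zero)
suc zero ⊕ suc (suc zero) = zero
suc (suc zero) ⊕ zero = suc (suc zero)
suc (suc zero) ⊕ suc zero = zero
suc (suc zero) ⊕ suc (suc zero) = suc zero

_⊖_ : Fin 3 → Fin 3 → Fin 3
x ⊖ zero = x
x ⊖ suc zero = x ⊕ suc (suc zero)
x ⊖ suc (suc zero) = x ⊕ suc zero

opaque
 ⊖-⊕ : ∀ x a → a ⊕ (x ⊖ a) ≡ x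
 ⊖-⊕ = from-yes (all? λ x → all? λ a → (a ⊕ (x ⊖ a)) ≟ᶠ x)

 ⊕-⊖ : ∀ x a → (a ⊕ x) ⊖ a ≡ x
 ⊕-⊖ = from-yes (all? λ x → all? λ a → ((a ⊕ x) ⊖ a) ≟ᶠ x)

 ⊕-⊖-⊕ : ∀ x a z → (x ⊕ z) ⊖ (a ⊕ z) ≡ x ⊖ a
 ⊕-⊖-⊕ = from-yes (all? λ x → all? λ a → all? λ z → ((x ⊕ z) ⊖ (a ⊕ z)) ≟ᶠ (x ⊖ a))

 ⊕-swap : ∀ a z x → (a ⊕ z) ⊕ x ≡ (a ⊕ x) ⊕ z
 ⊕-swap = from-yes (all? λ a → all? λ z → all? λ x → ((a ⊕ z) ⊕ x) ≟ᶠ ((a ⊕ x) ⊕ z))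

 ⊕-zero : ∀ a → a ⊕ zero ≡ a
 ⊕-zero = from-yes (all? λ a → (a ⊕ zero) ≟ᶠ a)

 ⊖-swap : ∀ x z a → (x ⊕ z) ⊖ a ≡ (x ⊖ a) ⊕ z
 ⊖-swap = from-yes (all? λ x → all? λ z → all? λ a → ((x ⊕ z) ⊖ a) ≟ᶠ ((x ⊖ a) ⊕ z))

-- The vertices coloured by the randomised procedure, arranged in paths; a path is coloured after
-- all paths of smaller rank, and its last vertex has a neighbour that is coloured later.
record Layout {n : ℕ} (G : Graph n) (K L g : ℕ) : Set where
 field
  act : Fin n → Bool
  arm : Fin n → Arm n
  rk : Fin n → ℕ
 key : Fin n → List (Fin n)
 key v = keys (arm v)
 field
  self : ∀ v → act v ! → v ∈ key v
  key-act : ∀ v w → act v ! → w ∈ key v → act w !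
  key-arm : ∀ v w → act v ! → w ∈ key v → arm w ≡ arm v
  key-rk : ∀ v w → act v ! → w ∈ key v → rk w ≡ rk v
  linked : ∀ v → act v ! → Linked G (key v)
  dist : ∀ v → act v ! → distinctᵇ (key v) !
  short : ∀ v → act v ! → length (key v) ≤ L
  rk<K : ∀ v → act v ! → rk v < K
  same : ∀ v w → act v ! → act w ! → G v w ! → rk v ≡ rk w → w ∈ key v
  onward : ∀ v → act v ! → ∃[ w ] G (lastA (arm v)) w ! × (act w ! → rk v < rk w)
  acyclic : ∀ v → act v ! → onShortCycle G g v ≡ false
  -- Length of the walk in `cones-disjoint`: 2L along an arm, one edge, and two descents through at
  -- most K arms at 2L + 1 each.
  g-large : (L + L) + suc (K * suc (L + L) + K * suc (L + L)) ≤ g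

module _ {n : ℕ} {E : Fin n → Fin n → Set} where

 walk-from-head : ∀ y t → (∀ a b → consec (y ∷ t) a b ! → E a b) → ∀ x → x ∈ y ∷ t → ∃[ k ] k ≤ length t × Walk E k y x
 walk-from-head y t h x e with elem-cons t e
 ... | inj₁ refl = 0 , z≤n , []
 walk-from-head y (z ∷ t) h x e | inj₂ e' with walk-from-head z t (λ a b p → h a b (consec-later y z t a b p)) x e'
 ... | k , le , p = suc k , s≤s le , h y z (consec-first y z t) ∷ p

 -- The walk returns to the first vertex and sets out again. This is wasteful but needs no
 -- distinction of the order of x and y.
 walk-in-list : (∀ {a b} → E a b → E b a) → ∀ l → (∀ a b → consec l a b ! → E a b) → ∀ x y → x ∈ l → y ∈ l →
  ∃[ k ] k ≤ length l + length l × Walk E k x y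
 walk-in-list s (u ∷ t) h x y ex ey with walk-from-head u t h x ex | walk-from-head u t h y ey
 ... | j , lj , p | k , lk , q = j + k , +-mono-≤ (≤-trans lj (n≤1+n _)) (≤-trans lk (n≤1+n _)) , reverse-walk s p +++ q

module Run {n : ℕ} (G : Graph n) (cG : Cubic G) (N : ∀ v → Nbrs G v) {K L g : ℕ} (lay : Layout G K L g) where
 open Cubic cG
 open Layout lay
 open Local (λ v → Nbrs.a (N v)) (λ v → Nbrs.b (N v)) (λ v → Nbrs.c (N v))

 hd : Fin n → Fin n
 hd v = headA (arm v)

 -- An arm is planned in coordinates in which its own shift is zero. Translating this shift and
 -- those on which its labels depend then translates its colours and leaves the plan unchanged.
 rel : Fin 3 → (Fin n → Label) → Fin n → Label
 rel a s w = Maybe.map (_⊖ a) (s w)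

 -- `k` is the number of ranks already coloured; the arms of rank k read only the stage before them.
 stage : (Fin n → Fin 3) → ℕ → Fin n → Label
 stage r zero v = nothing
 stage r (suc k) v = if act v ∧ (rk v ≡ᵇ k) then just (r (hd v) ⊕ local (rel (r (hd v)) (stage r k)) (arm v) v) else stage r k v

 view : (Fin n → Fin 3) → Fin n → Fin n → Label
 view r v = rel (r (hd v)) (stage r (rk v))

 final : (Fin n → Fin 3) → Fin n → Fin 3
 final r v = r (hd v) ⊕ local (view r v) (arm v) v

 stage-miss : ∀ r k v → (act v ! → rk v ≢ k) → stage r (suc k) v ≡ stage r k v
 stage-miss r k v h = cong (λ b → if b then just (r (hd v) ⊕ local (rel (r (hd v)) (stage r k)) (arm v) v) else stage r k v)
  (¬true {act v ∧ (rk v ≡ᵇ k)} λ e → h (∧ˡ e) (≡ᵇ-true (∧ʳ {act v} e)))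

 stage-hit : ∀ r v → act v ! → stage r (suc (rk v)) v ≡ just (final r v)
 stage-hit r v a = cong (λ b → if b then just (final r v) else stage r (rk v) v) (true-∧ a (true-≡ᵇ {rk v} refl))

 stage-before : ∀ r k v → (act v ! → k ≤ rk v) → stage r k v ≡ nothing
 stage-before r zero v h = refl
 stage-before r (suc k) v h = trans (stage-miss r k v (λ a e → 1+n≰n (subst (suc k ≤_) e (h a)))) (stage-before r k v (λ a → ≤-trans (n≤1+n k) (h a)))

 stage-after : ∀ r k v → act v ! → rk v < k → stage r k v ≡ just (final r v)
 stage-after r (suc k) v a (s≤s le) with m≤n⇒m<n∨m≡n le
 ... | inj₁ lt = trans (stage-miss r k v (λ _ e → 1+n≰n (subst (_< k) e lt))) (stage-after r k v a lt)
 ... | inj₂ refl = stage-hit r v a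

 -- A chord would close a short cycle with a part of the arm.
 chordless : ∀ u → act u ! → ∀ v w → v ∈ key u → w ∈ key u → G v w ! → consec (key u) v w ∨ consec (key u) w v !
 chordless u au v w v∈ w∈ vw = decide (consec (key u) v w ∨ consec (key u) w v) refl
  where
  decide : ∀ b → consec (key u) v w ∨ consec (key u) w v ≡ b → consec (key u) v w ∨ consec (key u) w v !
  decide true e = e
  decide false e = ⊥-elim (cyc (walk-in-list {E = Avoiding G cG v w} (λ {a} {b} p → syms (proj₁ p) , trans (sym (isPair-sym v w a b)) (proj₂ p)) (key u)
    (λ a b p → consec-adjacent G (key u) (linked u au) a b p , ¬true (unpaired a b p ∘ isPair-true)) v w v∈ w∈))
   where
   unpaired : ∀ a b → consec (key u) a b ! → (a ≡ v × b ≡ w) ⊎ (a ≡ w × b ≡ v) → ⊥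
   unpaired a b p (inj₁ (refl , refl)) = contra p (∨-falseˡ e)
   unpaired a b p (inj₂ (refl , refl)) = contra p (∨-falseʳ (consec (key u) v w) e)
   cyc : (∃[ k ] k ≤ length (key u) + length (key u) × Walk (Avoiding G cG v w) k v w) → ⊥
   cyc (k , le , p) = contra (short-cycle G cG vw p (≤-trans le (≤-trans (+-mono-≤ (short u au) (short u au)) (≤-trans (m≤m+n (L + L) _) g-large)))) (acyclic v (key-act u v au v∈))

 module Stage (r : Fin n → Fin 3) where

  view-nothing : ∀ v w → (act w ! → rk v ≤ rk w) → view r v w ≡ nothing
  view-nothing v w h rewrite stage-before r (rk v) w h = refl

  view-just : ∀ v w → act w ! → rk w < rk v → view r v w ≡ just (final r w ⊖ r (hd v))
  view-just v w a lt rewrite stage-after r (rk v) w a lt = refl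

  module At (v : Fin n) (av : act v !) where
   private
    z = proj₁ (onward v av)
    ℓz = proj₁ (proj₂ (onward v av))
    zrk = proj₂ (proj₂ (onward v av))
    z∉ : elemᵇ z (key v) ≡ false
    z∉ = ¬true λ e → 1+n≰n (≤-trans (zrk (key-act v z av e)) (≤-reflexive (key-rk v z av e)))
    module A = AtArm G cG N (view r v)
    blank : ∀ w → w ∈ key v → view r v w ≡ nothing
    blank w e = view-nothing v w λ _ → ≤-reflexive (sym (key-rk v w av e))
    zblank : view r v z ≡ nothing
    zblank = view-nothing v z λ a → ≤-trans (n≤1+n _) (zrk a)

   avoids-view : ∀ u w → u ∈ key v → G u w ! → is (view r v w) (local (view r v) (arm v) u) ≡ false
   avoids-view = A.local-avoids (arm v) (linked v av) (dist v av) (chordless v av) blank z ℓz z∉ zblank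

   differ : ∀ u w → consec (key v) u w ! → local (view r v) (arm v) u ≢ local (view r v) (arm v) w
   differ = A.local-differ (arm v) (linked v av) (dist v av) (chordless v av) blank z ℓz z∉ zblank

   determined : (d : Fin n → Fin 3) → (∀ u w → u ∈ key v → G u w ! → is (view r v w) (d u) ≡ false) →
    (∀ u w → consec (key v) u w ! → d u ≢ d w) → (∀ u → u ∈ key v → flag (view r v) (arm v) u ! → d u ≡ local (view r v) (arm v) u) →
    ∀ u → u ∈ key v → d u ≡ local (view r v) (arm v) u
   determined = A.local-unique (arm v) (linked v av) (dist v av) (chordless v av) blank z ℓz z∉ zblank

   outside : ∀ u t ℓ → arm v ≡ long u t ℓ → ∀ x → x ∈ t → ∀ w → G x w ! → elemᵇ w (key v) ≡ false → ∀ y → G x y ! → y ≢ w → y ∈ key v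
   outside = A.outside-only (arm v) (linked v av) (dist v av) (chordless v av) blank z ℓz z∉ zblank

  seed : Fin n → Bool
  seed v = flag (view r v) (arm v) v

  final-same : ∀ v w → act v ! → w ∈ key v → final r w ≡ r (hd v) ⊕ local (view r v) (arm v) w
  final-same v w av e = cong₂ (λ A k → r (headA A) ⊕ local (rel (r (headA A)) (stage r k)) A w) (key-arm v w av e) (key-rk v w av e)

  seed-same : ∀ v w → act v ! → w ∈ key v → seed w ≡ flag (view r v) (arm v) w
  seed-same v w av e = cong₂ (λ A k → flag (rel (r (headA A)) (stage r k)) A w) (key-arm v w av e) (key-rk v w av e)

  lower-differ : ∀ v w → act v ! → act w ! → G v w ! → rk w < rk v → final r v ≢ final r w
  lower-differ v w av aw vw lt e = is-≢ (subst (λ l → is l (local (view r v) (arm v) v) ≡ false) (view-just v w aw lt) (At.avoids-view v av v w (self v av) vw))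
   (trans (cong (_⊖ r (hd v)) (sym e)) (⊕-⊖ (local (view r v) (arm v) v) (r (hd v))))

  -- For different ranks the later vertex avoids the label of the earlier one. For equal ranks
  -- `same` puts both on one arm, where adjacent vertices are consecutive.
  final-proper : ∀ v w → act v ! → act w ! → G v w ! → final r v ≢ final r w
  final-proper v w av aw vw with <-cmp (rk v) (rk w)
  ... | tri< lt _ _ = λ e → lower-differ w v aw av (syms vw) lt (sym e)
  ... | tri> _ _ gt = lower-differ v w av aw vw gt
  ... | tri≈ _ eq _ = λ e → by (∨-true {consec (key v) v w} (chordless v av v w (self v av) w∈ vw))
      (trans (sym (⊕-⊖ _ (r (hd v)))) (trans (cong (_⊖ r (hd v)) (trans e (final-same v w av w∈))) (⊕-⊖ _ (r (hd v)))))
   where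
   w∈ = same v w av aw vw eq
   by : consec (key v) v w ! ⊎ consec (key v) w v ! → local (view r v) (arm v) v ≢ local (view r v) (arm v) w
   by (inj₁ p) = At.differ v av v w p
   by (inj₂ p) q = At.differ v av w v p (sym q)

  -- Induction on the rank: once the earlier colours are determined, `d` meets the same labels
  -- around an arm, and the plan of the arm has only one solution.
  final-unique : (d : Fin n → Fin 3) → (∀ i j → G i j ! → d i ≢ d j) → (∀ v → act v ! → seed v ! → d v ≡ final r v) →
   ∀ v → act v ! → d v ≡ final r v
  final-unique d pr ag v av = below (suc (rk v)) v av ≤-refl
   where
   below : ∀ k v → act v ! → rk v < k → d v ≡ final r v
   below (suc k) v av (s≤s le) = trans (sym (⊖-⊕ (d v) (r (hd v)))) (cong (r (hd v) ⊕_)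
     (At.determined v av (λ u → d u ⊖ r (hd v)) av₁ df₁ ag₁ v (self v av)))
    where
    cancel : ∀ {x y} a → x ⊖ a ≡ y ⊖ a → x ≡ y
    cancel {x} {y} a e = trans (sym (⊖-⊕ x a)) (trans (cong (a ⊕_) e) (⊖-⊕ y a))
    av₁ : ∀ u w → u ∈ key v → G u w ! → is (view r v w) (d u ⊖ r (hd v)) ≡ false
    av₁ u w u∈ uw = by (act w) refl (rk v ≤? rk w)
     where
     blank : view r v w ≡ nothing → is (view r v w) (d u ⊖ r (hd v)) ≡ false
     blank e rewrite e = refl
     by : ∀ a → act w ≡ a → Dec (rk v ≤ rk w) → is (view r v w) (d u ⊖ r (hd v)) ≡ false
     by false aw _ = blank (view-nothing v w λ a → contra a aw)
     by true aw (yes p) = blank (view-nothing v w λ _ → p)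
     by true aw (no np) = subst (λ l → is l (d u ⊖ r (hd v)) ≡ false) (sym (view-just v w aw (≰⇒> np)))
      (≢-is λ e → pr u w uw (trans (sym (cancel (r (hd v)) e)) (sym (below k w aw (<-≤-trans (≰⇒> np) le)))))
    df₁ : ∀ u w → consec (key v) u w ! → d u ⊖ r (hd v) ≢ d w ⊖ r (hd v)
    df₁ u w c e = pr u w (consec-adjacent G (key v) (linked v av) u w c) (cancel (r (hd v)) e)
    ag₁ : ∀ u → u ∈ key v → flag (view r v) (arm v) u ! → d u ⊖ r (hd v) ≡ local (view r v) (arm v) u
    ag₁ u u∈ fl = trans (cong (_⊖ r (hd v)) (trans (ag u (key-act v u av u∈) (trans (seed-same v u av u∈) fl)) (final-same v u av u∈))) (⊕-⊖ _ (r (hd v)))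

 -- Changing the random shifts by z on a set closed under dependence changes the colours there by z.
 module Shift (C : Fin n → Bool) (C-act : ∀ v → C v ! → act v !) (C-key : ∀ v w → C v ! → w ∈ key v → C w !)
  (C-down : ∀ v w → C v ! → G v w ! → act w ! → rk w < rk v → C w !)
  (r r' : Fin n → Fin 3) (z : Fin 3) (shifted : ∀ v → C v ! → r' (hd v) ≡ r (hd v) ⊕ z) where

  step : ∀ v → C v ! → (∀ w → C w ! → stage r' (rk v) w ≡ Maybe.map (_⊕ z) (stage r (rk v) w)) →
   stage r' (suc (rk v)) v ≡ Maybe.map (_⊕ z) (stage r (suc (rk v)) v)
  step v cv ih = trans (stage-hit r' v av) (trans (cong just eq) (cong (Maybe.map (_⊕ z)) (sym (stage-hit r v av))))
   where
   av = C-act v cv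
   views : ∀ u → u ∈ key v → ∀ w → G u w ! → view r' v w ≡ view r v w
   views u u∈ w uw = by (act w) refl (rk v ≤? rk w)
    where
    by : ∀ a → act w ≡ a → Dec (rk v ≤ rk w) → view r' v w ≡ view r v w
    by false aw _ = trans (Stage.view-nothing r' v w λ a → contra a aw) (sym (Stage.view-nothing r v w λ a → contra a aw))
    by true aw (yes p) = trans (Stage.view-nothing r' v w λ _ → p) (sym (Stage.view-nothing r v w λ _ → p))
    by true aw (no np) = trans (cong (Maybe.map (_⊖ r' (hd v))) (ih w (C-down u w (C-key v u cv u∈) uw aw
      (<-≤-trans (≰⇒> np) (≤-reflexive (sym (key-rk v u av u∈))))))) (rebase (stage r (rk v) w))
     where
     rebase : ∀ l → Maybe.map (_⊖ r' (hd v)) (Maybe.map (_⊕ z) l) ≡ Maybe.map (_⊖ r (hd v)) l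
     rebase nothing = refl
     rebase (just x) = cong just (trans (cong ((x ⊕ z) ⊖_) (shifted v cv)) (⊕-⊖-⊕ x (r (hd v)) z))
   eq : final r' v ≡ final r v ⊕ z
   eq = trans (cong₂ _⊕_ (shifted v cv) (cong (λ xs → assoc zero (key v) xs v)
     (vals-ext (view r' v) (view r v) (arm v) λ u u∈ → views u u∈ _ (Nbrs.va (N u)) , views u u∈ _ (Nbrs.vb (N u)) , views u u∈ _ (Nbrs.vc (N u)))))
    (⊕-swap (r (hd v)) z (local (view r v) (arm v) v))

  stage-shift : ∀ k v → C v ! → stage r' k v ≡ Maybe.map (_⊕ z) (stage r k v)
  stage-shift zero v cv = refl
  stage-shift (suc k) v cv with rk v ≟ k
  ... | no ne = trans (stage-miss r' k v (λ _ → ne)) (trans (stage-shift k v cv) (cong (Maybe.map (_⊕ z)) (sym (stage-miss r k v (λ _ → ne)))))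
  ... | yes e = subst (λ k → stage r' (suc k) v ≡ Maybe.map (_⊕ z) (stage r (suc k) v)) e
     (step v cv (subst (λ k → ∀ w → C w ! → stage r' k w ≡ Maybe.map (_⊕ z) (stage r k w)) (sym e) (stage-shift k)))

  final-shift : ∀ v → C v ! → final r' v ≡ final r v ⊕ z
  final-shift v cv = just-inj (trans (sym (stage-hit r' v (C-act v cv))) (trans (stage-shift (suc (rk v)) v cv) (cong (Maybe.map (_⊕ z)) (stage-hit r v (C-act v cv)))))
   where
   just-inj : ∀ {a b : Fin 3} → just a ≡ just b → a ≡ b
   just-inj refl = refl

-- The cost of a path and its average over the shifts.

elem-sum : (l : List (Fin n)) (v : Fin n) (f : Fin n → ℕ) → v ∈ l → f v ≤ ∑ l (λ w → ⟦ v == w ⟧ * f w)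
elem-sum (x ∷ l) v f e with elem-cons l e
... | inj₁ refl = ≤-trans (≤-reflexive (trans (sym (+-identityʳ (f v))) (cong (λ b → ⟦ b ⟧ * f v) (sym (==-refl {u = v}))))) (m≤m+n _ _)
... | inj₂ e' = ≤-trans (elem-sum l v f e') (m≤n+m _ _)

distinct-sum : (l : List (Fin n)) (f : Fin n → ℕ) → distinctᵇ l ! → ∑ l f ≤ ∑ᶠ (λ v → ⟦ elemᵇ v l ⟧ * f v)
distinct-sum {n} [] f d = z≤n
distinct-sum {n} (x ∷ l) f d = begin
 f x + ∑ l f ≤⟨ +-mono-≤ (≤-reflexive (sym (∑ᶠ-δ f x))) (distinct-sum l f (distinct-tail x l d)) ⟩
 ∑ᶠ (λ v → ⟦ v == x ⟧ * f v) + ∑ᶠ (λ v → ⟦ elemᵇ v l ⟧ * f v) ≡⟨ sym (∑-+ (allFin n) _ _) ⟩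
 ∑ᶠ (λ v → ⟦ v == x ⟧ * f v + ⟦ elemᵇ v l ⟧ * f v) ≤⟨ ∑-mono (allFin n) (λ v → ≤-trans (≤-reflexive (sym (*-distribʳ-+ (f v) ⟦ v == x ⟧ ⟦ elemᵇ v l ⟧))) (*-monoˡ-≤ (f v) (excl v (v == x) (elemᵇ v l) refl refl))) ⟩
 ∑ᶠ (λ v → ⟦ elemᵇ v (x ∷ l) ⟧ * f v) ∎
 where
 excl : ∀ v a b → v == x ≡ a → elemᵇ v l ≡ b → ⟦ a ⟧ + ⟦ b ⟧ ≤ ⟦ a ∨ b ⟧
 excl v true true p q = contra (subst (λ w → w ∈ l) (==-true p) q) (distinct-head x l d)
 excl v true false _ _ = ≤-refl
 excl v false b _ _ = ≤-refl

consec-left-unique : (l : List (Fin n)) {a b v : Fin n} → distinctᵇ l ! → consec l a v ! → consec l b v ! → a ≡ b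
consec-left-unique (x ∷ t) {a} {b} {v} = go x t
 where
 go : ∀ x t → distinctᵇ (x ∷ t) ! → consec (x ∷ t) a v ! → consec (x ∷ t) b v ! → a ≡ b
 go x (y ∷ t) d e f with consec-cons x y t {a} {v} e | consec-cons x y t {b} {v} f
 ... | inj₁ (p , _) | inj₁ (q , _) = trans p (sym q)
 ... | inj₂ p | inj₂ q = go y t (distinct-tail x (y ∷ t) d) p q
 ... | inj₁ (_ , refl) | inj₂ q = ⊥-elim (no-pred v t (distinct-tail x (v ∷ t) d) q)
  where
  no-pred : ∀ {b} v t → distinctᵇ (v ∷ t) ! → consec (v ∷ t) b v ! → ⊥
  no-pred {b} v (y ∷ t) d e with consec-cons v y t {b} {v} e
  ... | inj₁ (_ , refl) = contra (elem-here v t) (distinct-head v (v ∷ t) d)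
  ... | inj₂ p = contra (consec-∈ʳ (y ∷ t) p) (distinct-head v (y ∷ t) d)
 ... | inj₂ q | inj₁ (_ , refl) = ⊥-elim (no-pred v t (distinct-tail x (v ∷ t) d) q)
  where
  no-pred : ∀ {b} v t → distinctᵇ (v ∷ t) ! → consec (v ∷ t) b v ! → ⊥
  no-pred {b} v (y ∷ t) d e with consec-cons v y t {b} {v} e
  ... | inj₁ (_ , refl) = contra (elem-here v t) (distinct-head v (v ∷ t) d)
  ... | inj₂ p = contra (consec-∈ʳ (y ∷ t) p) (distinct-head v (y ∷ t) d)

consec-right-unique : (l : List (Fin n)) {a b v : Fin n} → distinctᵇ l ! → consec l v a ! → consec l v b ! → a ≡ b
consec-right-unique (x ∷ t) {a} {b} {v} = go x t
 where
 go : ∀ x t → distinctᵇ (x ∷ t) ! → consec (x ∷ t) v a ! → consec (x ∷ t) v b ! → a ≡ b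
 go x (y ∷ t) d e f with consec-cons x y t {v} {a} e | consec-cons x y t {v} {b} f
 ... | inj₁ (_ , p) | inj₁ (_ , q) = trans p (sym q)
 ... | inj₂ p | inj₂ q = go y t (distinct-tail x (y ∷ t) d) p q
 ... | inj₁ (refl , _) | inj₂ q = contra (consec-∈ˡ (y ∷ t) q) (distinct-head v (y ∷ t) d)
 ... | inj₂ q | inj₁ (refl , _) = contra (consec-∈ˡ (y ∷ t) q) (distinct-head v (y ∷ t) d)

-- Six times the constant collected by the sweep, amortised by the potential of the row that was
-- reached.
tot : List Label → ℕ
tot bs = 6 * proj₁ (sweep bs) + potential (proj₂ (sweep bs))

tot-F : ∀ bs → tot (nothing ∷ bs) ≤ 3 + tot bs
tot-F bs = begin
 6 * (i + k) + p' ≡⟨ cong (_+ p') (trans (*-distribˡ-+ 6 i k) (+-comm (6 * i) (6 * k))) ⟩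
 6 * k + 6 * i + p' ≡⟨ +-assoc (6 * k) (6 * i) p' ⟩
 6 * k + (6 * i + p') ≤⟨ +-monoʳ-≤ (6 * k) (potential-F σ) ⟩
 6 * k + (3 + potential σ) ≡⟨ trans (sym (+-assoc (6 * k) 3 _)) (trans (cong (_+ potential σ) (+-comm (6 * k) 3)) (+-assoc 3 (6 * k) _)) ⟩
 3 + (6 * k + potential σ) ∎
 where
 σ = proj₂ (sweep bs)
 k = proj₁ (sweep bs)
 i = proj₁ (rowStep σ nothing)
 p' = potential (proj₂ (rowStep σ nothing))

tot-B : ∀ bs → ∑ (allFin 3) (λ b → tot (just b ∷ bs)) ≤ 3 * (1 + tot bs)
tot-B bs = begin
 ∑ (allFin 3) (λ b → 6 * (i b + k) + p b) ≡⟨ ∑-cong (allFin 3) (λ b → trans (cong (_+ p b) (trans (*-distribˡ-+ 6 (i b) k) (+-comm (6 * i b) (6 * k)))) (+-assoc (6 * k) (6 * i b) (p b))) ⟩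
 ∑ (allFin 3) (λ b → 6 * k + (6 * i b + p b)) ≡⟨ ∑-+ (allFin 3) (λ _ → 6 * k) (λ b → 6 * i b + p b) ⟩
 3 * (6 * k) + ∑ (allFin 3) (λ b → 6 * i b + p b) ≤⟨ +-monoʳ-≤ (3 * (6 * k)) (potential-B σ) ⟩
 3 * (6 * k) + (3 + 3 * potential σ) ≡⟨ solve 2 (λ k p → con 3 :* (con 6 :* k) :+ (con 3 :+ con 3 :* p) := con 3 :* (con 1 :+ (con 6 :* k :+ p))) refl k (potential σ) ⟩
 3 * (1 + (6 * k + potential σ)) ∎
 where
 σ = proj₂ (sweep bs)
 k = proj₁ (sweep bs)
 i p : Fin 3 → ℕ
 i b = proj₁ (rowStep σ (just b))
 p b = potential (proj₂ (rowStep σ (just b)))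

∑-rotate : (H : Fin 3 → ℕ) (a : Fin 3) → ∑ (allFin 3) (λ z → H (a ⊕ z)) ≡ ∑ (allFin 3) H
∑-rotate H zero = refl
∑-rotate H (suc zero) = solve 3 (λ x y z → y :+ (z :+ (x :+ con 0)) := x :+ (y :+ (z :+ con 0))) refl (H zero) (H (suc zero)) (H (suc (suc zero)))
∑-rotate H (suc (suc zero)) = solve 3 (λ x y z → z :+ (x :+ (y :+ con 0)) := x :+ (y :+ (z :+ con 0))) refl (H zero) (H (suc zero)) (H (suc (suc zero)))

∑-rotate′ : (H : Fin 3 → ℕ) (z : Fin 3) → ∑ (allFin 3) (λ a → H (a ⊕ z)) ≡ ∑ (allFin 3) H
∑-rotate′ H z = trans (∑-cong (allFin 3) λ a → cong H (comm a z)) (∑-rotate H z)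
 where
 comm : ∀ a z → a ⊕ z ≡ z ⊕ a
 comm = from-yes (all? λ a → all? λ z → (a ⊕ z) ≟ᶠ (z ⊕ a))

head-∈ : (A : Arm n) → headA A ∈ keys A
head-∈ (single u) = elem-here u []
head-∈ (long u t ℓ) = elem-here u (t ++ ℓ ∷ [])

inner-long : (A : Arm n) (v : Fin n) → v ∈ inner A → ∃₂ λ u t → ∃[ ℓ ] A ≡ long u t ℓ × v ∈ t
inner-long (long u t ℓ) v e = u , t , ℓ , refl , e

inner-∈ : (A : Arm n) (v : Fin n) → v ∈ inner A → v ∈ keys A
inner-∈ (long u t ℓ) v e = elem-there v u (t ++ ℓ ∷ []) (elem-++ˡ v t (ℓ ∷ []) e)

inner-distinct : (A : Arm n) → distinctᵇ (keys A) ! → distinctᵇ (inner A) !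
inner-distinct (single u) d = refl
inner-distinct (long u t ℓ) d = go t (distinct-tail u (t ++ ℓ ∷ []) d)
 where
 go : ∀ t → distinctᵇ (t ++ ℓ ∷ []) ! → distinctᵇ t !
 go [] _ = refl
 go (x ∷ t) d = true-∧ (cong not (∨-falseˡ (trans (sym (elem-++ x t (ℓ ∷ []))) (distinct-head x (t ++ ℓ ∷ []) d)))) (go t (distinct-tail x (t ++ ℓ ∷ []) d))

module Average {n : ℕ} (G : Graph n) (cG : Cubic G) (N : ∀ v → Nbrs G v) {K L g : ℕ} (lay : Layout G K L g) where
 open Cubic cG
 open Layout lay
 open Run G cG N lay
 open Local (λ v → Nbrs.a (N v)) (λ v → Nbrs.b (N v)) (λ v → Nbrs.c (N v))

 private
  hd-∈ : ∀ v → hd v ∈ key v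
  hd-∈ v = head-∈ (arm v)

 -- The vertices on whose random shifts the colour of x depends.
 cone : ℕ → Fin n → Fin n → Bool
 cone zero x y = false
 cone (suc k) x y = elemᵇ y (key x) ∨ some (λ w → elemᵇ w (key x) ∧ some (λ w' → G w w' ∧ act w' ∧ (suc (rk w') ≤ᵇ rk w) ∧ cone k w' y))

 Descent : ℕ → Fin n → Fin n → Set
 Descent k x y = ∃₂ λ w w' → w ∈ key x × G w w' ! × act w' ! × rk w' < rk w × cone k w' y !

 cone-cases : ∀ k x y → cone (suc k) x y ! → y ∈ key x ⊎ Descent k x y
 cone-cases k x y e with ∨-true {elemᵇ y (key x)} e
 ... | inj₁ p = inj₁ p
 ... | inj₂ p with some-elim _ p
 ... | w , q with some-elim _ (∧ʳ {elemᵇ w (key x)} q)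
 ... | w' , m = inj₂ (w , w' , ∧ˡ q , ∧ˡ m , ∧ˡ (∧ʳ {G w w'} m) ,
       ≤ᵇ-true (∧ˡ (∧ʳ {act w'} (∧ʳ {G w w'} m))) ,
       ∧ʳ {suc (rk w') ≤ᵇ rk w} (∧ʳ {act w'} (∧ʳ {G w w'} m)))

 cone-descent : ∀ k x y → Descent k x y → cone (suc k) x y !
 cone-descent k x y (w , w' , wx , g , a , lt , c) = true-∨ʳ (elemᵇ y (key x))
  (some-intro (λ w → elemᵇ w (key x) ∧ some (λ w' → G w w' ∧ act w' ∧ (suc (rk w') ≤ᵇ rk w) ∧ cone k w' y)) w (true-∧ wx
   (some-intro (λ w' → G w w' ∧ act w' ∧ (suc (rk w') ≤ᵇ rk w) ∧ cone k w' y) w' (true-∧ g (true-∧ a (true-∧ (true-≤ᵇ lt) c))))))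

 cone-act : ∀ k x y → act x ! → cone k x y ! → act y ! × rk y ≤ rk x
 cone-act (suc k) x y ax e with cone-cases k x y e
 ... | inj₁ p = key-act x y ax p , ≤-reflexive (key-rk x y ax p)
 ... | inj₂ (w , w' , wx , g , a , lt , c) with cone-act k w' y a c
 ... | ay , le = ay , ≤-trans le (≤-trans (n≤1+n _) (≤-trans lt (≤-reflexive (key-rk x w ax wx))))

 cone-key : ∀ k x y z → act x ! → cone k x y ! → z ∈ key y → cone k x z !
 cone-key (suc k) x y z ax e zy with cone-cases k x y e
 ... | inj₁ p = true-∨ˡ _ (subst (λ A → z ∈ keys A) (key-arm x y ax p) zy)
 ... | inj₂ (w , w' , wx , g , a , lt , c) = cone-descent k x z (w , w' , wx , g , a , lt , cone-key k w' y z a c zy)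

 cone-self : ∀ k x → act x ! → rk x < k → cone k x x !
 cone-self (suc k) x ax _ = true-∨ˡ _ (self x ax)

 -- `k` counts levels of descent. Each level lowers the rank, so with more levels than the rank of x
 -- nothing is cut off.
 cone-down : ∀ k x y z → act x ! → rk x < k → cone k x y ! → G y z ! → act z ! → rk z < rk y → cone k x z !
 cone-down (suc k) x y z ax (s≤s le) e yz az lt with cone-cases k x y e
 ... | inj₁ p = cone-descent k x z (y , z , p , yz , az , lt , cone-self k z az (<-≤-trans lt (≤-trans (≤-reflexive (key-rk x y ax p)) le)))
 ... | inj₂ (w , w' , wx , g , a , lt' , c) = cone-descent k x z (w , w' , wx , g , a , lt' ,
     cone-down k w' y z a (<-≤-trans lt' (≤-trans (≤-reflexive (key-rk x w ax wx)) le)) c yz az lt)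

 Low : ℕ → Fin n → Fin n → Set
 Low m a b = G a b ! × rk a ≤ m × rk b ≤ m

 arm-walk : ∀ m x y z → act x ! → rk x ≤ m → y ∈ key x → z ∈ key x → ∃[ k ] k ≤ L + L × Walk (Low m) k y z
 arm-walk m x y z ax le yx zx with walk-in-list {E = Low m} (λ p → syms (proj₁ p) , proj₂ (proj₂ p) , proj₁ (proj₂ p)) (key x)
   (λ a b c → consec-adjacent G (key x) (linked x ax) a b c , ≤-trans (≤-reflexive (key-rk x a ax (consec-∈ˡ (key x) c))) le , ≤-trans (≤-reflexive (key-rk x b ax (consec-∈ʳ (key x) c))) le) y z yx zx
 ... | k , lk , p = k , ≤-trans lk (+-mono-≤ (short x ax) (short x ax)) , p

 -- Each level costs at most 2L steps inside an arm and one edge down. Keeping track of the ranks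
 -- ensures later that the walk stays below the arm under study.
 cone-walk : ∀ k m x y → act x ! → rk x ≤ m → cone k x y ! → ∃[ j ] j ≤ k * suc (L + L) × Walk (Low m) j x y
 cone-walk (suc k) m x y ax le e with cone-cases k x y e
 ... | inj₁ p with arm-walk m x x y ax le (self x ax) p
 ... | j , lj , q = j , ≤-trans lj (≤-trans (n≤1+n _) (m≤m+n _ _)) , q
 cone-walk (suc k) m x y ax le e | inj₂ (w , w' , wx , g , a , lt , c) with arm-walk m x x w ax le (self x ax) wx | cone-walk k m w' y a le' c
  where
  le' : rk w' ≤ m
  le' = ≤-trans (n≤1+n _) (≤-trans lt (≤-trans (≤-reflexive (key-rk x w ax wx)) le))
 ... | i , li , p | j , lj , q = i + suc j , ≤-trans (≤-reflexive (+-suc i j)) (s≤s (+-mono-≤ li lj)) ,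
    p +++ ((g , ≤-trans (≤-reflexive (key-rk x w ax wx)) le , ≤-trans (n≤1+n _) (≤-trans lt (≤-trans (≤-reflexive (key-rk x w ax wx)) le))) ∷ q)

 -- If the cones met, one could walk along the arm from v to w, step to x', descend to a common
 -- vertex and climb to x, and with the edge vx this would give a short cycle. The descents have
 -- smaller ranks than v, so they avoid vx.
 cones-disjoint : ∀ h v w x x' y → act h ! → v ∈ key h → w ∈ key h → v ≢ w → G v x ! → G w x' ! → act x ! → act x' ! →
  rk x < rk h → rk x' < rk h → cone K x y ! → cone K x' y ! → ⊥
 cones-disjoint h v w x x' y ah vh wh ne vx wx' ax ax' lt lt' c c' = close
   (walk-in-list {E = Avoiding G cG v x} symm (key h) along v w vh wh) (cone-walk K (rk x) x y ax ≤-refl c) (cone-walk K (rk x') x' y ax' ≤-refl c')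
  where
  symm : ∀ {a b} → Avoiding G cG v x a b → Avoiding G cG v x b a
  symm {a} {b} p = syms (proj₁ p) , trans (sym (isPair-sym v x a b)) (proj₂ p)
  rkv : rk v ≡ rk h
  rkv = key-rk h v ah vh
  along : ∀ a b → consec (key h) a b ! → Avoiding G cG v x a b
  along a b p = consec-adjacent G (key h) (linked h ah) a b p , ¬true (λ e → h' (isPair-true e))
   where
   x∉ : x ∈ key h → ⊥
   x∉ e = 1+n≰n (≤-trans lt (≤-reflexive (sym (key-rk h x ah e))))
   h' : (a ≡ v × b ≡ x) ⊎ (a ≡ x × b ≡ v) → ⊥
   h' (inj₁ (_ , refl)) = x∉ (consec-∈ʳ (key h) p)
   h' (inj₂ (refl , _)) = x∉ (consec-∈ˡ (key h) p)
  low : ∀ m → m < rk h → ∀ {a b} → Low m a b → Avoiding G cG v x a b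
  low m mh {a} {b} (ab , la , lb) = ab , ¬true (λ e → h' (isPair-true e))
   where
   h' : (a ≡ v × b ≡ x) ⊎ (a ≡ x × b ≡ v) → ⊥
   h' (inj₁ (refl , _)) = 1+n≰n (≤-trans mh (≤-trans (≤-reflexive (sym rkv)) la))
   h' (inj₂ (_ , refl)) = 1+n≰n (≤-trans mh (≤-trans (≤-reflexive (sym rkv)) lb))
  step : Avoiding G cG v x w x'
  step = wx' , ¬true (λ e → h' (isPair-true e))
   where
   h' : (w ≡ v × x' ≡ x) ⊎ (w ≡ x × x' ≡ v) → ⊥
   h' (inj₁ (e , _)) = ne (sym e)
   h' (inj₂ (_ , refl)) = 1+n≰n (≤-trans lt' (≤-reflexive (sym rkv)))
  close : (∃[ k ] k ≤ length (key h) + length (key h) × Walk (Avoiding G cG v x) k v w) → (∃[ j ] j ≤ K * suc (L + L) × Walk (Low (rk x)) j x y) →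
   (∃[ j ] j ≤ K * suc (L + L) × Walk (Low (rk x')) j x' y) → ⊥
  close (k , lk , p) (i , li , q) (j , lj , r) = contra (short-cycle G cG vx
    (p +++ (step ∷ (map-walk (low (rk x') lt') r +++ reverse-walk symm (map-walk (low (rk x) lt) q))))
    (≤-trans (+-mono-≤ (≤-trans lk (+-mono-≤ (short h ah) (short h ah))) (s≤s (+-mono-≤ lj li))) g-large)) (acyclic v (key-act h v ah vh))

 inn : Fin n → Bool
 inn v = act v ∧ elemᵇ v (inner (arm v))

 below : Fin n → Bool
 below v = some (λ x → G v x ∧ act x ∧ (suc (rk x) ≤ᵇ rk v))

 weight : Fin n → ℕ
 weight v = if below v then 1 else 3

 below-elim : ∀ v → below v ! → ∃[ x ] G v x ! × act x ! × rk x < rk v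
 below-elim v e with some-elim _ e
 ... | x , p = x , ∧ˡ p , ∧ˡ (∧ʳ {G v x} p) , ≤ᵇ-true (∧ʳ {act x} (∧ʳ {G v x} p))

 below-intro : ∀ v x → G v x ! → act x ! → rk x < rk v → below v !
 below-intro v x g a lt = some-intro (λ x → G v x ∧ act x ∧ (suc (rk x) ≤ᵇ rk v)) x (true-∧ g (true-∧ a (true-≤ᵇ lt)))

 record Outer (h v : Fin n) : Set where
  field
   out : Fin n
   v-out : G v out !
   out∉ : elemᵇ out (key h) ≡ false
   others : ∀ y → G v y ! → y ≢ out → y ∈ key h

 outer : ∀ h v → act h ! → v ∈ inner (arm h) → Outer h v
 outer h v ah e = from (inner-long (arm h) v e)
  where
  from : (∃₂ λ u t → ∃[ ℓ ] arm h ≡ long u t ℓ × v ∈ t) → Outer h v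
  from (u , t , ℓ , eq , vt) = find (subst (λ A → ∃₂ λ p q → consec (keys A) p v ! × consec (keys A) v q !) (sym eq) (inner-neighbours u t ℓ v vt))
   where
   find : (∃₂ λ p q → consec (key h) p v ! × consec (key h) v q !) → Outer h v
   find (p , q , cp , cq) = pick (M.a ≟ᶠ p) (M.a ≟ᶠ q) (M.b ≟ᶠ p) (M.b ≟ᶠ q)
    where
    module M = Nbrs (N v)
    make : ∀ x → G v x ! → x ≢ p → x ≢ q → Outer h v
    make x g np nq = record { out = x ; v-out = g ; out∉ = x∉ ; others = Stage.At.outside (λ _ → zero) h ah u t ℓ eq v vt x g x∉ }
     where
     x∉ : elemᵇ x (key h) ≡ false
     x∉ = ¬true λ e → by (∨-true {consec (key h) v x} (chordless h ah v x (consec-∈ʳ (key h) cp) e g))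
      where
      by : consec (key h) v x ! ⊎ consec (key h) x v ! → ⊥
      by (inj₁ c) = nq (consec-right-unique (key h) {x} {q} {v} (dist h ah) c cq)
      by (inj₂ c) = np (consec-left-unique (key h) {x} {p} {v} (dist h ah) c cp)
    pick : Dec (M.a ≡ p) → Dec (M.a ≡ q) → Dec (M.b ≡ p) → Dec (M.b ≡ q) → Outer h v
    pick (no x) (no y) _ _ = make M.a M.va x y
    pick _ _ (no x) (no y) = make M.b M.vb x y
    pick (yes x) _ (yes y) _ = ⊥-elim (M.a≢b (trans x (sym y)))
    pick _ (yes x) _ (yes y) = ⊥-elim (M.a≢b (trans x (sym y)))
    pick (yes x) _ _ (yes y) = make M.c M.vc (λ e → M.a≢c (trans x (sym e))) (λ e → M.b≢c (trans y (sym e)))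
    pick _ (yes x) (yes y) _ = make M.c M.vc (λ e → M.b≢c (trans y (sym e))) (λ e → M.a≢c (trans x (sym e)))

 -- All other neighbours of v lie on the arm, where nothing is coloured yet.
 outer-label : ∀ r h v → act h ! → (O : Outer h v) → lab (view r h) v ≡ view r h (Outer.out O)
 outer-label r h v ah O = AtArm.lab-just G cG N (view r h) v out (view r h out) v-out refl
  (λ y g ne → Stage.view-nothing r h y λ _ → ≤-reflexive (sym (key-rk h y ah (others y g ne))))
  where open Outer O

 labels : (Fin n → Fin 3) → Fin n → List (Fin n) → List Label
 labels r h t = map (lab (view r h)) t

 R : List (Fin n → Fin 3)
 R = allFuns n (allFin 3)

 -- Extensionality in r is the case of translating all active vertices by `zero`.
 view-ext : ∀ r r' h → (∀ i → r i ≡ r' i) → ∀ x → view r' h x ≡ view r h x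
 view-ext r r' h e x = by (act x) refl (rk h ≤? rk x)
  where
  open Run.Shift G cG N lay act (λ _ a → a) (λ v w a → key-act v w a) (λ _ _ _ _ a _ → a) r r' zero (λ v _ → trans (sym (e (hd v))) (sym (⊕-zero _)))
  by : ∀ a → act x ≡ a → Dec (rk h ≤ rk x) → view r' h x ≡ view r h x
  by false ax _ = trans (Stage.view-nothing r' h x λ a → contra a ax) (sym (Stage.view-nothing r h x λ a → contra a ax))
  by true ax (yes p) = trans (Stage.view-nothing r' h x λ _ → p) (sym (Stage.view-nothing r h x λ _ → p))
  by true ax (no np) = trans (Stage.view-just r' h x ax (≰⇒> np)) (trans (cong just (cong₂ _⊖_ (trans (final-shift x ax) (⊕-zero _)) (sym (e (hd h))))) (sym (Stage.view-just r h x ax (≰⇒> np))))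

 map-ext : {A B : Set} {f f' : A → B} (t : List A) → (∀ x → f x ≡ f' x) → map f t ≡ map f' t
 map-ext [] h = refl
 map-ext (x ∷ t) h = cong₂ _∷_ (h x) (map-ext t h)

 -- Shifting the cone of the outer neighbour of v changes its label and no other label of the path.
 module Resample (h v : Fin n) (ah : act h !) (vh : v ∈ inner (arm h)) (O : Outer h v) (ax : act (Outer.out O) !) (lt : rk (Outer.out O) < rk h) where
  open Outer O
  C : Fin n → Bool
  C = cone K out

  shift : Fin 3 → (Fin n → Fin 3) → Fin n → Fin 3
  shift z r i = if C i then r i ⊕ z else r i

  shift-in : ∀ z r i → C i ! → shift z r i ≡ r i ⊕ z
  shift-in z r i e rewrite e = refl

  shift-out : ∀ z r i → C i ≡ false → shift z r i ≡ r i
  shift-out z r i e rewrite e = refl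

  -- The cone contains only ranks below that of the arm, so the shift of the arm itself is not
  -- resampled.
  hd-out : C (hd h) ≡ false
  hd-out = ¬true λ e → 1+n≰n (≤-trans lt (≤-trans (≤-reflexive (sym (key-rk h (hd h) ah (hd-∈ h)))) (proj₂ (cone-act K out (hd h) ax e))))

  shifted-label : ∀ z r → lab (view (shift z r) h) v ≡ just ((final r out ⊖ r (hd h)) ⊕ z)
  shifted-label z r = trans (outer-label (shift z r) h v ah O) (trans (Stage.view-just (shift z r) h out ax lt)
   (cong just (trans (cong₂ _⊖_ (final-shift out (cone-self K out ax (rk<K out ax))) (shift-out z r (hd h) hd-out)) (⊖-swap (final r out) z (r (hd h))))))
   where
   open Run.Shift G cG N lay C (λ w c → proj₁ (cone-act K out w ax c)) (λ w y c → cone-key K out w y ax c)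
    (λ w y c → cone-down K out w y ax (rk<K out ax) c) r (shift z r) z (λ w c → shift-in z r (hd w) (cone-key K out w (hd w) ax c (hd-∈ w)))

  -- By `cones-disjoint` the cone on which this label depends contains no translated shift.
  other-label : ∀ z r w → w ∈ inner (arm h) → w ≢ v → lab (view (shift z r) h) w ≡ lab (view r h) w
  other-label z r w wh ne = trans (outer-label (shift z r) h w ah P) (trans (by (act y) refl (rk h ≤? rk y)) (sym (outer-label r h w ah P)))
   where
   P = outer h w ah wh
   y = Outer.out P
   by : ∀ a → act y ≡ a → Dec (rk h ≤ rk y) → view (shift z r) h y ≡ view r h y
   by false ay _ = trans (Stage.view-nothing (shift z r) h y λ a → contra a ay) (sym (Stage.view-nothing r h y λ a → contra a ay))
   by true ay (yes p) = trans (Stage.view-nothing (shift z r) h y λ _ → p) (sym (Stage.view-nothing r h y λ _ → p))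
   by true ay (no np) = trans (Stage.view-just (shift z r) h y ay (≰⇒> np)) (trans (cong just (cong₂ _⊖_ (trans (final-shift y (cone-self K y ay (rk<K y ay))) (⊕-zero _))
     (shift-out z r (hd h) hd-out))) (sym (Stage.view-just r h y ay (≰⇒> np))))
    where
    open Run.Shift G cG N lay (cone K y) (λ w c → proj₁ (cone-act K y w ay c)) (λ w u c → cone-key K y w u ay c)
     (λ w u c → cone-down K y w u ay (rk<K y ay) c) r (shift z r) zero
     (λ u c → trans (shift-out z r (hd u) (¬true λ e → cones-disjoint h v w out y (hd u) ah (inner-∈ (arm h) v vh) (inner-∈ (arm h) w wh) (ne ∘ sym) v-out (Outer.v-out P) ax ay lt (≰⇒> np) e
      (cone-key K y u (hd u) ay c (hd-∈ u)))) (sym (⊕-zero _)))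

  open FunctionSums {Fin 3} _≡_ refl

  -- Translating the cone by z permutes the choices of r, so the sum may be averaged over the three
  -- z. Then the label of v runs through all colours while the labels of `t` stay fixed, and `tot-B`
  -- applies.
  resample : ∀ t → (∀ w → w ∈ t → w ∈ inner (arm h)) → elemᵇ v t ≡ false →
   ∑ R (λ r → tot (labels r h (v ∷ t))) ≤ ∑ R (λ r → 1 + tot (labels r h t))
  resample t sub v∉ = *-cancelˡ-≤ 3 (begin
   3 * ∑ R F ≡⟨ sym (∑-const (allFin 3) (∑ R F)) ⟩
   ∑ (allFin 3) (λ _ → ∑ R F) ≡⟨ ∑-cong (allFin 3) (λ z → sym (∑-allFuns-shift n (allFin 3) (λ i a → if C i then a ⊕ z else a)
    (λ { i refl → refl }) (λ i H _ → inv (C i) z H) F resp-F)) ⟩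
   ∑ (allFin 3) (λ z → ∑ R (λ r → F (shift z r))) ≡⟨ ∑-cong (allFin 3) (λ z → ∑-cong R (λ r → cong tot (cong₂ _∷_ (shifted-label z r) (rest z r t sub v∉)))) ⟩
   ∑ (allFin 3) (λ z → ∑ R (λ r → tot (just (base r ⊕ z) ∷ labels r h t))) ≡⟨ ∑-swap (allFin 3) R (λ z r → tot (just (base r ⊕ z) ∷ labels r h t)) ⟩
   ∑ R (λ r → ∑ (allFin 3) (λ z → tot (just (base r ⊕ z) ∷ labels r h t))) ≡⟨ ∑-cong R (λ r → ∑-rotate (λ b → tot (just b ∷ labels r h t)) (base r)) ⟩
   ∑ R (λ r → ∑ (allFin 3) (λ b → tot (just b ∷ labels r h t))) ≤⟨ ∑-mono R (λ r → tot-B (labels r h t)) ⟩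
   ∑ R (λ r → 3 * (1 + tot (labels r h t))) ≡⟨ ∑-*ˡ 3 R (λ r → 1 + tot (labels r h t)) ⟩
   3 * ∑ R (λ r → 1 + tot (labels r h t)) ∎)
   where
   F : (Fin n → Fin 3) → ℕ
   F r = tot (labels r h (v ∷ t))
   base : (Fin n → Fin 3) → Fin 3
   base r = final r out ⊖ r (hd h)
   resp-F : Resp F
   resp-F r r' e = cong tot (map-ext (v ∷ t) λ w → sym (cong₂ _<∣>_ (view-ext r r' h e _) (cong₂ _<∣>_ (view-ext r r' h e _) (view-ext r r' h e _))))
   inv : ∀ b z (H : Fin 3 → ℕ) → ∑ (allFin 3) (λ a → H (if b then a ⊕ z else a)) ≡ ∑ (allFin 3) H
   inv true z H = ∑-rotate′ H z
   inv false z H = refl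
   rest : ∀ z r t → (∀ w → w ∈ t → w ∈ inner (arm h)) → elemᵇ v t ≡ false → labels (shift z r) h t ≡ labels r h t
   rest z r [] sub v∉ = refl
   rest z r (w ∷ t) sub v∉ = cong₂ _∷_ (other-label z r w (sub w (elem-here w t)) λ { refl → contra (elem-here v t) v∉ })
    (rest z r t (λ u e → sub u (elem-there u w t e)) (∨-falseʳ (v == w) v∉))

 -- Resampling one label at a time replaces a statement about the joint independence of all labels
 -- of the arm. The summand 3 is the potential at the end of the path.
 average : ∀ h → act h ! → ∀ t → (∀ w → w ∈ t → w ∈ inner (arm h)) → distinctᵇ t ! →
  ∑ R (λ r → tot (labels r h t)) ≤ ∑ R (λ _ → 3 + ∑ t weight)
 average h ah [] sub d = ∑-mono R λ _ → ≤-reflexive potential-start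
 average h ah (v ∷ t) sub d = by (below v) refl
  where
  vh = sub v (elem-here v t)
  sub' : ∀ w → w ∈ t → w ∈ inner (arm h)
  sub' w e = sub w (elem-there w v t e)
  O = outer h v ah vh
  open Outer O
  rkv : rk v ≡ rk h
  rkv = key-rk h v ah (inner-∈ (arm h) v vh)
  ih = average h ah t sub' (distinct-tail v t d)
  add : ∀ k → below v ≡ (if k ≤ᵇ 1 then true else false) → ∑ R (λ r → tot (labels r h (v ∷ t))) ≤ ∑ R (λ r → k + tot (labels r h t)) → weight v ≡ k →
   ∑ R (λ r → tot (labels r h (v ∷ t))) ≤ ∑ R (λ _ → 3 + ∑ (v ∷ t) weight)
  add k _ le wk = begin
   ∑ R (λ r → tot (labels r h (v ∷ t))) ≤⟨ le ⟩
   ∑ R (λ r → k + tot (labels r h t)) ≡⟨ ∑-+ R (λ _ → k) (λ r → tot (labels r h t)) ⟩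
   ∑ R (λ _ → k) + ∑ R (λ r → tot (labels r h t)) ≤⟨ +-monoʳ-≤ (∑ R (λ _ → k)) ih ⟩
   ∑ R (λ _ → k) + ∑ R (λ _ → 3 + ∑ t weight) ≡⟨ sym (∑-+ R (λ _ → k) (λ _ → 3 + ∑ t weight)) ⟩
   ∑ R (λ _ → k + (3 + ∑ t weight)) ≡⟨ ∑-cong R (λ _ → trans (trans (sym (+-assoc k 3 _)) (trans (cong (_+ ∑ t weight) (+-comm k 3)) (+-assoc 3 k _))) (cong (λ k → 3 + (k + ∑ t weight)) (sym wk))) ⟩
   ∑ R (λ _ → 3 + (weight v + ∑ t weight)) ∎
  by : ∀ b → below v ≡ b → ∑ R (λ r → tot (labels r h (v ∷ t))) ≤ ∑ R (λ _ → 3 + ∑ (v ∷ t) weight)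
  by false e = add 3 e (∑-mono R λ r → ≤-trans (≤-reflexive (cong (λ l → tot (l ∷ labels r h t)) (blank r))) (tot-F (labels r h t))) (cong (λ b → if b then 1 else 3) e)
   where
   blank : ∀ r → lab (view r h) v ≡ nothing
   blank r = trans (outer-label r h v ah O) (Stage.view-nothing r h out λ a → ≮⇒≥ λ lt → contra (below-intro v out v-out a (<-≤-trans lt (≤-reflexive (sym rkv)))) e)
  by true e = add 1 e (from (below-elim v e)) (cong (λ b → if b then 1 else 3) e)
   where
   from : (∃[ x ] G v x ! × act x ! × rk x < rk v) → ∑ R (λ r → tot (labels r h (v ∷ t))) ≤ ∑ R (λ r → 1 + tot (labels r h t))
   from (x , g , a , lt) with x ≟ᶠ out
   ... | yes refl = Resample.resample h v ah vh O a (<-≤-trans lt (≤-reflexive rkv)) t sub' (distinct-head v t d)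
   ... | no ne = ⊥-elim (1+n≰n (≤-trans lt (≤-reflexive (trans rkv (sym (key-rk h x ah (others x g ne)))))))

 isHead : Fin n → Bool
 isHead h = act h ∧ h == hd h

 rest : ℕ
 rest = ∣ (λ v → not (inn v)) ∣

 head-not-inner : ∀ h → isHead h ! → not (inn h) !
 head-not-inner h e = cong not (¬true λ i → by (inner-long (arm h) h (∧ʳ {act h} i)))
  where
  ah = ∧ˡ {act h} e
  by : (∃₂ λ u t → ∃[ ℓ ] arm h ≡ long u t ℓ × h ∈ t) → ⊥
  by (u , t , ℓ , eq , ht) = contra (elem-++ˡ u t (ℓ ∷ []) (subst (_∈ t) (trans (==-true (∧ʳ {act h} e)) (cong headA eq)) ht))
   (distinct-head u (t ++ ℓ ∷ []) (trans (cong (distinctᵇ ∘ keys) (sym eq)) (dist h ah)))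

 hd-head : ∀ v → act v ! → isHead (hd v) !
 hd-head v av = true-∧ (key-act v (hd v) av (hd-∈ v)) (subst (λ x → hd v == x !) (sym (cong headA (key-arm v (hd v) av (hd-∈ v)))) ==-refl)

 module Seeds (r : Fin n → Fin 3) where
  seeded : Fin n → Bool
  seeded v = act v ∧ Stage.seed r v

  fl : Fin n → Fin n → ℕ
  fl h w = ⟦ flag (view r h) (arm h) w ⟧

  arm-cost : ∀ h → act h ! → 6 * ∑ (key h) (fl h) ≤ tot (labels r h (inner (arm h))) + 18
  arm-cost h ah = by (arm h) (dist h ah)
   where
   by : ∀ A → distinctᵇ (keys A) ! → 6 * ∑ (keys A) (λ w → ⟦ flag (view r h) A w ⟧) ≤ tot (labels r h (inner A)) + 18
   by (single u) d = ≤-trans (*-monoʳ-≤ 6 (+-monoˡ-≤ 0 (⟦⟧≤1 (flag (view r h) (single u) u)))) (≤-trans (m≤m+n 6 12) (m≤n+m 18 (tot [])))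
   by (long u t ℓ) d = ≤-trans (*-monoʳ-≤ 6 (flags-cost (view r h) u t ℓ d)) (≤-trans (≤-reflexive (*-distribˡ-+ 6 (proj₁ (sweep (labels r h t))) 3))
    (+-monoˡ-≤ 18 (m≤m+n _ _)))

  count : ∣ seeded ∣ ≤ ∑ᶠ (λ h → ⟦ isHead h ⟧ * ∑ (key h) (fl h))
  count = begin
   ∣ seeded ∣ ≤⟨ ∑-mono (allFin n) (λ v → one v (act v) refl) ⟩
   ∑ᶠ (λ v → ∑ᶠ (λ h → ⟦ isHead h ⟧ * ∑ (key h) (λ w → ⟦ v == w ⟧ * fl h w))) ≡⟨ ∑-swap (allFin n) (allFin n) _ ⟩
   ∑ᶠ (λ h → ∑ᶠ (λ v → ⟦ isHead h ⟧ * ∑ (key h) (λ w → ⟦ v == w ⟧ * fl h w))) ≡⟨ ∑-cong (allFin n) (λ h → trans (∑-*ˡ ⟦ isHead h ⟧ (allFin n) _) (cong (⟦ isHead h ⟧ *_)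
    (trans (∑-swap (allFin n) (key h) _) (∑-cong (key h) (λ w → ∑ᶠ-δ (λ _ → fl h w) w))))) ⟩
   ∑ᶠ (λ h → ⟦ isHead h ⟧ * ∑ (key h) (fl h)) ∎
   where
   one : ∀ v a → act v ≡ a → ⟦ a ∧ Stage.seed r v ⟧ ≤ ∑ᶠ (λ h → ⟦ isHead h ⟧ * ∑ (key h) (λ w → ⟦ v == w ⟧ * fl h w))
   one v false _ = z≤n
   one v true av = ≤-trans (≤-trans (≤-reflexive (cong ⟦_⟧ (Stage.seed-same r (hd v) v ahd v∈))) (≤-trans (elem-sum (key (hd v)) v (fl (hd v)) v∈)
     (≤-reflexive (trans (sym (+-identityʳ _)) (cong (λ b → ⟦ b ⟧ * ∑ (key (hd v)) (λ w → ⟦ v == w ⟧ * fl (hd v) w)) (sym (hd-head v av)))))))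
     (∑ᶠ-pt (λ h → ⟦ isHead h ⟧ * ∑ (key h) (λ w → ⟦ v == w ⟧ * fl h w)) (hd v))
    where
    ahd : act (hd v) !
    ahd = key-act v (hd v) av (hd-∈ v)
    v∈ : v ∈ key (hd v)
    v∈ = subst (λ A → v ∈ keys A) (sym (key-arm v (hd v) av (hd-∈ v))) (self v av)

 bound : ℕ
 -- 21 is the 3 of `average` plus 18, six times the constant of `flags-cost`.
 bound = ∑ᶠ (λ h → ⟦ isHead h ⟧ * (21 + ∑ (inner (arm h)) weight))

 good-shift : ∃[ r ] 6 * ∣ Seeds.seeded r ∣ ≤ bound
 good-shift = from (∑-average (λ _ → zero) R Φ)
  where
  Φ : (Fin n → Fin 3) → ℕ
  Φ r = ∑ᶠ (λ h → ⟦ isHead h ⟧ * (tot (labels r h (inner (arm h))) + 18))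
  total : ∑ R Φ ≤ length R * bound
  total = begin
   ∑ R Φ ≡⟨ ∑-swap R (allFin n) (λ r h → ⟦ isHead h ⟧ * (tot (labels r h (inner (arm h))) + 18)) ⟩
   ∑ᶠ (λ h → ∑ R (λ r → ⟦ isHead h ⟧ * (tot (labels r h (inner (arm h))) + 18))) ≤⟨ ∑-mono (allFin n) (λ h → per h (isHead h) refl) ⟩
   ∑ᶠ (λ h → ∑ R (λ r → ⟦ isHead h ⟧ * (21 + ∑ (inner (arm h)) weight))) ≡⟨ sym (∑-swap R (allFin n) (λ _ h → ⟦ isHead h ⟧ * (21 + ∑ (inner (arm h)) weight))) ⟩
   ∑ R (λ _ → bound) ≡⟨ ∑-const R bound ⟩
   length R * bound ∎
   where
   per : ∀ h b → isHead h ≡ b → ∑ R (λ r → ⟦ b ⟧ * (tot (labels r h (inner (arm h))) + 18)) ≤ ∑ R (λ r → ⟦ b ⟧ * (21 + ∑ (inner (arm h)) weight))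
   per h false _ = ≤-reflexive refl
   per h true e = begin
    ∑ R (λ r → 1 * (tot (labels r h (inner (arm h))) + 18)) ≡⟨ ∑-*ˡ 1 R (λ r → tot (labels r h (inner (arm h))) + 18) ⟩
    1 * ∑ R (λ r → tot (labels r h (inner (arm h))) + 18) ≡⟨ cong (1 *_) (∑-+ R (λ r → tot (labels r h (inner (arm h)))) (λ _ → 18)) ⟩
    1 * (∑ R (λ r → tot (labels r h (inner (arm h)))) + ∑ R (λ _ → 18)) ≤⟨ *-monoʳ-≤ 1 (+-monoˡ-≤ (∑ R (λ _ → 18)) (average h ah (inner (arm h)) (λ _ m → m) (inner-distinct (arm h) (dist h ah)))) ⟩
    1 * (∑ R (λ _ → 3 + ∑ (inner (arm h)) weight) + ∑ R (λ _ → 18)) ≡⟨ cong (1 *_) (sym (∑-+ R (λ _ → 3 + ∑ (inner (arm h)) weight) (λ _ → 18))) ⟩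
    1 * ∑ R (λ _ → 3 + ∑ (inner (arm h)) weight + 18) ≡⟨ cong (1 *_) (∑-cong R (λ _ → +-comm (3 + ∑ (inner (arm h)) weight) 18)) ⟩
    1 * ∑ R (λ _ → 21 + ∑ (inner (arm h)) weight) ≡⟨ sym (∑-*ˡ 1 R (λ _ → 21 + ∑ (inner (arm h)) weight)) ⟩
    ∑ R (λ _ → 1 * (21 + ∑ (inner (arm h)) weight)) ∎
    where ah = ∧ˡ {act h} e
  from : (∃[ r ] length R * Φ r ≤ ∑ R Φ) → ∃[ r ] 6 * ∣ Seeds.seeded r ∣ ≤ bound
  from (r , le) = r , ≤-trans seeds≤Φ (cancel (length R) positive (≤-trans le total))
   where
   cancel : ∀ k {a b} → 1 ≤ k → k * a ≤ k * b → a ≤ b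
   cancel (suc k) _ = *-cancelˡ-≤ (suc k)
   positive : 1 ≤ length R
   positive = ≤-trans (m^n>0 3 n) (≤-reflexive (sym (length-allFuns n (allFin 3))))
   seeds≤Φ : 6 * ∣ Seeds.seeded r ∣ ≤ Φ r
   seeds≤Φ = ≤-trans (*-monoʳ-≤ 6 (Seeds.count r)) (≤-trans (≤-reflexive (sym (∑-*ˡ 6 (allFin n) (λ h → ⟦ isHead h ⟧ * ∑ (key h) (Seeds.fl r h))))) (∑-mono (allFin n) λ h → per h (isHead h) refl))
    where
    per : ∀ h b → isHead h ≡ b → 6 * (⟦ b ⟧ * ∑ (key h) (Seeds.fl r h)) ≤ ⟦ b ⟧ * (tot (labels r h (inner (arm h))) + 18)
    per h false _ = z≤n
    per h true e = ≤-trans (≤-reflexive (cong (6 *_) (*-identityˡ (∑ (key h) (Seeds.fl r h))))) (≤-trans (Seeds.arm-cost r h (∧ˡ {act h} e)) (≤-reflexive (sym (*-identityˡ (tot (labels r h (inner (arm h))) + 18)))))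

 weights : ∑ᶠ (λ h → ⟦ isHead h ⟧ * ∑ (inner (arm h)) weight) ≤ ∑ᶠ (λ v → ⟦ inn v ⟧ * weight v)
 weights = begin
  ∑ᶠ (λ h → ⟦ isHead h ⟧ * ∑ (inner (arm h)) weight) ≤⟨ ∑-mono (allFin n) (λ h → per h (isHead h) refl) ⟩
  ∑ᶠ (λ h → ∑ᶠ (λ v → ⟦ isHead h ∧ elemᵇ v (inner (arm h)) ⟧ * weight v)) ≡⟨ ∑-swap (allFin n) (allFin n) _ ⟩
  ∑ᶠ (λ v → ∑ᶠ (λ h → ⟦ isHead h ∧ elemᵇ v (inner (arm h)) ⟧ * weight v)) ≡⟨ ∑-cong (allFin n) (λ v → ∑-*ʳ (weight v) (allFin n) _) ⟩
  ∑ᶠ (λ v → ∣ (λ h → isHead h ∧ elemᵇ v (inner (arm h))) ∣ * weight v) ≤⟨ ∑-mono (allFin n) (λ v → *-monoˡ-≤ (weight v) (one v (inn v) refl)) ⟩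
  ∑ᶠ (λ v → ⟦ inn v ⟧ * weight v) ∎
  where
  per : ∀ h b → isHead h ≡ b → ⟦ b ⟧ * ∑ (inner (arm h)) weight ≤ ∑ᶠ (λ v → ⟦ b ∧ elemᵇ v (inner (arm h)) ⟧ * weight v)
  per h false _ = z≤n
  per h true e = ≤-trans (≤-reflexive (*-identityˡ _)) (distinct-sum (inner (arm h)) weight (inner-distinct (arm h) (dist h (∧ˡ {act h} e))))
  facts : ∀ v h → isHead h ∧ elemᵇ v (inner (arm h)) ! → act v ! × arm v ≡ arm h × h ≡ hd h × v ∈ inner (arm h)
  facts v h p = key-act h v ah vk , key-arm h v ah vk , ==-true (∧ʳ {act h} (∧ˡ p)) , vi
   where
   ah = ∧ˡ {act h} (∧ˡ {isHead h} p)
   vi = ∧ʳ {isHead h} p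
   vk = inner-∈ (arm h) v vi
  one : ∀ v b → inn v ≡ b → ∣ (λ h → isHead h ∧ elemᵇ v (inner (arm h))) ∣ ≤ ⟦ b ⟧
  one v true _ = ∣∣-unique (λ h → isHead h ∧ elemᵇ v (inner (arm h))) λ a b p q → uniq a b (facts v a p) (facts v b q)
   where
   uniq : ∀ a b → act v ! × arm v ≡ arm a × a ≡ hd a × v ∈ inner (arm a) → act v ! × arm v ≡ arm b × b ≡ hd b × v ∈ inner (arm b) → a ≡ b
   uniq a b (_ , p , q , _) (_ , p' , q' , _) = trans q (trans (cong headA (trans (sym p) p')) (sym q'))
  one v false e = ≤-reflexive (trans (∑-cong (allFin n) λ h → cong ⟦_⟧ (¬true {isHead h ∧ elemᵇ v (inner (arm h))} λ p → no' (facts v h p))) (∑-zero (allFin n)))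
   where
   no' : ∀ {h} → act v ! × arm v ≡ arm h × h ≡ hd h × v ∈ inner (arm h) → ⊥
   no' (av , p , _ , vi) = contra (true-∧ av (subst (λ A → v ∈ inner A) (sym p) vi)) e

 private
  F B : Fin n → Bool
  F v = inn v ∧ not (below v)
  B v = inn v ∧ below v

 -- Each inner vertex without an earlier outer neighbour is charged to its outer neighbour. If that
 -- one is inner, it has an earlier neighbour itself and is charged only once; any other vertex is
 -- charged at most three times.
 forward≤backward : ∣ F ∣ ≤ ∣ B ∣ + 3 * rest
 forward≤backward = begin
  ∣ F ∣ ≤⟨ ∣∣-mono {Q = λ v → F₁ v ∨ F₂ v} split ⟩
  ∣ (λ v → F₁ v ∨ F₂ v) ∣ ≤⟨ ∣∣-∨ F₁ F₂ ⟩
  ∣ F₁ ∣ + ∣ F₂ ∣ ≤⟨ +-mono-≤ (double-count (allFin n) (allFin n) F₁ B Q 1 (λ v e → ≤ᵇ-true e) at-most)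
   (double-count (allFin n) (allFin n) F₂ (λ v → not (inn v)) (λ v x → G v x) 3 (λ v e → ≤ᵇ-true e) (λ x _ → ≤-reflexive (∣∣-sym cG x))) ⟩
  1 * ∣ B ∣ + 3 * rest ≡⟨ cong (_+ 3 * rest) (*-identityˡ ∣ B ∣) ⟩
  ∣ B ∣ + 3 * rest ∎
  where
  Q : Fin n → Fin n → Bool
  Q v x = G x v ∧ not (elemᵇ v (key x))
  F₁ F₂ : Fin n → Bool
  F₁ v = some (λ x → B x ∧ Q v x)
  F₂ v = some (λ x → not (inn x) ∧ G v x)
  at-most : ∀ x → B x ! → ∣ (λ v → Q v x) ∣ ≤ 1
  at-most x bx = ∣∣-unique (λ v → Q v x) λ a b p q → by a b (a ≟ᶠ out) (b ≟ᶠ out) p q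
   where
   ax = ∧ˡ {act x} (∧ˡ {inn x} bx)
   open Outer (outer x x ax (∧ʳ {act x} (∧ˡ {inn x} bx)))
   by : ∀ a b → Dec (a ≡ out) → Dec (b ≡ out) → Q a x ! → Q b x ! → a ≡ b
   by a b (yes p) (yes q) _ _ = trans p (sym q)
   by a b (no p) _ e _ = contra (others a (∧ˡ e) p) (not-true (∧ʳ {G x a} e))
   by a b _ (no p) _ e = contra (others b (∧ˡ e) p) (not-true (∧ʳ {G x b} e))
  split : ∀ v → F v ! → F₁ v ∨ F₂ v !
  split v e = by (inn out) refl
   where
   av = ∧ˡ {act v} (∧ˡ {inn v} e)
   open Outer (outer v v av (∧ʳ {act v} (∧ˡ {inn v} e)))
   by : ∀ b → inn out ≡ b → F₁ v ∨ F₂ v !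
   by false i = true-∨ʳ (F₁ v) (some-intro (λ x → not (inn x) ∧ G v x) out (true-∧ (cong not i) v-out))
   by true i = true-∨ˡ (F₂ v) (some-intro (λ x → B x ∧ Q v x) out (true-∧ (true-∧ i (below-intro out v (syms v-out) av later)) (true-∧ (syms v-out) (cong not (¬true v∉)))))
    where
    ao = ∧ˡ {act out} i
    differ : rk v ≢ rk out
    differ eq = contra (same v out av ao v-out eq) out∉
    later : rk v < rk out
    later = ≤∧≢⇒< (≮⇒≥ λ lt → contra (below-intro v out v-out ao lt) (not-true (∧ʳ {inn v} e))) differ
    v∉ : v ∈ key out → ⊥
    v∉ m = differ (key-rk out v ao m)

 -- As F is hardly larger than B, the weight 3F + B is hardly larger than 2(F + B), which is at most
 -- 2n. The 24 collects 21 for each path, whose head is not inner, and 3 from `forward≤backward`.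
 total-bound : bound ≤ 2 * n + 24 * rest
 total-bound = begin
  bound ≡⟨ ∑-cong (allFin n) (λ h → *-distribˡ-+ ⟦ isHead h ⟧ 21 _) ⟩
  ∑ᶠ (λ h → ⟦ isHead h ⟧ * 21 + ⟦ isHead h ⟧ * ∑ (inner (arm h)) weight) ≡⟨ ∑-+ (allFin n) _ _ ⟩
  ∑ᶠ (λ h → ⟦ isHead h ⟧ * 21) + ∑ᶠ (λ h → ⟦ isHead h ⟧ * ∑ (inner (arm h)) weight) ≤⟨ +-mono-≤ (≤-reflexive (∑-*ʳ 21 (allFin n) _)) weights ⟩
  ∣ isHead ∣ * 21 + ∑ᶠ (λ v → ⟦ inn v ⟧ * weight v) ≤⟨ +-mono-≤ (*-monoˡ-≤ 21 (∣∣-mono head-not-inner)) (≤-reflexive (trans (∑-cong (allFin n) (λ v → pt (inn v) (below v))) (∑-+ (allFin n) _ _))) ⟩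
  rest * 21 + (∑ᶠ (λ v → 3 * ⟦ F v ⟧) + ∣ B ∣) ≡⟨ cong (λ k → rest * 21 + (k + ∣ B ∣)) (∑-*ˡ 3 (allFin n) _) ⟩
  rest * 21 + (3 * ∣ F ∣ + ∣ B ∣) ≡⟨ solve 3 (λ r f b → r :* con 21 :+ (con 3 :* f :+ b) := r :* con 21 :+ ((f :+ b) :+ (f :+ f))) refl rest ∣ F ∣ ∣ B ∣ ⟩
  rest * 21 + ((∣ F ∣ + ∣ B ∣) + (∣ F ∣ + ∣ F ∣)) ≤⟨ +-monoʳ-≤ (rest * 21) (+-monoʳ-≤ (∣ F ∣ + ∣ B ∣) (+-monoʳ-≤ ∣ F ∣ forward≤backward)) ⟩
  rest * 21 + ((∣ F ∣ + ∣ B ∣) + (∣ F ∣ + (∣ B ∣ + 3 * rest))) ≡⟨ solve 3 (λ r f b → r :* con 21 :+ ((f :+ b) :+ (f :+ (b :+ con 3 :* r))) := con 2 :* (f :+ b) :+ con 24 :* r) refl rest ∣ F ∣ ∣ B ∣ ⟩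
  2 * (∣ F ∣ + ∣ B ∣) + 24 * rest ≤⟨ +-monoˡ-≤ (24 * rest) (*-monoʳ-≤ 2 FB) ⟩
  2 * n + 24 * rest ∎
  where
  pt : ∀ i b → ⟦ i ⟧ * (if b then 1 else 3) ≡ 3 * ⟦ i ∧ not b ⟧ + ⟦ i ∧ b ⟧
  pt true true = refl
  pt true false = refl
  pt false _ = refl
  FB : ∣ F ∣ + ∣ B ∣ ≤ n
  FB = ≤-trans (≤-reflexive (sym (∑-+ (allFin n) _ _))) (≤-trans (∑-mono (allFin n) (λ v → le (inn v) (below v))) (≤-reflexive (trans (∑ᶠ-const n 1) (*-identityʳ n))))
   where
   le : ∀ i b → ⟦ i ∧ not b ⟧ + ⟦ i ∧ b ⟧ ≤ 1
   le true true = ≤-refl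
   le true false = ≤-refl
   le false _ = z≤n

 few-seeds : ∃[ r ] 6 * ∣ Seeds.seeded r ∣ ≤ 2 * n + 24 * rest
 few-seeds = proj₁ good-shift , ≤-trans (proj₂ good-shift) total-bound

-- Sets closed under a relation.

module _ {n : ℕ} (H : Fin n → Fin n → Bool) where

 record Closure (S₀ : Fin n → Bool) : Set where
  field
   S : Fin n → Bool
   start : ∀ v → S₀ v ! → S v !
   origin : ∀ v → S v ! → ∃[ a ] S₀ a ! × ∃[ k ] Walk (λ x y → H x y !) k a v
   closed : ∀ u v → S u ! → H u v ! → S v !

 closure : ∀ S₀ → Closure S₀
 closure S₀ = grow n S₀ (∣∣≤n _) (λ _ e → e) (λ v e → v , e , 0 , [])
  where
  grow : ∀ m (S : Fin n → Bool) → ∣ (λ v → not (S v)) ∣ ≤ m → (∀ v → S₀ v ! → S v !) →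
   (∀ v → S v ! → ∃[ a ] S₀ a ! × ∃[ k ] Walk (λ x y → H x y !) k a v) → Closure S₀
  grow m S le st or = by (search (λ v → not (S v) ∧ some (λ u → S u ∧ H u v)))
   where
   by : (∃[ v ] not (S v) ∧ some (λ u → S u ∧ H u v) !) ⊎ (∀ v → not (S v) ∧ some (λ u → S u ∧ H u v) ≡ false) → Closure S₀
   by (inj₂ f) = record { S = S ; start = st ; origin = or ; closed = cl }
    where
    cl : ∀ u v → S u ! → H u v ! → S v !
    cl u v su h with S v in sv
    ... | true = refl
    ... | false = contra (true-∧ (cong not sv) (some-intro (λ u → S u ∧ H u v) u (true-∧ su h))) (f v)
   by (inj₁ (v , e)) = more m le (some-elim (λ u → S u ∧ H u v) (∧ʳ {not (S v)} e))
    where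
    nv : not (S v) !
    nv = ∧ˡ {not (S v)} e
    more : ∀ m → ∣ (λ v → not (S v)) ∣ ≤ m → (∃[ u ] S u ∧ H u v !) → Closure S₀
    more zero le _ = ⊥-elim (1+n≰n (≤-trans (∣∣-pos (λ v → not (S v)) v nv) le))
    more (suc m) le (u , q) = grow m (λ w → S w ∨ w == v) (s≤s⁻¹ (≤-trans smaller le)) (λ w s → true-∨ˡ _ (st w s)) or'
     where
     smaller : suc ∣ (λ w → not (S w ∨ w == v)) ∣ ≤ ∣ (λ w → not (S w)) ∣
     smaller = ≤-trans (s≤s (∣∣-mono {Q = (λ w → not (S w)) ∖ v} λ w p → true-∖ {P = λ w → not (S w)} (cong not (∨-falseˡ (not-true p)))
      λ { refl → contra ==-refl (∨-falseʳ (S w) (not-true p)) })) (≤-reflexive (sym (∣∖∣ (λ w → not (S w)) v nv)))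
     extend-walk : (∃[ a ] S₀ a ! × ∃[ k ] Walk (λ x y → H x y !) k a u) → ∃[ a ] S₀ a ! × ∃[ k ] Walk (λ x y → H x y !) k a v
     extend-walk (a , sa , k , w) = a , sa , suc k , snoc-walk w (∧ʳ {S u} q)
     or' : ∀ w → S w ∨ w == v ! → ∃[ a ] S₀ a ! × ∃[ k ] Walk (λ x y → H x y !) k a w
     or' w p with ∨-true {S w} p
     ... | inj₁ s = or w s
     ... | inj₂ s rewrite ==-true s = extend-walk (or u (∧ˡ q))

-- A cubic graph has a permutation along its edges: Hall's theorem for its bipartite double cover.

module Hall {n : ℕ} (G : Graph n) (cG : Cubic G) where
 open Cubic cG

 Matching : Set
 Matching = Fin n → Maybe (Fin n)

 record Valid (m : Matching) : Set where
  field
   edge : ∀ {v w} → m v ≡ just w → G v w !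
   inj : ∀ {u v w} → m u ≡ just w → m v ≡ just w → u ≡ v

 Free : Matching → Fin n → Set
 Free m w = ∀ v → m v ≢ just w

 just-injective : ∀ {x y : Fin n} → just x ≡ just y → x ≡ y
 just-injective refl = refl

 set : Matching → Fin n → Maybe (Fin n) → Matching
 set m a x v = if v == a then x else m v

 set-same : ∀ m a x → set m a x a ≡ x
 set-same m a x rewrite ==-refl {u = a} = refl

 set-other : ∀ m a x v → v ≢ a → set m a x v ≡ m v
 set-other m a x v ne rewrite ≢-== ne = refl

 set-cases : ∀ m a x v {y} → set m a x v ≡ y → (v ≡ a × x ≡ y) ⊎ (v ≢ a × m v ≡ y)
 set-cases m a x v e with v ≟ᶠ a
 ... | yes refl = inj₁ (refl , trans (sym (set-same m v x)) e)
 ... | no ne = inj₂ (ne , trans (sym (set-other m a x v ne)) e)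

 set-valid : ∀ {m} a w → Valid m → G a w ! → Free m w → Valid (set m a (just w))
 set-valid {m} a w V g fr = record { edge = λ {v} e → ed v (set-cases m a (just w) v e) ; inj = λ {u} {v} e f → ij u v (set-cases m a (just w) u e) (set-cases m a (just w) v f) }
  where
  open Valid V
  ed : ∀ v {x} → (v ≡ a × just w ≡ just x) ⊎ (v ≢ a × m v ≡ just x) → G v x !
  ed v (inj₁ (refl , refl)) = g
  ed v (inj₂ (_ , e)) = edge e
  ij : ∀ u v {x} → (u ≡ a × just w ≡ just x) ⊎ (u ≢ a × m u ≡ just x) → (v ≡ a × just w ≡ just x) ⊎ (v ≢ a × m v ≡ just x) → u ≡ v
  ij u v (inj₁ (p , _)) (inj₁ (q , _)) = trans p (sym q)
  ij u v (inj₁ (_ , refl)) (inj₂ (_ , e)) = ⊥-elim (fr v e)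
  ij u v (inj₂ (_ , e)) (inj₁ (_ , refl)) = ⊥-elim (fr u e)
  ij u v (inj₂ (_ , e)) (inj₂ (_ , f)) = inj e f

 drop-valid : ∀ {m} a → Valid m → Valid (set m a nothing)
 drop-valid {m} a V = record { edge = λ {v} e → ed v (set-cases m a nothing v e) ; inj = λ {u} {v} e f → ij u v (set-cases m a nothing u e) (set-cases m a nothing v f) }
  where
  open Valid V
  ed : ∀ v {x} → (v ≡ a × nothing ≡ just x) ⊎ (v ≢ a × m v ≡ just x) → G v x !
  ed v (inj₂ (_ , e)) = edge e
  ij : ∀ u v {x} → (u ≡ a × nothing ≡ just x) ⊎ (u ≢ a × m u ≡ just x) → (v ≡ a × nothing ≡ just x) ⊎ (v ≢ a × m v ≡ just x) → u ≡ v
  ij u v (inj₂ (_ , e)) (inj₂ (_ , f)) = inj e f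

 Improved : Matching → Fin n → Set
 Improved m a = ∃[ m' ] Valid m' × (∀ v → m' v ≡ nothing → m v ≡ nothing × v ≢ a)

 -- One step of an alternating path in the bipartite double cover, whose two copies of the vertex
 -- set are the arguments and the values of `m`: u may take over the value of v.
 Alt : Matching → Fin n → Fin n → Set
 Alt m u v = ∃[ w ] G u w ! × m v ≡ just w

 -- The recursion releases the value x of b, augments from b, and then gives x to a. The clause on
 -- the range ensures that x has not been taken in between.
 augment : ∀ t a u w m → Valid m → Path (Alt m) a t u → distinctᵇ (a ∷ t) ! → G u w ! → Free m w → m a ≡ nothing →
  ∃[ m' ] Valid m' × (∀ v → m' v ≡ nothing → m v ≡ nothing × v ≢ a) × (∀ v x → m' v ≡ just x → x ≡ w ⊎ ∃[ v' ] m v' ≡ just x)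
 augment [] a .a w m V [] d g fr ma = set m a (just w) , set-valid a w V g fr , dom , ran
  where
  dom : ∀ v → set m a (just w) v ≡ nothing → m v ≡ nothing × v ≢ a
  dom v e with set-cases m a (just w) v e
  ... | inj₂ (ne , p) = p , ne
  ran : ∀ v x → set m a (just w) v ≡ just x → x ≡ w ⊎ ∃[ v' ] m v' ≡ just x
  ran v x e with set-cases m a (just w) v e
  ... | inj₁ (_ , refl) = inj₁ refl
  ... | inj₂ (_ , p) = inj₂ (v , p)
 augment (b ∷ t) a u w m V ((x , ax , mb) ∷ p) d g fr ma = finish (augment t b u w m₁ (drop-valid b V) (lift t p (distinct-head b t db)) db g free₁ (set-same m b nothing))
  where
  db = distinct-tail a (b ∷ t) d
  m₁ = set m b nothing
  lift : ∀ {c u} t → Path (Alt m) c t u → elemᵇ b t ≡ false → Path (Alt m₁) c t u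
  lift [] [] _ = []
  lift (y ∷ t) ((z , cz , my) ∷ p) n∉ = (z , cz , trans (set-other m b nothing y λ { refl → contra (elem-here y t) n∉ }) my) ∷ lift t p (∨-falseʳ (b == y) n∉)
  free₁ : Free m₁ w
  free₁ v e with set-cases m b nothing v e
  ... | inj₂ (_ , q) = fr v q
  x≢w : x ≢ w
  x≢w refl = fr b mb
  finish : (∃[ m' ] Valid m' × (∀ v → m' v ≡ nothing → m₁ v ≡ nothing × v ≢ b) × (∀ v x → m' v ≡ just x → x ≡ w ⊎ ∃[ v' ] m₁ v' ≡ just x)) →
   ∃[ m' ] Valid m' × (∀ v → m' v ≡ nothing → m v ≡ nothing × v ≢ a) × (∀ v x → m' v ≡ just x → x ≡ w ⊎ ∃[ v' ] m v' ≡ just x)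
  finish (m₂ , V₂ , dom₂ , ran₂) = set m₂ a (just x) , set-valid a x V₂ ax free₂ , dom , ran
   where
   free₂ : Free m₂ x
   free₂ v e with ran₂ v x e
   ... | inj₁ q = x≢w q
   ... | inj₂ (v' , q) with set-cases m b nothing v' q
   ... | inj₂ (ne , r) = ne (Valid.inj V r mb)
   dom : ∀ v → set m₂ a (just x) v ≡ nothing → m v ≡ nothing × v ≢ a
   dom v e with set-cases m₂ a (just x) v e
   ... | inj₂ (ne , q) with dom₂ v q
   ... | r , nb = trans (sym (set-other m b nothing v nb)) r , ne
   ran : ∀ v y → set m₂ a (just x) v ≡ just y → y ≡ w ⊎ ∃[ v' ] m v' ≡ just y
   ran v y e with set-cases m₂ a (just x) v e
   ... | inj₁ (_ , refl) = inj₂ (b , mb)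
   ... | inj₂ (_ , q) with ran₂ v y q
   ... | inj₁ r = inj₁ r
   ... | inj₂ (v' , r) with set-cases m b nothing v' r
   ... | inj₂ (_ , z) = inj₂ (v' , z)

 matched : Matching → Fin n → Fin n → Bool
 matched m v w with m v
 ... | nothing = false
 ... | just x = x == w

 matched-true : ∀ m v w → matched m v w ! → m v ≡ just w
 matched-true m v w e with m v
 ... | just x = cong just (==-true e)

 true-matched : ∀ m v w → m v ≡ just w → matched m v w !
 true-matched m v w e rewrite e = ==-refl

 undefined : Matching → Fin n → Bool
 undefined m v with m v
 ... | nothing = true
 ... | just _ = false

 undefined-true : ∀ m v → undefined m v ! → m v ≡ nothing
 undefined-true m v e with m v
 ... | nothing = refl

 true-undefined : ∀ m v → m v ≡ nothing → undefined m v !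
 true-undefined m v e rewrite e = refl

 module Step (m : Matching) (V : Valid m) (a : Fin n) (ma : m a ≡ nothing) where
  H : Fin n → Fin n → Bool
  H u v = some (λ w → G u w ∧ matched m v w)

  open Closure (closure H (λ v → v == a))

  T : Fin n → Bool
  T w = some (λ u → S u ∧ G u w)

  free? : Fin n → Bool
  free? w = not (some (λ v → matched m v w))

  -- Otherwise S would have at most ∣ S ∣ - 1 neighbours, which receive 3 ∣ S ∣ edges.
  free-neighbour : ∃[ w ] T w ∧ free? w !
  free-neighbour with search (λ w → T w ∧ free? w)
  ... | inj₁ w = w
  ... | inj₂ f = ⊥-elim (1+n≰n (≤-trans (≤-reflexive (sym (∣∖∣ S a (start a ==-refl)))) (*-cancelˡ-≤ 3 (≤-trans edges (*-monoʳ-≤ 3 partners)))))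
   where
   partner : ∀ w → T w ! → ∃[ v ] (S ∖ a) v ! × matched m v w !
   partner w tw = from (some-elim (λ u → S u ∧ G u w) tw) (some (λ v → matched m v w)) refl
    where
    from : (∃[ u ] S u ∧ G u w !) → ∀ b → some (λ v → matched m v w) ≡ b → ∃[ v ] (S ∖ a) v ! × matched m v w !
    from _ false e = contra (true-∧ tw (cong not e)) (f w)
    from (u , p) true e with some-elim (λ v → matched m v w) e
    ... | v , q = v , true-∖ {P = S} (closed u v (∧ˡ p) (some-intro (λ w → G u w ∧ matched m v w) w (true-∧ (∧ʳ {S u} p) q)))
        (λ { refl → just≢ (trans (sym (matched-true m v w q)) ma) }) , q
     where
     just≢ : ∀ {x : Fin n} → just x ≡ nothing → ⊥
     just≢ ()
   partners : ∣ T ∣ ≤ ∣ S ∖ a ∣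
   partners = ≤-trans (double-count (allFin n) (allFin n) T (S ∖ a) (λ w v → matched m v w) 1
    (λ w tw → from w (partner w tw))
    (λ v _ → ∣∣-unique (λ w → matched m v w) λ x y p q → just-injective (trans (sym (matched-true m v x p)) (matched-true m v y q)))) (≤-reflexive (*-identityˡ _))
    where
    from : ∀ w → (∃[ v ] (S ∖ a) v ! × matched m v w !) → 1 ≤ ∑ᶠ (λ v → ⟦ (S ∖ a) v ∧ matched m v w ⟧)
    from w (v , p , q) = ∣∣-pos (λ v → (S ∖ a) v ∧ matched m v w) v (true-∧ p q)
   edges : 3 * ∣ S ∣ ≤ 3 * ∣ T ∣
   edges = begin
    3 * ∣ S ∣ ≡⟨ sym (∑-*ˡ 3 (allFin n) _) ⟩
    ∑ᶠ (λ u → 3 * ⟦ S u ⟧) ≡⟨ ∑-cong (allFin n) (λ u → per u (S u)) ⟩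
    ∑ᶠ (λ u → ∑ᶠ (λ w → ⟦ S u ∧ G u w ⟧)) ≡⟨ ∑-swap (allFin n) (allFin n) _ ⟩
    ∑ᶠ (λ w → ∑ᶠ (λ u → ⟦ S u ∧ G u w ⟧)) ≤⟨ ∑-mono (allFin n) (λ w → col w (T w) refl) ⟩
    ∑ᶠ (λ w → 3 * ⟦ T w ⟧) ≡⟨ ∑-*ˡ 3 (allFin n) _ ⟩
    3 * ∣ T ∣ ∎
    where
    per : ∀ u b → 3 * ⟦ b ⟧ ≡ ∑ᶠ (λ w → ⟦ b ∧ G u w ⟧)
    per u true = sym (deg u)
    per u false = sym (∑-zero (allFin n))
    col : ∀ w b → T w ≡ b → ∑ᶠ (λ u → ⟦ S u ∧ G u w ⟧) ≤ 3 * ⟦ b ⟧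
    col w true _ = ≤-trans (∣∣-mono {P = λ u → S u ∧ G u w} {Q = λ u → G u w} λ u e → ∧ʳ {S u} e) (≤-reflexive (∣∣-sym cG w))
    col w false e = ≤-reflexive (trans (∑-cong (allFin n) λ u → cong ⟦_⟧ (¬true {S u ∧ G u w} λ p → contra (some-intro (λ u → S u ∧ G u w) u p) e)) (∑-zero (allFin n)))

  improve : Improved m a
  improve = from free-neighbour
   where
   from : (∃[ w ] T w ∧ free? w !) → Improved m a
   from (w , e) = from₂ (some-elim (λ u → S u ∧ G u w) (∧ˡ e))
    where
    fr : Free m w
    fr v q = contra (some-intro (λ v → matched m v w) v (true-matched m v w q)) (not-true (∧ʳ {T w} e))
    from₂ : (∃[ u ] S u ∧ G u w !) → Improved m a
    from₂ (u , p) = from₃ (origin u (∧ˡ p))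
     where
     from₃ : (∃[ b ] b == a ! × ∃[ k ] Walk (λ x y → H x y !) k b u) → Improved m a
     from₃ (b , ba , k , wk) with refl ← ==-true ba = from₄ (loop-erase (map-walk alt wk))
      where
      alt : ∀ {x y} → H x y ! → Alt m x y
      alt {x} {y} h with some-elim (λ w → G x w ∧ matched m y w) h
      ... | w , q = w , ∧ˡ q , matched-true m y w (∧ʳ {G x w} q)
      from₄ : (∃[ t ] Path (Alt m) a t u × distinctᵇ (a ∷ t) ! × length t ≤ k) → Improved m a
      from₄ (t , path , d , _) with augment t a u w m V path d (∧ʳ {S u} p) fr ma
      ... | m' , V' , dom , _ = m' , V' , dom

 permutation : ∃[ σ ] (∀ v → G v (σ v) !) × (∀ u v → σ u ≡ σ v → u ≡ v)
 permutation = grow n (λ _ → nothing) (record { edge = λ () ; inj = λ () }) (∣∣≤n _)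
  where
  grow : ∀ k m → Valid m → ∣ undefined m ∣ ≤ k → ∃[ σ ] (∀ v → G v (σ v) !) × (∀ u v → σ u ≡ σ v → u ≡ v)
  grow k m V le = by (search (undefined m))
   where
   by : (∃[ v ] undefined m v !) ⊎ (∀ v → undefined m v ≡ false) → ∃[ σ ] (∀ v → G v (σ v) !) × (∀ u v → σ u ≡ σ v → u ≡ v)
   by (inj₂ f) = (λ v → proj₁ (val v)) , (λ v → Valid.edge V (proj₂ (val v))) , λ u v e → Valid.inj V (proj₂ (val u)) (trans (proj₂ (val v)) (cong just (sym e)))
    where
    val : ∀ v → ∃[ w ] m v ≡ just w
    val v with m v in e
    ... | just w = w , refl
    ... | nothing = contra (true-undefined m v e) (f v)
   by (inj₁ (a , e)) = more k le (Step.improve m V a ma)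
    where
    ma = undefined-true m a e
    more : ∀ k → ∣ undefined m ∣ ≤ k → (Improved m a) → ∃[ σ ] (∀ v → G v (σ v) !) × (∀ u v → σ u ≡ σ v → u ≡ v)
    more zero le _ = ⊥-elim (1+n≰n (≤-trans (∣∣-pos (undefined m) a e) le))
    more (suc k) le (m' , V' , dom) = grow k m' V' (s≤s⁻¹ (≤-trans (s≤s (∣∣-mono {Q = undefined m ∖ a} λ v p →
      true-∖ {P = undefined m} (true-undefined m v (proj₁ (dom v (undefined-true m' v p)))) (proj₂ (dom v (undefined-true m' v p)))))
     (≤-trans (≤-reflexive (sym (∣∖∣ (undefined m) a e))) le)))

injective-surjective : (σ : Fin n → Fin n) → (∀ u v → σ u ≡ σ v → u ≡ v) → ∀ w → ∃[ v ] σ v ≡ w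
injective-surjective {n} σ inj w with search (λ v → σ v == w)
... | inj₁ (v , e) = v , ==-true e
... | inj₂ f = ⊥-elim (1+n≰n (begin
 suc ∣ (λ _ → true) ∖ w ∣ ≡⟨ sym (∣∖∣ {n} (λ _ → true) w refl) ⟩
 ∣ (λ (_ : Fin n) → true) ∣ ≡⟨ sym (*-identityˡ _) ⟩
 1 * ∣ (λ (_ : Fin n) → true) ∣ ≤⟨ disjoint-count (λ _ → true) (λ v x → x == σ v) ((λ _ → true) ∖ w) 1 (λ v _ → ≤-reflexive (sym (∣∣-== (σ v))))
  (λ v x _ e → true-∖ {P = λ _ → true} refl λ { refl → contra (subst (λ y → y == x !) (==-true e) ==-refl) (f v) })
  (λ u v x _ _ p q → inj u v (trans (sym (==-true p)) (==-true q))) ⟩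
 ∣ (λ _ → true) ∖ w ∣ ∎))

==-sym : (u v : Fin n) → u == v ≡ v == u
==-sym u v = iff-≡ (λ e → subst (λ w → w == u !) (==-true e) ==-refl) (λ e → subst (λ w → w == v !) (==-true e) ==-refl)

∑-mono-∈ : {A : Set} (xs : List A) {f g : A → ℕ} → (∀ x → x ∈ₗ xs → f x ≤ g x) → ∑ xs f ≤ ∑ xs g
∑-mono-∈ [] h = z≤n
∑-mono-∈ (x ∷ xs) h = +-mono-≤ (h x (here refl)) (∑-mono-∈ xs λ y e → h y (there e))

∑-pt-∈ : {A : Set} {xs : List A} (f : A → ℕ) {x : A} → x ∈ₗ xs → f x ≤ ∑ xs f
∑-pt-∈ f (here refl) = m≤m+n _ _
∑-pt-∈ f (there e) = ≤-trans (∑-pt-∈ f e) (m≤n+m _ _)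

any-∈ : {A : Set} (p : A → Bool) (xs : List A) → anyᵇ xs p ! → ∃[ x ] x ∈ₗ xs × p x !
any-∈ p (x ∷ xs) e with ∨-true {p x} e
... | inj₁ q = x , here refl , q
... | inj₂ q with any-∈ p xs q
... | y , m , r = y , there m , r

∈-any : {A : Set} (p : A → Bool) (xs : List A) {x : A} → x ∈ₗ xs → p x ! → anyᵇ xs p !
∈-any p xs m e = any-true p (Any.map (λ { refl → e }) m)

-- Covering a graph by disjoint paths.

occ : Fin n → List (Fin n) → ℕ
occ v l = ∑ l (λ u → ⟦ v == u ⟧)

∈-occ : (v : Fin n) (l : List (Fin n)) → v ∈ l → 1 ≤ occ v l
∈-occ v l e = ≤-trans (elem-sum l v (λ _ → 1) e) (≤-reflexive (∑-cong l λ u → *-identityʳ ⟦ v == u ⟧))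

occ-∈ : (v : Fin n) (l : List (Fin n)) → 1 ≤ occ v l → v ∈ l
occ-∈ v (x ∷ l) le with v == x
... | true = refl
... | false = occ-∈ v l le

occ-distinct : (l : List (Fin n)) → (∀ v → occ v l ≤ 1) → distinctᵇ l !
occ-distinct [] h = refl
occ-distinct (x ∷ l) h = true-∧ (cong not (¬true λ e → 1+n≰n (≤-trans (+-mono-≤ (≤-reflexive (cong ⟦_⟧ (sym (==-refl {u = x})))) (∈-occ x l e)) (h x))))
 (occ-distinct l λ v → ≤-trans (m≤n+m _ ⟦ v == x ⟧) (h v))

∑-occ : (l : List (Fin n)) (f : Fin n → ℕ) → ∑ l f ≡ ∑ᶠ (λ v → occ v l * f v)
∑-occ {n} l f = begin-equality
 ∑ l f ≡⟨ ∑-cong l (λ u → sym (∑ᶠ-δ f u)) ⟩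
 ∑ l (λ u → ∑ᶠ (λ v → ⟦ v == u ⟧ * f v)) ≡⟨ ∑-swap l (allFin n) (λ u v → ⟦ v == u ⟧ * f v) ⟩
 ∑ᶠ (λ v → ∑ l (λ u → ⟦ v == u ⟧ * f v)) ≡⟨ ∑-cong (allFin n) (λ v → ∑-*ʳ (f v) l (λ u → ⟦ v == u ⟧)) ⟩
 ∑ᶠ (λ v → occ v l * f v) ∎

NList : ℕ → Set
NList n = Fin n × List (Fin n)

full : NList n → List (Fin n)
full (x , t) = x ∷ t

final-vertex : NList n → Fin n
final-vertex (x , t) = lastOf x t

cnt : Fin n → List (NList n) → ℕ
cnt v ps = ∑ ps (λ p → occ v (full p))

consec-tail : (x : Fin n) (t : List (Fin n)) {a b : Fin n} → consec (x ∷ t) a b ! → b ∈ t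
consec-tail x (y ∷ t) {a} {b} e with consec-cons x y t {a} {b} e
... | inj₁ (_ , refl) = elem-here b t
... | inj₂ p = consec-∈ʳ (y ∷ t) p

middle : (x : Fin n) (t : List (Fin n)) (y : Fin n) → y ∈ t → y ≢ lastOf x t →
 ∃₂ λ p s → consec (x ∷ t) p y ! × consec (x ∷ t) y s !
middle x (z ∷ t) y e ne with elem-cons t e
middle x (z ∷ []) y e ne | inj₁ refl = ⊥-elim (ne refl)
middle x (z ∷ w ∷ t) y e ne | inj₁ refl = x , w , consec-first x y (w ∷ t) , consec-later x y (w ∷ t) y w (consec-first y w t)
middle x (z ∷ t) y e ne | inj₂ e' with middle z t y e' ne
... | p , s , a , b = p , s , consec-later x z t p y a , consec-later x z t y s b

module PathSystem {n : ℕ} (H : Graph n) (H-sym : ∀ {u v} → H u v ! → H v u !) (H-irr : ∀ {v} → H v v ! → ⊥) where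

 record System (ps : List (NList n)) : Set where
  field
   paths : All (λ p → Linked H (full p)) ps
   once : ∀ v → cnt v ps ≡ 1

  uniq : ∀ {p q} v → p ∈ₗ ps → q ∈ₗ ps → v ∈ full p → v ∈ full q → p ≡ q
  uniq {p} {q} v mp mq vp vq with ∈-∃++ mp
  ... | xs , ys , refl = by (∈-++⁻ xs mq)
   where
   two : 1 ≤ cnt v xs + cnt v ys → p ≡ q
   two le = ⊥-elim (1+n≰n (≤-trans (+-mono-≤ (∈-occ v (full p) vp) le) (≤-reflexive (trans (rearrange (occ v (full p)) (cnt v xs) (cnt v ys)) (trans (sym (∑-++ xs (p ∷ ys) (λ p → occ v (full p)))) (once v))))))
    where
    rearrange : ∀ a b c → a + (b + c) ≡ b + (a + c)
    rearrange a b c = trans (sym (+-assoc a b c)) (trans (cong (_+ c) (+-comm a b)) (+-assoc b a c))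
   in-occ : ∀ zs → q ∈ₗ zs → 1 ≤ cnt v zs
   in-occ zs m = ≤-trans (∈-occ v (full q) vq) (∑-pt-∈ (λ p → occ v (full p)) m)
   by : q ∈ₗ xs ⊎ q ∈ₗ p ∷ ys → p ≡ q
   by (inj₁ m) = two (≤-trans (in-occ xs m) (m≤m+n _ _))
   by (inj₂ (here refl)) = refl
   by (inj₂ (there m)) = two (≤-trans (in-occ ys m) (m≤n+m _ _))

  distinct : ∀ {p} → p ∈ₗ ps → distinctᵇ (full p) !
  distinct {p} m = occ-distinct (full p) λ v → ≤-trans (∑-pt-∈ (λ p → occ v (full p)) m) (≤-reflexive (once v))

  covers : ∀ v → ∃[ p ] p ∈ₗ ps × v ∈ full p
  covers v = go ps (≤-reflexive (sym (once v)))
   where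
   go : ∀ qs → 1 ≤ cnt v qs → ∃[ p ] p ∈ₗ qs × v ∈ full p
   go (q ∷ qs) le with elemᵇ v (full q) in e
   ... | true = q , here refl , e
   ... | false with go qs (≤-trans le (≤-reflexive (cong (_+ cnt v qs) (n≤0⇒n≡0 (≮⇒≥ λ lt → contra (occ-∈ v (full q) lt) e)))))
   ... | p , m , vp = p , there m , vp

  partition : ∀ f → ∑ ps (λ p → ∑ (full p) f) ≡ ∑ᶠ f
  partition f = begin-equality
   ∑ ps (λ p → ∑ (full p) f) ≡⟨ ∑-cong ps (λ p → ∑-occ (full p) f) ⟩
   ∑ ps (λ p → ∑ᶠ (λ v → occ v (full p) * f v)) ≡⟨ ∑-swap ps (allFin n) (λ p v → occ v (full p) * f v) ⟩
   ∑ᶠ (λ v → ∑ ps (λ p → occ v (full p) * f v)) ≡⟨ ∑-cong (allFin n) (λ v → trans (∑-*ʳ (f v) ps (λ p → occ v (full p))) (trans (cong (_* f v) (once v)) (*-identityˡ (f v)))) ⟩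
   ∑ᶠ f ∎

 reversed : ∀ x t → Linked H (x ∷ t) → ∃[ p ] final-vertex p ≡ x × proj₁ p ≡ lastOf x t × Linked H (full p) × (∀ v → occ v (full p) ≡ occ v (x ∷ t))
 reversed x [] lk = (x , []) , refl , refl , _ , λ v → refl
 reversed x (z ∷ t) (e , lk) with reversed z t lk
 ... | (y , s) , l , f , k , o = (y , s ++ x ∷ []) , lastOf-++ y s x [] , f , linked-join H y s x [] k (subst (λ w → H w x !) (sym l) (H-sym e)) _ ,
    λ v → trans (∑-++ (y ∷ s) (x ∷ []) (λ u → ⟦ v == u ⟧)) (trans (cong (_+ (⟦ v == x ⟧ + 0)) (o v)) (trans (+-comm (occ v (z ∷ t)) _) (cong (_+ occ v (z ∷ t)) (+-identityʳ ⟦ v == x ⟧))))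

 End : NList n → Fin n → Set
 End p a = a ≡ proj₁ p ⊎ a ≡ final-vertex p

 Stuck : List (NList n) → Set
 Stuck ps = ∀ p q a b → p ∈ₗ ps → q ∈ₗ ps → End p a → End q b → H a b ! → b ∈ full p

 ending : ∀ p a → Linked H (full p) → End p a → ∃[ p' ] final-vertex p' ≡ a × Linked H (full p') × (∀ v → occ v (full p') ≡ occ v (full p))
 ending (x , t) a lk (inj₂ e) = (x , t) , sym e , lk , λ v → refl
 ending (x , t) a lk (inj₁ e) with reversed x t lk
 ... | p' , l , _ , k , o = p' , trans l (sym e) , k , o

 starting : ∀ p a → Linked H (full p) → End p a → ∃[ p' ] proj₁ p' ≡ a × Linked H (full p') × (∀ v → occ v (full p') ≡ occ v (full p))
 starting (x , t) a lk (inj₁ e) = (x , t) , sym e , lk , λ v → refl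
 starting (x , t) a lk (inj₂ e) with reversed x t lk
 ... | p' , _ , f , k , o = p' , trans f (sym e) , k , o

 ends : NList n → List (Fin n)
 ends p = proj₁ p ∷ final-vertex p ∷ []

 ends-End : ∀ p a → a ∈ₗ ends p → End p a
 ends-End p a (here e) = inj₁ e
 ends-End p a (there (here e)) = inj₂ e

 End-ends : ∀ p a → End p a → a ∈ₗ ends p
 End-ends p a (inj₁ e) = here e
 End-ends p a (inj₂ e) = there (here e)

 joinable : List (NList n) → Bool
 joinable ps = anyᵇ ps λ p → anyᵇ ps λ q → anyᵇ (ends p) λ a → anyᵇ (ends q) λ b → H a b ∧ not (elemᵇ b (full p))

 remove : ∀ {ps p} → p ∈ₗ ps → ∃[ rest ] length ps ≡ suc (length rest) × (∀ v → cnt v ps ≡ occ v (full p) + cnt v rest) ×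
  (All (λ p → Linked H (full p)) ps → All (λ p → Linked H (full p)) rest) × (∀ q → q ∈ₗ ps → q ≢ p → q ∈ₗ rest)
 remove {p = p} m with ∈-∃++ m
 ... | xs , ys , refl = xs ++ ys , trans (length-++ xs) (trans (+-suc (length xs) (length ys)) (cong suc (sym (length-++ xs)))) ,
   (λ v → trans (∑-++ xs (p ∷ ys) (λ p → occ v (full p))) (trans (sym (+-assoc (cnt v xs) _ _)) (trans (cong (_+ cnt v ys) (+-comm (cnt v xs) _)) (trans (+-assoc (occ v (full p)) _ _) (cong (occ v (full p) +_) (sym (∑-++ xs ys (λ p → occ v (full p))))))))) ,
   (λ al → All.++⁺ (All.++⁻ˡ xs al) (tail (All.++⁻ʳ xs al))) , λ q mq ne → by q ne (∈-++⁻ xs mq)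
  where
  tail : ∀ {A : Set} {P : A → Set} {x xs} → All P (x ∷ xs) → All P xs
  tail (_ ∷ a) = a
  by : ∀ q → q ≢ p → q ∈ₗ xs ⊎ q ∈ₗ p ∷ ys → q ∈ₗ xs ++ ys
  by q ne (inj₁ mx) = ∈-++⁺ˡ mx
  by q ne (inj₂ (here e)) = ⊥-elim (ne e)
  by q ne (inj₂ (there my)) = ∈-++⁺ʳ xs my

 join-step : ∀ ps → System ps → joinable ps ! → ∃[ ps' ] System ps' × suc (length ps') ≡ length ps
 join-step ps sys e = s₁ (any-∈ _ ps e)
  where
  open System sys
  Result = ∃[ ps' ] System ps' × suc (length ps') ≡ length ps
  s₁ : (∃[ p ] p ∈ₗ ps × anyᵇ ps (λ q → anyᵇ (ends p) λ a → anyᵇ (ends q) λ b → H a b ∧ not (elemᵇ b (full p))) !) → Result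
  s₁ (p , mp , e) = s₂ (any-∈ _ ps e)
   where
   s₂ : (∃[ q ] q ∈ₗ ps × anyᵇ (ends p) (λ a → anyᵇ (ends q) λ b → H a b ∧ not (elemᵇ b (full p))) !) → Result
   s₂ (q , mq , e) = s₃ (any-∈ _ (ends p) e)
    where
    s₃ : (∃[ a ] a ∈ₗ ends p × anyᵇ (ends q) (λ b → H a b ∧ not (elemᵇ b (full p))) !) → Result
    s₃ (a , ma , e) = s₄ (any-∈ _ (ends q) e)
     where
     s₄ : (∃[ b ] b ∈ₗ ends q × H a b ∧ not (elemᵇ b (full p)) !) → Result
     s₄ (b , mb , e) = s₅ (remove mp)
      where
      b∉ : elemᵇ b (full p) ≡ false
      b∉ = not-true (∧ʳ {H a b} e)
      end-∈ : ∀ q → End q b → b ∈ full q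
      end-∈ (x , t) (inj₁ refl) = elem-here x t
      end-∈ (x , t) (inj₂ refl) = last-elem x t
      q≢p : q ≢ p
      q≢p refl = contra (end-∈ q (ends-End q b mb)) b∉
      s₅ : (∃[ rest ] length ps ≡ suc (length rest) × (∀ v → cnt v ps ≡ occ v (full p) + cnt v rest) ×
       (All (λ p → Linked H (full p)) ps → All (λ p → Linked H (full p)) rest) × (∀ q → q ∈ₗ ps → q ≢ p → q ∈ₗ rest)) → Result
      s₅ (rest , l₁ , c₁ , a₁ , m₁) = s₆ (remove (m₁ q mq q≢p))
       where
       s₆ : (∃[ rest' ] length rest ≡ suc (length rest') × (∀ v → cnt v rest ≡ occ v (full q) + cnt v rest') ×
        (All (λ p → Linked H (full p)) rest → All (λ p → Linked H (full p)) rest') × (∀ r → r ∈ₗ rest → r ≢ q → r ∈ₗ rest')) → Result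
       s₆ (rest' , l₂ , c₂ , a₂ , _) = s₇ (ending p a (All.lookup paths mp) (ends-End p a ma)) (starting q b (All.lookup paths mq) (ends-End q b mb))
        where
        s₇ : (∃[ p' ] final-vertex p' ≡ a × Linked H (full p') × (∀ v → occ v (full p') ≡ occ v (full p))) →
         (∃[ q' ] proj₁ q' ≡ b × Linked H (full q') × (∀ v → occ v (full q') ≡ occ v (full q))) → Result
        s₇ ((x , t) , lp , kp , op) ((y , s) , fq , kq , oq) = (x , t ++ y ∷ s) ∷ rest' , record
         { paths = linked-join H x t y s kp (subst₂ (λ u w → H u w !) (sym lp) (sym fq) (∧ˡ e)) kq ∷ a₂ (a₁ paths)
         ; once = λ v → trans (trans (cong (_+ cnt v rest') (trans (∑-++ (x ∷ t) (y ∷ s) (λ u → ⟦ v == u ⟧)) (cong₂ _+_ (op v) (oq v))))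
           (+-assoc (occ v (full p)) _ _)) (trans (cong (occ v (full p) +_) (sym (c₂ v))) (trans (sym (c₁ v)) (once v))) } , sym (trans l₁ (cong suc l₂))

 -- Starting from single vertices, paths are joined at adjacent ends as long as possible; every join
 -- lowers the number of paths.
 stuck-system : ∃[ ps ] System ps × Stuck ps
 stuck-system = grow (length ps₀) ps₀ sys₀ ≤-refl
  where
  ps₀ = map (λ v → v , []) (allFin n)
  linked₀ : ∀ (xs : List (Fin n)) → All (λ p → Linked H (full p)) (map (λ v → v , []) xs)
  linked₀ [] = []
  linked₀ (x ∷ xs) = _ ∷ linked₀ xs
  sys₀ : System ps₀
  sys₀ = record { paths = linked₀ (allFin n) ; once = λ v → trans (∑-map (λ v → v , []) (allFin n) (λ p → occ v (full p)))
   (trans (∑-cong (allFin n) (λ u → trans (+-identityʳ _) (cong ⟦_⟧ (==-sym v u)))) (∣∣-== v)) }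
  grow : ∀ k ps → System ps → length ps ≤ k → ∃[ ps ] System ps × Stuck ps
  grow k ps sys le = by (joinable ps) refl
   where
   by : ∀ b → joinable ps ≡ b → ∃[ ps ] System ps × Stuck ps
   by false e = ps , sys , st
    where
    st : Stuck ps
    st p q a b mp mq ea eb h with elemᵇ b (full p) in eq
    ... | true = refl
    ... | false = contra (∈-any _ ps mp (∈-any _ ps mq (∈-any (λ a → anyᵇ (ends q) λ b → H a b ∧ not (elemᵇ b (full p))) (ends p) (End-ends p a ea) (∈-any (λ b → H a b ∧ not (elemᵇ b (full p))) (ends q) (End-ends q b eb) (true-∧ h (cong not eq)))))) e
   by true e = more k le (join-step ps sys e)
    where
    more : ∀ k → length ps ≤ k → (∃[ ps' ] System ps' × suc (length ps') ≡ length ps) → ∃[ ps ] System ps × Stuck ps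
    more zero le (ps' , _ , l) = ⊥-elim (1+n≰n (≤-trans (≤-trans (s≤s z≤n) (≤-reflexive l)) le))
    more (suc k) le (ps' , s' , l) = grow k ps' s' (s≤s⁻¹ (≤-trans (≤-reflexive l) le))

 Closes : NList n → Set
 Closes (x , t) = 2 ≤ length t × H x (lastOf x t) !

 module Ends (deg2 : ∀ v → ∣ H v ∣ ≤ 2) (ps : List (NList n)) (sys : System ps) (stuck : Stuck ps) where
  open System sys

  two-of-three : ∀ v a b c → H v a ! → H v b ! → H v c ! → a ≢ b → c ≡ a ⊎ c ≡ b
  two-of-three v a b c ha hb hc ne with c ≟ᶠ a | c ≟ᶠ b
  ... | yes p | _ = inj₁ p
  ... | no _ | yes q = inj₂ q
  ... | no p | no q = ⊥-elim (1+n≰n (≤-trans (≤-trans (s≤s (s≤s (∣∣-pos ((H v ∖ a) ∖ b) c (true-∖ {P = H v ∖ a} (true-∖ {P = H v} hc p) q))))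
      (≤-trans (s≤s (≤-reflexive (sym (∣∖∣ (H v ∖ a) b (true-∖ {P = H v} hb (ne ∘ sym)))))) (≤-reflexive (sym (∣∖∣ (H v) a ha))))) (deg2 v)))

  -- If y is an end of its path, being stuck puts it on the path of x. Otherwise its two neighbours
  -- along its path exhaust the degree 2, so x is one of them and both paths coincide.
  first-neighbours : ∀ x t → (x , t) ∈ₗ ps → ∀ y → H x y ! → consec (x ∷ t) x y ! ⊎ y ≡ lastOf x t
  first-neighbours x t m y xy = from (covers y)
   where
   from : (∃[ q ] q ∈ₗ ps × y ∈ full q) → consec (x ∷ t) x y ! ⊎ y ≡ lastOf x t
   from ((x' , t') , mq , yq) = by (y ≟ᶠ x') (y ≟ᶠ lastOf x' t')
    where
    at-end : End (x' , t') y → consec (x ∷ t) x y ! ⊎ y ≡ lastOf x t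
    at-end en = same (uniq y m mq (stuck (x , t) (x' , t') x y m mq (inj₁ refl) en xy) yq) en
     where
     same : (x , t) ≡ (x' , t') → End (x' , t') y → consec (x ∷ t) x y ! ⊎ y ≡ lastOf x t
     same refl (inj₁ refl) = ⊥-elim (H-irr xy)
     same refl (inj₂ e) = inj₂ e
    by : Dec (y ≡ x') → Dec (y ≡ lastOf x' t') → consec (x ∷ t) x y ! ⊎ y ≡ lastOf x t
    by (yes e) _ = at-end (inj₁ e)
    by (no _) (yes e) = at-end (inj₂ e)
    by (no ne₁) (no ne₂) = inside (middle x' t' y (in-tail (elem-cons t' yq)) ne₂)
     where
     in-tail : y ≡ x' ⊎ y ∈ t' → y ∈ t'
     in-tail (inj₁ e) = ⊥-elim (ne₁ e)
     in-tail (inj₂ e) = e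
     inside : (∃₂ λ p s → consec (x' ∷ t') p y ! × consec (x' ∷ t') y s !) → consec (x ∷ t) x y ! ⊎ y ≡ lastOf x t
     inside (p , s , cp , cs) = pick (two-of-three y p s x (H-sym (adj p y cp)) (adj y s cs) (H-sym xy) λ { refl → consec-asym (x' ∷ t') (distinct mq) cp cs })
      where
      adj : ∀ u w → consec (x' ∷ t') u w ! → H u w !
      adj = consec-adjacent H (x' ∷ t') (All.lookup paths mq)
      same : x ∈ x' ∷ t' → (x , t) ≡ (x' , t')
      same xq = uniq x m mq (elem-here x t) xq
      pick : x ≡ p ⊎ x ≡ s → consec (x ∷ t) x y ! ⊎ y ≡ lastOf x t
      pick (inj₁ refl) = inj₁ (subst (λ r → consec (full r) x y !) (sym (same (consec-∈ˡ (x' ∷ t') cp))) cp)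
      pick (inj₂ refl) = ⊥-elim (first-not (same (consec-∈ʳ (x' ∷ t') cs)) cs)
       where
       first-not : (x , t) ≡ (x' , t') → consec (x' ∷ t') y x ! → ⊥
       first-not refl c = contra (consec-tail x t c) (distinct-head x t (distinct m))

  closes : ∀ x t → (x , t) ∈ₗ ps → ∀ a b → a ≢ b → H x a ! → H x b ! → Closes (x , t)
  closes x t m a b ne ha hb = by (first-neighbours x t m a ha) (first-neighbours x t m b hb)
   where
   long-enough : ∀ t s → consec (x ∷ t) x s ! → s ≢ lastOf x t → 2 ≤ length t
   long-enough (y ∷ []) s c ne with consec-cons x y [] {x} {s} c
   ... | inj₁ (_ , refl) = ⊥-elim (ne refl)
   long-enough (y ∷ z ∷ t) s c ne = s≤s (s≤s z≤n)
   by : consec (x ∷ t) x a ! ⊎ a ≡ lastOf x t → consec (x ∷ t) x b ! ⊎ b ≡ lastOf x t → Closes (x , t)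
   by (inj₁ p) (inj₁ q) = ⊥-elim (ne (consec-right-unique (x ∷ t) {a} {b} {x} (distinct m) p q))
   by (inj₂ p) (inj₂ q) = ⊥-elim (ne (trans p (sym q)))
   by (inj₁ p) (inj₂ refl) = long-enough t a p ne , hb
   by (inj₂ refl) (inj₁ q) = long-enough t b q (ne ∘ sym) , ha

 module Count (G : Graph n) (cG : Cubic G) (H⊂G : ∀ {u v} → H u v ! → G u v !) (g : ℕ) (ps : List (NList n)) (sys : System ps) where
  open System sys

  bad : ℕ
  bad = ∣ (λ v → onShortCycle G g v) ∣

  closed-short : ∀ x t → (x , t) ∈ₗ ps → Closes (x , t) → length t ≤ g → onShortCycle G g x !
  closed-short x t m (two , cl) le = by (walk-from-head x t av (lastOf x t) (last-elem x t))
   where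
   d = distinct m
   av : ∀ a b → consec (x ∷ t) a b ! → Avoiding G cG x (lastOf x t) a b
   av a b c = H⊂G (consec-adjacent H (x ∷ t) (All.lookup paths m) a b c) , ¬true (λ e → no' t two d c (isPair-true e))
    where
    no' : ∀ t → 2 ≤ length t → distinctᵇ (x ∷ t) ! → consec (x ∷ t) a b ! → (a ≡ x × b ≡ lastOf x t) ⊎ (a ≡ lastOf x t × b ≡ x) → ⊥
    no' t _ d c (inj₂ (_ , refl)) = contra (consec-tail b t c) (distinct-head b t d)
    no' (s ∷ []) (s≤s ()) _ _ _
    no' (s ∷ r ∷ t) _ d c (inj₁ (refl , refl)) = contra (subst (_∈ (r ∷ t)) (consec-right-unique (x ∷ s ∷ r ∷ t) {lastOf r t} {s} {x} d c (consec-first x s (r ∷ t))) (last-elem r t))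
     (distinct-head s (r ∷ t) (distinct-tail x (s ∷ r ∷ t) d))
   by : (∃[ k ] k ≤ length t × Walk (Avoiding G cG x (lastOf x t)) k x (lastOf x t)) → onShortCycle G g x !
   by (k , lk , w) = short-cycle G cG (H⊂G cl) w (≤-trans lk le)

  ∑-length : ∑ ps (λ p → length (full p)) ≡ n
  ∑-length = trans (∑-cong ps λ p → sym (trans (∑-const (full p) 1) (*-identityʳ _))) (trans (partition (λ _ → 1)) (trans (∑ᶠ-const n 1) (*-identityʳ n)))

  ∑-first : (P : Fin n → Bool) → ∑ ps (λ p → ⟦ P (proj₁ p) ⟧) ≤ ∣ P ∣
  ∑-first P = ≤-trans (∑-mono ps λ p → m≤m+n _ _) (≤-reflexive (partition (λ v → ⟦ P v ⟧)))

  -- A closing path with fewer than g vertices starts on a short cycle. A longer one is paid for by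
  -- its own vertices, so there are at most n / g of them.
  closed-count : (c : NList n → Bool) → (∀ p → p ∈ₗ ps → c p ! → Closes p) → g * ∑ ps (λ p → ⟦ c p ⟧) ≤ g * bad + n
  closed-count c h = begin
   g * ∑ ps (λ p → ⟦ c p ⟧) ≤⟨ *-monoʳ-≤ g (∑-mono-∈ ps (λ p m → pt p m (c p) refl)) ⟩
   g * ∑ ps (λ p → ⟦ onShortCycle G g (proj₁ p) ⟧ + ⟦ g ≤ᵇ length (full p) ⟧) ≡⟨ trans (cong (g *_) (∑-+ ps (λ p → ⟦ onShortCycle G g (proj₁ p) ⟧) (λ p → ⟦ g ≤ᵇ length (full p) ⟧))) (*-distribˡ-+ g _ _) ⟩
   g * ∑ ps (λ p → ⟦ onShortCycle G g (proj₁ p) ⟧) + g * ∑ ps (λ p → ⟦ g ≤ᵇ length (full p) ⟧)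
    ≤⟨ +-mono-≤ (*-monoʳ-≤ g (∑-first (λ v → onShortCycle G g v))) (≤-reflexive (sym (∑-*ˡ g ps (λ p → ⟦ g ≤ᵇ length (full p) ⟧)))) ⟩
   g * bad + ∑ ps (λ p → g * ⟦ g ≤ᵇ length (full p) ⟧) ≤⟨ +-monoʳ-≤ (g * bad) (∑-mono ps (λ p → big (length (full p)) (g ≤ᵇ length (full p)) refl)) ⟩
   g * bad + ∑ ps (λ p → length (full p)) ≡⟨ cong (g * bad +_) ∑-length ⟩
   g * bad + n ∎
   where
   big : ∀ k b → (g ≤ᵇ k) ≡ b → g * ⟦ b ⟧ ≤ k
   big k true e = ≤-trans (≤-reflexive (*-identityʳ g)) (≤ᵇ-true {g} e)
   big k false e = ≤-trans (≤-reflexive (*-zeroʳ g)) z≤n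
   pt : ∀ p → p ∈ₗ ps → ∀ b → c p ≡ b → ⟦ b ⟧ ≤ ⟦ onShortCycle G g (proj₁ p) ⟧ + ⟦ g ≤ᵇ length (full p) ⟧
   pt p m false e = z≤n
   pt (x , t) m true e = by (g ≤? length (x ∷ t))
    where
    by : Dec (g ≤ length (x ∷ t)) → 1 ≤ ⟦ onShortCycle G g x ⟧ + ⟦ g ≤ᵇ length (x ∷ t) ⟧
    by (yes le) = ≤-trans (≤-reflexive (cong ⟦_⟧ (sym (true-≤ᵇ le)))) (m≤n+m _ _)
    by (no nle) = ≤-trans (≤-reflexive (cong ⟦_⟧ (sym (closed-short x t m (h (x , t) m e) (≤-trans (n≤1+n _) (≤-trans (n≤1+n _) (≰⇒> nle))))))) (m≤m+n _ _)

-- Cutting paths into pieces of equal length.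

chop : ℕ → ℕ → List (Fin n) → List (NList n)
chop m zero l = []
chop m (suc f) [] = []
chop m (suc f) (x ∷ t) = (x , List.take m t) ∷ chop m f (List.drop m t)

partial : ℕ → NList n → ℕ
partial m p = ⟦ not (length (full p) ≡ᵇ suc m) ⟧ * length (full p)

module _ {n : ℕ} (m : ℕ) where

 chop-occ : ∀ f (l : List (Fin n)) → length l ≤ f → ∀ v → cnt v (chop m f l) ≡ occ v l
 chop-occ zero [] le v = refl
 chop-occ (suc f) [] le v = refl
 chop-occ (suc f) (x ∷ t) (s≤s le) v = trans (cong (occ v (x ∷ List.take m t) +_) (chop-occ f (List.drop m t) (≤-trans (≤-trans (≤-reflexive (length-drop m t)) (m∸n≤m _ m)) le) v))
  (trans (sym (∑-++ (x ∷ List.take m t) (List.drop m t) (λ u → ⟦ v == u ⟧))) (cong (λ l → occ v (x ∷ l)) (take++drop≡id m t)))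

 chop-linked : ∀ (H : Graph n) f (l : List (Fin n)) → Linked H l → All (λ p → Linked H (full p)) (chop m f l)
 chop-linked H zero l lk = []
 chop-linked H (suc f) [] lk = []
 chop-linked H (suc f) (x ∷ t) lk = linked-++ˡ H (x ∷ List.take m t) (List.drop m t) lk' ∷ chop-linked H f (List.drop m t) (linked-++ʳ H (x ∷ List.take m t) (List.drop m t) lk')
  where lk' = subst (λ l → Linked H (x ∷ l)) (sym (take++drop≡id m t)) lk

 chop-length : ∀ f (l : List (Fin n)) → All (λ p → length (full p) ≤ suc m) (chop m f l)
 chop-length zero l = []
 chop-length (suc f) [] = []
 chop-length (suc f) (x ∷ t) = s≤s (≤-trans (≤-reflexive (length-take m t)) (m⊓n≤m m _)) ∷ chop-length f (List.drop m t)

 -- Only the last piece can fall short.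
 chop-partial : ∀ f (l : List (Fin n)) → ∑ (chop m f l) (partial m) ≤ suc m
 chop-partial zero l = z≤n
 chop-partial (suc f) [] = z≤n
 chop-partial (suc f) (x ∷ t) with m ≤? length t
 ... | yes le = ≤-trans (≤-reflexive (cong (λ b → ⟦ not b ⟧ * suc (length (List.take m t)) + ∑ (chop m f (List.drop m t)) (partial m))
          (true-≡ᵇ {length (List.take m t)} (trans (length-take m t) (m≤n⇒m⊓n≡m le))))) (chop-partial f (List.drop m t))
 ... | no nle = ≤-trans (≤-reflexive (trans (cong (λ l → partial m (x , List.take m t) + ∑ (chop m f l) (partial m)) (empty (List.drop m t) (trans (length-drop m t) (m≤n⇒m∸n≡0 (≤-trans (n≤1+n _) (≰⇒> nle))))))
          (trans (cong (partial m (x , List.take m t) +_) (chop-[] f)) (+-identityʳ _)))) (≤-trans (*-monoˡ-≤ (suc (length (List.take m t))) (⟦⟧≤1 (not (length (List.take m t) ≡ᵇ m))))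
          (≤-trans (≤-reflexive (*-identityˡ _)) (s≤s (≤-trans (≤-reflexive (length-take m t)) (m⊓n≤m m _)))))
  where
  empty : ∀ (l : List (Fin n)) → length l ≡ 0 → l ≡ []
  empty [] _ = refl
  chop-[] : ∀ f → ∑ (chop {n} m f []) (partial m) ≡ 0
  chop-[] zero = refl
  chop-[] (suc f) = refl

oddᵇ : {A : Set} → List A → Bool
oddᵇ [] = false
oddᵇ (x ∷ []) = true
oddᵇ (x ∷ y ∷ t) = oddᵇ t

chop-pairs : (f : ℕ) (l : List (Fin n)) → ∑ (chop 1 f l) (partial 1) ≤ ⟦ oddᵇ l ⟧
chop-pairs zero l = z≤n
chop-pairs (suc f) [] = z≤n
chop-pairs (suc zero) (x ∷ []) = ≤-refl
chop-pairs (suc (suc f)) (x ∷ []) = ≤-refl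
chop-pairs (suc f) (x ∷ y ∷ t) = chop-pairs f t

-- The partition is given by the piece of each vertex instead of a list of pieces, since later
-- constructions proceed vertex by vertex.
record Pieces {n : ℕ} (H : Graph n) (m : ℕ) : Set where
 field
  piece : Fin n → NList n
  self : ∀ v → v ∈ full (piece v)
  same : ∀ v w → w ∈ full (piece v) → piece w ≡ piece v
  linked : ∀ v → Linked H (full (piece v))
  distinct : ∀ v → distinctᵇ (full (piece v)) !
  short : ∀ v → length (full (piece v)) ≤ suc m

 incomplete : Fin n → Bool
 incomplete v = not (length (full (piece v)) ≡ᵇ suc m)

pieces : (H : Graph n) (H-sym : ∀ {u v} → H u v ! → H v u !) (H-irr : ∀ {v} → H v v ! → ⊥) (m : ℕ) →
 (ps : List (NList n)) → PathSystem.System H H-sym H-irr ps →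
 Σ (Pieces H m) λ P → ∣ Pieces.incomplete P ∣ ≤ ∑ ps (λ p → ∑ (chop m (length (full p)) (full p)) (partial m))
pieces {n} H H-sym H-irr m ps sys = P , count
 where
 open PathSystem H H-sym H-irr
 cs = concatMap (λ p → chop m (length (full p)) (full p)) ps
 all-concat : ∀ {Q : NList n → Set} ps → (∀ p → p ∈ₗ ps → All Q (chop m (length (full p)) (full p))) → All Q (concatMap (λ p → chop m (length (full p)) (full p)) ps)
 all-concat [] h = []
 all-concat (p ∷ ps) h = All.++⁺ (h p (here refl)) (all-concat ps λ q e → h q (there e))
 sys' : System cs
 sys' = record { paths = all-concat ps (λ p e → chop-linked m H (length (full p)) (full p) (All.lookup (System.paths sys) e))
  ; once = λ v → trans (∑-concatMap (λ p → chop m (length (full p)) (full p)) ps (λ p → occ v (full p))) (trans (∑-cong ps (λ p → chop-occ m (length (full p)) (full p) ≤-refl v)) (System.once sys v)) }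
 open System sys'
 P : Pieces H m
 P = record { piece = λ v → proj₁ (covers v) ; self = λ v → proj₂ (proj₂ (covers v))
  ; same = λ v w e → uniq w (proj₁ (proj₂ (covers w))) (proj₁ (proj₂ (covers v))) (proj₂ (proj₂ (covers w))) e
  ; linked = λ v → All.lookup paths (proj₁ (proj₂ (covers v))) ; distinct = λ v → distinct (proj₁ (proj₂ (covers v)))
  ; short = λ v → All.lookup (all-concat ps λ p e → chop-length m (length (full p)) (full p)) (proj₁ (proj₂ (covers v))) }
 count : ∣ Pieces.incomplete P ∣ ≤ ∑ ps (λ p → ∑ (chop m (length (full p)) (full p)) (partial m))
 count = begin
  ∣ Pieces.incomplete P ∣ ≡⟨ sym (partition (λ v → ⟦ Pieces.incomplete P v ⟧)) ⟩
  ∑ cs (λ c → ∑ (full c) (λ v → ⟦ Pieces.incomplete P v ⟧)) ≤⟨ ∑-mono-∈ cs (λ c e → ≤-trans (inside c e (full c) (λ _ x → x)) (≤-reflexive (*-comm (length (full c)) _))) ⟩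
  ∑ cs (partial m) ≡⟨ ∑-concatMap (λ p → chop m (length (full p)) (full p)) ps (partial m) ⟩
  ∑ ps (λ p → ∑ (chop m (length (full p)) (full p)) (partial m)) ∎
  where
  inside : ∀ c → c ∈ₗ cs → ∀ l → (∀ v → v ∈ l → v ∈ full c) → ∑ l (λ v → ⟦ Pieces.incomplete P v ⟧) ≤ length l * ⟦ not (length (full c) ≡ᵇ suc m) ⟧
  inside c e [] h = z≤n
  inside c e (v ∷ l) h = +-mono-≤ (≤-reflexive (cong (λ p → ⟦ not (length (full p) ≡ᵇ suc m) ⟧) (uniq v (proj₁ (proj₂ (covers v))) e (proj₂ (proj₂ (covers v))) (h v (elem-here v l)))))
   (inside c e l λ w x → h w (elem-there w v l x))

-- A nearly perfect matching and its complement.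

partner : (v : Fin n) (p : NList n) → length (full p) ≡ 2 → v ∈ full p →
 ∃[ w ] w ∈ full p × (consec (full p) v w ! ⊎ consec (full p) w v !) × (∀ u → u ∈ full p → u ≡ v ⊎ u ≡ w)
partner v (a , b ∷ []) _ e = by (elem-cons (b ∷ []) e)
 where
 only-b : ∀ u → u ∈ b ∷ [] → u ≡ b
 only-b u e with elem-cons {v = u} [] e
 ... | inj₁ q = q
 by : v ≡ a ⊎ v ∈ b ∷ [] → ∃[ w ] w ∈ a ∷ b ∷ [] × (consec (a ∷ b ∷ []) v w ! ⊎ consec (a ∷ b ∷ []) w v !) × (∀ u → u ∈ a ∷ b ∷ [] → u ≡ v ⊎ u ≡ w)
 by (inj₁ refl) = b , elem-there b v (b ∷ []) (elem-here b []) , inj₁ (consec-first v b []) , λ u m → two u (elem-cons (b ∷ []) m)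
  where
  two : ∀ u → u ≡ v ⊎ u ∈ b ∷ [] → u ≡ v ⊎ u ≡ b
  two u (inj₁ r) = inj₁ r
  two u (inj₂ r) = inj₂ (only-b u r)
 by (inj₂ m) = a , elem-here a (b ∷ []) , inj₂ (subst (λ w → consec (a ∷ b ∷ []) a w !) (sym (only-b v m)) (consec-first a b [])) , λ u m' → two u (elem-cons (b ∷ []) m')
  where
  two : ∀ u → u ≡ a ⊎ u ∈ b ∷ [] → u ≡ v ⊎ u ≡ a
  two u (inj₁ r) = inj₂ r
  two u (inj₂ r) = inj₁ (trans (only-b u r) (sym (only-b v m)))

module Tiling {n : ℕ} (G : Graph n) (cG : Cubic G) (g : ℕ) where
 open Cubic cG

 bad : ℕ
 bad = ∣ (λ v → onShortCycle G g v) ∣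

 private
  σ : Fin n → Fin n
  σ = proj₁ (Hall.permutation G cG)
  Gσ : ∀ v → G v (σ v) !
  Gσ = proj₁ (proj₂ (Hall.permutation G cG))
  σ-inj : ∀ u v → σ u ≡ σ v → u ≡ v
  σ-inj = proj₂ (proj₂ (Hall.permutation G cG))

  -- The edges of the permutation without their direction. The orbits become cycles, or single edges
  -- where σ exchanges two vertices.
  H₁ : Graph n
  H₁ u v = v == σ u ∨ u == σ v

  H₁⊂G : ∀ {u v} → H₁ u v ! → G u v !
  H₁⊂G {u} {v} e with ∨-true {v == σ u} e
  ... | inj₁ p = subst (λ w → G u w !) (sym (==-true p)) (Gσ u)
  ... | inj₂ p = syms (subst (λ w → G v w !) (sym (==-true p)) (Gσ v))

  H₁-sym : ∀ {u v} → H₁ u v ! → H₁ v u !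
  H₁-sym {u} {v} e with ∨-true {v == σ u} e
  ... | inj₁ p = true-∨ʳ (u == σ v) p
  ... | inj₂ p = true-∨ˡ (v == σ u) p

  H₁-irr : ∀ {v} → H₁ v v ! → ⊥
  H₁-irr e = edge≢ (H₁⊂G e) refl

  H₁-deg : ∀ v → ∣ H₁ v ∣ ≤ 2
  H₁-deg v = ≤-trans (∣∣-∨ (λ w → w == σ v) (λ w → v == σ w)) (+-mono-≤ (≤-reflexive (∣∣-== (σ v)))
   (∣∣-unique (λ w → v == σ w) λ a b p q → σ-inj a b (trans (sym (==-true p)) (==-true q))))

  module P₁ = PathSystem H₁ H₁-sym H₁-irr

  ps₁ = proj₁ P₁.stuck-system
  sys₁ = proj₁ (proj₂ P₁.stuck-system)
  stuck₁ = proj₂ (proj₂ P₁.stuck-system)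
  module E₁ = P₁.Ends H₁-deg ps₁ sys₁ stuck₁

  -- A path that does not close up starts at a vertex x with σ (σ x) = x and is the edge from x to σ x.
  odd-closes : ∀ p → p ∈ₗ ps₁ → oddᵇ (full p) ! → P₁.Closes p
  odd-closes (x , t) m od = from (injective-surjective σ σ-inj x)
   where
   from : (∃[ y ] σ y ≡ x) → P₁.Closes (x , t)
   from (y , σy) = by (σ x ≟ᶠ y)
    where
    xy : H₁ x y !
    xy = true-∨ʳ (y == σ x) (subst (λ w → x == w !) (sym σy) ==-refl)
    by : Dec (σ x ≡ y) → P₁.Closes (x , t)
    by (no ne) = E₁.closes x t m (σ x) y ne (true-∨ˡ _ ==-refl) xy
    by (yes e) = ⊥-elim (pair t (P₁.System.distinct sys₁ m) (All.lookup (P₁.System.paths sys₁) m) od (E₁.first-neighbours x t m y xy))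
     where
     only-x : ∀ w → H₁ y w ! → w ≡ x
     only-x w h with ∨-true {w == σ y} h
     ... | inj₁ p = trans (==-true p) σy
     ... | inj₂ p = σ-inj w x (trans (sym (==-true p)) (sym e))
     before-last : ∀ z w t → ∃[ u ] consec (z ∷ w ∷ t) u (lastOf w t) !
     before-last z w [] = z , consec-first z w []
     before-last z w (v ∷ t) with before-last w v t
     ... | u , c = u , consec-later z w (v ∷ t) u (lastOf v t) c
     pair : ∀ t → distinctᵇ (x ∷ t) ! → Linked H₁ (x ∷ t) → oddᵇ (x ∷ t) ! → consec (x ∷ t) x y ! ⊎ y ≡ lastOf x t → ⊥
     pair [] d lk od (inj₂ refl) = H₁-irr xy
     pair (z ∷ w ∷ t) d lk od (inj₁ c) with consec-cons x z (w ∷ t) {x} {y} c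
     ... | inj₁ (_ , refl) = contra (subst (_∈ (y ∷ w ∷ t)) (only-x w (proj₁ (proj₂ lk))) (elem-there w y (w ∷ t) (elem-here w t))) (distinct-head x (y ∷ w ∷ t) d)
     ... | inj₂ c' = contra (consec-∈ˡ (z ∷ w ∷ t) c') (distinct-head x (z ∷ w ∷ t) d)
     pair (z ∷ w ∷ t) d lk od (inj₂ refl) with before-last z w t
     ... | u , c = contra (subst (_∈ (z ∷ w ∷ t)) (only-x u (H₁-sym (consec-adjacent H₁ (z ∷ w ∷ t) (proj₂ lk) u y c))) (consec-∈ˡ (z ∷ w ∷ t) c)) (distinct-head x (z ∷ w ∷ t) d)

  Q = pieces H₁ H₁-sym H₁-irr 1 ps₁ sys₁
  open Pieces (proj₁ Q) using (piece) renaming (incomplete to U)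

  -- Cutting into pairs leaves one vertex over on each odd path. Such paths close up to cycles, of
  -- which few are short and at most n / g are long.
  small-U : g * ∣ U ∣ ≤ g * bad + n
  small-U = ≤-trans (*-monoʳ-≤ g (≤-trans (proj₂ Q) (∑-mono ps₁ λ p → chop-pairs (length (full p)) (full p))))
   (P₁.Count.closed-count G cG H₁⊂G g ps₁ sys₁ (λ p → oddᵇ (full p)) odd-closes)

  M : Fin n → Fin n → Bool
  M u v = not (u == v) ∧ elemᵇ v (full (piece u))

  M-sym : ∀ u v → M u v ! → M v u !
  M-sym u v e = true-∧ (trans (cong not (==-sym v u)) (∧ˡ e))
   (subst (λ p → u ∈ full p) (sym (Pieces.same (proj₁ Q) u v (∧ʳ {not (u == v)} e))) (Pieces.self (proj₁ Q) u))

  record Mate (v : Fin n) : Set where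
   field
    mate : Fin n
    v-mate : G v mate !
    paired : M v mate !
    only : ∀ w → M v w ! → w ≡ mate

  has-mate : ∀ v → U v ≡ false → Mate v
  has-mate v e = from (partner v (piece v) (≡ᵇ-true (not-false e)) (Pieces.self (proj₁ Q) v))
   where
   not-false : ∀ {b} → not b ≡ false → b !
   not-false {true} _ = refl
   from : (∃[ w ] w ∈ full (piece v) × (consec (full (piece v)) v w ! ⊎ consec (full (piece v)) w v !) × (∀ u → u ∈ full (piece v) → u ≡ v ⊎ u ≡ w)) → Mate v
   from (w , w∈ , c , all) = record { mate = w ; v-mate = H₁⊂G vw ; paired = true-∧ (cong not (≢-== λ { refl → H₁-irr vw })) w∈ ; only = λ u m → pick u m (all u (∧ʳ {not (v == u)} m)) }
    where
    vw : H₁ v w !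
    vw = edge-of c
     where
     edge-of : consec (full (piece v)) v w ! ⊎ consec (full (piece v)) w v ! → H₁ v w !
     edge-of (inj₁ p) = consec-adjacent H₁ (full (piece v)) (Pieces.linked (proj₁ Q) v) v w p
     edge-of (inj₂ p) = H₁-sym (consec-adjacent H₁ (full (piece v)) (Pieces.linked (proj₁ Q) v) w v p)
    pick : ∀ u → M v u ! → u ≡ v ⊎ u ≡ w → u ≡ w
    pick u m (inj₁ refl) = contra (==-refl {u = u}) (not-true (∧ˡ {not (u == u)} m))
    pick u m (inj₂ r) = r

  -- Unmatched vertices lose all their edges, so that the degree is at most 2 everywhere.
  H₂ : Graph n
  H₂ u v = G u v ∧ not (M u v) ∧ not (U u) ∧ not (U v)

  H₂⊂G : ∀ {u v} → H₂ u v ! → G u v !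
  H₂⊂G e = ∧ˡ e

  H₂-facts : ∀ u v → H₂ u v ! → M u v ≡ false × U u ≡ false × U v ≡ false
  H₂-facts u v e = not-true (∧ˡ r) , not-true (∧ˡ s) , not-true (∧ʳ {not (U u)} s)
   where
   r = ∧ʳ {G u v} e
   s = ∧ʳ {not (M u v)} r

  H₂-intro : ∀ u v → G u v ! → M u v ≡ false → U u ≡ false → U v ≡ false → H₂ u v !
  H₂-intro u v g m a b = true-∧ g (true-∧ (cong not m) (true-∧ (cong not a) (cong not b)))

  H₂-sym : ∀ {u v} → H₂ u v ! → H₂ v u !
  H₂-sym {u} {v} e = H₂-intro v u (syms (H₂⊂G {u} {v} e)) (¬true λ m → contra (M-sym v u m) (proj₁ (H₂-facts u v e))) (proj₂ (proj₂ (H₂-facts u v e))) (proj₁ (proj₂ (H₂-facts u v e)))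

  H₂-irr : ∀ {v} → H₂ v v ! → ⊥
  H₂-irr {v} e = edge≢ (H₂⊂G {v} {v} e) refl

  without-mate : ∀ v → (m : Mate v) → ∣ G v ∖ Mate.mate m ∣ ≡ 2
  without-mate v m = suc-injective (trans (sym (∣∖∣ (G v) (Mate.mate m) (Mate.v-mate m))) (deg v))

  H₂-deg : ∀ v → ∣ H₂ v ∣ ≤ 2
  H₂-deg v = by (U v) refl
   where
   by : ∀ b → U v ≡ b → ∣ H₂ v ∣ ≤ 2
   by true e = ≤-trans (≤-reflexive (trans (∑-cong (allFin n) λ w → cong ⟦_⟧ (¬true {H₂ v w} λ h → contra e (proj₁ (proj₂ (H₂-facts v w h))))) (∑-zero (allFin n)))) z≤n
   by false e = ≤-trans (∣∣-mono {P = H₂ v} {Q = G v ∖ Mate.mate m} λ w h → true-∖ {P = G v} (H₂⊂G {v} {w} h) λ { refl → contra (Mate.paired m) (proj₁ (H₂-facts v w h)) })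
     (≤-reflexive (without-mate v m))
    where m = has-mate v e

  module P₂ = PathSystem H₂ (λ {u} {v} → H₂-sym {u} {v}) (λ {v} → H₂-irr {v})

  ps₂ = proj₁ P₂.stuck-system
  sys₂ = proj₁ (proj₂ P₂.stuck-system)
  stuck₂ = proj₂ (proj₂ P₂.stuck-system)

  low near-U : Fin n → Bool
  low v = ∣ H₂ v ∣ ≤ᵇ 1
  near-U v = some (λ w → U w ∧ G v w)

  low-U : ∀ v → low v ! → U v ∨ near-U v !
  low-U v e = by (U v) (near-U v) refl refl
   where
   by : ∀ a b → U v ≡ a → near-U v ≡ b → a ∨ b !
   by true _ _ _ = refl
   by false true _ _ = refl
   by false false p q = ⊥-elim (1+n≰n (≤-trans (≤-trans (≤-reflexive (sym (without-mate v m))) (∣∣-mono {P = G v ∖ Mate.mate m} {Q = H₂ v} λ w h →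
     H₂-intro v w (proj₁ (∖-true {P = G v} h)) (¬true λ mw → proj₂ (∖-true {P = G v} h) (Mate.only m w mw)) p
      (¬true λ uw → contra (some-intro (λ w → U w ∧ G v w) w (true-∧ uw (proj₁ (∖-true {P = G v} h)))) q))) (≤ᵇ-true e)))
    where m = has-mate v p

  few-low : ∣ low ∣ ≤ 4 * ∣ U ∣
  few-low = ≤-trans (∣∣-mono {Q = λ v → U v ∨ near-U v} low-U) (≤-trans (∣∣-∨ U near-U)
   (+-monoʳ-≤ ∣ U ∣ (double-count (allFin n) (allFin n) near-U U G 3 (λ v e → ≤ᵇ-true e) (λ w _ → ≤-reflexive (∣∣-sym cG w)))))

  two-witnesses : ∀ v → low v ≡ false → ∃₂ λ a b → a ≢ b × H₂ v a ! × H₂ v b !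
  two-witnesses v e = from (search (H₂ v))
   where
   big : 2 ≤ ∣ H₂ v ∣
   big = ≰⇒> λ le → contra (true-≤ᵇ le) e
   none : ∀ (P : Fin n → Bool) → (∀ v → P v ≡ false) → ∣ P ∣ ≡ 0
   none P f = ∣∣-empty f
   from : (∃[ a ] H₂ v a !) ⊎ (∀ a → H₂ v a ≡ false) → ∃₂ λ a b → a ≢ b × H₂ v a ! × H₂ v b !
   from (inj₂ f) = ⊥-elim (1+n≰n (≤-trans (≤-trans (s≤s z≤n) big) (≤-reflexive (none (H₂ v) f))))
   from (inj₁ (a , ha)) = from₂ (search (H₂ v ∖ a))
    where
    from₂ : (∃[ b ] (H₂ v ∖ a) b !) ⊎ (∀ b → (H₂ v ∖ a) b ≡ false) → ∃₂ λ a b → a ≢ b × H₂ v a ! × H₂ v b !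
    from₂ (inj₁ (b , hb)) = a , b , (λ r → proj₂ (∖-true {P = H₂ v} hb) (sym r)) , ha , proj₁ (∖-true {P = H₂ v} hb)
    from₂ (inj₂ f) = ⊥-elim (1+n≰n (≤-trans big (≤-reflexive (trans (∣∖∣ (H₂ v) a ha) (cong suc (none (H₂ v ∖ a) f))))))

  -- A path that starts at a vertex of degree 2 closes up and is counted by `closed-count`. Smaller
  -- degrees occur only at unmatched vertices and their neighbours. The 5 is 4 + 1.
  few-paths : g * length ps₂ ≤ 5 * (g * bad + n)
  few-paths = begin
   g * length ps₂ ≡⟨ cong (g *_) (trans (sym (*-identityʳ _)) (sym (∑-const ps₂ 1))) ⟩
   g * ∑ ps₂ (λ _ → 1) ≡⟨ cong (g *_) (trans (∑-cong ps₂ λ p → sym (split (low (proj₁ p)))) (∑-+ ps₂ (λ p → ⟦ low (proj₁ p) ⟧) (λ p → ⟦ not (low (proj₁ p)) ⟧))) ⟩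
   g * (∑ ps₂ (λ p → ⟦ low (proj₁ p) ⟧) + ∑ ps₂ (λ p → ⟦ not (low (proj₁ p)) ⟧)) ≡⟨ *-distribˡ-+ g _ _ ⟩
   g * ∑ ps₂ (λ p → ⟦ low (proj₁ p) ⟧) + g * ∑ ps₂ (λ p → ⟦ not (low (proj₁ p)) ⟧) ≤⟨ +-mono-≤ (*-monoʳ-≤ g (≤-trans (P₂.Count.∑-first G cG (λ {u} {v} → H₂⊂G {u} {v}) g ps₂ sys₂ low) few-low))
    (P₂.Count.closed-count G cG (λ {u} {v} → H₂⊂G {u} {v}) g ps₂ sys₂ (λ p → not (low (proj₁ p))) closing) ⟩
   g * (4 * ∣ U ∣) + (g * bad + n) ≡⟨ cong (_+ (g * bad + n)) (trans (sym (*-assoc g 4 ∣ U ∣)) (trans (cong (_* ∣ U ∣) (*-comm g 4)) (*-assoc 4 g ∣ U ∣))) ⟩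
   4 * (g * ∣ U ∣) + (g * bad + n) ≤⟨ +-monoˡ-≤ (g * bad + n) (*-monoʳ-≤ 4 small-U) ⟩
   4 * (g * bad + n) + (g * bad + n) ≡⟨ +-comm (4 * (g * bad + n)) _ ⟩
   5 * (g * bad + n) ∎
   where
   split : ∀ b → ⟦ b ⟧ + ⟦ not b ⟧ ≡ 1
   split true = refl
   split false = refl
   closing : ∀ p → p ∈ₗ ps₂ → not (low (proj₁ p)) ! → P₂.Closes p
   closing (x , t) m e = let (a , b , ne , ha , hb) = two-witnesses x (not-true e) in P₂.Ends.closes H₂-deg ps₂ sys₂ stuck₂ x t m a b ne ha hb

  linked-mono : ∀ l → Linked H₂ l → Linked G l
  linked-mono [] _ = _
  linked-mono (x ∷ []) _ = _
  linked-mono (x ∷ y ∷ t) (e , lk) = H₂⊂G {x} {y} e , linked-mono (y ∷ t) lk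

 -- The matching obtained from a permutation along edges is nearly perfect, and its complement is nearly a 2-factor.
 tiling : ∀ m → Σ (Pieces G m) λ P → g * ∣ Pieces.incomplete P ∣ ≤ suc m * (5 * (g * bad + n))
 tiling m = record { piece = Pieces.piece R ; self = Pieces.self R ; same = Pieces.same R ; linked = λ v → linked-mono _ (Pieces.linked R v)
   ; distinct = Pieces.distinct R ; short = Pieces.short R } , (begin
  g * ∣ Pieces.incomplete R ∣ ≤⟨ *-monoʳ-≤ g (proj₂ R′) ⟩
  g * ∑ ps₂ (λ p → ∑ (chop m (length (full p)) (full p)) (partial m)) ≤⟨ *-monoʳ-≤ g (∑-mono ps₂ λ p → chop-partial m (length (full p)) (full p)) ⟩
  g * ∑ ps₂ (λ _ → suc m) ≡⟨ trans (cong (g *_) (∑-const ps₂ (suc m))) (sym (*-assoc g (length ps₂) (suc m))) ⟩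
  g * length ps₂ * suc m ≡⟨ *-comm (g * length ps₂) (suc m) ⟩
  suc m * (g * length ps₂) ≤⟨ *-monoʳ-≤ (suc m) few-paths ⟩
  suc m * (5 * (g * bad + n)) ∎)
  where
  R′ = pieces H₂ (λ {u} {v} → H₂-sym {u} {v}) (λ {v} → H₂-irr {v}) m ps₂ sys₂
  R = proj₁ R′

-- Sinks: vertices where the greedy colouring can end.

module Near {n : ℕ} (G : Graph n) (cG : Cubic G) where
 open Cubic cG

 Edge : Fin n → Fin n → Set
 Edge u v = G u v !

 near : ℕ → (Fin n → Bool) → Fin n → Bool
 near zero P v = P v
 near (suc k) P v = near k P v ∨ some (λ w → near k P w ∧ G v w)

 near-step : ∀ k P v w → G v w ! → near k P w ! → near (suc k) P v !
 near-step k P v w g e = true-∨ʳ (near k P v) (some-intro (λ w → near k P w ∧ G v w) w (true-∧ e g))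

 near-walk : ∀ {j} P v w → Walk Edge j v w → P w ! → near j P v !
 near-walk P v .v [] e = e
 near-walk P v w (_∷_ {v = u} {k = k} g p) e = near-step k P v u g (near-walk P u w p e)

 near-≤ : ∀ {j k} P v → j ≤ k → near j P v ! → near k P v !
 near-≤ {j} {zero} P v z≤n e = e
 near-≤ {j} {suc k} P v le e with m≤n⇒m<n∨m≡n le
 ... | inj₁ (s≤s le') = true-∨ˡ _ (near-≤ P v le' e)
 ... | inj₂ refl = e

 near-mono : ∀ k {P Q : Fin n → Bool} v → (∀ w → P w ! → Q w !) → near k P v ! → near k Q v !
 near-mono zero v h e = h v e
 near-mono (suc k) {P} {Q} v h e with ∨-true {near k P v} e
 ... | inj₁ p = true-∨ˡ _ (near-mono k v h p)
 ... | inj₂ p with some-elim (λ w → near k P w ∧ G v w) p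
 ... | w , q = near-step k Q v w (∧ʳ {near k P w} q) (near-mono k w h (∧ˡ q))

 near-count : ∀ k P → ∣ near k P ∣ ≤ 4 ^ k * ∣ P ∣
 near-count zero P = ≤-reflexive (sym (*-identityˡ _))
 near-count (suc k) P = begin
  ∣ near (suc k) P ∣ ≤⟨ ∣∣-∨ (near k P) _ ⟩
  ∣ near k P ∣ + ∣ (λ v → some (λ w → near k P w ∧ G v w)) ∣ ≤⟨ +-monoʳ-≤ ∣ near k P ∣ (double-count (allFin n) (allFin n) (λ v → some (λ w → near k P w ∧ G v w)) (near k P) G 3
   (λ v e → ≤ᵇ-true e) (λ w _ → ≤-reflexive (∣∣-sym cG w))) ⟩
  4 * ∣ near k P ∣ ≤⟨ *-monoʳ-≤ 4 (near-count k P) ⟩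
  4 * (4 ^ k * ∣ P ∣) ≡⟨ sym (*-assoc 4 (4 ^ k) ∣ P ∣) ⟩
  4 ^ suc k * ∣ P ∣ ∎

two-of-two : ∀ (x a b c : Fin 3) → x ≢ a → x ≢ b → x ≢ c → a ≢ b → a ≢ c → b ≡ c
two-of-two x a b c xa xb xc ab ac = trans (third-only x a b xa (xb ∘ sym) (ab ∘ sym)) (sym (third-only x a c xa (xc ∘ sym) (ac ∘ sym)))

module Sinks {n : ℕ} (G : Graph n) (cG : Cubic G) (φ : Fin n → Fin 3) (φ-proper : ∀ i j → G i j ! → φ i ≢ φ j)
 (g β : ℕ) (3≤g : 3 ≤ g) (β≤g : β ≤ g) where
 open Cubic cG
 open Near G cG
 open Greedy G cG using (Within; Twins)

 bad : ℕ
 bad = ∣ (λ v → onShortCycle G g v) ∣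

 record Fork (y : Fin n) : Set where
  field
   p q o : Fin n
   yp : G y p !
   yq : G y q !
   yo : G y o !
   p≢q : p ≢ q
   o≢p : o ≢ p
   o≢q : o ≢ q
   same : φ p ≡ φ q

 opaque
  -- The three neighbours of y use only the two colours other than that of y. The neighbour `o`
  -- beside the agreeing pair is the way out of y.
  fork : ∀ y → Fork y
  fork y = by (φ N.a ≟ᶠ φ N.b) (φ N.a ≟ᶠ φ N.c) (φ N.b ≟ᶠ φ N.c)
   where
   module N = Nbrs (nbrs cG y)
   by : Dec (φ N.a ≡ φ N.b) → Dec (φ N.a ≡ φ N.c) → Dec (φ N.b ≡ φ N.c) → Fork y
   by (yes e) _ _ = record { p = N.a ; q = N.b ; o = N.c ; yp = N.va ; yq = N.vb ; yo = N.vc ; p≢q = N.a≢b ; o≢p = N.a≢c ∘ sym ; o≢q = N.b≢c ∘ sym ; same = e }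
   by _ (yes e) _ = record { p = N.a ; q = N.c ; o = N.b ; yp = N.va ; yq = N.vc ; yo = N.vb ; p≢q = N.a≢c ; o≢p = N.a≢b ∘ sym ; o≢q = N.b≢c ; same = e }
   by _ _ (yes e) = record { p = N.b ; q = N.c ; o = N.a ; yp = N.vb ; yq = N.vc ; yo = N.va ; p≢q = N.b≢c ; o≢p = N.a≢b ; o≢q = N.a≢c ; same = e }
   by (no e₁) (no e₂) (no e₃) = ⊥-elim (e₃ (two-of-two (φ y) (φ N.a) (φ N.b) (φ N.c) (φ-proper y N.a N.va) (φ-proper y N.b N.vb) (φ-proper y N.c N.vc) e₁ e₂))

 prongs : Fin n → Fin n → Bool
 prongs y v = v == Fork.p (fork y) ∨ v == Fork.q (fork y)

 prong-edge : ∀ y v → prongs y v ! → G y v !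
 prong-edge y v e with ∨-true {v == Fork.p (fork y)} e
 ... | inj₁ r = subst (λ w → G y w !) (sym (==-true r)) (Fork.yp (fork y))
 ... | inj₂ r = subst (λ w → G y w !) (sym (==-true r)) (Fork.yq (fork y))

 p-prong : ∀ y → prongs y (Fork.p (fork y)) !
 p-prong y = true-∨ˡ _ ==-refl

 q-prong : ∀ y → prongs y (Fork.q (fork y)) !
 q-prong y = true-∨ʳ (Fork.q (fork y) == Fork.p (fork y)) ==-refl

 module Given (Y : Fin n → Bool) where
  X : Fin n → Bool
  X v = some (λ y → Y y ∧ prongs y v)

  H : Fin n → Fin n → Bool
  H u v = G u v ∧ not (X u) ∧ not (X v)

  rooted : Closure H (λ v → Y v ∧ not (X v))
  rooted = closure H (λ v → Y v ∧ not (X v))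

  X-elim : ∀ v → X v ! → ∃[ y ] Y y ! × prongs y v !
  X-elim v e with some-elim (λ y → Y y ∧ prongs y v) e
  ... | y , r = y , ∧ˡ r , ∧ʳ {Y y} r

  X-intro : ∀ y v → Y y ! → prongs y v ! → X v !
  X-intro y v a b = some-intro (λ y → Y y ∧ prongs y v) y (true-∧ a b)

  Free : Fin n → Fin n → Set
  Free u v = H u v !

  free-intro : ∀ u v → G u v ! → X u ≡ false → X v ≡ false → Free u v
  free-intro u v g a b = true-∧ g (true-∧ (cong not a) (cong not b))

  free-elim : ∀ u v → Free u v → G u v ! × X u ≡ false × X v ≡ false
  free-elim u v e = ∧ˡ e , not-true (∧ˡ r) , not-true (∧ʳ {not (X u)} r)
   where r = ∧ʳ {G u v} e

  free-sym : ∀ {u v} → Free u v → Free v u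
  free-sym {u} {v} e = free-intro v u (syms (proj₁ (free-elim u v e))) (proj₂ (proj₂ (free-elim u v e))) (proj₁ (proj₂ (free-elim u v e)))

 -- A vertex that is added is far from all earlier prongs, but its own prongs may be close to
 -- earlier sinks. So `far` excludes only that both kinds of closeness occur.
 record Spaced (Y : Fin n → Bool) : Set where
  open Given Y
  field
   separated : ∀ y z k → Y y ! → Y z ! → Walk Free k y z → X y ≡ false → X z ≡ false → y ≡ z
   far : ∀ y z → Y y ! → Y z ! → y ≢ z → near 3 (prongs y) z ! → near 3 (prongs z) y ! → ⊥

 record Maximal : Set where
  field
   Y : Fin n → Bool
   spaced : Spaced Y
   all : ∀ v → near 3 (Given.X Y) v ! ⊎ Closure.S (Given.rooted Y) v !

 -- A vertex that is neither near a prong nor reached by a sink can be added. New prongs only remove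
 -- vertices from the free graph, so the old sinks stay separated.
 maximal : Maximal
 maximal = grow n (λ _ → false) (∣∣≤n _) record { separated = λ _ _ _ () ; far = λ _ _ () }
  where
  grow : ∀ m (Y : Fin n → Bool) → ∣ (λ v → not (Y v)) ∣ ≤ m → Spaced Y → Maximal
  grow m Y le sp = by (search (λ v → not (near 3 X v) ∧ not (S v)))
   where
   open Given Y
   open Closure rooted
   by : (∃[ v ] not (near 3 X v) ∧ not (S v) !) ⊎ (∀ v → not (near 3 X v) ∧ not (S v) ≡ false) → Maximal
   by (inj₂ f) = record { Y = Y ; spaced = sp ; all = λ v → dec v (near 3 X v) (S v) refl refl }
    where
    dec : ∀ v a b → near 3 X v ≡ a → S v ≡ b → near 3 X v ! ⊎ S v !
    dec v true _ e _ = inj₁ e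
    dec v false true _ e = inj₂ e
    dec v false false e e' = contra (true-∧ (cong not e) (cong not e')) (f v)
   by (inj₁ (v , e)) = more m le
    where
    nv : near 3 X v ≡ false
    nv = not-true (∧ˡ e)
    sv : S v ≡ false
    sv = not-true (∧ʳ {not (near 3 X v)} e)
    xv : X v ≡ false
    xv = ¬true λ x → contra (near-≤ {0} {3} X v z≤n x) nv
    yv : Y v ≡ false
    yv = ¬true λ y → contra (start v (true-∧ y (cong not xv))) sv
    Y' : Fin n → Bool
    Y' w = Y w ∨ w == v
    module N = Given Y'
    X⊂ : ∀ w → X w ! → N.X w !
    X⊂ w x with X-elim w x
    ... | y , yy , p = N.X-intro y w (true-∨ˡ _ yy) p
    X⊃ : ∀ w → N.X w ≡ false → X w ≡ false
    X⊃ w e = ¬true λ x → contra (X⊂ w x) e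
    lower : ∀ {u w} → N.Free u w → Free u w
    lower {u} {w} h = free-intro u w (proj₁ (N.free-elim u w h)) (X⊃ u (proj₁ (proj₂ (N.free-elim u w h)))) (X⊃ w (proj₂ (proj₂ (N.free-elim u w h))))
    reach : ∀ {k y w} → S y ! → Walk Free k y w → S w !
    reach sy [] = sy
    reach sy (h ∷ p) = reach (closed _ _ sy h) p
    new : ∀ w → Y' w ! → Y w ! ⊎ w ≡ v
    new w e with ∨-true {Y w} e
    ... | inj₁ p = inj₁ p
    ... | inj₂ p = inj₂ (==-true p)
    cut : ∀ z k → Y z ! → Walk N.Free k z v → N.X z ≡ false → ⊥
    cut z k yz p xz = contra (reach (start z (true-∧ yz (cong not (X⊃ z xz)))) (map-walk lower p)) sv
    sep : ∀ y z k → Y' y ! → Y' z ! → Walk N.Free k y z → N.X y ≡ false → N.X z ≡ false → y ≡ z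
    sep y z k a b p xy xz with new y a | new z b
    ... | inj₁ ya | inj₁ zb = Spaced.separated sp y z k ya zb (map-walk lower p) (X⊃ y xy) (X⊃ z xz)
    ... | inj₂ refl | inj₂ refl = refl
    ... | inj₁ ya | inj₂ refl = ⊥-elim (cut y k ya p xy)
    ... | inj₂ refl | inj₁ zb = ⊥-elim (cut z k zb (reverse-walk N.free-sym p) xz)
    not-near : ∀ y → Y y ! → near 3 (prongs y) v ! → ⊥
    not-near y yy e = contra (near-mono 3 {prongs y} {X} v (λ w → X-intro y w yy) e) nv
    fr : ∀ y z → Y' y ! → Y' z ! → y ≢ z → near 3 (prongs y) z ! → near 3 (prongs z) y ! → ⊥
    fr y z a b ne c d with new y a | new z b
    ... | inj₁ ya | inj₁ zb = Spaced.far sp y z ya zb ne c d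
    ... | inj₂ refl | inj₂ refl = ne refl
    ... | inj₁ ya | inj₂ refl = not-near y ya c
    ... | inj₂ refl | inj₁ zb = not-near z zb d
    more : ∀ m → ∣ (λ v → not (Y v)) ∣ ≤ m → Maximal
    more zero le = ⊥-elim (1+n≰n (≤-trans (∣∣-pos (λ v → not (Y v)) v (cong not yv)) le))
    more (suc m) le = grow m Y' (s≤s⁻¹ (≤-trans smaller le)) record { separated = sep ; far = fr }
     where
     smaller : suc ∣ (λ w → not (Y w ∨ w == v)) ∣ ≤ ∣ (λ w → not (Y w)) ∣
     smaller = ≤-trans (s≤s (∣∣-mono {Q = (λ w → not (Y w)) ∖ v} λ w p → true-∖ {P = λ w → not (Y w)} (cong not (∨-falseˡ (not-true p)))
      λ { refl → contra ==-refl (∨-falseʳ (Y w) (not-true p)) })) (≤-reflexive (sym (∣∖∣ (λ w → not (Y w)) v (cong not yv))))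

 open Maximal maximal public
 open Given Y
 open Closure rooted using () renaming (S to R; start to R-start; origin to R-origin; closed to R-closed)
 open Spaced spaced

 Y-clear : ∀ y → Y y ! → X y ≡ false
 Y-clear y yy = ¬true λ x → from (X-elim y x)
  where
  from : (∃[ z ] Y z ! × prongs z y !) → ⊥
  from (z , zz , e) = far y z yy zz (λ { refl → edge≢ (prong-edge y y e) refl })
   (near-≤ {2} {3} (prongs y) z (s≤s (s≤s z≤n)) (near-walk {2} (prongs y) z (Fork.p (fork y)) (prong-edge z y e ∷ Fork.yp (fork y) ∷ []) (p-prong y)))
   (near-≤ {0} {3} (prongs z) y z≤n e)

 o-clear : ∀ y → Y y ! → X (Fork.o (fork y)) ≡ false
 o-clear y yy = ¬true λ x → from (X-elim (Fork.o (fork y)) x)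
  where
  open Fork (fork y)
  from : (∃[ z ] Y z ! × prongs z o !) → ⊥
  from (z , zz , e) with z ≟ᶠ y
  ... | no ne = far y z yy zz (ne ∘ sym)
     (near-walk {3} (prongs y) z p (prong-edge z o e ∷ syms yo ∷ yp ∷ []) (p-prong y))
     (near-≤ {1} {3} (prongs z) y (s≤s z≤n) (near-walk {1} (prongs z) y o (yo ∷ []) e))
  ... | yes refl with ∨-true {o == p} e
  ... | inj₁ r = o≢p (==-true r)
  ... | inj₂ r = o≢q (==-true r)

 -- From a sink far from short cycles one can walk on without meeting X, and without returning.
 module Escape (y : Fin n) (yy : Y y !) (good : near β (λ v → onShortCycle G g v) y ≡ false) where

  record Trail (u : Fin n) (t : List (Fin n)) : Set where
   field
    tail-end : lastOf u t ≡ y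
    linked : Linked G (u ∷ t)
    dist : distinctᵇ (u ∷ t) !
    clear : ∀ v → v ∈ u ∷ t → X v ≡ false

  not-short : ∀ {u t} → Trail u t → length t ≤ β → onShortCycle G g u ≡ false
  not-short {u} {t} T le = ¬true λ s → contra (near-≤ {length t} {β} (λ v → onShortCycle G g v) y le (from (walk-to u t (Trail.linked T)) s)) good
   where
   walk-to : ∀ u t → Linked G (u ∷ t) → Walk Edge (length t) u (lastOf u t)
   walk-to u [] _ = []
   walk-to u (x ∷ t) (e , lk) = e ∷ walk-to x t lk
   from : Walk Edge (length t) u (lastOf u t) → onShortCycle G g u ! → near (length t) (λ v → onShortCycle G g v) y !
   from w s = near-walk {length t} (λ v → onShortCycle G g v) y u (reverse-walk syms (subst (Walk Edge (length t) u) (Trail.tail-end T) w)) s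

  longer : ∀ {u w t} → Trail u (w ∷ t) → suc (length t) ≤ β → ∀ a → G u a ! → a ≢ w → X a ≡ false → Trail a (u ∷ w ∷ t)
  longer {u} {w} {t} T le a ua ne xa = record { tail-end = Trail.tail-end T ; linked = syms ua , Trail.linked T ; dist = true-∧ (cong not (¬true a∉)) (Trail.dist T)
   ; clear = λ v e → cl v (elem-cons (u ∷ w ∷ t) e) }
   where
   cl : ∀ v → v ≡ a ⊎ v ∈ u ∷ w ∷ t → X v ≡ false
   cl v (inj₁ refl) = xa
   cl v (inj₂ e) = Trail.clear T v e
   a∉ : a ∈ u ∷ w ∷ t → ⊥
   a∉ e = cyc (walk-from-head u (w ∷ t) av a e)
    where
    av : ∀ b c → consec (u ∷ w ∷ t) b c ! → Avoiding G cG u a b c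
    av b c k = consec-adjacent G (u ∷ w ∷ t) (Trail.linked T) b c k , ¬true λ i → h (isPair-true i)
     where
     h : (b ≡ u × c ≡ a) ⊎ (b ≡ a × c ≡ u) → ⊥
     h (inj₁ (refl , refl)) = ne (consec-right-unique (u ∷ w ∷ t) {a} {w} {u} (Trail.dist T) k (consec-first u w t))
     h (inj₂ (_ , refl)) = contra (consec-tail u (w ∷ t) k) (distinct-head u (w ∷ t) (Trail.dist T))
    cyc : (∃[ k ] k ≤ length (w ∷ t) × Walk (Avoiding G cG u a) k u a) → ⊥
    cyc (k , lk , p) = contra (short-cycle G cG ua p (≤-trans lk (≤-trans le β≤g))) (not-short T le)

  trail-walk : ∀ u t → Linked G (u ∷ t) → (∀ v → v ∈ u ∷ t → X v ≡ false) → ∀ v → v ∈ u ∷ t → ∃[ k ] Walk Free k (lastOf u t) v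
  trail-walk u t lk cl v e with walk-in-list {E = Free} free-sym (u ∷ t)
   (λ a b c → free-intro a b (consec-adjacent G (u ∷ t) lk a b c) (cl a (consec-∈ˡ (u ∷ t) c)) (cl b (consec-∈ʳ (u ∷ t) c)))
   (lastOf u t) v (last-elem u t) e
  ... | k , _ , p = k , p

  -- Two forks with prongs next to u would be too close to each other, or form a 4-cycle through u.
  one-free : ∀ {u w t} → Trail u (w ∷ t) → suc (length t) ≤ β → ∀ a b → a ≢ b → G u a ! → G u b ! → X a ! → X b ! → ⊥
  one-free {u} {w} {t} T le a b ne ua ub xa xb = from (X-elim a xa) (X-elim b xb)
   where
   from : (∃[ z ] Y z ! × prongs z a !) → (∃[ z ] Y z ! × prongs z b !) → ⊥
   from (z , zz , za) (z' , zz' , zb) with z ≟ᶠ z'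
   ... | no nz = far z z' zz zz' nz (near-walk {3} (prongs z) z' a (prong-edge z' b zb ∷ syms ub ∷ ua ∷ []) za)
           (near-walk {3} (prongs z') z b (prong-edge z a za ∷ syms ua ∷ ub ∷ []) zb)
   ... | yes refl with u ≟ᶠ z
   ... | no nu = contra (short-cycle G cG ua ((ub , pair (λ { (inj₁ (_ , e)) → ne (sym e) ; (inj₂ (e , _)) → edge≢ ua e })) ∷
            (syms (prong-edge z b zb) , pair (λ { (inj₁ (e , _)) → edge≢ ub (sym e) ; (inj₂ (e , _)) → ne (sym e) })) ∷
            (prong-edge z a za , pair (λ { (inj₁ (e , _)) → nu (sym e) ; (inj₂ (e , _)) → edge≢ (prong-edge z a za) e })) ∷ []) 3≤g) (not-short T le)
    where
    pair : ∀ {c d} → ¬ ((c ≡ u × d ≡ a) ⊎ (c ≡ a × d ≡ u)) → isPair u a c d ≡ false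
    pair h = ¬true (h ∘ isPair-true)
   ... | yes refl = contra (subst (_∈ (w ∷ t)) (trans (Trail.tail-end T) (root (trail-walk u (w ∷ t) (Trail.linked T) (Trail.clear T) u (elem-here u (w ∷ t))))) (last-elem w t))
    (distinct-head u (w ∷ t) (Trail.dist T))
    where
    root : (∃[ k ] Walk Free k (lastOf w t) u) → y ≡ u
    root (k , p) = separated y u k yy zz (subst (λ v → Walk Free k v u) (Trail.tail-end T) p) (Y-clear y yy) (Y-clear u zz)

  -- Of the two further neighbours of the current end at most one lies in `X`, by `one-free`. The
  -- other one is new, because a return would close a short cycle.
  trail : ∀ k → suc k ≤ β → ∃₂ λ u w → ∃[ t ] Trail u (w ∷ t) × length t ≡ k
  trail zero _ = o , y , [] , record { tail-end = refl ; linked = syms yo , _ ; dist = true-∧ (cong not (both-false (≢-== λ e → edge≢ yo (sym e)) refl)) refl ; clear = λ v e → cl v (elem-cons (y ∷ []) e) } , refl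
   where
   open Fork (fork y)
   cl : ∀ v → v ≡ o ⊎ v ∈ y ∷ [] → X v ≡ false
   cl v (inj₁ refl) = o-clear y yy
   cl v (inj₂ e) with elem-cons {v = v} [] e
   ... | inj₁ refl = Y-clear y yy
  trail (suc k) le = from (trail k (≤-trans (n≤1+n _) le))
   where
   from : (∃₂ λ u w → ∃[ t ] Trail u (w ∷ t) × length t ≡ k) → ∃₂ λ u w → ∃[ t ] Trail u (w ∷ t) × length t ≡ suc k
   from (u , w , t , T , refl) = pick (two-others (nbrs cG u))
    where
    le' : suc (length t) ≤ β
    le' = ≤-trans (n≤1+n _) le
    two-others : Nbrs G u → ∃₂ λ a b → a ≢ b × a ≢ w × b ≢ w × G u a ! × G u b !
    two-others M with Nbrs.a M ≟ᶠ w | Nbrs.b M ≟ᶠ w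
    ... | yes e | _ = Nbrs.b M , Nbrs.c M , Nbrs.b≢c M , (λ r → Nbrs.a≢b M (trans e (sym r))) , (λ r → Nbrs.a≢c M (trans e (sym r))) , Nbrs.vb M , Nbrs.vc M
    ... | no ne | yes e = Nbrs.a M , Nbrs.c M , Nbrs.a≢c M , ne , (λ r → Nbrs.b≢c M (trans e (sym r))) , Nbrs.va M , Nbrs.vc M
    ... | no ne | no nf = Nbrs.a M , Nbrs.b M , Nbrs.a≢b M , ne , nf , Nbrs.va M , Nbrs.vb M
    pick : (∃₂ λ a b → a ≢ b × a ≢ w × b ≢ w × G u a ! × G u b !) → ∃₂ λ u w → ∃[ t' ] Trail u (w ∷ t') × length t' ≡ suc (length t)
    pick (a , b , ab , aw , bw , ua , ub) = by (X a) (X b) refl refl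
     where
     by : ∀ c d → X a ≡ c → X b ≡ d → ∃₂ λ u w → ∃[ t' ] Trail u (w ∷ t') × length t' ≡ suc (length t)
     by false _ e _ = a , u , w ∷ t , longer T le' a ua aw e , refl
     by true false _ e = b , u , w ∷ t , longer T le' b ub bw e , refl
     by true true e f = ⊥-elim (one-free T le' a b ab ua ub e f)

  component : Closure H (λ v → v == y)
  component = closure H (λ v → v == y)

  big : β ≤ ∣ Closure.S component ∣
  big = by β ≤-refl
   where
   open Closure component using (S; closed) renaming (start to begins)
   by : ∀ k → k ≤ β → k ≤ ∣ S ∣
   by zero _ = z≤n
   by (suc k) le = from (trail k le)
    where
    from : (∃₂ λ u w → ∃[ t ] Trail u (w ∷ t) × length t ≡ k) → suc k ≤ ∣ S ∣
    from (u , w , t , T , refl) = begin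
     suc (length t) ≤⟨ n≤1+n _ ⟩
     length (u ∷ w ∷ t) ≡⟨ trans (sym (*-identityʳ _)) (sym (∑-const (u ∷ w ∷ t) 1)) ⟩
     ∑ (u ∷ w ∷ t) (λ _ → 1) ≤⟨ distinct-sum (u ∷ w ∷ t) (λ _ → 1) (Trail.dist T) ⟩
     ∑ᶠ (λ v → ⟦ elemᵇ v (u ∷ w ∷ t) ⟧ * 1) ≡⟨ ∑-cong (allFin n) (λ v → *-identityʳ _) ⟩
     ∣ (λ v → elemᵇ v (u ∷ w ∷ t)) ∣ ≤⟨ ∣∣-mono (λ v e → inside v (trail-walk u (w ∷ t) (Trail.linked T) (Trail.clear T) v e)) ⟩
     ∣ S ∣ ∎
     where
     reach : ∀ {k a v} → S a ! → Walk Free k a v → S v !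
     reach sa [] = sa
     reach sa (h ∷ p) = reach (closed _ _ sa h) p
     inside : ∀ v → (∃[ k ] Walk Free k (lastOf w t) v) → S v !
     inside v (k , p) = reach (begins y ==-refl) (subst (λ a → Walk Free k a v) (Trail.tail-end T) p)

 nearBad : Fin n → Bool
 nearBad = near β (λ v → onShortCycle G g v)

 -- Away from short cycles the component of a sink in the graph without `X` has at least β vertices,
 -- and components of different sinks are disjoint. The other sinks are within distance β of a short
 -- cycle.
 few-sinks : β * ∣ Y ∣ ≤ n + β * (4 ^ β * bad)
 few-sinks = begin
  β * ∣ Y ∣ ≤⟨ *-monoʳ-≤ β (≤-trans (∣∣-mono {Q = λ v → D v ∨ nearBad v} λ v e → split v e (nearBad v) refl) (∣∣-∨ D nearBad)) ⟩
  β * (∣ D ∣ + ∣ nearBad ∣) ≡⟨ *-distribˡ-+ β ∣ D ∣ ∣ nearBad ∣ ⟩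
  β * ∣ D ∣ + β * ∣ nearBad ∣ ≤⟨ +-mono-≤ (≤-trans (disjoint-count D comp (λ _ → true) β (λ d e → Escape.big d (dY d e) (dN d e)) (λ _ _ _ _ → refl) disjoint) (∣∣≤n _))
   (*-monoʳ-≤ β (near-count β (λ v → onShortCycle G g v))) ⟩
  n + β * (4 ^ β * bad) ∎
  where
  D : Fin n → Bool
  D v = Y v ∧ not (nearBad v)
  dY : ∀ d → D d ! → Y d !
  dY d e = ∧ˡ e
  dN : ∀ d → D d ! → nearBad d ≡ false
  dN d e = not-true (∧ʳ {Y d} e)
  split : ∀ v → Y v ! → ∀ b → nearBad v ≡ b → D v ∨ nearBad v !
  split v e true f = true-∨ʳ (D v) f
  split v e false f = true-∨ˡ (nearBad v) (true-∧ e (cong not f))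
  comp : Fin n → Fin n → Bool
  comp y = Closure.S (closure H (λ v → v == y))
  disjoint : ∀ d e x → D d ! → D e ! → comp d x ! → comp e x ! → d ≡ e
  disjoint d e x dd de cd ce = from (Closure.origin (closure H (λ v → v == d)) x cd) (Closure.origin (closure H (λ v → v == e)) x ce)
   where
   from : (∃[ a ] a == d ! × ∃[ k ] Walk Free k a x) → (∃[ a ] a == e ! × ∃[ k ] Walk Free k a x) → d ≡ e
   from (a , ad , k , p) (b , be , j , q) with refl ← ==-true ad | refl ← ==-true be =
    separated a b (k + j) (dY a dd) (dY b de) (p +++ reverse-walk free-sym q) (Y-clear a (dY a dd)) (Y-clear b (dY b de))

 -- Everything that no sink reaches will be precoloured by φ. By maximality it stays within distance
 -- 3 of the prongs.
 Xᶠ : Fin n → Bool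
 Xᶠ v = not (R v)

 R-clear : ∀ v → R v ! → X v ≡ false
 R-clear v r = from (R-origin v r)
  where
  last-clear : ∀ {k a} → X a ≡ false → Walk Free k a v → X v ≡ false
  last-clear xa [] = xa
  last-clear {a = a} xa (_∷_ {v = b} h p) = last-clear (proj₂ (proj₂ (free-elim a b h))) p
  from : (∃[ a ] Y a ∧ not (X a) ! × ∃[ k ] Walk Free k a v) → X v ≡ false
  from (a , e , k , p) = last-clear (not-true (∧ʳ {Y a} e)) p

 sink-clear : ∀ y → Y y ! → Xᶠ y ≡ false
 sink-clear y yy = cong not (R-start y (true-∧ yy (cong not (Y-clear y yy))))

 X⊂Xᶠ : ∀ v → X v ! → Xᶠ v !
 X⊂Xᶠ v x = cong not (¬true λ r → contra x (R-clear v r))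

 sink-fork : ∀ y → Y y ! → Twins Xᶠ φ y
 sink-fork y yy = p , q , p≢q , yp , yq , X⊂Xᶠ p (X-intro y p yy (p-prong y)) , X⊂Xᶠ q (X-intro y q yy (q-prong y)) , same
  where open Fork (fork y)

 sink-walk : ∀ v → Xᶠ v ≡ false → ∃[ y ] Y y ! × Star (Within (λ w → not (Xᶠ w))) v y
 sink-walk v xv = from (R-origin v rv)
  where
  rv : R v !
  rv with R v
  ... | true = refl
  back : ∀ {k a} → R a ! → Walk Free k a v → Star (Within (λ w → not (Xᶠ w))) v a
  back ra [] = ε
  back {a = a} ra (_∷_ {v = b} h p) = back (R-closed a b ra h) p ◅◅ (syms (proj₁ (free-elim a b h)) , cong (not ∘ not) ra) ◅ ε
  from : (∃[ a ] Y a ∧ not (X a) ! × ∃[ k ] Walk Free k a v) → ∃[ y ] Y y ! × Star (Within (λ w → not (Xᶠ w))) v y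
  from (a , e , k , p) = a , ∧ˡ e , back (R-start a e) p

 -- 128 is 2 · 64: each sink has two prongs, and at most 4 ^ 3 vertices are within distance 3 of a
 -- prong.
 few-X : ∣ Xᶠ ∣ ≤ 128 * ∣ Y ∣
 few-X = begin
  ∣ Xᶠ ∣ ≤⟨ ∣∣-mono {Q = near 3 X} (λ v e → pick v e (all v)) ⟩
  ∣ near 3 X ∣ ≤⟨ near-count 3 X ⟩
  64 * ∣ X ∣ ≤⟨ *-monoʳ-≤ 64 (double-count (allFin n) (allFin n) X Y (λ v y → prongs y v) 2 (λ v e → ≤ᵇ-true e)
   (λ y _ → ≤-trans (∣∣-∨ (λ v → v == Fork.p (fork y)) (λ v → v == Fork.q (fork y))) (+-mono-≤ (≤-reflexive (∣∣-== (Fork.p (fork y)))) (≤-reflexive (∣∣-== (Fork.q (fork y))))))) ⟩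
  64 * (2 * ∣ Y ∣) ≡⟨ sym (*-assoc 64 2 ∣ Y ∣) ⟩
  128 * ∣ Y ∣ ∎
  where
  pick : ∀ v → Xᶠ v ! → near 3 X v ! ⊎ R v ! → near 3 X v !
  pick v e (inj₁ p) = p
  pick v e (inj₂ r) = contra r (not-true e)


-- Small sets that contain given items and stay connected to roots.

module _ {n : ℕ} (A : Fin n → Fin n → Bool) (A-sym : ∀ {i j} → A i j ! → A j i !)
 (V I Y : Fin n → Bool) (A⊂V : ∀ {i j} → A i j ! → V j !) (I⊂V : ∀ i → I i ! → V i !) (Y⊂I : ∀ i → Y i ! → I i !) where

 AWalk : ℕ → Fin n → Fin n → Set
 AWalk = Walk (λ i j → A i j !)

 RootedIn : (Fin n → Bool) → Fin n → Set
 RootedIn T i = ∃[ y ] Y y ! × Star (λ i j → A i j ! × T j !) i y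

 record Rooted-set : Set where
  field
   T : Fin n → Bool
   T⊂V : ∀ i → T i ! → V i !
   Y⊂T : ∀ i → Y i ! → T i !
   rooted : ∀ i → T i ! → RootedIn T i

 star-mono : ∀ {T T' : Fin n → Bool} → (∀ i → T i ! → T' i !) → ∀ {i} → RootedIn T i → RootedIn T' i
 star-mono h (y , yy , s) = y , yy , gmap id (λ p → proj₁ p , h _ (proj₂ p)) s

 add-one : (R : Rooted-set) → ∀ i j → V i ! → A i j ! → Rooted-set.T R j ! →
  Σ Rooted-set λ R' → (∀ v → Rooted-set.T R v ! → Rooted-set.T R' v !) × Rooted-set.T R' i ! × ∣ Rooted-set.T R' ∣ ≤ ∣ Rooted-set.T R ∣ + 1
 add-one R i j vi aij tj = record { T = T' ; T⊂V = λ v e → sub v (split v e) ; Y⊂T = λ v e → up v (Y⊂T v e) ; rooted = λ v e → rt v (split v e) } , up , true-∨ʳ (T i) ==-refl ,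
   ≤-trans (∣∣-∨ T (λ v → v == i)) (+-monoʳ-≤ ∣ T ∣ (≤-reflexive (∣∣-== i)))
  where
  open Rooted-set R
  T' : Fin n → Bool
  T' v = T v ∨ v == i
  up : ∀ v → T v ! → T' v !
  up v e = true-∨ˡ (v == i) e
  split : ∀ v → T' v ! → T v ! ⊎ v ≡ i
  split v e with ∨-true {T v} e
  ... | inj₁ p = inj₁ p
  ... | inj₂ p = inj₂ (==-true p)
  sub : ∀ v → T v ! ⊎ v ≡ i → V v !
  sub v (inj₁ p) = T⊂V v p
  sub v (inj₂ refl) = vi
  rt : ∀ v → T v ! ⊎ v ≡ i → RootedIn T' v
  rt v (inj₁ p) = star-mono up (rooted v p)
  rt v (inj₂ refl) = let (y , yy , s) = star-mono up (rooted j tj) in y , yy , (aij , up j tj) ◅ s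

 attach : ∀ {k e w} → (R : Rooted-set) → AWalk k e w → V e ! → Rooted-set.T R w ! →
  Σ Rooted-set λ R' → (∀ v → Rooted-set.T R v ! → Rooted-set.T R' v !) × Rooted-set.T R' e ! × ∣ Rooted-set.T R' ∣ ≤ ∣ Rooted-set.T R ∣ + k
 attach R [] ve tw = R , (λ _ e → e) , tw , m≤m+n _ 0
 attach {e = e} R (_∷_ {v = x} {k = k} a p) ve tw = next (attach R p (A⊂V a) tw)
  where
  next : (Σ Rooted-set λ R' → (∀ v → Rooted-set.T R v ! → Rooted-set.T R' v !) × Rooted-set.T R' x ! × ∣ Rooted-set.T R' ∣ ≤ ∣ Rooted-set.T R ∣ + k) → _
  next (R₁ , up₁ , t₁ , c₁) with add-one R₁ e x ve a t₁
  ... | R₂ , up₂ , t₂ , c₂ = R₂ , (λ v q → up₂ v (up₁ v q)) , t₂ , ≤-trans c₂ (≤-trans (+-monoˡ-≤ 1 c₁) (≤-reflexive (trans (+-assoc _ k 1) (cong (∣ Rooted-set.T R ∣ +_) (+-comm k 1)))))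

 reach₂ : Fin n → Fin n → Bool
 reach₂ i d = i == d ∨ A i d ∨ some (λ k → A i k ∧ A k d)

 reach₂-walk : ∀ i d → reach₂ i d ! → ∃[ k ] k ≤ 2 × AWalk k i d
 reach₂-walk i d e with ∨-true {i == d} e
 ... | inj₁ p with refl ← ==-true p = 0 , z≤n , []
 ... | inj₂ p with ∨-true {A i d} p
 ... | inj₁ q = 1 , s≤s z≤n , q ∷ []
 ... | inj₂ q with some-elim (λ k → A i k ∧ A k d) q
 ... | k , r = 2 , ≤-refl , ∧ˡ r ∷ ∧ʳ {A i k} r ∷ []

 module _ (dom : ∀ i → V i ! → ∃[ d ] I d ! × reach₂ i d !)
  (conn : ∀ i → V i ! → ∃[ y ] Y y ! × Star (λ i j → A i j !) i y) where

  -- While an item is missing, some missing item is within distance 5 of the set: on a walk from a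
  -- missing item to a root, an edge enters the region within distance 2 of collected items, and
  -- before that edge the dominating item is missing. The 5 is 2 + 1 + 2, and each new item pays for
  -- the walk that attaches it.
  connected-items : Σ Rooted-set λ R → (∀ i → I i ! → Rooted-set.T R i !) × ∣ Rooted-set.T R ∣ ≤ 5 * ∣ I ∣
  connected-items = grow n R₀ (∣∣≤n _) (≤-trans (≤-trans (∣∣-mono {Q = λ i → I i ∧ Y i} λ i e → true-∧ (Y⊂I i e) e) (m≤m+n _ (4 * ∣ (λ i → I i ∧ Y i) ∣))) (≤-reflexive refl))
   where
   R₀ : Rooted-set
   R₀ = record { T = Y ; T⊂V = λ i e → I⊂V i (Y⊂I i e) ; Y⊂T = λ _ e → e ; rooted = λ i e → i , e , ε }
   Result = Σ Rooted-set λ R → (∀ i → I i ! → Rooted-set.T R i !) × ∣ Rooted-set.T R ∣ ≤ 5 * ∣ I ∣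
   grow : ∀ m R → ∣ (λ i → I i ∧ not (Rooted-set.T R i)) ∣ ≤ m → ∣ Rooted-set.T R ∣ ≤ 5 * ∣ (λ i → I i ∧ Rooted-set.T R i) ∣ → Result
   grow m R le sz = by (search (λ i → I i ∧ not (T i)))
    where
    open Rooted-set R
    close : Fin n → Bool
    close i = some (λ d → I d ∧ T d ∧ reach₂ i d)
    by : (∃[ i ] I i ∧ not (T i) !) ⊎ (∀ i → I i ∧ not (T i) ≡ false) → Result
    by (inj₂ f) = R , all , ≤-trans sz (*-monoʳ-≤ 5 (∣∣-mono {P = λ i → I i ∧ T i} λ i e → ∧ˡ e))
     where
     all : ∀ i → I i ! → T i !
     all i e with T i in t
     ... | true = refl
     ... | false = contra (true-∧ e (cong not t)) (f i)
    by (inj₁ (d , e)) = more m le (target-walk (close d) refl)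
     where
     vd = I⊂V d (∧ˡ e)
     Target = ∃[ e ] I e ! × T e ≡ false × ∃[ w ] T w ! × ∃[ k ] k ≤ 5 × AWalk k e w
     close-walk : ∀ i → close i ! → ∃[ w ] T w ! × ∃[ k ] k ≤ 2 × AWalk k i w
     close-walk i c with some-elim (λ d → I d ∧ T d ∧ reach₂ i d) c
     ... | w , q = w , ∧ˡ (∧ʳ {I w} q) , reach₂-walk i w (∧ʳ {T w} (∧ʳ {I w} q))
     close-intro : ∀ i d → I d ! → T d ! → reach₂ i d ! → close i !
     close-intro i d a b c = some-intro (λ d → I d ∧ T d ∧ reach₂ i d) d (true-∧ a (true-∧ b c))
     crossing : ∀ {i y} → V i ! → close i ≡ false → close y ! → Star (λ i j → A i j !) i y →
      ∃₂ λ i j → V i ! × A i j ! × close i ≡ false × close j !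
     crossing vi ci cy ε = contra cy ci
     crossing {i} vi ci cy (_◅_ {j = j} a s) = step (close j) refl
      where
      step : ∀ b → close j ≡ b → ∃₂ λ i j → V i ! × A i j ! × close i ≡ false × close j !
      step true c = i , j , vi , a , ci , c
      step false c = crossing (A⊂V a) c cy s
     target-walk : ∀ b → close d ≡ b → Target
     target-walk true c with close-walk d c
     ... | w , tw , k , le , p = d , ∧ˡ e , not-true (∧ʳ {I d} e) , w , tw , k , ≤-trans le (s≤s (s≤s z≤n)) , p
     target-walk false c = across (conn d vd)
      where
      across : (∃[ y ] Y y ! × Star (λ i j → A i j !) d y) → Target
      across (y , yy , s) = from (crossing vd c (close-intro y y (Y⊂I y yy) (Y⊂T y yy) (true-∨ˡ _ ==-refl)) s)
       where
       from : (∃₂ λ i j → V i ! × A i j ! × close i ≡ false × close j !) → Target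
       from (i , j , vi , a , ci , cj) = finish (dom i vi) (close-walk j cj)
        where
        finish : (∃[ d ] I d ! × reach₂ i d !) → (∃[ w ] T w ! × ∃[ k ] k ≤ 2 × AWalk k j w) → Target
        finish (e , ie , r) (w , tw , k , le , p) = e , ie , ¬true (λ te → contra (close-intro i e ie te r) ci) , w , tw , compose (reach₂-walk i e r)
         where
         compose : (∃[ k ] k ≤ 2 × AWalk k i e) → ∃[ k ] k ≤ 5 × AWalk k e w
         compose (l , le' , q) = l + suc k , +-mono-≤ le' (s≤s le) , reverse-walk A-sym q +++ (a ∷ p)
     more : ∀ m → ∣ (λ i → I i ∧ not (T i)) ∣ ≤ m → Target → Result
     more zero le _ = ⊥-elim (1+n≰n (≤-trans (∣∣-pos (λ i → I i ∧ not (T i)) d e) le))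
     more (suc m) le (x , ix , tx , w , tw , k , lk , p) = go (attach R p (I⊂V x ix) tw)
      where
      go : (Σ Rooted-set λ R' → (∀ v → T v ! → Rooted-set.T R' v !) × Rooted-set.T R' x ! × ∣ Rooted-set.T R' ∣ ≤ ∣ T ∣ + k) → Result
      go (R' , up , t' , c) = grow m R' (s≤s⁻¹ (≤-trans (s≤s (∣∣-mono {P = λ i → I i ∧ not (Rooted-set.T R' i)} {Q = (λ i → I i ∧ not (T i)) ∖ x} shrink))
        (≤-trans (≤-reflexive (sym (∣∖∣ (λ i → I i ∧ not (T i)) x (true-∧ ix (cong not tx))))) le))) size
       where
       T' = Rooted-set.T R'
       shrink : ∀ i → I i ∧ not (T' i) ! → ((λ i → I i ∧ not (T i)) ∖ x) i !
       shrink i q = true-∖ {P = λ i → I i ∧ not (T i)} (true-∧ (∧ˡ q) (cong not (¬true λ ti → contra (up i ti) nt))) λ { refl → contra t' nt }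
        where nt = not-true (∧ʳ {I i} q)
       size : ∣ T' ∣ ≤ 5 * ∣ (λ i → I i ∧ T' i) ∣
       size = begin
        ∣ T' ∣ ≤⟨ ≤-trans c (+-mono-≤ sz lk) ⟩
        5 * ∣ (λ i → I i ∧ T i) ∣ + 5 ≡⟨ trans (+-comm _ 5) (sym (*-suc 5 ∣ (λ i → I i ∧ T i) ∣)) ⟩
        5 * suc ∣ (λ i → I i ∧ T i) ∣ ≤⟨ *-monoʳ-≤ 5 (≤-trans (s≤s (∣∣-mono {P = λ i → I i ∧ T i} {Q = (λ i → I i ∧ T' i) ∖ x} λ i q →
         true-∖ {P = λ i → I i ∧ T' i} (true-∧ (∧ˡ q) (up i (∧ʳ {I i} q))) λ { refl → contra (∧ʳ {I x} q) tx }))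
         (≤-reflexive (sym (∣∖∣ (λ i → I i ∧ T' i) x (true-∧ ix t'))))) ⟩
        5 * ∣ (λ i → I i ∧ T' i) ∣ ∎

-- Greedy colouring in bounded degree.

greedy-colouring : (A : Fin n → Fin n → Bool) (A-sym : ∀ {i j} → A i j ! → A j i !) (Δ : ℕ) → (∀ i → ∣ A i ∣ ≤ Δ) →
 ∃ λ (col : Fin n → ℕ) → (∀ i → col i < suc Δ) × (∀ i j → A i j ! → i ≢ j → col i ≢ col j)
greedy-colouring {n} A A-sym Δ deg = from (colour-list (allFin n))
 where
 Good : List (Fin n) → Set
 Good l = ∃ λ (col : Fin n → ℕ) → (∀ i → col i < suc Δ) × (∀ i j → i ∈ l → j ∈ l → A i j ! → i ≢ j → col i ≢ col j)
 from : Good (allFin n) → ∃ λ (col : Fin n → ℕ) → (∀ i → col i < suc Δ) × (∀ i j → A i j ! → i ≢ j → col i ≢ col j)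
 from (col , b , p) = col , b , λ i j → p i j (elem-allFin i) (elem-allFin j)
 colour-list : ∀ l → Good l
 colour-list [] = (λ _ → 0) , (λ _ → s≤s z≤n) , λ _ _ ()
 colour-list (v ∷ l) = step (colour-list l)
  where
  step : Good l → Good (v ∷ l)
  step (col , b , p) = pick (search λ c → not (some (λ j → A v j ∧ (col j ≡ᵇ toℕ c))))
   where
   pick : (∃ λ (c : Fin (suc Δ)) → not (some (λ j → A v j ∧ (col j ≡ᵇ toℕ c))) !) ⊎ (∀ (c : Fin (suc Δ)) → not (some (λ j → A v j ∧ (col j ≡ᵇ toℕ c))) ≡ false) → Good (v ∷ l)
   pick (inj₂ f) = ⊥-elim (1+n≰n (begin
    suc Δ ≡⟨ sym (trans (∑ᶠ-const (suc Δ) 1) (*-identityʳ (suc Δ))) ⟩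
    ∣ (λ (c : Fin (suc Δ)) → true) ∣ ≤⟨ double-count (allFin (suc Δ)) (allFin n) (λ _ → true) (A v) (λ c j → col j ≡ᵇ toℕ c) 1
     (λ c _ → used c) (λ j _ → ∣∣-unique (λ (c : Fin (suc Δ)) → col j ≡ᵇ toℕ c) λ a b e e' → toℕ-injective (trans (sym (≡ᵇ-true {col j} e)) (≡ᵇ-true {col j} e'))) ⟩
    1 * ∣ A v ∣ ≤⟨ ≤-trans (≤-reflexive (*-identityˡ _)) (deg v) ⟩
    Δ ∎))
    where
    used : ∀ c → 1 ≤ ∑ᶠ (λ j → ⟦ A v j ∧ (col j ≡ᵇ toℕ c) ⟧)
    used c with some (λ j → A v j ∧ (col j ≡ᵇ toℕ c)) in e
    ... | true = ≤ᵇ-true e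
    ... | false = contra (cong not e) (f c)
   pick (inj₁ (c , e)) = col' , bound , proper
    where
    fresh : ∀ j → A v j ! → col j ≢ toℕ c
    fresh j a q = contra (some-intro (λ j → A v j ∧ (col j ≡ᵇ toℕ c)) j (true-∧ a (true-≡ᵇ {col j} q))) (not-true e)
    col' : Fin n → ℕ
    col' w = if w == v then toℕ c else col w
    bound : ∀ i → col' i < suc Δ
    bound i with i == v
    ... | true = toℕ<n c
    ... | false = b i
    at-v : ∀ i → i ≡ v → col' i ≡ toℕ c
    at-v i refl rewrite ==-refl {u = i} = refl
    off-v : ∀ i → i ≢ v → col' i ≡ col i
    off-v i ne rewrite ≢-== ne = refl
    in-l : ∀ i → i ∈ v ∷ l → i ≢ v → i ∈ l
    in-l i m ne with elem-cons l m
    ... | inj₁ q = ⊥-elim (ne q)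
    ... | inj₂ q = q
    proper : ∀ i j → i ∈ v ∷ l → j ∈ v ∷ l → A i j ! → i ≢ j → col' i ≢ col' j
    proper i j mi mj a ne = by (i ≟ᶠ v) (j ≟ᶠ v)
     where
     by : Dec (i ≡ v) → Dec (j ≡ v) → col' i ≢ col' j
     by (yes r) (yes s) = ⊥-elim (ne (trans r (sym s)))
     by (yes r) (no s) q = fresh j (subst (λ i → A i j !) r a) (trans (sym (off-v j s)) (trans (sym q) (at-v i r)))
     by (no r) (yes s) q = fresh i (A-sym (subst (λ j → A i j !) s a)) (trans (sym (off-v i r)) (trans q (at-v j s)))
     by (no r) (no s) q = p i j (in-l i mi r) (in-l j mj s) a ne (trans (sym (off-v i r)) (trans q (off-v j s)))

mixed-radix : ∀ C a b x y → x < C → y < C → a * C + x ≡ b * C + y → a ≡ b × x ≡ y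
mixed-radix C zero zero x y lx ly e = refl , e
mixed-radix C zero (suc b) x y lx ly e = ⊥-elim (1+n≰n (≤-trans lx (≤-trans (≤-trans (m≤m+n C (b * C)) (m≤m+n _ y)) (≤-reflexive (sym e)))))
mixed-radix C (suc a) zero x y lx ly e = ⊥-elim (1+n≰n (≤-trans ly (≤-trans (≤-trans (m≤m+n C (a * C)) (m≤m+n _ x)) (≤-reflexive e))))
mixed-radix C (suc a) (suc b) x y lx ly e with mixed-radix C a b x y lx ly (+-cancelˡ-≡ C (a * C + x) (b * C + y) (trans (sym (+-assoc C (a * C) x)) (trans e (+-assoc C (b * C) y))))
... | p , q = cong suc p , q

-- Splitting a path into two arms.

backwards : Fin n → List (Fin n) → NList n
backwards x [] = x , []
backwards x (z ∷ t) = proj₁ (backwards z t) , proj₂ (backwards z t) ++ x ∷ []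

backwards-occ : (x : Fin n) (t : List (Fin n)) (v : Fin n) → occ v (full (backwards x t)) ≡ occ v (x ∷ t)
backwards-occ x [] v = refl
backwards-occ x (z ∷ t) v = trans (∑-++ (full (backwards z t)) (x ∷ []) (λ u → ⟦ v == u ⟧)) (trans (cong (_+ (⟦ v == x ⟧ + 0)) (backwards-occ z t v))
 (trans (+-comm (occ v (z ∷ t)) _) (cong (_+ occ v (z ∷ t)) (+-identityʳ ⟦ v == x ⟧))))

backwards-last : (x : Fin n) (t : List (Fin n)) → final-vertex (backwards x t) ≡ x
backwards-last x [] = refl
backwards-last x (z ∷ t) = lastOf-++ (proj₁ (backwards z t)) (proj₂ (backwards z t)) x []

backwards-linked : (H : Graph n) → (∀ {u v} → H u v ! → H v u !) → ∀ x t → Linked H (x ∷ t) → Linked H (full (backwards x t))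
backwards-linked H s x [] lk = _
backwards-linked H s x (z ∷ t) (e , lk) = linked-join H (proj₁ (backwards z t)) (proj₂ (backwards z t)) x [] (backwards-linked H s z t lk)
 (subst (λ w → H w x !) (sym (backwards-last z t)) (s e)) _

backwards-length : (x : Fin n) (t : List (Fin n)) → length (full (backwards x t)) ≡ length (x ∷ t)
backwards-length x [] = refl
backwards-length x (z ∷ t) = cong suc (trans (length-++ (proj₂ (backwards z t))) (trans (+-comm _ 1) (backwards-length z t)))

backwards-∈ : (x : Fin n) (t : List (Fin n)) (v : Fin n) → v ∈ full (backwards x t) → v ∈ x ∷ t
backwards-∈ x t v e = occ-∈ v (x ∷ t) (≤-trans (∈-occ v (full (backwards x t)) e) (≤-reflexive (backwards-occ x t v)))

∈-backwards : (x : Fin n) (t : List (Fin n)) (v : Fin n) → v ∈ x ∷ t → v ∈ full (backwards x t)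
∈-backwards x t v e = occ-∈ v (full (backwards x t)) (≤-trans (∈-occ v (x ∷ t) e) (≤-reflexive (sym (backwards-occ x t v))))

distinct-occ : (l : List (Fin n)) → distinctᵇ l ! → ∀ v → occ v l ≤ 1
distinct-occ [] d v = z≤n
distinct-occ (x ∷ l) d v with v == x in e
... | false = distinct-occ l (distinct-tail x l d) v
... | true = s≤s (≮⇒≥ λ lt → contra (subst (_∈ l) (==-true e) (occ-∈ v l lt)) (distinct-head x l d))

before after : Fin n → List (Fin n) → List (Fin n)
before f [] = []
before f (x ∷ t) = if f == x then [] else x ∷ before f t
after f [] = []
after f (x ∷ t) = if f == x then t else after f t

cut-list : (f : Fin n) (l : List (Fin n)) → f ∈ l → before f l ++ f ∷ after f l ≡ l
cut-list f (x ∷ t) e with f == x in q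
... | true = cong (_∷ t) (==-true q)
... | false = cong (x ∷_) (cut-list f t e)

toArm : Fin n → List (Fin n) → Arm n
toArm x [] = single x
toArm x (y ∷ t) = long x (inits y t) (lastOf y t)
 where
 inits : Fin n → List (Fin n) → List (Fin n)
 inits y [] = []
 inits y (z ∷ t) = y ∷ inits z t

keys-toArm : (x : Fin n) (t : List (Fin n)) → keys (toArm x t) ≡ x ∷ t
keys-toArm x [] = refl
keys-toArm x (y ∷ t) = cong (x ∷_) (go y t)
 where
 go : ∀ y t → inner (toArm x (y ∷ t)) ++ lastOf y t ∷ [] ≡ y ∷ t
 go y [] = refl
 go y (z ∷ t) = cong (y ∷_) (go z t)

last-toArm : (x : Fin n) (t : List (Fin n)) → lastA (toArm x t) ≡ lastOf x t
last-toArm x [] = refl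
last-toArm x (y ∷ t) = refl

key-cases : (A : Arm n) (v : Fin n) → v ∈ keys A → v ∈ inner A ⊎ v ≡ headA A ⊎ v ≡ lastA A
key-cases (single u) v e with elem-cons {v = v} [] e
... | inj₁ q = inj₂ (inj₁ q)
key-cases (long u t ℓ) v e with elem-cons (t ++ ℓ ∷ []) e
... | inj₁ q = inj₂ (inj₁ q)
... | inj₂ q with elem-split v t (ℓ ∷ []) q
... | inj₁ r = inj₁ r
... | inj₂ r with elem-cons {v = v} [] r
... | inj₁ s = inj₂ (inj₂ s)

find : (Fin n → Bool) → Fin n → Fin n
find P d = pick (search P)
 where
 pick : (∃[ v ] P v !) ⊎ (∀ v → P v ≡ false) → Fin _
 pick (inj₁ (v , _)) = v
 pick (inj₂ _) = d

find-true : (P : Fin n → Bool) (d v : Fin n) → P v ! → P (find P d) !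
find-true P d v e with search P
... | inj₁ (w , p) = p
... | inj₂ f = contra e (f v)

toNList : Fin n → List (Fin n) → NList n
toNList d [] = d , []
toNList d (x ∷ t) = x , t

-- The default `d` serves empty lists only; the arms in use come from nonempty ones.
frontArm backArm : Fin n → List (Fin n) → Arm n
frontArm d l = toArm (proj₁ (toNList d l)) (proj₂ (toNList d l))
backArm d [] = single d
backArm d (y ∷ t) = toArm (proj₁ (backwards y t)) (proj₂ (backwards y t))

keys-front : (d : Fin n) (xs : List (Fin n)) (f : Fin n) → keys (frontArm d (xs ++ f ∷ [])) ≡ xs ++ f ∷ []
keys-front d [] f = refl
keys-front d (x ∷ xs) f = keys-toArm x (xs ++ f ∷ [])

last-front : (d : Fin n) (xs : List (Fin n)) (f : Fin n) → lastA (frontArm d (xs ++ f ∷ [])) ≡ f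
last-front d [] f = refl
last-front d (x ∷ xs) f = trans (last-toArm x (xs ++ f ∷ [])) (lastOf-++ x xs f [])

keys-back : (d y : Fin n) (t : List (Fin n)) → keys (backArm d (y ∷ t)) ≡ full (backwards y t)
keys-back d y t = keys-toArm (proj₁ (backwards y t)) (proj₂ (backwards y t))

last-back : (d y : Fin n) (t : List (Fin n)) → lastA (backArm d (y ∷ t)) ≡ y
last-back d y t = trans (last-toArm (proj₁ (backwards y t)) (proj₂ (backwards y t))) (backwards-last y t)

∣elem∣-distinct : (l : List (Fin n)) → distinctᵇ l ! → length l ≤ ∣ (λ v → elemᵇ v l) ∣
∣elem∣-distinct {n} l d = ≤-trans (≤-reflexive (trans (sym (*-identityʳ _)) (sym (∑-const l 1)))) (≤-trans (distinct-sum l (λ _ → 1) d) (≤-reflexive (∑-cong (allFin n) λ v → *-identityʳ _)))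

-- The order of the paths: units, late vertices and ranks.

module Build {n : ℕ} (G : Graph n) (cG : Cubic G) (g m : ℕ) (P : Pieces G m) (X Y : Fin n → Bool)
 (Y-clear : ∀ y → Y y ! → X y ≡ false)
 (sink-walk : ∀ v → X v ≡ false → ∃[ y ] Y y ! × Star (Greedy.Within G cG (λ w → not (X w))) v y) where
 open Cubic cG
 open Near G cG
 open Greedy G cG using (Within)

 -- `C` exceeds the largest degree of the unit graph by one. `K` is twice 2C: the values of `base`
 -- times the two arms of a piece.
 L C K : ℕ
 L = suc m
 C = suc (3 * L)
 K = (C + C) * 2

 module _ (g-large : (L + L) + suc (K * suc (L + L) + K * suc (L + L)) ≤ g) where

  open Pieces P using (piece; incomplete) renaming (self to piece-self; same to piece-same; linked to piece-linked; distinct to piece-distinct; short to piece-short)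

  pl : Fin n → List (Fin n)
  pl v = full (piece v)

  danger : Fin n → Bool
  danger w = near 1 (λ u → onShortCycle G g u ∨ X u) w ∨ Y w

  -- Only these pieces are coloured as paths. Avoiding danger keeps them off short cycles and away
  -- from the precoloured set, and leaves the sinks as single vertices.
  bulkP : NList n → Bool
  bulkP p = (length (full p) ≡ᵇ L) ∧ not (some (λ w → elemᵇ w (full p) ∧ danger w))

  bulk : Fin n → Bool
  bulk v = bulkP (piece v)

  bulk-length : ∀ v → bulk v ! → length (pl v) ≡ L
  bulk-length v e = ≡ᵇ-true (∧ˡ e)

  bulk-safe : ∀ v → bulk v ! → danger v ≡ false
  bulk-safe v e = ¬true λ d → contra (some-intro (λ w → elemᵇ w (pl v) ∧ danger w) v (true-∧ (piece-self v) d)) (not-true (∧ʳ {length (pl v) ≡ᵇ L} e))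

  bulk-near : ∀ v → bulk v ! → near 1 (λ u → onShortCycle G g u ∨ X u) v ≡ false
  bulk-near v e = ∨-falseˡ (bulk-safe v e)

  bulk-here : ∀ v → bulk v ! → onShortCycle G g v ∨ X v ≡ false
  bulk-here v e = ¬true λ q → contra (near-≤ {0} {1} (λ u → onShortCycle G g u ∨ X u) v z≤n q) (bulk-near v e)

  bulk-acyclic : ∀ v → bulk v ! → onShortCycle G g v ≡ false
  bulk-acyclic v e = ∨-falseˡ (bulk-here v e)

  bulk-X : ∀ v → bulk v ! → X v ≡ false
  bulk-X v e = ∨-falseʳ (onShortCycle G g v) (bulk-here v e)

  bulk-nbr : ∀ v w → bulk v ! → G v w ! → X w ≡ false
  bulk-nbr v w e vw = ¬true λ x → contra (near-walk {1} (λ u → onShortCycle G g u ∨ X u) v w (vw ∷ []) (true-∨ʳ (onShortCycle G g w) x)) (bulk-near v e)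

  bulk-Y : ∀ v → bulk v ! → Y v ≡ false
  bulk-Y v e = ∨-falseʳ (near 1 (λ u → onShortCycle G g u ∨ X u) v) (bulk-safe v e)

  bulk-piece : ∀ v w → w ∈ pl v → bulk w ≡ bulk v
  bulk-piece v w e = cong bulkP (piece-same v w e)

  pl-sym : ∀ v w → w ∈ pl v → v ∈ pl w
  pl-sym v w e = subst (λ p → v ∈ full p) (sym (piece-same v w e)) (piece-self v)

  head-pl : ∀ v → proj₁ (piece v) ∈ pl v
  head-pl v = elem-here (proj₁ (piece v)) (proj₂ (piece v))

  -- The units are the bulk pieces and all other vertices singly. A piece is represented by its
  -- first vertex.
  ident : Fin n → Fin n
  ident v = if bulk v then proj₁ (piece v) else v

  ident-bulk : ∀ v → bulk v ! → ident v ≡ proj₁ (piece v)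
  ident-bulk v e = cong (λ b → if b then proj₁ (piece v) else v) e

  ident-single : ∀ v → bulk v ≡ false → ident v ≡ v
  ident-single v e = cong (λ b → if b then proj₁ (piece v) else v) e

  ident-pl : ∀ v → bulk v ! → ident v ∈ pl v
  ident-pl v e = subst (_∈ pl v) (sym (ident-bulk v e)) (head-pl v)

  ident-same : ∀ v w → bulk v ! → w ∈ pl v → ident w ≡ ident v
  ident-same v w e m = trans (ident-bulk w (trans (bulk-piece v w m) e)) (trans (cong proj₁ (piece-same v w m)) (sym (ident-bulk v e)))

  bulk-ident : ∀ v → bulk (ident v) ≡ bulk v
  bulk-ident v = by (bulk v) refl
   where
   by : ∀ b → bulk v ≡ b → bulk (ident v) ≡ bulk v
   by true e = bulk-piece v (ident v) (ident-pl v e)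
   by false e = cong bulk (ident-single v e)

  ident-ident : ∀ v → ident (ident v) ≡ ident v
  ident-ident v = by (bulk v) refl
   where
   by : ∀ b → bulk v ≡ b → ident (ident v) ≡ ident v
   by true e = ident-same v (ident v) e (ident-pl v e)
   by false e = cong ident (ident-single v e)

  same-ident : ∀ u v → bulk v ! → ident u ≡ ident v → bulk u ! × u ∈ pl v
  same-ident u v e q = bu , pl-sym u v (subst (v ∈_) pieces-agree (piece-self v))
   where
   bu : bulk u !
   bu = trans (sym (bulk-ident u)) (trans (cong bulk q) (trans (bulk-ident v) e))
   pieces-agree : pl v ≡ pl u
   pieces-agree = cong full (trans (sym (piece-same v (ident v) (ident-pl v e))) (trans (cong piece (sym q)) (piece-same u (ident u) (ident-pl u bu))))

  X-ident : ∀ v → X v ≡ false → X (ident v) ≡ false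
  X-ident v x = by (bulk v) refl
   where
   by : ∀ b → bulk v ≡ b → X (ident v) ≡ false
   by true e = bulk-X (ident v) (trans (bulk-ident v) e)
   by false e = trans (cong X (ident-single v e)) x

  V : Fin n → Bool
  V i = not (X i) ∧ ident i == i

  V-ident : ∀ v → X v ≡ false → V (ident v) !
  V-ident v x = true-∧ (cong not (X-ident v x)) (subst (λ w → w == ident v !) (sym (ident-ident v)) ==-refl)

  Contact : Fin n → Fin n → Fin n → Fin n → Bool
  Contact i j u w = G u w ∧ not (X u) ∧ not (X w) ∧ ident u == i ∧ ident w == j

  A : Fin n → Fin n → Bool
  A i j = some (λ u → some (λ w → Contact i j u w))

  A-intro : ∀ u w → G u w ! → X u ≡ false → X w ≡ false → A (ident u) (ident w) !
  A-intro u w g x y = some-intro (λ u' → some (λ w' → Contact (ident u) (ident w) u' w')) u (some-intro (λ w' → Contact (ident u) (ident w) u w') w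
   (true-∧ g (true-∧ (cong not x) (true-∧ (cong not y) (true-∧ (==-refl {u = ident u}) (==-refl {u = ident w}))))))

  A-elim : ∀ i j → A i j ! → ∃₂ λ u w → G u w ! × X u ≡ false × X w ≡ false × ident u ≡ i × ident w ≡ j
  A-elim i j e with some-elim (λ u → some (λ w → Contact i j u w)) e
  ... | u , e' with some-elim (λ w → Contact i j u w) e'
  ... | w , c = u , w , ∧ˡ c , not-true (∧ˡ c₁) , not-true (∧ˡ c₂) , ==-true (∧ˡ c₃) , ==-true (∧ʳ {ident u == i} c₃)
   where
   c₁ = ∧ʳ {G u w} c
   c₂ = ∧ʳ {not (X u)} c₁
   c₃ = ∧ʳ {not (X w)} c₂

  A-sym : ∀ {i j} → A i j ! → A j i !
  A-sym {i} {j} e with A-elim i j e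
  ... | u , w , uw , xu , xw , refl , refl = A-intro w u (syms uw) xw xu

  A⊂V : ∀ {i j} → A i j ! → V j !
  A⊂V {i} {j} e with A-elim i j e
  ... | u , w , uw , xu , xw , refl , refl = V-ident w xw

  unit : Fin n → Fin n → Bool
  unit i u = not (X u) ∧ ident u == i

  unit-size : ∀ i → ∣ unit i ∣ ≤ L
  unit-size i = by (bulk i) refl
   where
   by : ∀ b → bulk i ≡ b → ∣ unit i ∣ ≤ L
   by true e = ≤-trans (∣∣-mono {P = unit i} {Q = λ u → elemᵇ u (pl i)} λ u q → inside u (==-true (∧ʳ {not (X u)} q))) (≤-trans (∣elem∣≤ (pl i)) (piece-short i))
    where
    inside : ∀ u → ident u ≡ i → u ∈ pl i
    inside u refl = proj₂ (same-ident u (ident u) e (sym (ident-ident u)))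
   by false e = ≤-trans (∣∣-mono {P = unit i} {Q = λ u → u == i} λ u q → alone u (==-true (∧ʳ {not (X u)} q))) (≤-trans (≤-reflexive (∣∣-== i)) (s≤s z≤n))
    where
    alone : ∀ u → ident u ≡ i → u == i !
    alone u refl = subst (λ w → w == ident u !) (ident-single u (trans (sym (bulk-ident u)) e)) ==-refl

  A-degree : ∀ i → ∣ A i ∣ ≤ 3 * L
  A-degree i = begin
   ∣ A i ∣ ≤⟨ double-count (allFin n) (allFin n) (A i) W (λ j w → j == ident w) 1 (λ j e → seen j (A-elim i j e)) (λ w _ → ≤-reflexive (∣∣-== (ident w))) ⟩
   1 * ∣ W ∣ ≡⟨ *-identityˡ _ ⟩
   ∣ W ∣ ≤⟨ double-count (allFin n) (allFin n) W (unit i) (λ w u → G u w) 3 (λ w e → ≤ᵇ-true e) (λ u _ → ≤-reflexive (deg u)) ⟩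
   3 * ∣ unit i ∣ ≤⟨ *-monoʳ-≤ 3 (unit-size i) ⟩
   3 * L ∎
   where
   W : Fin n → Bool
   W w = some (λ u → unit i u ∧ G u w)
   seen : ∀ j → (∃₂ λ u w → G u w ! × X u ≡ false × X w ≡ false × ident u ≡ i × ident w ≡ j) → 1 ≤ ∑ᶠ (λ w → ⟦ W w ∧ j == ident w ⟧)
   seen j (u , w , uw , xu , xw , refl , refl) = ∣∣-pos (λ w' → W w' ∧ ident w == ident w') w
    (true-∧ (some-intro (λ u' → unit (ident u) u' ∧ G u' w) u (true-∧ (true-∧ (cong not xu) (==-refl {u = ident u})) uw)) (==-refl {u = ident w}))

  lone : Fin n → Bool
  lone i = V i ∧ not (bulk i)

  heads : Fin n → Bool
  heads i = bulk i ∧ ident i == i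

  -- A piece all of whose neighbouring units are pieces. Only these need further items nearby, since
  -- lone units are items anyway.
  pure : Fin n → Bool
  pure h = heads h ∧ not (some (λ s → lone s ∧ A h s))

  ball : Fin n → Fin n → Bool
  ball h j = j == h ∨ A h j

  private
   module Pk = Packing ball pure
   packed = Pk.pack (allFin n)
  open Pk.Packed packed using (D; D⊂P; disjoint; hit)

  I : Fin n → Bool
  I i = lone i ∨ D i

  heads-V : ∀ h → heads h ! → V h !
  heads-V h e = true-∧ (cong not (bulk-X h (∧ˡ e))) (∧ʳ {bulk h} e)

  V-heads : ∀ i → V i ! → lone i ! ⊎ heads i !
  V-heads i e = by (bulk i) refl
   where
   by : ∀ b → bulk i ≡ b → lone i ! ⊎ heads i !
   by true q = inj₂ (true-∧ q (∧ʳ {not (X i)} e))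
   by false q = inj₁ (true-∧ e (cong not q))

  I⊂V : ∀ i → I i ! → V i !
  I⊂V i e with ∨-true {lone i} e
  ... | inj₁ p = ∧ˡ p
  ... | inj₂ p = heads-V i (∧ˡ (D⊂P i p))

  Y-single : ∀ y → Y y ! → bulk y ≡ false
  Y-single y e = ¬true λ b → contra e (bulk-Y y b)

  Y⊂I : ∀ y → Y y ! → I y !
  Y⊂I y e = true-∨ˡ (D y) (true-∧ (subst (λ w → V w !) (ident-single y (Y-single y e)) (V-ident y (Y-clear y e))) (cong not (Y-single y e)))

  reach : Fin n → Fin n → Bool
  reach = reach₂ A A-sym V I Y A⊂V I⊂V Y⊂I

  reach-0 : ∀ i → reach i i !
  reach-0 i = true-∨ˡ _ ==-refl

  reach-1 : ∀ i d → A i d ! → reach i d !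
  reach-1 i d a = true-∨ʳ (i == d) (true-∨ˡ _ a)

  reach-2 : ∀ i k d → A i k ! → A k d ! → reach i d !
  reach-2 i k d a b = true-∨ʳ (i == d) (true-∨ʳ (A i d) (some-intro (λ k → A i k ∧ A k d) k (true-∧ a b)))

  -- A lone unit is an item, a piece that is not pure is adjacent to one, and the ball of a pure
  -- piece meets a packed ball.
  dom : ∀ i → V i ! → ∃[ d ] I d ! × reach i d !
  dom i vi = by (V-heads i vi)
   where
   by : lone i ! ⊎ heads i ! → ∃[ d ] I d ! × reach i d !
   by (inj₁ s) = i , true-∨ˡ (D i) s , reach-0 i
   by (inj₂ h) = by₂ (some (λ s → lone s ∧ A i s)) refl
    where
    by₂ : ∀ b → some (λ s → lone s ∧ A i s) ≡ b → ∃[ d ] I d ! × reach i d !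
    by₂ true e with some-elim (λ s → lone s ∧ A i s) e
    ... | s , p = s , true-∨ˡ (D s) (∧ˡ p) , reach-1 i s (∧ʳ {lone s} p)
    by₂ false e = from (hit i (elem-allFin i) (true-∧ h (cong not e)) (i , true-∨ˡ _ ==-refl))
     where
     from : (∃₂ λ d x → D d ! × ball i x ! × ball d x !) → ∃[ d ] I d ! × reach i d !
     from (d , x , dd , bi , bd) = d , true-∨ʳ (lone d) dd , path (∨-true {x == i} bi) (∨-true {x == d} bd)
      where
      path : x == i ! ⊎ A i x ! → x == d ! ⊎ A d x ! → reach i d !
      path (inj₁ p) (inj₁ q) = subst₂ (λ a b → reach a b !) (==-true p) (==-true q) (reach-0 x)
      path (inj₁ p) (inj₂ q) = reach-1 i d (A-sym (subst (λ z → A d z !) (==-true p) q))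
      path (inj₂ p) (inj₁ q) = reach-1 i d (subst (λ z → A i z !) (==-true q) p)
      path (inj₂ p) (inj₂ q) = reach-2 i x d p (A-sym q)

  conn : ∀ i → V i ! → ∃[ y ] Y y ! × Star (λ i j → A i j !) i y
  conn i vi = from (sink-walk i xi)
   where
   xi = not-true (∧ˡ vi)
   lift : ∀ {v y} → X v ≡ false → Star (Within (λ w → not (X w))) v y → Star (λ i j → A i j !) (ident v) (ident y)
   lift x ε = ε
   lift {v} x (_◅_ {j = w} (vw , xw) s) = A-intro v w vw x (not-true xw) ◅ lift (not-true xw) s
   from : (∃[ y ] Y y ! × Star (Within (λ w → not (X w))) i y) → ∃[ y ] Y y ! × Star (λ i j → A i j !) i y
   from (y , yy , s) = y , yy , subst₂ (Star (λ i j → A i j !)) (==-true (∧ʳ {not (X i)} vi)) (ident-single y (Y-single y yy)) (lift xi s)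

  opaque
   T : Fin n → Bool
   T = Rooted-set.T (proj₁ (connected-items A A-sym V I Y A⊂V I⊂V Y⊂I dom conn))

   T-rooted : ∀ i → T i ! → RootedIn A A-sym V I Y A⊂V I⊂V Y⊂I T i
   T-rooted = Rooted-set.rooted (proj₁ (connected-items A A-sym V I Y A⊂V I⊂V Y⊂I dom conn))

   I⊂T : ∀ i → I i ! → T i !
   I⊂T = proj₁ (proj₂ (connected-items A A-sym V I Y A⊂V I⊂V Y⊂I dom conn))

   T-size : ∣ T ∣ ≤ 5 * ∣ I ∣
   T-size = proj₂ (proj₂ (connected-items A A-sym V I Y A⊂V I⊂V Y⊂I dom conn))

  -- The vertices of the units in `T`. They come after all paths, and the greedy colouring ends at
  -- the sinks among them.
  late : Fin n → Bool
  late v = not (X v) ∧ T (ident v)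

  -- Inside a unit one can walk along its path, and between units along the edges of the unit graph.
  late-walk : ∀ v → late v ! → ∃[ y ] Y y ! × Star (Within late) v y
  late-walk v e = from (T-rooted (ident v) (∧ʳ {not (X v)} e))
   where
   inside : ∀ u w → late u ! → X w ≡ false → ident u ≡ ident w → Star (Within late) u w
   inside u w lu xw q = by (bulk w) refl
    where
    by : ∀ b → bulk w ≡ b → Star (Within late) u w
    by true bw = connected G cG late (pl w) (piece-linked w) (λ x xm → true-∧ (cong not (bulk-X x (trans (bulk-piece w x xm) bw)))
       (subst (λ i → T i !) (trans q (sym (ident-same w x bw xm))) (∧ʳ {not (X u)} lu))) u w (proj₂ (same-ident u w bw q)) (piece-self w)
    by false bw = subst (Star (Within late) u) (trans (sym (ident-single u (trans (sym (bulk-ident u)) (trans (cong bulk q) (trans (bulk-ident w) bw))))) (trans q (ident-single w bw))) ε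
   go : ∀ {i y} v → late v ! → ident v ≡ i → X y ≡ false → ident y ≡ y → Star (λ i j → A i j ! × T j !) i y → Star (Within late) v y
   go v lv q xy iy ε = inside v _ lv xy (trans q (sym iy))
   go {y = y} v lv q xy iy (_◅_ {i = i} {j = j} (a , tj) s) = next (A-elim i j a)
    where
    next : (∃₂ λ u w → G u w ! × X u ≡ false × X w ≡ false × ident u ≡ i × ident w ≡ j) → Star (Within late) v y
    next (u , w , uw , xu , xw , qu , qw) = inside v u lv xu (trans q (sym qu)) ◅◅ (uw , lw) ◅ go w lw qw xy iy s
     where
     lw : late w !
     lw = true-∧ (cong not xw) (subst (λ k → T k !) (sym qw) tj)
   from : RootedIn A A-sym V I Y A⊂V I⊂V Y⊂I T (ident v) → ∃[ y ] Y y ! × Star (Within late) v y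
   from (y , yy , s) = y , yy , go v e refl (Y-clear y yy) (ident-single y (Y-single y yy)) s

  Y-late : ∀ y → Y y ! → late y !
  Y-late y yy = true-∧ (cong not (Y-clear y yy)) (subst (λ i → T i !) (sym (ident-single y (Y-single y yy))) (I⊂T y (Y⊂I y yy)))

  act : Fin n → Bool
  act v = bulk v ∧ not (T (ident v))

  act-or-late : ∀ v → X v ≡ false → act v ≡ false → late v !
  act-or-late v x a = true-∧ (cong not x) (by (bulk v) (T (ident v)) refl refl)
   where
   by : ∀ b t → bulk v ≡ b → T (ident v) ≡ t → T (ident v) !
   by _ true _ e = e
   by true false p q = contra (true-∧ p (cong not q)) a
   by false false p q = subst (λ i → T i !) (sym (ident-single v p)) (I⊂T v (true-∨ˡ (D v) (true-∧ (subst (λ w → V w !) (ident-single v p) (V-ident v x)) (cong not p))))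

  opaque
   col : Fin n → ℕ
   col = proj₁ (greedy-colouring A A-sym (3 * L) A-degree)
   col<C : ∀ i → col i < C
   col<C = proj₁ (proj₂ (greedy-colouring A A-sym (3 * L) A-degree))
   col-proper : ∀ i j → A i j ! → i ≢ j → col i ≢ col j
   col-proper = proj₂ (proj₂ (greedy-colouring A A-sym (3 * L) A-degree))

  adjT : Fin n → Bool
  adjT i = some (λ t → T t ∧ A i t)

  -- Units that are not adjacent to `T` precede those that are. Within each class a proper colouring
  -- separates adjacent units, which keeps the number of ranks bounded.
  base : Fin n → ℕ
  base i = ⟦ adjT i ⟧ * C + col i

  base<2C : ∀ i → base i < C + C
  base<2C i = ≤-trans (≤-reflexive (sym (+-suc (⟦ adjT i ⟧ * C) (col i)))) (+-mono-≤ (≤-trans (*-monoˡ-≤ C (⟦⟧≤1 (adjT i))) (≤-reflexive (*-identityˡ C))) (col<C i))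

  exit : Fin n → Fin n → Fin n → Bool
  exit i u z = G u z ∧ not (ident z == i) ∧ (T (ident z) ∨ not (adjT i) ∧ adjT (ident z))

  leaving : Fin n → Fin n → Bool
  leaving i u = elemᵇ u (pl i) ∧ some (exit i u)

  foot : Fin n → Fin n
  foot i = find (leaving i) i

  -- Every unit is within distance 2 of `T`, so it has an edge to `T` or to a unit adjacent to `T`.
  -- If it is not adjacent to `T` itself, the latter unit has the larger `base`.
  has-exit : ∀ i → heads i ! → T i ≡ false → ∃[ u ] leaving i u !
  has-exit i hi ti = from (dom i (heads-V i hi))
   where
   bi = ∧ˡ {bulk i} hi
   ii : ident i ≡ i
   ii = ==-true (∧ʳ {bulk i} hi)
   make : ∀ k → A i k ! → k ≢ i → T k ∨ not (adjT i) ∧ adjT k ! → ∃[ u ] leaving i u !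
   make k a ne good with A-elim i k a
   ... | u , w , uw , xu , xw , qu , refl = u , true-∧ (proj₂ (same-ident u i bi (trans qu (sym ii)))) (some-intro (exit i u) w (true-∧ uw (true-∧ (cong not (≢-== ne)) good)))
   to-T : ∀ t → T t ! → A i t ! → ∃[ u ] leaving i u !
   to-T t tt a = make t a (λ { refl → contra tt ti }) (true-∨ˡ _ tt)
   from : (∃[ d ] I d ! × reach i d !) → ∃[ u ] leaving i u !
   from (d , id , r) = by (∨-true {i == d} r)
    where
    td = I⊂T d id
    by : i == d ! ⊎ A i d ∨ some (λ k → A i k ∧ A k d) ! → ∃[ u ] leaving i u !
    by (inj₁ p) = contra td (subst (λ j → T j ≡ false) (==-true p) ti)
    by (inj₂ p) with ∨-true {A i d} p
    ... | inj₁ a = to-T d td a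
    ... | inj₂ q with some-elim (λ k → A i k ∧ A k d) q
    ... | k , kk = by₂ (adjT i) refl
     where
     ik = ∧ˡ {A i k} kk
     ak : adjT k !
     ak = some-intro (λ t → T t ∧ A k t) d (true-∧ td (∧ʳ {A i k} kk))
     by₂ : ∀ b → adjT i ≡ b → ∃[ u ] leaving i u !
     by₂ true e with some-elim (λ t → T t ∧ A i t) e
     ... | t , q = to-T t (∧ˡ q) (∧ʳ {T t} q)
     by₂ false e = make k ik (λ { refl → contra ak e }) (true-∨ʳ (T k) (true-∧ (cong not e) ak))

  -- The piece is cut after its foot. The front arm ends at the foot, from which an edge leads to
  -- something later; the back arm is reversed, so that it ends beside the foot.
  front-list back-list : Fin n → List (Fin n)
  front-list i = before (foot i) (pl i) ++ foot i ∷ []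
  back-list i = after (foot i) (pl i)

  side : Fin n → Fin n → Bool
  side i v = elemᵇ v (back-list i)

  front back : Fin n → Arm n
  front i = frontArm i (front-list i)
  back i = backArm i (back-list i)

  arm : Fin n → Arm n
  arm v = if side (ident v) v then back (ident v) else front (ident v)

  -- The back arm goes first, so that the foot is still uncoloured when the last vertex of the back
  -- arm is reached.
  rk : Fin n → ℕ
  rk v = base (ident v) * 2 + ⟦ not (side (ident v) v) ⟧

  rk-intro : ∀ v i b → ident v ≡ i → side i v ≡ b → rk v ≡ base i * 2 + ⟦ not b ⟧
  rk-intro v i b refl refl = refl

  arm-true : ∀ v i → ident v ≡ i → side i v ! → arm v ≡ back i
  arm-true v i refl e = cong (λ b → if b then back i else front i) e

  arm-false : ∀ v i → ident v ≡ i → side i v ≡ false → arm v ≡ front i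
  arm-false v i refl e = cong (λ b → if b then back i else front i) e

  module Unit (i : Fin n) (hi : heads i !) (ti : T i ≡ false) where
   bi = ∧ˡ {bulk i} hi
   ii : ident i ≡ i
   ii = ==-true (∧ʳ {bulk i} hi)
   f : Fin n
   f = foot i

   f-leaves : leaving i f !
   f-leaves = find-true (leaving i) i (proj₁ (has-exit i hi ti)) (proj₂ (has-exit i hi ti))
   f∈ : f ∈ pl i
   f∈ = ∧ˡ f-leaves

   cut : front-list i ++ back-list i ≡ pl i
   cut = trans (++-assoc (before f (pl i)) (f ∷ []) (back-list i)) (cut-list f (pl i) f∈)

   member : ∀ v → v ∈ pl i → ident v ≡ i
   member v e = trans (ident-same i v bi e) ii

   member-act : ∀ v → v ∈ pl i → act v !
   member-act v e = true-∧ (trans (bulk-piece i v e) bi) (cong not (subst (λ j → T j ≡ false) (sym (member v e)) ti))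

   occ-cut : ∀ v → occ v (front-list i) + occ v (back-list i) ≡ occ v (pl i)
   occ-cut v = trans (sym (∑-++ (front-list i) (back-list i) (λ u → ⟦ v == u ⟧))) (cong (occ v) cut)

   distinct-front : distinctᵇ (front-list i) !
   distinct-front = occ-distinct (front-list i) λ v → ≤-trans (m≤m+n _ (occ v (back-list i))) (≤-trans (≤-reflexive (occ-cut v)) (distinct-occ (pl i) (piece-distinct i) v))

   occ-back≤1 : ∀ v → occ v (back-list i) ≤ 1
   occ-back≤1 v = ≤-trans (m≤n+m _ (occ v (front-list i))) (≤-trans (≤-reflexive (occ-cut v)) (distinct-occ (pl i) (piece-distinct i) v))

   front-side : ∀ v → v ∈ front-list i → side i v ≡ false
   front-side v e = ¬true λ s → 1+n≰n (≤-trans (+-mono-≤ (∈-occ v (front-list i) e) (∈-occ v (back-list i) s)) (≤-trans (≤-reflexive (occ-cut v)) (distinct-occ (pl i) (piece-distinct i) v)))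

   front⊂ : ∀ v → v ∈ front-list i → v ∈ pl i
   front⊂ v e = subst (v ∈_) cut (elem-++ˡ v (front-list i) (back-list i) e)
   back⊂ : ∀ v → v ∈ back-list i → v ∈ pl i
   back⊂ v e = subst (v ∈_) cut (elem-++ʳ v (front-list i) (back-list i) e)

   linked-cut : Linked G (front-list i ++ back-list i)
   linked-cut = subst (Linked G) (sym cut) (piece-linked i)

   length-cut : length (front-list i) + length (back-list i) ≤ L
   length-cut = ≤-trans (≤-reflexive (trans (sym (length-++ (front-list i))) (cong length cut))) (piece-short i)

   keys-f : keys (front i) ≡ front-list i
   keys-f = keys-front i (before f (pl i)) f

   f-front : f ∈ front-list i
   f-front = elem-++ʳ f (before f (pl i)) (f ∷ []) (elem-here f [])

   record Arm-facts (b : Bool) (A : Arm n) : Set where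
    field
     members : ∀ v → v ∈ keys A → v ∈ pl i × side i v ≡ b
     members′ : ∀ v → v ∈ pl i → side i v ≡ b → v ∈ keys A
     lnk : Linked G (keys A)
     dst : distinctᵇ (keys A) !
     len : length (keys A) ≤ L
     next : ∃[ w ] G (lastA A) w ! × (act w ! → base i * 2 + ⟦ not b ⟧ < rk w)

   front-facts : Arm-facts false (front i)
   front-facts = record
    { members = λ v e → front⊂ v (subst (v ∈_) keys-f e) , front-side v (subst (v ∈_) keys-f e)
    ; members′ = λ v e s → subst (v ∈_) (sym keys-f) (in-front v s (elem-split v (front-list i) (back-list i) (subst (v ∈_) (sym cut) e)))
    ; lnk = subst (Linked G) (sym keys-f) (linked-++ˡ G (front-list i) (back-list i) linked-cut)
    ; dst = trans (cong distinctᵇ keys-f) distinct-front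
    ; len = ≤-trans (≤-reflexive (cong length keys-f)) (≤-trans (m≤m+n _ _) length-cut)
    ; next = go (some-elim (exit i f) (∧ʳ {elemᵇ f (pl i)} f-leaves)) }
    where
    in-front : ∀ v → side i v ≡ false → v ∈ front-list i ⊎ v ∈ back-list i → v ∈ front-list i
    in-front v s (inj₁ e) = e
    in-front v s (inj₂ e) = contra e s
    go : (∃[ z ] exit i f z !) → ∃[ w ] G (lastA (front i)) w ! × (act w ! → base i * 2 + 1 < rk w)
    go (z , e) = z , subst (λ ℓ → G ℓ z !) (sym (last-front i (before f (pl i)) f)) (∧ˡ {G f z} e) , later (∨-true {T (ident z)} (∧ʳ {not (ident z == i)} (∧ʳ {G f z} e)))
     where
     later : T (ident z) ! ⊎ not (adjT i) ∧ adjT (ident z) ! → act z ! → base i * 2 + 1 < rk z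
     later (inj₁ t) az = contra t (not-true (∧ʳ {bulk z} az))
     later (inj₂ p) _ = begin
      suc (base i * 2 + 1) ≡⟨ trans (cong suc (+-comm (base i * 2) 1)) refl ⟩
      suc (base i) * 2 ≤⟨ *-monoˡ-≤ 2 low ⟩
      C * 2 ≤⟨ *-monoˡ-≤ 2 high ⟩
      base (ident z) * 2 ≤⟨ m≤m+n _ _ ⟩
      rk z ∎
      where
      low : suc (base i) ≤ C
      low = subst (λ b → suc (⟦ b ⟧ * C + col i) ≤ C) (sym (not-true {adjT i} (∧ˡ {not (adjT i)} p))) (col<C i)
      high : C ≤ base (ident z)
      high = subst (λ b → C ≤ ⟦ b ⟧ * C + col (ident z)) (sym (∧ʳ {not (adjT i)} p)) (≤-trans (≤-reflexive (sym (*-identityˡ C))) (m≤m+n _ _))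

   back-facts : ∀ v → v ∈ back-list i → Arm-facts true (back i)
   back-facts v e = by (back-list i) refl e
    where
    by : ∀ l → back-list i ≡ l → v ∈ l → Arm-facts true (back i)
    by (y ∷ t) eq _ = subst (λ l → Arm-facts true (backArm i l)) (sym eq) record
     { members = λ w m → back⊂ w (to-back w m) , to-back w m
     ; members′ = λ w _ s → subst (w ∈_) (sym (keys-back i y t)) (∈-backwards y t w (subst (w ∈_) eq s))
     ; lnk = subst (Linked G) (sym (keys-back i y t)) (backwards-linked G syms y t (subst (Linked G) eq (linked-++ʳ G (front-list i) (back-list i) linked-cut)))
     ; dst = trans (cong distinctᵇ (keys-back i y t)) (occ-distinct (full (backwards y t)) λ w → ≤-trans (≤-reflexive (trans (backwards-occ y t w) (cong (occ w) (sym eq)))) (occ-back≤1 w))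
     ; len = ≤-trans (≤-reflexive (trans (cong length (keys-back i y t)) (trans (backwards-length y t) (cong length (sym eq))))) (≤-trans (m≤n+m _ (length (front-list i))) length-cut)
     ; next = f , subst (λ ℓ → G ℓ f !) (sym (last-back i y t)) (syms fy) , λ _ → ≤-trans (≤-reflexive (sym (+-suc (base i * 2) 0))) (≤-reflexive (sym (rk-intro f i false (member f f∈) (front-side f f-front)))) }
     where
     to-back : ∀ w → w ∈ keys (backArm i (y ∷ t)) → w ∈ back-list i
     to-back w m = subst (w ∈_) (sym eq) (backwards-∈ y t w (subst (w ∈_) (keys-back i y t) m))
     fy : G f y !
     fy = proj₁ (linked-++ʳ G (before f (pl i)) (f ∷ y ∷ t) (subst (Linked G) (trans (++-assoc (before f (pl i)) (f ∷ []) (back-list i)) (cong (λ l → before f (pl i) ++ f ∷ l) eq)) linked-cut))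

   arm-facts : ∀ v → v ∈ pl i → Arm-facts (side i v) (arm v)
   arm-facts v e = by (side i v) refl
    where
    by : ∀ b → side i v ≡ b → Arm-facts (side i v) (arm v)
    by true s = subst₂ Arm-facts (sym s) (sym (arm-true v i (member v e) s)) (back-facts v s)
    by false s = subst₂ Arm-facts (sym s) (sym (arm-false v i (member v e) s)) front-facts

  act-facts : ∀ v → act v ! → heads (ident v) ! × T (ident v) ≡ false × v ∈ pl (ident v)
  act-facts v a = true-∧ (trans (bulk-ident v) bv) (subst (λ w → w == ident v !) (sym (ident-ident v)) ==-refl) , not-true (∧ʳ {bulk v} a) , pl-sym v (ident v) (ident-pl v bv)
   where bv = ∧ˡ {bulk v} a

  module At (v : Fin n) (av : act v !) where
   i = ident v
   open Unit i (proj₁ (act-facts v av)) (proj₁ (proj₂ (act-facts v av))) public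
   v∈ : v ∈ pl i
   v∈ = proj₂ (proj₂ (act-facts v av))
   open Arm-facts (arm-facts v v∈) public

   key-side : ∀ w → w ∈ keys (arm v) → side i w ≡ side i v
   key-side w e = proj₂ (members w e)

   key-ident : ∀ w → w ∈ keys (arm v) → ident w ≡ i
   key-ident w e = member w (proj₁ (members w e))

  layout : Layout G K L g
  layout = record
   { act = act ; arm = arm ; rk = rk
   ; self = λ v a → At.members′ v a v (At.v∈ v a) refl
   ; key-act = λ v w a e → At.member-act v a w (proj₁ (At.members v a w e))
   ; key-arm = λ v w a e → cong₂ (λ b i → if b then back i else front i) (trans (cong (λ i → side i w) (At.key-ident v a w e)) (At.key-side v a w e)) (At.key-ident v a w e)
   ; key-rk = λ v w a e → rk-intro w (ident v) (side (ident v) v) (At.key-ident v a w e) (At.key-side v a w e)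
   ; linked = At.lnk ; dist = At.dst ; short = At.len
   ; rk<K = λ v a → ≤-trans (≤-trans (≤-reflexive (sym (+-suc (base (ident v) * 2) _))) (≤-trans (+-monoʳ-≤ (base (ident v) * 2) (s≤s (⟦⟧≤1 (not (side (ident v) v))))) (≤-reflexive (+-comm _ 2)))) (*-monoˡ-≤ 2 (base<2C (ident v)))
   ; same = same-rank
   ; onward = At.next
   ; acyclic = λ v a → bulk-acyclic v (∧ˡ {bulk v} a)
   ; g-large = g-large }
   where
   -- Equal ranks have equal `base`, hence equal colours, so adjacent vertices belong to one unit.
   -- The last binary digit then tells the arm.
   same-rank : ∀ v w → act v ! → act w ! → G v w ! → rk v ≡ rk w → w ∈ keys (arm v)
   same-rank v w av aw vw e = by (ident w ≟ᶠ ident v)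
    where
    bit : ∀ b → ⟦ b ⟧ < 2
    bit b = s≤s (⟦⟧≤1 b)
    split = mixed-radix 2 (base (ident v)) (base (ident w)) ⟦ not (side (ident v) v) ⟧ ⟦ not (side (ident w) w) ⟧ (bit (not (side (ident v) v))) (bit (not (side (ident w) w))) e
    cols : col (ident v) ≡ col (ident w)
    cols = proj₂ (mixed-radix C ⟦ adjT (ident v) ⟧ ⟦ adjT (ident w) ⟧ (col (ident v)) (col (ident w)) (col<C (ident v)) (col<C (ident w)) (proj₁ split))
    not-bit : ∀ a b → ⟦ not a ⟧ ≡ ⟦ not b ⟧ → b ≡ a
    not-bit true true _ = refl
    not-bit false false _ = refl
    by : Dec (ident w ≡ ident v) → w ∈ keys (arm v)
    by (no ne) = ⊥-elim (col-proper (ident v) (ident w) (A-intro v w vw (bulk-X v (∧ˡ {bulk v} av)) (bulk-X w (∧ˡ {bulk w} aw))) (ne ∘ sym) cols)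
    by (yes q) = At.members′ v av w (subst (λ i → w ∈ pl i) q (At.v∈ w aw)) (trans (cong (λ i → side i w) (sym q)) (not-bit (side (ident v) v) (side (ident w) w) (proj₂ split)))

  ending : Fin n → Bool
  ending v = act v ∧ not (elemᵇ v (inner (arm v)))

  exceptional : Fin n → Bool
  exceptional v = not (act v ∧ elemᵇ v (inner (arm v)))

  exceptional-size : ∣ exceptional ∣ ≤ ∣ X ∣ + (∣ late ∣ + ∣ ending ∣)
  exceptional-size = ≤-trans (∣∣-mono {Q = λ v → X v ∨ (late v ∨ ending v)} λ v e → by v (X v) (act v) refl refl e)
    (≤-trans (∣∣-∨ X (λ v → late v ∨ ending v)) (+-monoʳ-≤ ∣ X ∣ (∣∣-∨ late ending)))
   where
   by : ∀ v x a → X v ≡ x → act v ≡ a → exceptional v ! → X v ∨ (late v ∨ ending v) !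
   by v true _ p _ e = true-∨ˡ _ p
   by v false false p q e = true-∨ʳ (X v) (true-∨ˡ _ (act-or-late v p q))
   by v false true p q e = true-∨ʳ (X v) (true-∨ʳ (late v) (true-∧ q (cong not (¬true λ i → contra (true-∧ q i) (not-true e)))))

  late-size : ∣ late ∣ ≤ L * ∣ T ∣
  late-size = double-count (allFin n) (allFin n) late T (λ v i → unit i v) L
   (λ v e → ∣∣-pos (λ i → T i ∧ unit i v) (ident v) (true-∧ (∧ʳ {not (X v)} e) (true-∧ (∧ˡ e) ==-refl))) (λ i _ → unit-size i)

  -- A piece has two arms with two ends each.
  ending-size : ∣ ending ∣ ≤ 4 * ∣ heads ∣
  ending-size = double-count (allFin n) (allFin n) ending heads (λ v i → ending v ∧ ident v == i) 4
    (λ v e → ∣∣-pos (λ i → heads i ∧ (ending v ∧ ident v == i)) (ident v) (true-∧ (proj₁ (act-facts v (∧ˡ e))) (true-∧ e ==-refl)))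
    (λ i _ → ≤-trans (∣∣-mono {Q = λ v → elemᵇ v (four i)} λ v e → in-four v i (∧ˡ e) (==-true (∧ʳ {ending v} e))) (∣elem∣≤ (four i)))
   where
   four : Fin n → List (Fin n)
   four i = headA (front i) ∷ lastA (front i) ∷ headA (back i) ∷ lastA (back i) ∷ []
   four₁ : ∀ i v → v ≡ headA (front i) → v ∈ four i
   four₁ i v e = true-∨ˡ _ (subst (λ w → v == w !) e ==-refl)
   four₂ : ∀ i v → v ≡ lastA (front i) → v ∈ four i
   four₂ i v e = true-∨ʳ (v == headA (front i)) (true-∨ˡ _ (subst (λ w → v == w !) e ==-refl))
   four₃ : ∀ i v → v ≡ headA (back i) → v ∈ four i
   four₃ i v e = true-∨ʳ (v == headA (front i)) (true-∨ʳ (v == lastA (front i)) (true-∨ˡ _ (subst (λ w → v == w !) e ==-refl)))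
   four₄ : ∀ i v → v ≡ lastA (back i) → v ∈ four i
   four₄ i v e = true-∨ʳ (v == headA (front i)) (true-∨ʳ (v == lastA (front i)) (true-∨ʳ (v == headA (back i)) (true-∨ˡ _ (subst (λ w → v == w !) e ==-refl))))
   in-four : ∀ v i → ending v ! → ident v ≡ i → v ∈ four i
   in-four v i e q = by (side i v) refl
    where
    a = ∧ˡ {act v} e
    pick : v ∈ inner (arm v) ⊎ v ≡ headA (arm v) ⊎ v ≡ lastA (arm v) → v ≡ headA (arm v) ⊎ v ≡ lastA (arm v)
    pick (inj₁ m) = contra m (not-true (∧ʳ {act v} e))
    pick (inj₂ r) = r
    by : ∀ b → side i v ≡ b → v ∈ four i
    by true s = go (pick (key-cases (arm v) v (Layout.self layout v a)))
     where
     eq = arm-true v i q s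
     go : v ≡ headA (arm v) ⊎ v ≡ lastA (arm v) → v ∈ four i
     go (inj₁ r) = four₃ i v (trans r (cong headA eq))
     go (inj₂ r) = four₄ i v (trans r (cong lastA eq))
    by false s = go (pick (key-cases (arm v) v (Layout.self layout v a)))
     where
     eq = arm-false v i q s
     go : v ≡ headA (arm v) ⊎ v ≡ lastA (arm v) → v ∈ four i
     go (inj₁ r) = four₁ i v (trans r (cong headA eq))
     go (inj₂ r) = four₂ i v (trans r (cong lastA eq))

  ident-heads : ∀ i x → heads i ! → x ∈ pl i → ident x ≡ i
  ident-heads i x h e = trans (ident-same i x (∧ˡ h) e) (==-true (∧ʳ {bulk i} h))

  heads-size : L * ∣ heads ∣ ≤ n
  heads-size = ≤-trans (disjoint-count heads (λ i x → elemᵇ x (pl i)) (λ _ → true) L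
   (λ i h → ≤-trans (≤-reflexive (sym (bulk-length i (∧ˡ h)))) (∣elem∣-distinct (pl i) (piece-distinct i))) (λ _ _ _ _ → refl)
   (λ i j x hi hj xi xj → trans (sym (ident-heads i x hi xi)) (ident-heads j x hj xj))) (∣∣≤n _)

  -- A lone vertex lies in an incomplete piece or shares its piece with a dangerous vertex, and a
  -- dangerous vertex spoils at most L vertices.
  lone-size : ∣ lone ∣ ≤ ∣ incomplete ∣ + L * ∣ danger ∣
  lone-size = ≤-trans (∣∣-mono {Q = λ i → incomplete i ∨ hitᵇ i} λ i e → by i (length (pl i) ≡ᵇ L) (hitᵇ i) refl refl (not-true (∧ʳ {V i} e)))
    (≤-trans (∣∣-∨ incomplete hitᵇ) (+-monoʳ-≤ ∣ incomplete ∣ (double-count (allFin n) (allFin n) hitᵇ danger (λ i w → elemᵇ w (pl i)) L (λ i e → ≤ᵇ-true (swapped i e))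
     (λ w _ → ≤-trans (∣∣-mono {P = λ i → elemᵇ w (pl i)} {Q = λ i → elemᵇ i (pl w)} λ i e → pl-sym i w e) (≤-trans (∣elem∣≤ (pl w)) (piece-short w))))))
   where
   hitᵇ : Fin n → Bool
   hitᵇ i = some (λ w → elemᵇ w (pl i) ∧ danger w)
   swapped : ∀ i → hitᵇ i ! → some (λ w → danger w ∧ elemᵇ w (pl i)) !
   swapped i e with some-elim (λ w → elemᵇ w (pl i) ∧ danger w) e
   ... | w , q = some-intro (λ w → danger w ∧ elemᵇ w (pl i)) w (true-∧ (∧ʳ {elemᵇ w (pl i)} q) (∧ˡ q))
   by : ∀ i a b → (length (pl i) ≡ᵇ L) ≡ a → hitᵇ i ≡ b → bulk i ≡ false → incomplete i ∨ hitᵇ i !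
   by i false _ p q e = true-∨ˡ (hitᵇ i) (cong not p)
   by i true true p q e = true-∨ʳ (incomplete i) q
   by i true false p q e = contra (true-∧ p (cong not q)) e

  danger-size : ∣ danger ∣ ≤ 4 * (∣ (λ v → onShortCycle G g v) ∣ + ∣ X ∣) + ∣ Y ∣
  danger-size = ≤-trans (∣∣-∨ (near 1 (λ u → onShortCycle G g u ∨ X u)) Y) (+-monoˡ-≤ ∣ Y ∣
   (≤-trans (near-count 1 (λ u → onShortCycle G g u ∨ X u)) (*-monoʳ-≤ 4 (∣∣-∨ (λ v → onShortCycle G g v) X))))

  two-lengths : (L + L) + suc (L + L) ≤ g
  two-lengths = ≤-trans (+-monoʳ-≤ (L + L) (s≤s (≤-trans (n≤1+n _) (≤-trans (m≤m+n (suc (L + L)) _) (m≤m+n (K * suc (L + L)) (K * suc (L + L))))))) g-large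

  piece-chordless : ∀ h v w → bulk h ! → v ∈ pl h → w ∈ pl h → G v w ! → consec (pl h) v w ! ⊎ consec (pl h) w v !
  piece-chordless h v w bh vh wh vw = decide (consec (pl h) v w) (consec (pl h) w v) refl refl
   where
   decide : ∀ a b → consec (pl h) v w ≡ a → consec (pl h) w v ≡ b → consec (pl h) v w ! ⊎ consec (pl h) w v !
   decide true _ p _ = inj₁ p
   decide false true _ q = inj₂ q
   decide false false p q = ⊥-elim (cyc (walk-in-list {E = Avoiding G cG v w} (λ {a} {b} r → syms (proj₁ r) , trans (sym (isPair-sym v w a b)) (proj₂ r)) (pl h)
     (λ a b r → consec-adjacent G (pl h) (piece-linked h) a b r , ¬true (un a b r ∘ isPair-true)) v w vh wh))
    where
    un : ∀ a b → consec (pl h) a b ! → (a ≡ v × b ≡ w) ⊎ (a ≡ w × b ≡ v) → ⊥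
    un a b r (inj₁ (refl , refl)) = contra r p
    un a b r (inj₂ (refl , refl)) = contra r q
    cyc : (∃[ k ] k ≤ length (pl h) + length (pl h) × Walk (Avoiding G cG v w) k v w) → ⊥
    cyc (k , le , r) = contra (short-cycle G cG vw r (≤-trans le (≤-trans (+-mono-≤ (piece-short h) (piece-short h)) (≤-trans (m≤m+n (L + L) _) two-lengths))))
     (bulk-acyclic v (trans (bulk-piece h v vh) bh))

  -- Neighbours on the same piece are consecutive to v, and at most two vertices are.
  leaves-piece : ∀ h v → bulk h ! → v ∈ pl h → ∃[ x ] G v x ! × elemᵇ x (pl h) ≡ false
  leaves-piece h v bh vh = by (elemᵇ N.a (pl h)) (elemᵇ N.b (pl h)) (elemᵇ N.c (pl h)) refl refl refl
   where
   module N = Nbrs (nbrs cG v)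
   by : ∀ a b c → elemᵇ N.a (pl h) ≡ a → elemᵇ N.b (pl h) ≡ b → elemᵇ N.c (pl h) ≡ c → ∃[ x ] G v x ! × elemᵇ x (pl h) ≡ false
   by false _ _ p _ _ = N.a , N.va , p
   by true false _ _ p _ = N.b , N.vb , p
   by true true false _ _ p = N.c , N.vc , p
   by true true true p q r = ⊥-elim (pigeon (piece-chordless h v N.a bh vh p N.va) (piece-chordless h v N.b bh vh q N.vb) (piece-chordless h v N.c bh vh r N.vc))
    where
    rt : ∀ {x y} → consec (pl h) v x ! → consec (pl h) v y ! → x ≡ y
    rt {x} {y} = consec-right-unique (pl h) {x} {y} {v} (piece-distinct h)
    lt : ∀ {x y} → consec (pl h) x v ! → consec (pl h) y v ! → x ≡ y
    lt {x} {y} = consec-left-unique (pl h) {x} {y} {v} (piece-distinct h)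
    pigeon : consec (pl h) v N.a ! ⊎ consec (pl h) N.a v ! → consec (pl h) v N.b ! ⊎ consec (pl h) N.b v ! →
     consec (pl h) v N.c ! ⊎ consec (pl h) N.c v ! → ⊥
    pigeon (inj₁ x) (inj₁ y) _ = N.a≢b (rt x y)
    pigeon (inj₂ x) (inj₂ y) _ = N.a≢b (lt x y)
    pigeon (inj₁ x) (inj₂ y) (inj₁ z) = N.a≢c (rt x z)
    pigeon (inj₁ x) (inj₂ y) (inj₂ z) = N.b≢c (lt y z)
    pigeon (inj₂ x) (inj₁ y) (inj₁ z) = N.b≢c (rt y z)
    pigeon (inj₂ x) (inj₁ y) (inj₂ z) = N.a≢c (lt x z)

  -- Two vertices of a piece with neighbours in one other piece would lie on a short cycle.
  separate-pieces : ∀ h v w x x' → bulk h ! → v ∈ pl h → w ∈ pl h → G v x ! → G w x' ! → elemᵇ x (pl h) ≡ false → x' ∈ pl x → v ≡ w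
  separate-pieces h v w x x' bh vh wh vx wx' x∉ x'x with v ≟ᶠ w
  ... | yes e = e
  ... | no ne = ⊥-elim (close (walk-in-list {E = Avoiding G cG v x} symm (pl h) (λ a b r → consec-adjacent G (pl h) (piece-linked h) a b r , ¬true (un₁ a b r ∘ isPair-true)) v w vh wh)
     (walk-in-list {E = Avoiding G cG v x} symm (pl x) (λ a b r → consec-adjacent G (pl x) (piece-linked x) a b r , ¬true (un₂ a b r ∘ isPair-true)) x' x x'x (piece-self x)))
   where
   symm : ∀ {a b} → Avoiding G cG v x a b → Avoiding G cG v x b a
   symm {a} {b} p = syms (proj₁ p) , trans (sym (isPair-sym v x a b)) (proj₂ p)
   v∉ : v ∈ pl x → ⊥
   v∉ e = contra (subst (λ p → x ∈ full p) (piece-same h v vh) (subst (λ p → x ∈ full p) (sym (piece-same x v e)) (piece-self x))) x∉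
   un₁ : ∀ a b → consec (pl h) a b ! → (a ≡ v × b ≡ x) ⊎ (a ≡ x × b ≡ v) → ⊥
   un₁ a b r (inj₁ (_ , refl)) = contra (consec-∈ʳ (pl h) r) x∉
   un₁ a b r (inj₂ (refl , _)) = contra (consec-∈ˡ (pl h) r) x∉
   un₂ : ∀ a b → consec (pl x) a b ! → (a ≡ v × b ≡ x) ⊎ (a ≡ x × b ≡ v) → ⊥
   un₂ a b r (inj₁ (refl , _)) = v∉ (consec-∈ˡ (pl x) r)
   un₂ a b r (inj₂ (_ , refl)) = v∉ (consec-∈ʳ (pl x) r)
   step : Avoiding G cG v x w x'
   step = wx' , ¬true λ e → un₃ (isPair-true e)
    where
    un₃ : (w ≡ v × x' ≡ x) ⊎ (w ≡ x × x' ≡ v) → ⊥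
    un₃ (inj₁ (q , _)) = ne (sym q)
    un₃ (inj₂ (_ , q)) = v∉ (subst (_∈ pl x) q x'x)
   close : (∃[ k ] k ≤ length (pl h) + length (pl h) × Walk (Avoiding G cG v x) k v w) → (∃[ k ] k ≤ length (pl x) + length (pl x) × Walk (Avoiding G cG v x) k x' x) → ⊥
   close (j , lj , p) (k , lk , q) = contra (short-cycle G cG vx (p +++ (step ∷ q)) (≤-trans (+-mono-≤ (≤-trans lj (+-mono-≤ (piece-short h) (piece-short h)))
    (s≤s (≤-trans lk (+-mono-≤ (piece-short x) (piece-short x))))) two-lengths)) (bulk-acyclic v (trans (bulk-piece h v vh) bh))

  D-heads : ∀ d j → D d ! → ball d j ! → heads j !
  D-heads d j dd b = by (∨-true {j == d} b)
   where
   pd = D⊂P d dd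
   by : j == d ! ⊎ A d j ! → heads j !
   by (inj₁ e) = subst (λ k → heads k !) (sym (==-true e)) (∧ˡ pd)
   by (inj₂ a) with V-heads j (A⊂V a)
   ... | inj₁ s = contra (some-intro (λ s → lone s ∧ A d s) j (true-∧ s a)) (not-true (∧ʳ {heads d} pd))
   ... | inj₂ h = h

  -- The L vertices of a pure piece have outer neighbours in different units, because two edges
  -- between the same two pieces would lie on a short cycle. Large disjoint balls make the packing,
  -- and with it `T`, small.
  D-ball : ∀ d → D d ! → L ≤ ∣ ball d ∣
  D-ball d dd = begin
   L ≡⟨ sym (bulk-length d bd) ⟩
   length (pl d) ≤⟨ ∣elem∣-distinct (pl d) (piece-distinct d) ⟩
   ∣ (λ v → elemᵇ v (pl d)) ∣ ≤⟨ double-count (allFin n) (allFin n) (λ v → elemᵇ v (pl d)) (ball d) Q 1 (λ v e → exists v e (leaves-piece d v bd e))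
    (λ j b → ∣∣-unique (λ v → Q v j) λ v w p q → one j b v w (Q-elim v j p) (Q-elim w j q)) ⟩
   1 * ∣ ball d ∣ ≡⟨ *-identityˡ _ ⟩
   ∣ ball d ∣ ∎
   where
   hd′ = ∧ˡ {heads d} (D⊂P d dd)
   bd = ∧ˡ {bulk d} hd′
   Q : Fin n → Fin n → Bool
   Q v j = elemᵇ v (pl d) ∧ some (λ x → G v x ∧ not (elemᵇ x (pl d)) ∧ ident x == j)
   Q-elim : ∀ v j → Q v j ! → v ∈ pl d × ∃[ x ] G v x ! × elemᵇ x (pl d) ≡ false × ident x ≡ j
   Q-elim v j e = ∧ˡ e , from (some-elim (λ x → G v x ∧ not (elemᵇ x (pl d)) ∧ ident x == j) (∧ʳ {elemᵇ v (pl d)} e))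
    where
    from : (∃[ x ] G v x ∧ not (elemᵇ x (pl d)) ∧ ident x == j !) → ∃[ x ] G v x ! × elemᵇ x (pl d) ≡ false × ident x ≡ j
    from (x , q) = x , ∧ˡ q , not-true (∧ˡ (∧ʳ {G v x} q)) , ==-true (∧ʳ {not (elemᵇ x (pl d))} (∧ʳ {G v x} q))
   exists : ∀ v → v ∈ pl d → (∃[ x ] G v x ! × elemᵇ x (pl d) ≡ false) → 1 ≤ ∑ᶠ (λ j → ⟦ ball d j ∧ Q v j ⟧)
   exists v e (x , vx , x∉) = ∣∣-pos (λ j → ball d j ∧ Q v j) (ident x) (true-∧ (true-∨ʳ (ident x == d) (subst (λ i → A i (ident x) !) (ident-heads d v hd′ e)
     (A-intro v x vx (bulk-X v bv) (bulk-nbr v x bv vx)))) (true-∧ e (some-intro (λ y → G v y ∧ not (elemᵇ y (pl d)) ∧ ident y == ident x) x (true-∧ vx (true-∧ (cong not x∉) (==-refl {u = ident x}))))))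
    where bv = trans (bulk-piece d v e) bd
   one : ∀ j → ball d j ! → ∀ v w → (v ∈ pl d × ∃[ x ] G v x ! × elemᵇ x (pl d) ≡ false × ident x ≡ j) →
    (w ∈ pl d × ∃[ x ] G w x ! × elemᵇ x (pl d) ≡ false × ident x ≡ j) → v ≡ w
   one j b v w (vd , x , vx , x∉ , xj) (wd , x' , wx' , _ , xj') = separate-pieces d v w x x' bd vd wd vx wx' x∉
    (proj₂ (same-ident x' x (trans (sym (bulk-ident x)) (trans (cong bulk xj) (∧ˡ (D-heads d j dd b)))) (trans xj' (sym xj))))

  D-size : L * ∣ D ∣ ≤ ∣ heads ∣
  D-size = disjoint-count D ball heads L D-ball (λ d x dd b → D-heads d x dd b) (λ d e x p q r s → disjoint d e x p q r s)

  waste : ℕ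
  waste = ∣ X ∣ + L * (5 * (∣ incomplete ∣ + L * (4 * (∣ (λ v → onShortCycle G g v) ∣ + ∣ X ∣) + ∣ Y ∣)))

  -- 5n comes from the packed pieces, as L · L · ∣D∣ ≤ n and each item brings at most 5 units into
  -- `T`; 4n comes from the ends of arms. Everything else is `waste`.
  exceptional-bound : L * ∣ exceptional ∣ ≤ 9 * n + L * waste
  exceptional-bound = begin
   L * ∣ exceptional ∣ ≤⟨ *-monoʳ-≤ L exceptional-size ⟩
   L * (∣ X ∣ + (∣ late ∣ + ∣ ending ∣)) ≤⟨ *-monoʳ-≤ L (+-monoʳ-≤ ∣ X ∣ (+-mono-≤ (≤-trans late-size (*-monoʳ-≤ L (≤-trans T-size (*-monoʳ-≤ 5 (∣∣-∨ lone D))))) ending-size)) ⟩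
   L * (∣ X ∣ + (L * (5 * (∣ lone ∣ + ∣ D ∣)) + 4 * ∣ heads ∣)) ≡⟨ solve 5 (λ l x s d h → l :* (x :+ (l :* (con 5 :* (s :+ d)) :+ con 4 :* h)) := con 5 :* (l :* (l :* d)) :+ con 4 :* (l :* h) :+ l :* (x :+ l :* (con 5 :* s))) refl L (∣ X ∣) (∣ lone ∣) (∣ D ∣) (∣ heads ∣) ⟩
   5 * (L * (L * ∣ D ∣)) + 4 * (L * ∣ heads ∣) + L * (∣ X ∣ + L * (5 * ∣ lone ∣))
    ≤⟨ +-mono-≤ (+-mono-≤ (*-monoʳ-≤ 5 (≤-trans (*-monoʳ-≤ L D-size) heads-size)) (*-monoʳ-≤ 4 heads-size))
    (*-monoʳ-≤ L (+-monoʳ-≤ ∣ X ∣ (*-monoʳ-≤ L (*-monoʳ-≤ 5 (≤-trans lone-size (+-monoʳ-≤ ∣ incomplete ∣ (*-monoʳ-≤ L danger-size))))))) ⟩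
   5 * n + 4 * n + L * waste
    ≡⟨ cong (_+ L * waste) (sym (*-distribʳ-+ n 5 4)) ⟩
   9 * n + L * waste ∎

-- Assembling the Sudoku set.

module Finish {n : ℕ} (G : Graph n) (cG : Cubic G) (χ : 3 ≡ chromatic G) (φ : Fin n → Fin 3) (φ-proper : ∀ i j → G i j ! → φ i ≢ φ j)
 {K L g : ℕ} (lay : Layout G K L g) (X Y late : Fin n → Bool)
 (rest-late : ∀ v → X v ≡ false → Layout.act lay v ≡ false → late v !)
 (act-X : ∀ v → Layout.act lay v ! → X v ≡ false)
 (act-nbr : ∀ v w → Layout.act lay v ! → G v w ! → X w ≡ false)
 (act-late : ∀ v → Layout.act lay v ! → late v ≡ false)
 (X-late : ∀ v → X v ! → late v ≡ false)
 (Y-late : ∀ y → Y y ! → late y !)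
 (fork : ∀ y → Y y ! → Greedy.Twins G cG X φ y)
 (late-walk : ∀ v → late v ! → ∃[ y ] Y y ! × Star (Greedy.Within G cG late) v y) where

 open Cubic cG
 open Layout lay using (act; arm)
 open Greedy G cG
 module Av = Average G cG (nbrs cG) lay
 open Run G cG (nbrs cG) lay using (final; module Stage)

 -- 30 is the 24 of `few-seeds` plus 6, since the vertices outside the paths are all precoloured and
 -- are among the exceptional ones.
 few : 6 * sudokuNumber G ≤ 2 * n + 30 * ∣ (λ v → not (act v ∧ elemᵇ v (inner (arm v)))) ∣
 few = from Av.few-seeds
  where
  exc = ∣ (λ v → not (act v ∧ elemᵇ v (inner (arm v)))) ∣
  from : (∃[ r ] 6 * ∣ Av.Seeds.seeded r ∣ ≤ 2 * n + 24 * exc) → 6 * sudokuNumber G ≤ 2 * n + 30 * exc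
  from (r , le) = complete′ Rt.rooted-colouring
   where
   -- No edge joins a path to the precoloured set, so the two colourings can be put side by side
   -- although they are unrelated.
   c₀ : Fin n → Fin 3
   c₀ v = if act v then final r v else φ v
   c₀-act : ∀ v → act v ! → c₀ v ≡ final r v
   c₀-act v e = cong (λ b → if b then final r v else φ v) e
   c₀-X : ∀ v → X v ! → c₀ v ≡ φ v
   c₀-X v x = cong (λ b → if b then final r v else φ v) (¬true λ a → contra x (act-X v a))
   U : Fin n → Bool
   U v = X v ∨ act v
   U-proper : ProperOn U c₀
   U-proper i j ui uj ij = by (∨-true {X i} ui) (∨-true {X j} uj)
    where
    by : X i ! ⊎ act i ! → X j ! ⊎ act j ! → c₀ i ≢ c₀ j
    by (inj₁ x) (inj₁ y) e = φ-proper i j ij (trans (sym (c₀-X i x)) (trans e (c₀-X j y)))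
    by (inj₂ a) (inj₂ b) e = Stage.final-proper r i j a b ij (trans (sym (c₀-act i a)) (trans e (c₀-act j b)))
    by (inj₁ x) (inj₂ b) _ = contra x (act-nbr j i b (syms ij))
    by (inj₂ a) (inj₁ y) _ = contra y (act-nbr i j a ij)
   U-late : ∀ v → U v ! → late v ≡ false
   U-late v u with ∨-true {X v} u
   ... | inj₁ x = X-late v x
   ... | inj₂ a = act-late v a
   root : ∀ y → Twins X φ y →
    Twins U c₀ y
   root y (p , q , ne , yp , yq , xp , xq , e) = p , q , ne , yp , yq , true-∨ˡ (act p) xp , true-∨ˡ (act q) xq , trans (c₀-X p xp) (trans e (sym (c₀-X q xq)))
   module Rt = Rooted U late Y c₀ U-proper U-late Y-late
    (λ y yy → root y (fork y yy)) late-walk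
   complete′ : (∃[ c ] ProperOn (λ v → U v ∨ late v) c × (∀ v → U v ! → c v ≡ c₀ v)) → 6 * sudokuNumber G ≤ 2 * n + 30 * exc
   complete′ (c , pr , ag) = ≤-trans (*-monoʳ-≤ 6 (≤-trans (sudokuNumber-≤ G c proper S uniq χ) count)) (begin
    6 * (exc + ∣ Av.Seeds.seeded r ∣) ≡⟨ *-distribˡ-+ 6 exc _ ⟩
    6 * exc + 6 * ∣ Av.Seeds.seeded r ∣ ≤⟨ +-monoʳ-≤ (6 * exc) le ⟩
    6 * exc + (2 * n + 24 * exc) ≡⟨ trans (+-comm (6 * exc) _) (trans (+-assoc (2 * n) (24 * exc) (6 * exc)) (cong (2 * n +_) (sym (*-distribʳ-+ exc 24 6)))) ⟩
    2 * n + 30 * exc ∎)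
    where
    everywhere : ∀ v → U v ∨ late v !
    everywhere v = by (X v) (act v) refl refl
     where
     by : ∀ x a → X v ≡ x → act v ≡ a → (X v ∨ act v) ∨ late v !
     by true _ p _ = true-∨ˡ (late v) (true-∨ˡ (act v) p)
     by false true _ q = true-∨ˡ (late v) (true-∨ʳ (X v) q)
     by false false p q = true-∨ʳ (X v ∨ act v) (rest-late v p q)
    proper : ∀ i j → G i j ! → c i ≢ c j
    proper i j = pr i j (everywhere i) (everywhere j)
    S : Fin n → Bool
    S v = not (act v) ∨ Stage.seed r v
    c-act : ∀ v → act v ! → c v ≡ final r v
    c-act v a = trans (ag v (true-∨ʳ (X v) a)) (c₀-act v a)
    uniq : ∀ c' → (∀ i j → G i j ! → c' i ≢ c' j) → (∀ v → S v ! → c' v ≡ c v) → ∀ v → c' v ≡ c v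
    uniq c' pr' agr v = by (act v) refl
     where
     by : ∀ a → act v ≡ a → c' v ≡ c v
     by false e = agr v (true-∨ˡ (Stage.seed r v) (cong not e))
     by true e = trans (Stage.final-unique r c' pr' (λ w aw sw → trans (agr w (true-∨ʳ (not (act w)) sw)) (c-act w aw)) v e) (sym (c-act v e))
    count : ∣ S ∣ ≤ exc + ∣ Av.Seeds.seeded r ∣
    count = ≤-trans (∣∣-mono {P = S} {Q = λ v → not (act v ∧ elemᵇ v (inner (arm v))) ∨ Av.Seeds.seeded r v} λ v e → by v (act v) refl e)
      (∣∣-∨ (λ v → not (act v ∧ elemᵇ v (inner (arm v)))) (Av.Seeds.seeded r))
     where
     by : ∀ v a → act v ≡ a → S v ! → not (act v ∧ elemᵇ v (inner (arm v))) ∨ Av.Seeds.seeded r v !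
     by v false e s = true-∨ˡ (Av.Seeds.seeded r v) (cong not (¬true {act v ∧ elemᵇ v (inner (arm v))} λ q → contra (∧ˡ q) e))
     by v true e s = pick (∨-true {not (act v)} s)
      where
      pick : not (act v) ! ⊎ Stage.seed r v ! → not (act v ∧ elemᵇ v (inner (arm v))) ∨ Av.Seeds.seeded r v !
      pick (inj₁ p) = contra e (not-true p)
      pick (inj₂ p) = true-∨ʳ (not (act v ∧ elemᵇ v (inner (arm v)))) (true-∧ e p)

no-diamonds : (G : Graph n) → Cubic G → diamonds {n} G ≡ 0 → NoDiamond G
no-diamonds {n} G cG e x y z w xy xz yz wy wz with x ≟ᶠ w
... | yes p = p
... | no ne = ⊥-elim (1+n≰n (≤-trans one (≤-reflexive e)))
 where
 open Cubic cG
 t = y ∷ z ∷ w ∷ []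
 dia : isDiamond {n} G x t !
 dia = true-∧ (true-∧ (cong not (both-false (≢-== (edge≢ xy)) (both-false (≢-== (edge≢ xz)) (both-false (≢-== ne) refl))))
   (true-∧ (cong not (both-false (≢-== (edge≢ yz)) (both-false (≢-== (edge≢ (syms wy))) refl)))
   (true-∧ (cong not (both-false (≢-== (edge≢ (syms wz))) refl)) refl)))
  (true-∧ xz (true-∧ (syms wy) (true-∧ xy (true-∧ yz (true-∧ (syms wz) refl)))))
 one : 1 ≤ diamonds {n} G
 one = ≤-trans (≤-trans (≤-reflexive (cong ⟦_⟧ (sym dia))) (∑-tuples-pt (λ t → ⟦ isDiamond {n} G x t ⟧) t)) (∑ᶠ-pt (λ a → ∑ (tuples {n} 3) (λ t → ⟦ isDiamond {n} G a t ⟧)) x)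

-- Collecting the error terms: ex, x, y, inc and bad count the exceptional vertices, the precoloured vertices, the sinks,
-- the vertices outside the pieces of full length, and the vertices on short cycles.
error-terms : ∀ n k L β g κ ex x y inc bad → 1 ≤ L → L * ex ≤ 9 * n + L * (x + L * (5 * (inc + L * (4 * (bad + x) + y)))) →
 x ≤ k * y → β * y ≤ n + β * (4 ^ β * bad) → g * inc ≤ L * (5 * (g * bad + n)) → κ * bad ≤ n →
 4 * (L * (k + L * (5 * (L * (4 * k + 1))))) ≤ β → 4 * ((L * (L * 5)) * (L * 5)) ≤ g → β * 4 ^ β + g + 4 * (L * (L * (5 * (L * 4)))) ≤ κ →
 L * ex ≤ 10 * n
error-terms n k L β g κ ex x y inc bad L>0 hex hx hy hinc hbad hβ hg hκ = ≤-trans hex (≤-trans (+-monoʳ-≤ (9 * n) E≤n) (≤-reflexive (+-comm (9 * n) n)))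
 where
 c₁ = L * (k + L * (5 * (L * (4 * k + 1))))
 c₂ = L * (L * 5)
 c₃ = L * (L * (5 * (L * 4)))
 E = L * (x + L * (5 * (inc + L * (4 * (bad + x) + y))))
 cancel : ∀ j {p q} → 1 ≤ j → j * p ≤ j * q → p ≤ q
 cancel (suc j) _ = *-cancelˡ-≤ (suc j)
 E-split : E ≤ c₁ * y + c₂ * inc + c₃ * bad
 E-split = ≤-trans (*-monoʳ-≤ L (+-mono-≤ hx (*-monoʳ-≤ L (*-monoʳ-≤ 5 (+-monoʳ-≤ inc (*-monoʳ-≤ L (+-monoˡ-≤ y (*-monoʳ-≤ 4 (+-monoʳ-≤ bad hx)))))))))
  (≤-reflexive (solve 5 (λ k L y i b → L :* (k :* y :+ L :* (con 5 :* (i :+ L :* (con 4 :* (b :+ k :* y) :+ y)))) :=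
   L :* (k :+ L :* (con 5 :* (L :* (con 4 :* k :+ con 1)))) :* y :+ L :* (L :* con 5) :* i :+ L :* (L :* (con 5 :* (L :* con 4))) :* b) refl k L y inc bad))
 i-part : 4 * (c₂ * inc) ≤ g * bad + n
 i-part = cancel (L * 5) (*-mono-≤ L>0 (s≤s {n = 4} z≤n)) (begin
  L * 5 * (4 * (c₂ * inc)) ≡⟨ solve 3 (λ l c i → l :* (con 4 :* (c :* i)) := con 4 :* (c :* l) :* i) refl (L * 5) c₂ inc ⟩
  4 * (c₂ * (L * 5)) * inc ≤⟨ *-monoˡ-≤ inc hg ⟩
  g * inc ≤⟨ hinc ⟩
  L * (5 * (g * bad + n)) ≡⟨ sym (*-assoc L 5 _) ⟩
  L * 5 * (g * bad + n) ∎)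
 y-part : 4 * (c₁ * y) ≤ n + β * (4 ^ β * bad)
 y-part = ≤-trans (≤-reflexive (sym (*-assoc 4 c₁ y))) (≤-trans (*-monoˡ-≤ y hβ) hy)
 -- Scaled by 4, the sinks and the incomplete pieces contribute n each, up to multiples of `bad`;
 -- all multiples of `bad` together contribute another n by the choice of κ.
 E≤n : E ≤ n
 E≤n = cancel 4 (s≤s z≤n) (begin
  4 * E ≤⟨ *-monoʳ-≤ 4 E-split ⟩
  4 * (c₁ * y + c₂ * inc + c₃ * bad) ≡⟨ solve 3 (λ p q r → con 4 :* (p :+ q :+ r) := con 4 :* p :+ con 4 :* q :+ con 4 :* r) refl (c₁ * y) (c₂ * inc) (c₃ * bad) ⟩
  4 * (c₁ * y) + 4 * (c₂ * inc) + 4 * (c₃ * bad) ≤⟨ +-monoˡ-≤ (4 * (c₃ * bad)) (+-mono-≤ y-part i-part) ⟩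
  n + β * (4 ^ β * bad) + (g * bad + n) + 4 * (c₃ * bad) ≡⟨ solve 6 (λ n b f s g c → n :+ b :* (f :* s) :+ (g :* s :+ n) :+ con 4 :* (c :* s) := con 2 :* n :+ (b :* f :+ g :+ con 4 :* c) :* s) refl n β (4 ^ β) bad g c₃ ⟩
  2 * n + (β * 4 ^ β + g + 4 * c₃) * bad ≤⟨ +-monoʳ-≤ (2 * n) (≤-trans (*-monoˡ-≤ bad hκ) hbad) ⟩
  2 * n + n ≡⟨ +-comm (2 * n) n ⟩
  3 * n ≤⟨ *-monoˡ-≤ n (n≤1+n 3) ⟩
  4 * n ∎)

-- Choice of the constants and conclusion.

cycle-length sink-spacing path-length : ℕ → ℕ
cycle-length m = (suc m + suc m) + suc (((suc (3 * suc m) + suc (3 * suc m)) * 2) * suc (suc m + suc m) + ((suc (3 * suc m) + suc (3 * suc m)) * 2) * suc (suc m + suc m))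
sink-spacing m = 4 * (suc m * (128 + suc m * (5 * (suc m * (4 * 128 + 1)))))
path-length m = 4 * ((suc m * (suc m * 5)) * (suc m * 5))

-- The order of choice is the length m of the pieces, the size β of the components of sinks, the
-- bound g on short cycles, and κ, which makes short cycles rare. Each lower bound involves only
-- constants chosen before.
record Constants (a : ℕ) : Set where
 field
  m β g κ : ℕ
  m-large : 150 * suc a ≤ suc m
  3≤g : 3 ≤ g
  β≤g : β ≤ g
  β-large : sink-spacing m ≤ β
  g-large : path-length m ≤ g
  girth : cycle-length m ≤ g
  κ-large : β * 4 ^ β + g + 4 * (suc m * (suc m * (5 * (suc m * 4)))) ≤ κ

constants : ∀ a → Constants a
constants a = from (at-least (150 * suc a))
 where
 at-least : ∀ x → ∃[ y ] x ≤ y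
 at-least x = x , ≤-refl
 all-four : ∀ p q r s → ∃[ y ] p ≤ y × q ≤ y × r ≤ y × s ≤ y
 all-four p q r s = p + (q + (r + s)) , m≤m+n p _ , ≤-trans (m≤m+n q _) (m≤n+m _ p) , ≤-trans (≤-trans (m≤m+n r s) (m≤n+m _ q)) (m≤n+m _ p) , ≤-trans (≤-trans (m≤n+m s r) (m≤n+m _ q)) (m≤n+m _ p)
 from : (∃[ m ] 150 * suc a ≤ m) → Constants a
 from (m , hm) = from₂ (at-least (sink-spacing m))
  where
  from₂ : (∃[ β ] sink-spacing m ≤ β) → Constants a
  from₂ (β , hβ) = from₃ (all-four 3 β (path-length m)
    (cycle-length m))
   where
   from₃ : (∃[ g ] 3 ≤ g × β ≤ g × path-length m ≤ g ×
    cycle-length m ≤ g) → Constants a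
   from₃ (g , h₁ , h₂ , h₃ , h₄) = record { m = m ; β = β ; g = g ; κ = proj₁ κ ; m-large = ≤-trans hm (n≤1+n m) ; 3≤g = h₁ ; β≤g = h₂ ; β-large = hβ ; g-large = h₃ ; girth = h₄ ; κ-large = proj₂ κ }
    where κ = at-least (β * 4 ^ β + g + 4 * (suc m * (suc m * (5 * (suc m * 4)))))

module Typical {a : ℕ} (cs : Constants a) {n : ℕ} (G : Graph n) (cG : Cubic G) (n≥4 : 4 ≤ n)
 (typical : atypical {n} (Constants.g cs) (Constants.κ cs) G ≡ false) where
 open Constants cs

 bad : ℕ
 bad = ∣ (λ v → onShortCycle G g v) ∣

 few-bad : κ * bad ≤ n
 few-bad = ≤-trans (*-monoʳ-≤ κ (∑-mono (allFin n) λ v → le (cyclesAt G g v))) (≮⇒≥ λ lt → contra (true-≤ᵇ lt) (∨-falseˡ typical))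
  where
  le : ∀ k → ⟦ 1 ≤ᵇ k ⟧ ≤ k
  le zero = z≤n
  le (suc k) = s≤s z≤n

 nd : NoDiamond G
 nd = no-diamonds G cG (n≤0⇒n≡0 (≮⇒≥ λ lt → contra (true-≤ᵇ lt) (∨-falseʳ (suc n ≤ᵇ κ * cycleWeight G g) typical)))

 colouring₃ : ∃ λ (c : Fin n → Fin 3) → ∀ i j → G i j ! → c i ≢ c j
 colouring₃ = Brooks.brooks G cG nd

 three-case : 3 ≡ chromatic G → 3 * suc a * sudokuNumber G ≤ suc (suc a) * n
 three-case χ = from colouring₃
  where
  from : (∃ λ (c : Fin n → Fin 3) → ∀ i j → G i j ! → c i ≢ c j) → 3 * suc a * sudokuNumber G ≤ suc (suc a) * n
  from (φ , φ-proper) = tile (Tiling.tiling G cG g m)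
   where
   module S = Sinks G cG φ φ-proper g β 3≤g β≤g
   tile : (Σ (Pieces G m) λ P → g * ∣ Pieces.incomplete P ∣ ≤ suc m * (5 * (g * bad + n))) → 3 * suc a * sudokuNumber G ≤ suc (suc a) * n
   tile (P , tiled) = arithmetic (sudokuNumber G) few ex-bound
    where
    module B = Build G cG g m P S.Xᶠ S.Y S.sink-clear S.sink-walk
    exc = ∣ B.exceptional girth ∣
    few : 6 * sudokuNumber G ≤ 2 * n + 30 * exc
    few = Finish.few G cG χ φ φ-proper (B.layout girth) S.Xᶠ S.Y (B.late girth) (B.act-or-late girth)
     (λ v e → B.bulk-X girth v (∧ˡ e)) (λ v w e vw → B.bulk-nbr girth v w (∧ˡ e) vw)
     (λ v e → ¬true λ l → contra (∧ʳ {not (S.Xᶠ v)} l) (not-true (∧ʳ {B.bulk girth v} e)))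
     (λ v x → ¬true λ l → contra x (not-true (∧ˡ l))) (B.Y-late girth) S.sink-fork (B.late-walk girth)
    ex-bound : suc m * exc ≤ 10 * n
    ex-bound = error-terms n 128 (suc m) β g κ exc (∣ S.Xᶠ ∣) (∣ S.Y ∣) (∣ Pieces.incomplete P ∣) bad (s≤s z≤n) (B.exceptional-bound girth) S.few-X S.few-sinks tiled few-bad β-large g-large κ-large
    arithmetic : ∀ s → 6 * s ≤ 2 * n + 30 * exc → suc m * exc ≤ 10 * n → 3 * suc a * s ≤ suc (suc a) * n
    arithmetic s h₁ h₂ = divide 1 (3 * suc a * s) (suc (suc a) * n) (begin
     2 * (3 * suc a * s) ≡⟨ solve 2 (λ a s → con 2 :* (con 3 :* a :* s) := a :* (con 6 :* s)) refl (suc a) s ⟩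
     suc a * (6 * s) ≤⟨ *-monoʳ-≤ (suc a) h₁ ⟩
     suc a * (2 * n + 30 * exc) ≡⟨ solve 3 (λ a n e → a :* (con 2 :* n :+ con 30 :* e) := con 2 :* (a :* n) :+ con 2 :* (con 15 :* a :* e)) refl (suc a) n exc ⟩
     2 * (suc a * n) + 2 * (15 * suc a * exc) ≤⟨ +-monoʳ-≤ (2 * (suc a * n)) (*-monoʳ-≤ 2 (divide 9 (15 * suc a * exc) n ten)) ⟩
     2 * (suc a * n) + 2 * n ≡⟨ trans (+-comm (2 * (suc a * n)) (2 * n)) (sym (*-distribˡ-+ 2 n (suc a * n))) ⟩
     2 * (suc (suc a) * n) ∎)
     where
     divide : ∀ j p q → suc j * p ≤ suc j * q → p ≤ q
     divide j p q = *-cancelˡ-≤ (suc j)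
     -- 150 is 10 · 15: there are at most 10 n / L exceptional vertices, and the target allows 15 (a
     -- + 1) times their number to reach n.
     ten : 10 * (15 * suc a * exc) ≤ 10 * n
     ten = ≤-trans (≤-reflexive (trans (sym (*-assoc 10 (15 * suc a) exc)) (cong (_* exc) (sym (*-assoc 10 15 (suc a)))))) (≤-trans (*-monoˡ-≤ exc m-large) h₂)

 two-case : 2 ≡ chromatic G → (∃ λ (c : Fin n → Fin 2) → ∀ i j → G i j ! → c i ≢ c j) → 3 * suc a * sudokuNumber G ≤ suc (suc a) * n
 two-case χ c = begin
  3 * suc a * sudokuNumber G ≡⟨ trans (cong (_* sudokuNumber G) (*-comm 3 (suc a))) (*-assoc (suc a) 3 (sudokuNumber G)) ⟩
  suc a * (3 * sudokuNumber G) ≤⟨ *-monoʳ-≤ (suc a) (≤-trans (*-monoˡ-≤ (sudokuNumber G) (n≤1+n 3)) (bipartite-case G cG χ c)) ⟩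
  suc a * n ≤⟨ m≤n+m _ n ⟩
  suc (suc a) * n ∎

 good : 3 * suc a * sudokuNumber G ≤ suc (suc a) * n
 good = by (chromatic-cubic G cG n≥4 colouring₃)
  where
  by : (2 ≡ chromatic G × ∃ λ (c : Fin n → Fin 2) → ∀ i j → G i j ! → c i ≢ c j) ⊎ 3 ≡ chromatic G → 3 * suc a * sudokuNumber G ≤ suc (suc a) * n
  by (inj₁ (χ , c)) = two-case χ c
  by (inj₂ χ) = three-case χ

theorem1p1 : (a b : ℕ) → ∃ λ N → (n : ℕ) → N ≤ n → 2 ∣ n →
  b * numCubic n ≤ suc b * numGood a n
theorem1p1 a b = from (constants a)
 where
 from : Constants a → ∃ λ N → (n : ℕ) → N ≤ n → 2 ∣ n → b * numCubic n ≤ suc b * numGood a n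
 from cs = from₂ (few-atypical g κ b)
  where
  open Constants cs
  from₂ : (∃[ N ] ∀ n → N ≤ n → suc b * SumG {n} (λ G → ⟦ cub G ∧ atypical {n} g κ G ⟧) ≤ numCubic n) →
   ∃ λ N → (n : ℕ) → N ≤ n → 2 ∣ n → b * numCubic n ≤ suc b * numGood a n
  -- The 4 serves `chromatic-cubic`.
  from₂ (N , rare) = N + 4 , λ n le _ → conclude n (rare n (≤-trans (m≤m+n N 4) le)) (split n (≤-trans (m≤n+m 4 N) le))
   where
   exceptions : ℕ → ℕ
   exceptions n = SumG {n} (λ G → ⟦ cub G ∧ atypical {n} g κ G ⟧)
   split : ∀ n → 4 ≤ n → numCubic n ≤ numGood a n + exceptions n
   split n n≥4 = begin
    numCubic n ≡⟨ countᵇ≡∑ isSimple3Regular (allGraphs n) ⟩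
    SumG {n} (λ G → ⟦ cub G ⟧) ≤⟨ ∑-mono (allGraphs n) (λ G → pt G (cub G) (atypical {n} g κ G) refl refl) ⟩
    SumG {n} (λ G → ⟦ isSimple3Regular G ∧ (3 * suc a * sudokuNumber G ≤ᵇ suc (suc a) * n) ⟧ + ⟦ cub G ∧ atypical {n} g κ G ⟧)
     ≡⟨ ∑-+ (allGraphs n) _ _ ⟩
    SumG {n} (λ G → ⟦ isSimple3Regular G ∧ (3 * suc a * sudokuNumber G ≤ᵇ suc (suc a) * n) ⟧) + exceptions n
     ≡⟨ cong (_+ exceptions n) (sym (countᵇ≡∑ _ (allGraphs n))) ⟩
    numGood a n + exceptions n ∎
    where
    pt : ∀ G c t → cub G ≡ c → atypical {n} g κ G ≡ t → ⟦ c ⟧ ≤ ⟦ c ∧ (3 * suc a * sudokuNumber G ≤ᵇ suc (suc a) * n) ⟧ + ⟦ c ∧ t ⟧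
    pt G false _ _ _ = z≤n
    pt G true true _ _ = m≤n+m 1 _
    pt G true false e f = ≤-trans (≤-reflexive (cong ⟦_⟧ (sym (true-≤ᵇ (Typical.good cs G (simple3Regular⇒Cubic G e) n≥4 f))))) (m≤m+n _ 0)
   conclude : ∀ n → suc b * exceptions n ≤ numCubic n → numCubic n ≤ numGood a n + exceptions n → b * numCubic n ≤ suc b * numGood a n
   -- Multiplied by b + 1, the exceptions amount to at most one copy of `numCubic n`, which cancels.
   conclude n h₁ h₂ = +-cancelˡ-≤ (numCubic n) _ _ (begin
    suc b * numCubic n ≤⟨ *-monoʳ-≤ (suc b) h₂ ⟩
    suc b * (numGood a n + exceptions n) ≡⟨ *-distribˡ-+ (suc b) (numGood a n) (exceptions n) ⟩
    suc b * numGood a n + suc b * exceptions n ≤⟨ +-monoʳ-≤ (suc b * numGood a n) h₁ ⟩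
    suc b * numGood a n + numCubic n ≡⟨ +-comm _ (numCubic n) ⟩
    numCubic n + suc b * numGood a n ∎)
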